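{- For every finite graph $H$ and every $\Delta\in\mathbb{N}$, the class $\mathcal{G}$ of finite graphs that have maximum degree at most $\Delta$ and do not contain $H$ as an induced minor has bounded Baker-treewidth; that is, there exists a function $f\colon\mathbb{N}\to\mathbb{N}$ such that every $G\in\mathcal{G}$ has a layering $(L_0,L_1,\dots)$ such that for every $\ell\in\mathbb{N}$ and every $i\ge 0$, the subgraph of $G$ induced by $L_i\cup L_{i+1}\cup\dots\cup L_{i+\ell-1}$ has treewidth at most $f(\ell)$.
   Context: All graphs are finite and simple. $H$ is an induced minor of $G$ if $H$ can be obtained from an induced subgraph of $G$ by contracting edges. A layering of a graph $G$ is an ordered partition $(L_0,L_1,\dots)$ of $V(G)$ such that for every edge $vw$ with $v\in L_i$, $w\in L_j$ we have $|i-j|\le 1$. A graph class $\mathcal{G}$ has bounded Baker-treewidth if there is a function $f\colon\mathbb{N}\to\mathbb{N}$ such that every graph in $\mathcal{G}$ has a layering in which the subgraph induced by the union of any $\ell$ consecutive layers has treewidth at most $f(\ell)$. -}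

module Defs where

open import Data.Nat using (ℕ; zero; suc; _+_; _≤_; _<_; ∣_-_∣)
open import Data.Fin using (Fin; inject₁; fromℕ) renaming (zero to fzero; suc to fsuc)
open import Data.Bool using (Bool; true; false; if_then_else_)
open import Data.List using (List; map; allFin)
open import Data.Nat.ListAction using (sum)
open import Data.Product using (Σ; ∃; _×_; _,_)
open import Relation.Binary.PropositionalEquality using (_≡_; _≢_)
open import Relation.Nullary using (¬_)
open import Function.Definitions using (Injective)

record Graph : Set where
  field
    n      : ℕ
    adj    : Fin n → Fin n → Bool
    sym    : ∀ u v → adj u v ≡ adj v u
    irrefl : ∀ v → adj v v ≡ false

open Graph public

Adj : (G : Graph) → Fin (n G) → Fin (n G) → Set
Adj G u v = adj G u v ≡ true

countB : ∀ {m} → (Fin m → Bool) → ℕ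
countB {m} p = sum (map (λ u → if p u then 1 else 0) (allFin m))

degree : (G : Graph) → Fin (n G) → ℕ
degree G v = countB (adj G v)

MaxDegreeAtMost : Graph → ℕ → Set
MaxDegreeAtMost G Δ = ∀ v → degree G v ≤ Δ

data Walk (G : Graph) (P : Fin (n G) → Set) : Fin (n G) → Fin (n G) → Set where
  [_]  : ∀ {v} → P v → Walk G P v v
  _∷⟨_⟩_ : ∀ {u w v} → P u → Adj G u w → Walk G P w v → Walk G P u v

ConnectedIn : (G : Graph) → (Fin (n G) → Set) → Set
ConnectedIn G P = ∀ u v → P u → P v → Walk G P u v




Connected : Graph → Set
Connected G = ConnectedIn G (λ _ → Data.Unit.⊤)
  where import Data.Unit

HasCycle : Graph → Set
HasCycle G = Σ ℕ λ k → Σ (Fin (suc (suc (suc k))) → Fin (n G)) λ c →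
  Injective _≡_ _≡_ c
  × (∀ (i : Fin (suc (suc k))) → Adj G (c (inject₁ i)) (c (fsuc i)))
  × Adj G (c (fromℕ (suc (suc k)))) (c fzero)

IsTree : Graph → Set
IsTree T = (0 < n T) × Connected T × ¬ HasCycle T

-- A tree decomposition of width at most k of the subgraph of G induced by the
-- vertex set S (vertices of G[S] are identified with the vertices of G in S).
record TreeDecomposition (G : Graph) (S : Fin (n G) → Set) (k : ℕ) : Set where
  field
    tree       : Graph
    isTree     : IsTree tree
    bag        : Fin (n tree) → Fin (n G) → Bool
    bag⊆S      : ∀ t v → bag t v ≡ true → S v
    vertexCov  : ∀ v → S v → ∃ λ t → bag t v ≡ true
    edgeCov    : ∀ u v → S u → S v → Adj G u v →
                   ∃ λ t → (bag t u ≡ true) × (bag t v ≡ true)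
    coherent   : ∀ v → ConnectedIn tree (λ t → bag t v ≡ true)
    width      : ∀ t → countB (bag t) ≤ suc k

TreewidthAtMost : (G : Graph) → (Fin (n G) → Set) → ℕ → Set
TreewidthAtMost G S k = TreeDecomposition G S k

-- H is an induced minor of G: there are nonempty, pairwise disjoint, connected
-- branch sets X_a (a ∈ V(H)) in G such that for distinct a, b, ab ∈ E(H) iff
-- there is an edge of G between X_a and X_b.  (This is exactly the graph
-- obtained from G[⋃ X_a] by contracting the edges inside the X_a's.)
InducedMinor : Graph → Graph → Set
InducedMinor H G =
  Σ (Fin (n H) → Fin (n G) → Bool) λ X →
    (∀ a → ∃ λ v → X a v ≡ true)
  × (∀ a b → a ≢ b → ∀ v → X a v ≡ true → X b v ≡ true → Data.Empty.⊥)
  × (∀ a → ConnectedIn G (λ v → X a v ≡ true))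
  × (∀ a b → a ≢ b →
       (Adj H a b → ∃ λ u → ∃ λ v → (X a u ≡ true) × (X b v ≡ true) × Adj G u v)
     × ((∃ λ u → ∃ λ v → (X a u ≡ true) × (X b v ≡ true) × Adj G u v) → Adj H a b))
  where import Data.Empty

-- A layering: vertex v lies in layer L v; edges join equal or consecutive layers.
IsLayering : (G : Graph) → (Fin (n G) → ℕ) → Set
IsLayering G L = ∀ u v → Adj G u v → ∣ L u - L v ∣ ≤ 1

Window : {G : Graph} → (Fin (n G) → ℕ) → ℕ → ℕ → Fin (n G) → Set
Window L i ℓ v = (i ≤ L v) × (L v < i + ℓ)

Fin′ : Graph → Set
Fin′ G = Fin (n G)

-- Layer G by the distance to a root in every component.  If the window of ℓ layers starting at layer i had large
-- treewidth, it would contain a large set W that no separation of small order q breaks.  The layers up to i − 2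
-- of the component of most of W form a connected set B without edges to the window, and every vertex of the
-- window hangs from an ancestor in B by a short path.  For X ⊆ B let r(X) be the least order of a separation that
-- cuts off from W everything hanging from X; r is subadditive, so B can be partitioned into connected cells of
-- moderate r.  The contact graph of the cells is sparse on every set of cells, since otherwise Mader's argument
-- produces a large complete minor and hence H as an induced minor.  So there are |H| pairwise non-adjacent cells
-- with large r, and an induced version of Menger's theorem (valid for bounded degree) links what hangs from any
-- two of them by many pairwise anticomplete lanes inside the window.
-- Two bundles of k lanes have only O(k) contacts: repartition B into cells that are each met by a bounded number
-- of lanes; many such cells would force many lanes to share many cells, and lanes as vertices with shared cells as
-- edges give H.  Therefore one lane per pair of cells can be chosen so that the lanes are pairwise anticomplete,
-- and together with the cells they form H as an induced minor.
module Submission where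

open import Data.Nat
open import Data.Nat.Properties
open import Data.Fin using (Fin; inject≤; toℕ) renaming (zero to fz; suc to fs)
import Data.Fin as F
open import Data.Fin.Properties using (any?; all?; inject≤-injective)
import Data.Fin.Properties as FP
open import Data.Bool using (Bool; true; false; _∨_; _∧_; not; if_then_else_)
import Data.Bool.Properties as BP
open import Data.Product
open import Data.Sum using (_⊎_; inj₁; inj₂; [_,_]′)
open import Data.Empty using (⊥; ⊥-elim)
open import Relation.Nullary
open import Relation.Nullary.Decidable using (_×-dec_; _⊎-dec_; _→-dec_; ¬?; dec-true; dec-false; decidable-stable; map′)
open import Relation.Binary.PropositionalEquality hiding ([_])
open import Data.Nat.Tactic.RingSolver using (solve-∀)
open import Function using (_∘_; id)
open import Relation.Binary.Definitions using (tri<; tri≈; tri>)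
open import Defs renaming (sym to adj-sym; irrefl to adj-irrefl)
import Data.Nat.ListAction
import Data.List
open import Data.Unit using (⊤; tt)
open import Data.List using (List; []; _∷_; filter; cartesianProduct; allFin)
open import Data.List.Relation.Unary.Any using (here; there)
import Data.List.Membership.Propositional as ML
open import Data.List.Membership.Propositional.Properties using (∈-filter⁺; ∈-filter⁻; ∈-cartesianProduct⁺; ∈-allFin)

-- Finite sets as Boolean predicates

-- The obstacle is that contracted cells touch where they should not: a minor of the contact graph
-- need not be an induced minor of `G`. So cells get light and heavy vertices: every edge between
-- cells has a light end, and every vertex reaches the core of its cell through boundedly many light
-- ones. A connection between two cells then has few light vertices, by the degree bound it disturbs
-- few other cells, and a suitable colouring followed by restriction to two colour classes removes
-- the disturbances. Vertices outside `B` all count as light, and the layer left out below the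
-- window hides heavy vertices from the lanes. Both partitions of `B` come from one lemma on
-- subadditive functions, applied first to the separation order with respect to `W` and later to the
-- number of lanes met. In the second use the number of cells must be linear in the number of lanes,
-- with a factor that does not involve `k`; otherwise `k` would have to exceed a function of itself
-- when the conflicts are removed. Hence `goal` and `load` are fixed by `H`, `Δ` and the height of
-- the window before `k` is chosen.

Sub : ℕ → Set
Sub dim = Fin dim → Bool

infix 4 _∈_ _∉_ _⊆_ _∈?_
infixr 6 _∪_
infixl 7 _∩_ _∖_
infix 7 _▹_

private variable
  dim dim′ : ℕ

-- A record rather than a bare equation, so that unification can recover `v` and `S` from a
-- membership proof; the implicit arguments of the set lemmas rely on it.
record _∈_ {dim : ℕ} (v : Fin dim) (S : Sub dim) : Set where
  constructor ∈!
  field !∈ : S v ≡ true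

open _∈_ public

_∉_ : Fin dim → Sub dim → Set
v ∉ S = ¬ (v ∈ S)

_∈?_ : (v : Fin dim) (S : Sub dim) → Dec (v ∈ S)
v ∈? S = map′ ∈! !∈ (S v BP.≟ true)

_⊆_ : Sub dim → Sub dim → Set
S ⊆ T = ∀ v → v ∈ S → v ∈ T

does⁻ : {P : Set} (d : Dec P) → does d ≡ true → P
does⁻ (yes p) _ = p

opaque
  set : {P : Fin dim → Set} → (∀ v → Dec (P v)) → Sub dim
  set P? v = does (P? v)

  set⁺ : {P : Fin dim → Set} {P? : ∀ v → Dec (P v)} {v : Fin dim} → P v → v ∈ set P?
  set⁺ {P? = P?} {v} p = ∈! (dec-true (P? v) p)

  set⁻ : {P : Fin dim → Set} {P? : ∀ v → Dec (P v)} {v : Fin dim} → v ∈ set P? → P v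
  set⁻ {P? = P?} {v} (∈! e) with P? v
  ... | yes p = p

⊤ˢ ∅ : Sub dim
⊤ˢ _ = true
∅ _ = false

opaque
  _∪_ _∩_ _∖_ : Sub dim → Sub dim → Sub dim
  (S ∪ T) v = S v ∨ T v
  (S ∩ T) v = S v ∧ T v
  (S ∖ T) v = S v ∧ not (T v)

∈⊤ : {v : Fin dim} → v ∈ ⊤ˢ
∈⊤ = ∈! refl

∉∅ : {v : Fin dim} → v ∉ ∅
∉∅ (∈! ())

module _ {S T : Sub dim} {v : Fin dim} where
 opaque
  unfolding _∪_ _∩_ _∖_

  ∪ˡ : v ∈ S → v ∈ S ∪ T
  ∪ˡ (∈! p) = ∈! (subst (λ b → b ∨ T v ≡ true) (sym p) refl)

  ∪ʳ : v ∈ T → v ∈ S ∪ T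
  ∪ʳ (∈! p) = ∈! (subst (λ b → S v ∨ b ≡ true) (sym p) (BP.∨-zeroʳ (S v)))

  ∪⁻ : v ∈ S ∪ T → v ∈ S ⊎ v ∈ T
  ∪⁻ (∈! p) = go (S v) refl p
    where
    go : ∀ b → S v ≡ b → b ∨ T v ≡ true → v ∈ S ⊎ v ∈ T
    go true  e _ = inj₁ (∈! e)
    go false e q = inj₂ (∈! q)

  ∩⁺ : v ∈ S → v ∈ T → v ∈ S ∩ T
  ∩⁺ (∈! p) (∈! q) = ∈! (cong₂ _∧_ p q)

  ∩ˡ : v ∈ S ∩ T → v ∈ S
  ∩ˡ (∈! p) = ∈! (go (S v) p)
    where
    go : ∀ b → b ∧ T v ≡ true → b ≡ true
    go true _ = refl

  ∩ʳ : v ∈ S ∩ T → v ∈ T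
  ∩ʳ (∈! p) = ∈! (go (S v) p)
    where
    go : ∀ b → b ∧ T v ≡ true → T v ≡ true
    go true q = q

  ∖⁺ : v ∈ S → v ∉ T → v ∈ S ∖ T
  ∖⁺ (∈! p) q = ∈! (cong₂ (λ a b → a ∧ not b) p (BP.¬-not (q ∘ ∈!)))

  ∖ˡ : v ∈ S ∖ T → v ∈ S
  ∖ˡ (∈! p) = ∈! (go (S v) p)
    where
    go : ∀ b → b ∧ not (T v) ≡ true → b ≡ true
    go true _ = refl

  ∖ʳ : v ∈ S ∖ T → v ∉ T
  ∖ʳ (∈! p) (∈! q) = go (S v) (T v) q p
    where
    go : ∀ a b → b ≡ true → a ∧ not b ≡ true → ⊥
    go true  .true refl ()
    go false .true refl ()

opaque
  ｛_｝ : Fin dim → Sub dim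
  ｛ x ｝ = set (λ v → v FP.≟ x)

  ｛｝⁺ : (x : Fin dim) → x ∈ ｛ x ｝
  ｛｝⁺ x = set⁺ refl

  ｛｝⁻ : {x v : Fin dim} → v ∈ ｛ x ｝ → v ≡ x
  ｛｝⁻ = set⁻

  ⋃ : Sub dim′ → (Fin dim′ → Sub dim) → Sub dim
  ⋃ I F = set (λ v → any? (λ i → (i ∈? I) ×-dec (v ∈? F i)))

  ⋃⁺ : {I : Sub dim′} {F : Fin dim′ → Sub dim} {v : Fin dim} (i : Fin dim′) → i ∈ I → v ∈ F i → v ∈ ⋃ I F
  ⋃⁺ i p q = set⁺ (i , p , q)

  ⋃⁻ : {I : Sub dim′} {F : Fin dim′ → Sub dim} {v : Fin dim} → v ∈ ⋃ I F → ∃ λ i → i ∈ I × v ∈ F i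
  ⋃⁻ = set⁻

-- Sums and cardinalities

∑ : (Fin dim → ℕ) → ℕ
∑ {zero}  f = 0
∑ {suc dim} f = f fz + ∑ (f ∘ fs)

_▹_ : Bool → ℕ → ℕ
b ▹ x = if b then x else 0

opaque
  # : Sub dim → ℕ
  # S = ∑ (λ v → S v ▹ 1)

  #-def : (S : Sub dim) → # S ≡ ∑ (λ v → S v ▹ 1)
  #-def S = refl

+-interchange : ∀ a b c d → (a + b) + (c + d) ≡ (a + c) + (b + d)
+-interchange = solve-∀

∑-cong : {f g : Fin dim → ℕ} → (∀ i → f i ≡ g i) → ∑ f ≡ ∑ g
∑-cong {zero}  e = refl
∑-cong {suc dim} e = cong₂ _+_ (e fz) (∑-cong (e ∘ fs))

∑-mono : {f g : Fin dim → ℕ} → (∀ i → f i ≤ g i) → ∑ f ≤ ∑ g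
∑-mono {zero}  e = z≤n
∑-mono {suc dim} e = +-mono-≤ (e fz) (∑-mono (e ∘ fs))

∑-+ : (f g : Fin dim → ℕ) → ∑ (λ i → f i + g i) ≡ ∑ f + ∑ g
∑-+ {zero}  f g = refl
∑-+ {suc dim} f g rewrite ∑-+ (f ∘ fs) (g ∘ fs) = +-interchange (f fz) (g fz) _ _

∑-0 : ∑ {dim} (λ _ → 0) ≡ 0
∑-0 {zero}  = refl
∑-0 {suc dim} = ∑-0 {dim}

∑-const : (c : ℕ) → ∑ {dim} (λ _ → c) ≡ dim * c
∑-const {zero}  c = refl
∑-const {suc dim} c = cong (c +_) (∑-const {dim} c)

∑-* : (c : ℕ) (f : Fin dim → ℕ) → ∑ (λ i → c * f i) ≡ c * ∑ f
∑-* {zero}  c f = sym (*-zeroʳ c)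
∑-* {suc dim} c f rewrite ∑-* c (f ∘ fs) = sym (*-distribˡ-+ c _ _)

∑-swap : (f : Fin dim → Fin dim′ → ℕ) → ∑ (λ i → ∑ (f i)) ≡ ∑ (λ j → ∑ (λ i → f i j))
∑-swap {zero}  {dim′} f = sym (∑-0 {dim′})
∑-swap {suc dim} f rewrite ∑-swap (f ∘ fs) = sym (∑-+ (f fz) _)

∑-∋ : (f : Fin dim → ℕ) (i : Fin dim) → f i ≤ ∑ f
∑-∋ f fz     = m≤m+n _ _
∑-∋ f (fs i) = ≤-trans (∑-∋ (f ∘ fs) i) (m≤n+m _ _)

▹-≤ : (b : Bool) {x y : ℕ} → (b ≡ true → x ≤ y) → b ▹ x ≤ y
▹-≤ true  f = f refl
▹-≤ false f = z≤n

▹-mono : (b : Bool) {x y : ℕ} → (b ≡ true → x ≤ y) → b ▹ x ≤ b ▹ y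
▹-mono true  f = f refl
▹-mono false f = z≤n

▹-true : {b : Bool} (x : ℕ) → b ≡ true → b ▹ x ≡ x
▹-true x refl = refl

opaque
  unfolding #

  ∑-#* : (S : Sub dim) (c : ℕ) → ∑ (λ i → S i ▹ c) ≡ c * # S
  ∑-#* S c = trans (∑-cong λ i → h (S i)) (∑-* c (λ i → S i ▹ 1))
    where
    h : ∀ b → b ▹ c ≡ c * (b ▹ 1)
    h true  = sym (*-identityʳ c)
    h false = sym (*-zeroʳ c)

∑-bound : (S : Sub dim) (f : Fin dim → ℕ) (c : ℕ) → (∀ i → i ∈ S → f i ≤ c) → ∑ (λ i → S i ▹ f i) ≤ c * # S
∑-bound S f c h = ≤-trans (∑-mono λ i → ▹-mono (S i) (h i ∘ ∈!)) (≤-reflexive (∑-#* S c))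

∑-lower : (S : Sub dim) (f : Fin dim → ℕ) (c : ℕ) → (∀ i → i ∈ S → c ≤ f i) → c * # S ≤ ∑ (λ i → S i ▹ f i)
∑-lower S f c h = ≤-trans (≤-reflexive (sym (∑-#* S c))) (∑-mono λ i → ▹-mono (S i) (h i ∘ ∈!))

-- Otherwise every term is at least `c + 1`, and the sum is at least `(c + 1) * # S`, which exceeds
-- `c * # S` because `S` is nonempty.
average≤ : (S : Sub dim) (f : Fin dim → ℕ) (c : ℕ) → 0 < # S → ∑ (λ i → S i ▹ f i) ≤ c * # S → ∃ λ i → i ∈ S × f i ≤ c
average≤ S f c pos le with any? (λ i → (i ∈? S) ×-dec (f i ≤? c))
... | yes p = p
... | no ¬p = ⊥-elim (<⇒≱ lt le)
  where
  lt : c * # S < ∑ (λ i → S i ▹ f i)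
  lt = ≤-trans (+-monoˡ-≤ (c * # S) pos) (∑-lower S f (suc c) λ i i∈ → ≰⇒> λ l → ¬p (i , i∈ , l))

opaque
  unfolding #

  #-mono : {S T : Sub dim} → S ⊆ T → # S ≤ # T
  #-mono {S = S} {T} h = ∑-mono λ i → ▹-≤ (S i) λ e → ≤-reflexive (sym (▹-true 1 (!∈ (h i (∈! e)))))

opaque
  unfolding _∪_ _∩_ _∖_ #

  #-∪ : (S T : Sub dim) → # (S ∪ T) ≤ # S + # T
  #-∪ S T = ≤-trans (∑-mono λ i → h (S i) (T i)) (≤-reflexive (∑-+ (λ i → S i ▹ 1) (λ i → T i ▹ 1)))
    where
    h : ∀ a b → (a ∨ b) ▹ 1 ≤ a ▹ 1 + b ▹ 1
    h true  b = s≤s z≤n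
    h false b = ≤-refl

  #-∪∖ : (S T : Sub dim) → # S ≡ # (S ∖ T) + # (S ∩ T)
  #-∪∖ S T = trans (∑-cong λ i → h (S i) (T i)) (∑-+ (λ i → (S i ∧ not (T i)) ▹ 1) (λ i → (S i ∧ T i) ▹ 1))
    where
    h : ∀ a b → a ▹ 1 ≡ (a ∧ not b) ▹ 1 + (a ∧ b) ▹ 1
    h true  true  = refl
    h true  false = refl
    h false b     = refl

#-∖ : (S T : Sub dim) → # S ≤ # (S ∖ T) + # T
#-∖ S T = ≤-trans (≤-reflexive (#-∪∖ S T)) (+-monoʳ-≤ (# (S ∖ T)) (#-mono λ v → ∩ʳ))

opaque
  unfolding #

  #-∅ : {S : Sub dim} → (∀ v → v ∉ S) → # S ≡ 0
  #-∅ {dim} {S} h = trans (∑-cong λ i → g (S i) (h i ∘ ∈!)) (∑-0 {dim})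
    where
    g : ∀ b → ¬ (b ≡ true) → b ▹ 1 ≡ 0
    g true  n = ⊥-elim (n refl)
    g false n = refl

  #-⊤ : # {dim} ⊤ˢ ≡ dim
  #-⊤ {dim} = trans (∑-const {dim} 1) (*-identityʳ dim)

opaque
  unfolding #

  #-tail : (S : Sub (suc dim)) → # (S ∘ fs) ≤ # S
  #-tail S = m≤n+m _ (S fz ▹ 1)

#≤ : (S : Sub dim) → # S ≤ dim
#≤ {dim} S = ≤-trans (#-mono {S = S} {⊤ˢ} λ _ _ → ∈⊤) (≤-reflexive #-⊤)

opaque
  unfolding #

  #-∈ : {S : Sub dim} {v : Fin dim} → v ∈ S → 1 ≤ # S
  #-∈ {S = S} {v} p = ≤-trans (≤-reflexive (sym (▹-true 1 (!∈ p)))) (∑-∋ (λ i → S i ▹ 1) v)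

#-∃ : {S : Sub dim} → 1 ≤ # S → ∃ λ v → v ∈ S
#-∃ {S = S} le with any? (λ v → v ∈? S)
... | yes p = p
... | no ¬p = ⊥-elim (<⇒≱ le (≤-reflexive (#-∅ λ v e → ¬p (v , e))))

opaque
  unfolding ｛_｝ set #

  #-｛｝ : (x : Fin dim) → # ｛ x ｝ ≤ 1
  #-｛｝ {suc dim} fz     = s≤s (≤-reflexive (trans (∑-cong {dim} {g = λ _ → 0} λ i → refl) (∑-0 {dim})))
  #-｛｝ {suc dim} (fs x) = ≤-trans (≤-reflexive (∑-cong λ i → cong (_▹ 1) (h i))) (#-｛｝ x)
    where
    h : ∀ i → does (fs i FP.≟ fs x) ≡ does (i FP.≟ x)
    h i with i FP.≟ x
    ... | yes e = refl
    ... | no ¬e = refl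

#-strict : {S T : Sub dim} {v : Fin dim} → S ⊆ T → v ∈ T → v ∉ S → # S < # T
#-strict {S = S} {T} {v} h p q =
  ≤-trans (+-mono-≤ (#-∈ {S = T ∖ S} (∖⁺ p q)) (#-mono {S = S} {T ∩ S} λ x e → ∩⁺ (h x e) e))
          (≤-reflexive (sym (#-∪∖ T S)))

opaque
  unfolding #

  #-⋃ : (I : Sub dim′) (F : Fin dim′ → Sub dim) → # (⋃ I F) ≤ ∑ (λ i → I i ▹ # (F i))
  #-⋃ {dim′} {dim} I F = ≤-trans (∑-mono bound) (≤-trans (≤-reflexive (∑-swap (λ v i → I i ▹ (F i v ▹ 1)))) (∑-mono {dim′} inner))
    where
    bound : ∀ v → ⋃ I F v ▹ 1 ≤ ∑ (λ i → I i ▹ (F i v ▹ 1))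
    bound v = ▹-≤ (⋃ I F v) λ e → let (i , p , q) = ⋃⁻ {I = I} {F} (∈! e) in
      ≤-trans (≤-reflexive (sym (trans (▹-true _ (!∈ p)) (▹-true 1 (!∈ q))))) (∑-∋ (λ i → I i ▹ (F i v ▹ 1)) i)
    inner : ∀ i → ∑ (λ v → I i ▹ (F i v ▹ 1)) ≤ I i ▹ # (F i)
    inner i with I i
    ... | true  = ≤-refl
    ... | false = ≤-reflexive (∑-0 {dim})

#-⋃-bound : (I : Sub dim′) (F : Fin dim′ → Sub dim) (c : ℕ) → (∀ i → i ∈ I → # (F i) ≤ c) → # (⋃ I F) ≤ c * # I
#-⋃-bound I F c h = ≤-trans (#-⋃ I F) (∑-bound I (# ∘ F) c h)

-- Enumeration of a finite set

opaque
  unfolding #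

  enum : (S : Sub dim) → Fin (# S) → Fin dim
  enum {suc dim} S i with S fz
  enum {suc dim} S fz     | true  = fz
  enum {suc dim} S (fs i) | true  = fs (enum (S ∘ fs) i)
  enum {suc dim} S i      | false = fs (enum (S ∘ fs) i)

  enum-∈ : (S : Sub dim) (i : Fin (# S)) → enum S i ∈ S
  enum-∈ {suc dim} S i with S fz in eq
  enum-∈ {suc dim} S fz     | true  = ∈! eq
  enum-∈ {suc dim} S (fs i) | true  = ∈! (!∈ (enum-∈ (S ∘ fs) i))
  enum-∈ {suc dim} S i      | false = ∈! (!∈ (enum-∈ (S ∘ fs) i))

  enum-inj : (S : Sub dim) (i j : Fin (# S)) → enum S i ≡ enum S j → i ≡ j
  enum-inj {suc dim} S i j e with S fz
  enum-inj {suc dim} S fz     fz     e | true = refl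
  enum-inj {suc dim} S (fs i) (fs j) e | true = cong fs (enum-inj (S ∘ fs) i j (FP.suc-injective e))
  enum-inj {suc dim} S i      j      e | false = enum-inj (S ∘ fs) i j (FP.suc-injective e)

record Pick {dim : ℕ} (S : Sub dim) (x : ℕ) : Set where
  field
    at  : Fin x → Fin dim
    inj : ∀ i j → at i ≡ at j → i ≡ j
    mem : ∀ i → at i ∈ S

pick : (S : Sub dim) (x : ℕ) → x ≤ # S → Pick S x
pick S x le = record
  { at  = λ i → enum S (inject≤ i le)
  ; inj = λ i j e → inject≤-injective le le i j (enum-inj S _ _ e)
  ; mem = λ i → enum-∈ S _
  }

opaque
  image : (Fin dim′ → Fin dim) → Sub dim
  image f = set (λ v → any? (λ i → v FP.≟ f i))

  image⁺ : {f : Fin dim′ → Fin dim} (i : Fin dim′) → f i ∈ image f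
  image⁺ i = set⁺ (i , refl)

  image⁻ : {f : Fin dim′ → Fin dim} {v : Fin dim} → v ∈ image f → ∃ λ i → v ≡ f i
  image⁻ = set⁻

#-image : (f : Fin dim′ → Fin dim) → # (image f) ≤ dim′
#-image {zero} f = ≤-reflexive (#-∅ {S = image f} λ v e → case (image⁻ e))
  where case : ∀ {v} → (∃ λ (i : Fin 0) → v ≡ f i) → ⊥
        case (() , _)
#-image {suc dim′} f = ≤-trans (#-mono {T = ｛ f fz ｝ ∪ image (f ∘ fs)} sub)
  (≤-trans (#-∪ ｛ f fz ｝ (image (f ∘ fs))) (+-mono-≤ (#-｛｝ (f fz)) (#-image (f ∘ fs))))
  where
  sub : image f ⊆ ｛ f fz ｝ ∪ image (f ∘ fs)
  sub v e with image⁻ e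
  ... | fz   , refl = ∪ˡ (｛｝⁺ v)
  ... | fs i , q    = ∪ʳ (subst (_∈ image (f ∘ fs)) (sym q) (image⁺ i))

#-image-inj : (f : Fin dim′ → Fin dim) → (∀ i j → f i ≡ f j → i ≡ j) → dim′ ≤ # (image f)
#-image-inj {zero} f inj = z≤n
#-image-inj {suc dim′} f inj = ≤-trans (s≤s (#-image-inj (f ∘ fs) λ i j e → FP.suc-injective (inj _ _ e)))
  (#-strict {S = image (f ∘ fs)} {image f} {f fz} sub (image⁺ fz) new)
  where
  sub : image (f ∘ fs) ⊆ image f
  sub v e with image⁻ e
  ... | i , q = subst (_∈ image f) (sym q) (image⁺ (fs i))
  new : f fz ∉ image (f ∘ fs)
  new e with image⁻ e
  ... | i , q with inj _ _ q
  ... | ()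

-- Independent sets in hereditarily sparse symmetric relations

deg : (E : Fin dim → Fin dim → Bool) → Sub dim → Fin dim → ℕ
deg E Q q = # (Q ∩ E q)

-- Average degree at most `D` on every subset. Excluding a minor gives this hereditary average but
-- no bound on the maximum degree.
Sparse : (Fin dim → Fin dim → Bool) → ℕ → Set
Sparse E D = ∀ Q → ∑ (λ q → Q q ▹ deg E Q q) ≤ D * # Q

Independent : (Fin dim → Fin dim → Bool) → Sub dim → Set
Independent E I = ∀ q q′ → q ∈ I → q′ ∈ I → q ≢ q′ → ¬ (E q q′ ≡ true)

-- Greedy choice: hereditary sparsity supplies a vertex of degree at most `D` in what is left, and
-- discarding it with its neighbours costs at most `D + 1` vertices per choice.
independent : (E : Fin dim → Fin dim → Bool) (D : ℕ) → (∀ q q′ → E q q′ ≡ E q′ q) → Sparse E D →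
  (x : ℕ) (Q : Sub dim) → x * suc D ≤ # Q → ∃ λ I → I ⊆ Q × x ≤ # I × Independent E I
independent E D E-sym sp zero Q le = ∅ , (λ _ e → ⊥-elim (∉∅ e)) , z≤n , λ _ _ e → ⊥-elim (∉∅ e)
independent E D E-sym sp (suc x) Q le = ｛ q ｝ ∪ I , sub , size , ind′
  where
  least = average≤ Q (deg E Q) D (≤-trans (s≤s z≤n) le) (sp Q)
  q = proj₁ least
  q∈Q = proj₁ (proj₂ least)
  J′ = ｛ q ｝ ∪ (Q ∩ E q)
  le′ : x * suc D + suc D ≤ # (Q ∖ J′) + suc D
  le′ = ≤-trans (≤-reflexive (+-comm (x * suc D) (suc D))) (≤-trans le (≤-trans (#-∖ Q J′)
    (+-monoʳ-≤ (# (Q ∖ J′)) (≤-trans (#-∪ ｛ q ｝ _) (+-mono-≤ (#-｛｝ q) (proj₂ (proj₂ least)))))))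
  rec = independent E D E-sym sp x (Q ∖ J′) (+-cancelʳ-≤ (suc D) _ _ le′)
  I = proj₁ rec
  I⊆ = proj₁ (proj₂ rec)
  xI = proj₁ (proj₂ (proj₂ rec))
  ind = proj₂ (proj₂ (proj₂ rec))
  sub : ｛ q ｝ ∪ I ⊆ Q
  sub v e with ∪⁻ e
  ... | inj₁ a = subst (_∈ Q) (sym (｛｝⁻ a)) q∈Q
  ... | inj₂ b = ∖ˡ (I⊆ v b)
  size : suc x ≤ # (｛ q ｝ ∪ I)
  size = ≤-trans (s≤s xI) (#-strict {S = I} {v = q} (λ v e → ∪ʳ e) (∪ˡ (｛｝⁺ q))
    λ e → ∖ʳ (I⊆ q e) (∪ˡ (｛｝⁺ q)))
  far : ∀ v → v ∈ I → ¬ (E q v ≡ true)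
  far v e adj = ∖ʳ (I⊆ v e) (∪ʳ (∩⁺ (∖ˡ (I⊆ v e)) (∈! adj)))
  ind′ : Independent E (｛ q ｝ ∪ I)
  ind′ a b a∈ b∈ a≢b adj with ∪⁻ a∈ | ∪⁻ b∈
  ... | inj₁ p | inj₁ r = a≢b (trans (｛｝⁻ p) (sym (｛｝⁻ r)))
  ... | inj₁ p | inj₂ r = far b r (subst (λ z → E z b ≡ true) (｛｝⁻ p) adj)
  ... | inj₂ p | inj₁ r = far a p (trans (E-sym q a) (subst (λ z → E a z ≡ true) (｛｝⁻ r) adj))
  ... | inj₂ p | inj₂ r = ind a b p r a≢b adj

-- Walks, connected sets and components

countB≡# : ∀ {m} (S : Sub m) → countB S ≡ # S
countB≡# S = trans (tab S id) (sym (#-def S))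
  where
  tab : ∀ {a m} (S : Sub a) (f : Fin m → Fin a) →
    Data.Nat.ListAction.sum (Data.List.map (λ u → if S u then 1 else 0) (Data.List.tabulate f)) ≡ ∑ (λ i → S (f i) ▹ 1)
  tab {m = zero}  S f = refl
  tab {m = suc m} S f = cong (_ +_) (tab S (f ∘ fs))

opaque
  -- An opaque copy of exponentiation: the constants built from it should stay symbolic during
  -- conversion checking.
  _^ᵒ_ : ℕ → ℕ → ℕ
  b ^ᵒ r = b ^ r

  ^ᵒ-zero : ∀ b → b ^ᵒ 0 ≡ 1
  ^ᵒ-zero b = refl

  ^ᵒ-suc : ∀ b r → b ^ᵒ suc r ≡ b * b ^ᵒ r
  ^ᵒ-suc b r = refl

infixr 8 _^ᵒ_

module Walks (G : Graph) where

  V : Set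
  V = Fin (n G)

  infix 4 _~_ _~?_
  _~_ : V → V → Set
  u ~ v = Adj G u v

  _~?_ : (u v : V) → Dec (u ~ v)
  u ~? v = adj G u v BP.≟ true

  ~-sym : ∀ {u v} → u ~ v → v ~ u
  ~-sym {u} {v} e = trans (adj-sym G v u) e

  ~-irrefl : ∀ {v} → ¬ (v ~ v)
  ~-irrefl {v} e = BP.not-¬ (adj-irrefl G v) e

  nbr : V → Sub (n G)
  nbr = adj G

  Path : Sub (n G) → V → V → Set
  Path S = Walk G (_∈ S)

  Connected′ : Sub (n G) → Set
  Connected′ S = ∀ u v → u ∈ S → v ∈ S → Path S u v

  module _ {S : Sub (n G)} where

    start : ∀ {u v} → Path S u v → u ∈ S
    start [ p ]          = p
    start (p ∷⟨ _ ⟩ _)   = p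

    infixr 5 _++ʷ_
    _++ʷ_ : ∀ {u v w} → Path S u v → Path S v w → Path S u w
    [ _ ]          ++ʷ q = q
    (p ∷⟨ e ⟩ r)   ++ʷ q = p ∷⟨ e ⟩ (r ++ʷ q)

    reverseʷ : ∀ {u v} → Path S u v → Path S v u
    reverseʷ [ p ]        = [ p ]
    reverseʷ (p ∷⟨ e ⟩ r) = reverseʷ r ++ʷ (start r ∷⟨ ~-sym e ⟩ [ p ])

    end : ∀ {u v} → Path S u v → v ∈ S
    end [ p ]        = p
    end (p ∷⟨ e ⟩ r) = end r

    edge : ∀ {u v} → u ∈ S → v ∈ S → u ~ v → Path S u v
    edge p q e = p ∷⟨ e ⟩ [ q ]

  mapʷ : ∀ {S T u v} → S ⊆ T → Path S u v → Path T u v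
  mapʷ h [ p ]        = [ h _ p ]
  mapʷ h (p ∷⟨ e ⟩ r) = h _ p ∷⟨ e ⟩ mapʷ h r

  -- Stops at the first edge leaving `T`. That the walk stays in `T` up to there lets callers place
  -- `x` in the same component as `u`, and `y` just beyond it.
  crossing : ∀ {S u v} (T : Sub (n G)) → Path S u v → u ∈ T → v ∉ T →
    ∃₂ λ x y → Path (S ∩ T) u x × y ∈ S × x ~ y × y ∉ T
  crossing T [ p ] u∈ v∉ = ⊥-elim (v∉ u∈)
  crossing {u = u} T (_∷⟨_⟩_ {w = w} p e r) u∈ v∉ with w ∈? T
  ... | no w∉  = u , w , [ ∩⁺ p u∈ ] , start r , e , w∉
  ... | yes w∈ with crossing T r w∈ v∉
  ...   | x , y , q , y∈ , f , y∉ = x , y , (∩⁺ p u∈ ∷⟨ e ⟩ q) , y∈ , f , y∉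

  conn-hub : ∀ {S} (c : V) → (∀ u → u ∈ S → Path S u c) → Connected′ S
  conn-hub c h u v p q = h u p ++ʷ reverseʷ (h v q)

  conn-⊆⊇ : ∀ {S T} → S ⊆ T → T ⊆ S → Connected′ S → Connected′ T
  conn-⊆⊇ f g c u v p q = mapʷ f (c u v (g u p) (g v q))

  ∪⊆ˡ : ∀ {m} {S T : Sub m} → S ⊆ S ∪ T
  ∪⊆ˡ _ = ∪ˡ
  ∪⊆ʳ : ∀ {m} {S T : Sub m} → T ⊆ S ∪ T
  ∪⊆ʳ _ = ∪ʳ

  conn-∪ : ∀ {S T x y} → Connected′ S → Connected′ T → x ∈ S → y ∈ T → x ≡ y ⊎ x ~ y → Connected′ (S ∪ T)
  conn-∪ {S} {T} {x} {y} cS cT x∈ y∈ t = conn-hub x go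
    where
    link : x ≡ y ⊎ x ~ y → Path (S ∪ T) y x
    link (inj₁ refl) = [ ∪ˡ x∈ ]
    link (inj₂ e)    = edge (∪ʳ y∈) (∪ˡ x∈) (~-sym e)
    go : ∀ u → u ∈ S ∪ T → Path (S ∪ T) u x
    go u p with ∪⁻ p
    ... | inj₁ a = mapʷ ∪⊆ˡ (cS u x a x∈)
    ... | inj₂ b = mapʷ ∪⊆ʳ (cT u y b y∈) ++ʷ link t

  conn-｛｝ : ∀ x → Connected′ ｛ x ｝
  conn-｛｝ x u v p q with ｛｝⁻ p | ｛｝⁻ q
  ... | refl | refl = [ p ]

  private
    record Comp (S : Sub (n G)) (u : V) : Set where
      field
        R      : Sub (n G)
        R⊆     : R ⊆ S
        u∈     : u ∈ R
        walk   : ∀ v → v ∈ R → Path R u v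
        closed : ∀ x y → x ∈ R → y ∈ S → x ~ y → y ∈ R

    -- Each round adds a vertex to `R`, so `n G < fuel + # R` is preserved; with no fuel left it
    -- would say that `R` has more than `n G` elements.
    grow : (S : Sub (n G)) (u : V) (fuel : ℕ) (R : Sub (n G)) → n G < fuel + # R → R ⊆ S → u ∈ R →
      (∀ v → v ∈ R → Path R u v) → Comp S u
    grow S u zero R lt _ _ _ = ⊥-elim (<⇒≱ lt (#≤ R))
    grow S u (suc f) R lt R⊆ u∈ w
      with any? (λ x → any? (λ y → (x ∈? R) ×-dec ((y ∈? S) ×-dec ((x ~? y) ×-dec ¬? (y ∈? R)))))
    ... | no ¬p = record { R = R ; R⊆ = R⊆ ; u∈ = u∈ ; walk = w
                         ; closed = λ x y x∈ y∈ e → decidable-stable (y ∈? R) λ y∉ → ¬p (x , y , x∈ , y∈ , e , y∉) }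
    ... | yes (x , y , x∈ , y∈ , e , y∉) = grow S u f (R ∪ ｛ y ｝) lt′ sub (∪ˡ u∈) w′
      where
      lt′ : n G < f + # (R ∪ ｛ y ｝)
      lt′ = ≤-trans lt (≤-trans (≤-reflexive (sym (+-suc f (# R))))
        (+-monoʳ-≤ f (#-strict {v = y} ∪⊆ˡ (∪ʳ (｛｝⁺ y)) y∉)))
      sub : R ∪ ｛ y ｝ ⊆ S
      sub v p with ∪⁻ p
      ... | inj₁ a = R⊆ v a
      ... | inj₂ b = subst (_∈ S) (sym (｛｝⁻ b)) y∈
      w′ : ∀ v → v ∈ R ∪ ｛ y ｝ → Path (R ∪ ｛ y ｝) u v
      w′ v p with ∪⁻ p
      ... | inj₁ a = mapʷ ∪⊆ˡ (w v a)
      ... | inj₂ b with ｛｝⁻ b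
      ...   | refl = mapʷ ∪⊆ˡ (w x x∈) ++ʷ edge (∪ˡ x∈) p e

    mkComp : ∀ S u → u ∈ S → Comp S u
    mkComp S u p = grow S u (suc (n G)) ｛ u ｝ (m≤m+n _ _) (λ v q → subst (_∈ S) (sym (｛｝⁻ q)) p) (｛｝⁺ u)
      λ v q → conn-｛｝ u u v (｛｝⁺ u) q

  opaque
    comp : Sub (n G) → V → Sub (n G)
    comp S u with u ∈? S
    ... | yes p = Comp.R (mkComp S u p)
    ... | no  _ = ∅

    comp-⊆ : ∀ {S u} → comp S u ⊆ S
    comp-⊆ {S} {u} v q with u ∈? S
    ... | yes p = Comp.R⊆ (mkComp S u p) v q
    ... | no  _ = ⊥-elim (∉∅ q)

    comp-∋ : ∀ {S u} → u ∈ S → u ∈ comp S u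
    comp-∋ {S} {u} p with u ∈? S
    ... | yes p′ = Comp.u∈ (mkComp S u p′)
    ... | no ¬p  = ⊥-elim (¬p p)

    comp-path : ∀ {S u v} → v ∈ comp S u → Path (comp S u) u v
    comp-path {S} {u} {v} q with u ∈? S
    ... | yes p = Comp.walk (mkComp S u p) v q
    ... | no  _ = ⊥-elim (∉∅ q)

    comp-closed : ∀ {S u x y} → x ∈ comp S u → y ∈ S → x ~ y → y ∈ comp S u
    comp-closed {S} {u} {x} {y} q r e with u ∈? S
    ... | yes p = Comp.closed (mkComp S u p) x y q r e
    ... | no  _ = ⊥-elim (∉∅ q)

  comp-walk : ∀ {S u x y} → x ∈ comp S u → Path S x y → y ∈ comp S u
  comp-walk q [ _ ]        = q
  comp-walk q (p ∷⟨ e ⟩ r) = comp-walk (comp-closed q (start r) e) r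

  comp-reach : ∀ {S u v} → Path S u v → v ∈ comp S u
  comp-reach w = comp-walk (comp-∋ (start w)) w

  comp-conn : ∀ {S u} → Connected′ (comp S u)
  comp-conn {S} {u} = conn-hub u λ v p → reverseʷ (comp-path p)

  comp-sym : ∀ {S u v} → v ∈ comp S u → u ∈ comp S v
  comp-sym p = comp-reach (reverseʷ (mapʷ comp-⊆ (comp-path p)))

  comp-⊆comp : ∀ {S u v} → v ∈ comp S u → comp S v ⊆ comp S u
  comp-⊆comp p w q = comp-walk p (mapʷ comp-⊆ (comp-path q))

  conn⊆comp : ∀ {S T u} → Connected′ T → T ⊆ S → u ∈ T → T ⊆ comp S u
  conn⊆comp c h p v q = comp-reach (mapʷ h (c _ v p q))

  N[_] : Sub (n G) → Sub (n G)
  N[ S ] = S ∪ ⋃ S nbr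

  N-self : ∀ {S v} → v ∈ S → v ∈ N[ S ]
  N-self = ∪ˡ

  N-adj : ∀ {S u v} → u ∈ S → u ~ v → v ∈ N[ S ]
  N-adj {u = u} p e = ∪ʳ (⋃⁺ u p (∈! e))

  N⁻ : ∀ {S v} → v ∈ N[ S ] → ∃ λ u → u ∈ S × (u ≡ v ⊎ u ~ v)
  N⁻ {v = v} p with ∪⁻ p
  ... | inj₁ a = v , a , inj₁ refl
  ... | inj₂ b with ⋃⁻ b
  ...   | u , q , e = u , q , inj₂ (!∈ e)

  Apart : Sub (n G) → Sub (n G) → Set
  Apart S T = ∀ u v → u ∈ S → v ∈ T → u ≢ v × ¬ (u ~ v)

  apart-sym : ∀ {S T} → Apart S T → Apart T S
  apart-sym h u v p q = (λ e → proj₁ (h v u q p) (sym e)) , λ e → proj₂ (h v u q p) (~-sym e)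

  ball : V → ℕ → Sub (n G)
  ball x zero    = ｛ x ｝
  ball x (suc r) = N[ ball x r ]

  module Degree (Δ : ℕ) (Δ-bound : ∀ v → # (nbr v) ≤ Δ) where

    #-N : ∀ S → # N[ S ] ≤ suc Δ * # S
    #-N S = ≤-trans (#-∪ S _) (+-monoʳ-≤ (# S) (#-⋃-bound S nbr Δ λ i _ → Δ-bound i))

    #-ball : ∀ x r → # (ball x r) ≤ suc Δ ^ᵒ r
    #-ball x zero    = ≤-trans (#-｛｝ x) (≤-reflexive (sym (^ᵒ-zero (suc Δ))))
    #-ball x (suc r) = ≤-trans (#-N (ball x r)) (≤-trans (*-monoʳ-≤ (suc Δ) (#-ball x r)) (≤-reflexive (sym (^ᵒ-suc (suc Δ) r))))

-- Trees built by attaching leaves; the newest node has index zero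

data Tree : ℕ → Set where
  root : Tree 0
  add  : ∀ {m} → Tree m → Fin (suc m) → Tree (suc m)

tadj : ∀ {m} → Tree m → Fin (suc m) → Fin (suc m) → Bool
tadj root      _      _      = false
tadj (add t p) fz     fz     = false
tadj (add t p) fz     (fs v) = does (v FP.≟ p)
tadj (add t p) (fs u) fz     = does (u FP.≟ p)
tadj (add t p) (fs u) (fs v) = tadj t u v

tadj-sym : ∀ {m} (t : Tree m) u v → tadj t u v ≡ tadj t v u
tadj-sym root      u      v      = refl
tadj-sym (add t p) fz     fz     = refl
tadj-sym (add t p) fz     (fs v) = refl
tadj-sym (add t p) (fs u) fz     = refl
tadj-sym (add t p) (fs u) (fs v) = tadj-sym t u v

tadj-irrefl : ∀ {m} (t : Tree m) v → tadj t v v ≡ false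
tadj-irrefl root      v      = refl
tadj-irrefl (add t p) fz     = refl
tadj-irrefl (add t p) (fs v) = tadj-irrefl t v

treeGraph : ∀ {m} → Tree m → Graph
treeGraph {m} t = record { n = suc m ; adj = tadj t ; sym = tadj-sym t ; irrefl = tadj-irrefl t }

lift : ∀ {m} {t : Tree m} {p} {P Q} → (∀ x → P x → Q (fs x)) → ∀ {u v} →
  Walk (treeGraph t) P u v → Walk (treeGraph (add t p)) Q (fs u) (fs v)
lift h [ a ]        = [ h _ a ]
lift h (a ∷⟨ e ⟩ r) = h _ a ∷⟨ e ⟩ lift h r

tree-conn : ∀ {m} (t : Tree m) → Connected (treeGraph t)
tree-conn root fz fz _ _ = [ tt ]
tree-conn (add t p) fz fz _ _ = [ tt ]
tree-conn (add t p) fz (fs v) _ _ = tt ∷⟨ dec-true (p FP.≟ p) refl ⟩ lift (λ _ _ → tt) (tree-conn t p v tt tt)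
tree-conn (add t p) (fs u) (fs v) _ _ = lift (λ _ _ → tt) (tree-conn t u v tt tt)
tree-conn (add t p) (fs u) fz _ _ = snoc (lift (λ _ _ → tt) (tree-conn t u p tt tt))
  where
  snoc : ∀ {u} → Walk (treeGraph (add t p)) (λ _ → ⊤) u (fs p) → Walk (treeGraph (add t p)) (λ _ → ⊤) u fz
  snoc [ _ ]        = tt ∷⟨ dec-true (p FP.≟ p) refl ⟩ [ tt ]
  snoc (a ∷⟨ e ⟩ r) = a ∷⟨ e ⟩ snoc r

fz-nbr : ∀ {m} (t : Tree m) p {v} → Adj (treeGraph (add t p)) fz v → v ≡ fs p
fz-nbr t p {fs v} e with v FP.≟ p
... | yes q = cong fs q

-- The newest vertex is a leaf, so a cycle avoids it and lives in the smaller tree.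
tree-acyclic : ∀ {m} (t : Tree m) → ¬ HasCycle (treeGraph t)
tree-acyclic root (k , c , inj , _ , _) with inj {fz} {fs fz} (trans (only (c fz)) (sym (only (c (fs fz)))))
  where
  only : (x : Fin 1) → x ≡ fz
  only fz = refl
... | ()
tree-acyclic (add t p) (k , c , inj , step , close) with any? (λ i → c i FP.≟ fz)
... | no none = tree-acyclic t (k , c′ , inj′ , step′ , close′)
  where
  low : ∀ i → ∃ λ x → c i ≡ fs x
  low i with c i in eq
  ... | fz   = ⊥-elim (none (i , eq))
  ... | fs x = x , refl
  c′ = λ i → proj₁ (low i)
  inj′ : ∀ {i j} → c′ i ≡ c′ j → i ≡ j
  inj′ {i} {j} e = inj (trans (proj₂ (low i)) (trans (cong fs e) (sym (proj₂ (low j)))))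
  down : ∀ i j → Adj (treeGraph (add t p)) (c i) (c j) → Adj (treeGraph t) (c′ i) (c′ j)
  down i j e = subst₂ (Adj (treeGraph (add t p))) (proj₂ (low i)) (proj₂ (low j)) e
  step′ : ∀ i → Adj (treeGraph t) (c′ (F.inject₁ i)) (c′ (fs i))
  step′ i = down (F.inject₁ i) (fs i) (step i)
  close′ = down (F.fromℕ (suc (suc k))) fz close
... | yes (i , e) = two-nbrs i e
  where
  Γ = treeGraph (add t p)
  clash : ∀ i a b → c i ≡ fz → Adj Γ (c i) (c a) → Adj Γ (c i) (c b) → a ≡ b
  clash i a b e x y = inj (trans (fz-nbr t p (subst (λ z → Adj Γ z (c a)) e x))
                            (sym (fz-nbr t p (subst (λ z → Adj Γ z (c b)) e y))))
  sw : ∀ i j → Adj Γ (c i) (c j) → Adj Γ (c j) (c i)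
  sw i j x = trans (tadj-sym (add t p) (c j) (c i)) x
  pred-or-zero : ∀ {K} (j : Fin (suc K)) → j ≡ fz ⊎ ∃ λ (i : Fin K) → j ≡ fs i
  pred-or-zero fz     = inj₁ refl
  pred-or-zero (fs i) = inj₂ (i , refl)
  last-or-inj : ∀ {K} (j : Fin (suc K)) → j ≡ F.fromℕ K ⊎ ∃ λ (i : Fin K) → j ≡ F.inject₁ i
  last-or-inj {zero}  fz     = inj₁ refl
  last-or-inj {suc K} fz     = inj₂ (fz , refl)
  last-or-inj {suc K} (fs j) with last-or-inj j
  ... | inj₁ q       = inj₁ (cong fs q)
  ... | inj₂ (i , q) = inj₂ (fs i , cong fs q)
  suc≢inj : ∀ {K} (i j : Fin K) → F.inject₁ j ≡ fs i → fs j ≡ F.inject₁ i → ⊥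
  suc≢inj i j p q = <-asym
    (≤-reflexive (sym (trans (sym (FP.toℕ-inject₁ j)) (cong toℕ p))))
    (≤-reflexive (trans (cong toℕ q) (FP.toℕ-inject₁ i)))
  -- The cyclic predecessor and successor of position `i` are both mapped to the only neighbour of
  -- `fz`, so injectivity identifies them. The cases distinguish the two ends of the index range
  -- from its interior.
  two-nbrs : ∀ i → c i ≡ fz → ⊥
  two-nbrs i e with pred-or-zero i | last-or-inj i
  ... | inj₁ refl | inj₁ ()
  ... | inj₁ refl | inj₂ (fz , refl) with clash fz (fs fz) (F.fromℕ (suc (suc k))) e (step fz) (sw (F.fromℕ (suc (suc k))) fz close)
  ...   | ()
  two-nbrs i e | inj₂ (j , refl) | inj₁ q with FP.suc-injective q
  ... | refl = ⊥-elim (l (clash (fs j) (F.inject₁ j) fz e (sw (F.inject₁ j) (fs j) (step j)) (subst (λ z → Adj Γ (c z) (c fz)) (sym q) close)))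
    where
    l : F.inject₁ j ≡ fz → ⊥
    l ()
  two-nbrs i e | inj₂ (j , refl) | inj₂ (j′ , q) =
    suc≢inj′ (clash (fs j) (F.inject₁ j) (fs j′) e (sw (F.inject₁ j) (fs j) (step j)) (subst (λ z → Adj Γ (c z) (c (fs j′))) (sym q) (step j′)))
    where
    suc≢inj′ : F.inject₁ j ≡ fs j′ → ⊥
    suc≢inj′ r = suc≢inj j′ j r q

-- Separations and the recursive construction of tree decompositions

consˢ : ∀ {m} → Bool → Sub m → Sub (suc m)
consˢ b S fz     = b
consˢ b S (fs i) = S i

-- Exhaustive search over Boolean tables reaches a set only up to pointwise equality; `resp`
-- transfers `P` to the given function in the absence of extensionality.
anySub? : ∀ {m} {P : Sub m → Set} → (∀ {S T} → (∀ v → S v ≡ T v) → P S → P T) → (∀ S → Dec (P S)) → Dec (∃ P)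
anySub? {zero} resp P? with P? ∅
... | yes p = yes (∅ , p)
... | no ¬p = no λ (S , p) → ¬p (resp (λ ()) p)
anySub? {suc m} {P} resp P?
  with anySub? {m} {λ S → P (consˢ true S)} (λ e → resp λ { fz → refl ; (fs i) → e i }) (λ S → P? _)
     | anySub? {m} {λ S → P (consˢ false S)} (λ e → resp λ { fz → refl ; (fs i) → e i }) (λ S → P? _)
... | yes (S , p) | _ = yes (_ , p)
... | no _ | yes (S , p) = yes (_ , p)
... | no ¬p | no ¬q = no λ (S , p) → split S p (S fz) refl
  where
  split : ∀ S → P S → ∀ b → S fz ≡ b → ⊥
  split S p true  e = ¬p (S ∘ fs , resp (λ { fz → e ; (fs i) → refl }) p)
  split S p false e = ¬q (S ∘ fs , resp (λ { fz → e ; (fs i) → refl }) p)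

≗-∈ : ∀ {m} {S T : Sub m} → (∀ v → S v ≡ T v) → S ⊆ T
≗-∈ e v (∈! p) = ∈! (trans (sym (e v)) p)

≗-sym : ∀ {m} {S T : Sub m} → (∀ v → S v ≡ T v) → ∀ v → T v ≡ S v
≗-sym e v = sym (e v)

-- Unbreakable sets are excluded only at size exactly `w`, so a smaller boundary is first enlarged
-- inside `C`.
pad : ∀ {m} (w : ℕ) (W C : Sub m) → W ⊆ C → # W ≤ w → w ≤ # C → ∃ λ W′ → W ⊆ W′ × W′ ⊆ C × # W′ ≡ w
pad w W C W⊆ lo hi = go (w ∸ # W) W W⊆ (m∸n+n≡m lo)
  where
  go : ∀ f W → W ⊆ C → f + # W ≡ w → ∃ λ W′ → W ⊆ W′ × W′ ⊆ C × # W′ ≡ w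
  go zero W W⊆ e = W , (λ _ p → p) , W⊆ , e
  go (suc f) W W⊆ e with any? (λ v → (v ∈? C) ×-dec ¬? (v ∈? W))
  ... | no ¬p = ⊥-elim (<⇒≱ (≤-trans (s≤s (m≤n+m (# W) f)) (≤-trans (≤-reflexive e) hi))
                  (#-mono λ v p → decidable-stable (v ∈? W) λ q → ¬p (v , p , q)))
  ... | yes (v , p , q) with go f (W ∪ ｛ v ｝) sub (trans (cong (f +_) size) (trans (+-suc f (# W)) e))
    where
    sub : W ∪ ｛ v ｝ ⊆ C
    sub x r with ∪⁻ r
    ... | inj₁ a = W⊆ x a
    ... | inj₂ b = subst (_∈ C) (sym (｛｝⁻ b)) p
    size : # (W ∪ ｛ v ｝) ≡ suc (# W)
    size = ≤-antisym (≤-trans (#-∪ W ｛ v ｝) (≤-trans (+-monoʳ-≤ (# W) (#-｛｝ v)) (≤-reflexive (+-comm (# W) 1))))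
             (#-strict {v = v} (λ _ → ∪ˡ) (∪ʳ (｛｝⁺ v)) q)
  ...   | W′ , a , b , c = W′ , (λ x r → a x (∪ˡ r)) , b , c

module Decompose (G : Graph) where
  open Walks G

  side₁ side₂ : Sub (n G) → Sub (n G) → Sub (n G) → Sub (n G)
  side₁ C Z D = (C ∩ D) ∖ Z
  side₂ C Z D = (C ∖ D) ∖ Z

  NoEdge : Sub (n G) → Sub (n G) → Set
  NoEdge S T = ∀ u v → u ∈ S → v ∈ T → ¬ (u ~ v)

  -- `Z` and `D` encode a separation of `C` with separator `Z` and open sides inside and outside
  -- `D`. The loss allowed is `q` rather than a fraction of `W`: the failure of this condition is
  -- exactly what keeps both boundaries small in the recursive decomposition.
  Unbreakable : Sub (n G) → Sub (n G) → ℕ → Set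
  Unbreakable C W q = ∀ Z D → # Z ≤ q → NoEdge (side₁ C Z D) (side₂ C Z D) →
    (# W ≤ # (W ∩ side₁ C Z D) + q) ⊎ (# W ≤ # (W ∩ side₂ C Z D) + q)

  Breaks : Sub (n G) → Sub (n G) → ℕ → Sub (n G) → Sub (n G) → Set
  Breaks C W q Z D = # Z ≤ q × NoEdge (side₁ C Z D) (side₂ C Z D) ×
    (# (W ∩ side₁ C Z D) + q < # W) × (# (W ∩ side₂ C Z D) + q < # W)

  side₁-⊆ : ∀ {C Z Z′ D D′} → Z′ ⊆ Z → D ⊆ D′ → side₁ C Z D ⊆ side₁ C Z′ D′
  side₁-⊆ z d v p = ∖⁺ (∩⁺ (∩ˡ (∖ˡ p)) (d v (∩ʳ (∖ˡ p)))) (λ q → ∖ʳ p (z v q))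

  side₂-⊆ : ∀ {C Z Z′ D D′} → Z′ ⊆ Z → D′ ⊆ D → side₂ C Z D ⊆ side₂ C Z′ D′
  side₂-⊆ z d v p = ∖⁺ (∖⁺ (∖ˡ (∖ˡ p)) (λ q → ∖ʳ (∖ˡ p) (d v q))) (λ q → ∖ʳ p (z v q))

  ∩-⊆ : ∀ {m} {W S T : Sub m} → S ⊆ T → W ∩ S ⊆ W ∩ T
  ∩-⊆ h v p = ∩⁺ (∩ˡ p) (h v (∩ʳ p))

  breaks-resp : ∀ {C W q Z Z′ D D′} → (∀ v → Z v ≡ Z′ v) → (∀ v → D v ≡ D′ v) → Breaks C W q Z D → Breaks C W q Z′ D′
  breaks-resp {q = q} {Z} {Z′} {D} {D′} z d (a , b , c , e) =
    ≤-trans (#-mono (≗-∈ (≗-sym z))) a ,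
    (λ u v p r → b u v (side₁-⊆ (≗-∈ z) (≗-∈ (≗-sym d)) u p) (side₂-⊆ (≗-∈ z) (≗-∈ d) v r)) ,
    ≤-trans (s≤s (+-monoˡ-≤ q (#-mono (∩-⊆ (side₁-⊆ (≗-∈ z) (≗-∈ (≗-sym d))))))) c ,
    ≤-trans (s≤s (+-monoˡ-≤ q (#-mono (∩-⊆ (side₂-⊆ (≗-∈ z) (≗-∈ d)))))) e

  breaks? : ∀ C W q Z D → Dec (Breaks C W q Z D)
  breaks? C W q Z D = (# Z ≤? q) ×-dec
    (all? (λ u → all? λ v → (u ∈? side₁ C Z D) →-dec ((v ∈? side₂ C Z D) →-dec ¬? (u ~? v))) ×-dec
    ((_ <? _) ×-dec (_ <? _)))

  break-or-not : ∀ C W q → (∃₂ λ Z D → Breaks C W q Z D) ⊎ Unbreakable C W q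
  break-or-not C W q with anySub? (λ z (D , b) → D , breaks-resp z (λ _ → refl) b)
      (λ Z → anySub? (λ d b → breaks-resp {Z = Z} {Z} (λ _ → refl) d b) (λ D → breaks? C W q Z D))
  ... | yes p = inj₁ p
  ... | no ¬p = inj₂ λ Z D z e → choose Z D z e (_ ≤? _) (_ ≤? _)
    where
    choose : ∀ Z D → # Z ≤ q → NoEdge (side₁ C Z D) (side₂ C Z D) →
      Dec (# W ≤ # (W ∩ side₁ C Z D) + q) → Dec (# W ≤ # (W ∩ side₂ C Z D) + q) →
      (# W ≤ # (W ∩ side₁ C Z D) + q) ⊎ (# W ≤ # (W ∩ side₂ C Z D) + q)
    choose Z D z e (yes a) _       = inj₁ a
    choose Z D z e (no _)  (yes b) = inj₂ b
    choose Z D z e (no a)  (no b)  = ⊥-elim (¬p (Z , D , z , e , ≰⇒> a , ≰⇒> b))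

  record Partial (k : ℕ) : Set where
    field
      {m}      : ℕ
      tree     : Tree m
      bag      : Fin (suc m) → Sub (n G)
      coherent : ∀ v → ConnectedIn (treeGraph tree) (λ x → v ∈ bag x)
      width    : ∀ x → # (bag x) ≤ k

    Covered : V → Set
    Covered v = ∃ λ x → v ∈ bag x

  open Partial

  -- A new leaf keeps the occurrences of a vertex connected provided that everything old in its bag
  -- also lies in the bag it hangs from.
  addBag : ∀ {k} (A : Partial k) (x : Fin (suc (m A))) (β : Sub (n G)) → # β ≤ k →
    (∀ v → v ∈ β → Covered A v → v ∈ bag A x) → Partial k
  addBag {k} A x β β≤ ok = record { tree = t ; bag = bag′ ; coherent = coh ; width = width′ }
    where
    t = add (tree A) x
    bag′ : Fin (suc (suc (m A))) → Sub (n G)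
    bag′ fz     = β
    bag′ (fs y) = bag A y
    width′ : ∀ y → # (bag′ y) ≤ k
    width′ fz     = β≤
    width′ (fs y) = width A y
    up : ∀ v y → v ∈ β → v ∈ bag A y → Walk (treeGraph t) (λ x → v ∈ bag′ x) (fs y) fz
    up v y p q = snoc (lift (λ _ r → r) (coherent A v y x q (ok v p (y , q))))
      where
      snoc : ∀ {u} → Walk (treeGraph t) (λ x → v ∈ bag′ x) u (fs x) → Walk (treeGraph t) (λ x → v ∈ bag′ x) u fz
      snoc [ a ]        = a ∷⟨ dec-true (x FP.≟ x) refl ⟩ [ p ]
      snoc (a ∷⟨ e ⟩ r) = a ∷⟨ e ⟩ snoc r
    down : ∀ v y → v ∈ β → v ∈ bag A y → Walk (treeGraph t) (λ x → v ∈ bag′ x) fz (fs y)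
    down v y p q = p ∷⟨ dec-true (x FP.≟ x) refl ⟩ lift (λ _ r → r) (coherent A v x y (ok v p (y , q)) q)
    coh : ∀ v → ConnectedIn (treeGraph t) (λ x → v ∈ bag′ x)
    coh v fz     fz     p q = [ p ]
    coh v fz     (fs y) p q = down v y p q
    coh v (fs y) fz     p q = up v y q p
    coh v (fs y) (fs z) p q = lift (λ _ r → r) (coherent A v y z p q)

  record Extension {k : ℕ} (A : Partial k) (C : Sub (n G)) : Set where
    field
      B     : Partial k
      ι     : Fin (suc (m A)) → Fin (suc (m B))
      bag-ι : ∀ x v → v ∈ bag A x → v ∈ bag B (ι x)
      new   : ∀ v → Covered B v → Covered A v ⊎ v ∈ C
      vcov  : ∀ v → v ∈ C → Covered B v
      ecov  : ∀ u v → u ∈ C → v ∈ C → u ~ v → ∃ λ x → u ∈ bag B x × v ∈ bag B x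

  open Extension

  module _ (w q : ℕ) (S : Sub (n G))
           (no-unbreakable : ∀ C W → C ⊆ S → W ⊆ C → # W ≡ w → ¬ Unbreakable C W q) where

    -- The Robertson-Seymour recursion. Whatever part of `C` is already decomposed lies in `W`, and
    -- `W` fits into the bag at `x`. A breaking separation leaves more than `q` elements of the
    -- padded boundary `W′` outside each side `s`, so `(W′ ∩ s) ∪ Zc` is again a boundary of at most
    -- `w` vertices.
    extend : (fuel : ℕ) (A : Partial (w + q)) (x : Fin (suc (m A))) (C W : Sub (n G)) → # C ≤ fuel → C ⊆ S →
      W ⊆ C → # W ≤ w → (∀ v → v ∈ C → Covered A v → v ∈ W) → (∀ v → v ∈ W → v ∈ bag A x) → Extension A C
    extend fuel A x C W fu C⊆ W⊆ W≤ old inbag with # C ≤? w + q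
    ... | yes small = record
      { B = addBag A x C small (λ v p c → inbag v (old v p c)) ; ι = fs ; bag-ι = λ _ _ p → p
      ; new = λ { v (fz , p) → inj₂ p ; v (fs y , p) → inj₁ (y , p) }
      ; vcov = λ v p → fz , p ; ecov = λ u v p r _ → fz , p , r }
    ... | no large with pad w W C W⊆ W≤ (≤-trans (m≤m+n w q) (<⇒≤ (≰⇒> large)))
    ... | W′ , W⊆W′ , W′⊆ , refl with break-or-not C W′ q
    ... | inj₂ unb = ⊥-elim (no-unbreakable C W′ C⊆ W′⊆ refl unb)
    ... | inj₁ (Z , D , Z≤ , noE , b₁ , b₂) = go fuel fu
      where
      Zc = Z ∩ C
      s₁ = side₁ C Z D
      s₂ = side₂ C Z D
      Zc≤ : # Zc ≤ q
      Zc≤ = ≤-trans (#-mono λ _ → ∩ˡ) Z≤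
      s₁⊆ : s₁ ⊆ C
      s₁⊆ v p = ∩ˡ (∖ˡ p)
      s₂⊆ : s₂ ⊆ C
      s₂⊆ v p = ∖ˡ (∖ˡ p)
      kid⊆ : ∀ {s} → s ⊆ C → s ∪ Zc ⊆ C
      kid⊆ h v p with ∪⁻ p
      ... | inj₁ a = h v a
      ... | inj₂ b = ∩ʳ b
      W-kid : ∀ {s} → W′ ∩ s ∪ Zc ⊆ s ∪ Zc
      W-kid v p with ∪⁻ p
      ... | inj₁ a = ∪ˡ (∩ʳ a)
      ... | inj₂ b = ∪ʳ b
      W-kid≤ : ∀ {s} → # (W′ ∩ s) + q < # W′ → # (W′ ∩ s ∪ Zc) ≤ # W′
      W-kid≤ {s} b = ≤-trans (#-∪ (W′ ∩ s) Zc) (≤-trans (+-monoʳ-≤ _ Zc≤) (<⇒≤ b))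
      -- If a half contained all of `W′`, then `# W′` would be at most `# (W′ ∩ s) + q`, against the
      -- choice of the separation. So both halves are proper subsets of `C`.
      kid< : ∀ {s} → s ⊆ C → # (W′ ∩ s) + q < # W′ → # (s ∪ Zc) < # C
      kid< {s} h b with any? (λ v → (v ∈? W′) ×-dec ¬? (v ∈? (s ∪ Zc)))
      ... | yes (v , p , r) = #-strict (kid⊆ h) (W′⊆ v p) r
      ... | no ¬p = ⊥-elim (<⇒≱ b (≤-trans (#-mono cover) (≤-trans (#-∪ (W′ ∩ s) Zc) (+-monoʳ-≤ _ Zc≤))))
        where
        cover : W′ ⊆ W′ ∩ s ∪ Zc
        cover v p with ∪⁻ (decidable-stable (v ∈? (s ∪ Zc)) λ r → ¬p (v , p , r))
        ... | inj₁ a = ∪ˡ (∩⁺ p a)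
        ... | inj₂ b = ∪ʳ b
      β = W′ ∪ Zc
      β≤ : # β ≤ # W′ + q
      β≤ = ≤-trans (#-∪ W′ Zc) (+-monoʳ-≤ _ Zc≤)
      βC : ∀ v → v ∈ β → v ∈ C
      βC v p with ∪⁻ p
      ... | inj₁ a = W′⊆ v a
      ... | inj₂ b = ∩ʳ b
      A₀ = addBag A x β β≤ (λ v p c → inbag v (old v (βC v p) c))
      split : ∀ v → v ∈ C → v ∈ s₁ ∪ Zc ⊎ v ∈ s₂ ∪ Zc
      split v p with v ∈? Z | v ∈? D
      ... | yes z | _     = inj₁ (∪ʳ (∩⁺ z p))
      ... | no z  | yes d = inj₁ (∪ˡ (∖⁺ (∩⁺ p d) z))
      ... | no z  | no d  = inj₂ (∪ˡ (∖⁺ (∖⁺ p d) z))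
      other : ∀ v → v ∈ s₁ ∪ Zc → v ∈ s₂ ∪ Zc → v ∈ Zc
      other v p r with ∪⁻ p | ∪⁻ r
      ... | inj₂ a | _      = a
      ... | inj₁ _ | inj₂ b = b
      ... | inj₁ a | inj₁ b = ⊥-elim (∖ʳ (∖ˡ b) (∩ʳ (∖ˡ a)))
      bound : ∀ {s} v → v ∈ s ∪ Zc → v ∈ β → v ∈ W′ ∩ s ∪ Zc
      bound v p b with ∪⁻ p | ∪⁻ b
      ... | inj₂ z | _      = ∪ʳ z
      ... | inj₁ a | inj₁ c = ∪ˡ (∩⁺ c a)
      ... | inj₁ a | inj₂ z = ∪ʳ z
      cov₀ : ∀ v → v ∈ C → Covered A₀ v → v ∈ β
      cov₀ v p (fz , r)   = r
      cov₀ v p (fs y , r) = ∪ˡ (W⊆W′ v (old v p (y , r)))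
      kid-in : ∀ {s} v → v ∈ W′ ∩ s ∪ Zc → v ∈ β
      kid-in v p with ∪⁻ p
      ... | inj₁ a = ∪ˡ (∩ˡ a)
      ... | inj₂ b = ∪ʳ b
      go : ∀ fuel → # C ≤ fuel → Extension A C
      go zero fu = ⊥-elim (<⇒≱ (≰⇒> large) (≤-trans fu z≤n))
      go (suc f) fu = record
        { B = B E₂ ; ι = ι E₂ ∘ ι E₁ ∘ fs ; bag-ι = λ y v p → bag-ι E₂ _ v (bag-ι E₁ _ v p)
        ; new = new′ ; vcov = vcov′ ; ecov = ecov′ }
        where
        E₁ = extend f A₀ fz (s₁ ∪ Zc) (W′ ∩ s₁ ∪ Zc) (≤-pred (≤-trans (kid< s₁⊆ b₁) fu))
               (λ v p → C⊆ v (kid⊆ s₁⊆ v p)) W-kid (W-kid≤ b₁)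
               (λ v p c → bound v p (cov₀ v (kid⊆ s₁⊆ v p) c)) kid-in
        old₂ : ∀ v → v ∈ s₂ ∪ Zc → Covered (B E₁) v → v ∈ W′ ∩ s₂ ∪ Zc
        old₂ v p c with new E₁ v c
        ... | inj₁ c₀ = bound v p (cov₀ v (kid⊆ s₂⊆ v p) c₀)
        ... | inj₂ r  = ∪ʳ (other v r p)
        -- The second half hangs from the same bag `β`, tracked through `ι E₁`; it shares only `Zc`
        -- with the first half, and `β` contains `Zc`.
        E₂ = extend f (B E₁) (ι E₁ fz) (s₂ ∪ Zc) (W′ ∩ s₂ ∪ Zc) (≤-pred (≤-trans (kid< s₂⊆ b₂) fu))
               (λ v p → C⊆ v (kid⊆ s₂⊆ v p)) W-kid (W-kid≤ b₂) old₂ (λ v p → bag-ι E₁ fz v (kid-in v p))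
        new′ : ∀ v → Covered (B E₂) v → Covered A v ⊎ v ∈ C
        new′ v c with new E₂ v c
        ... | inj₂ p = inj₂ (kid⊆ s₂⊆ v p)
        ... | inj₁ c₁ with new E₁ v c₁
        ...   | inj₂ p            = inj₂ (kid⊆ s₁⊆ v p)
        ...   | inj₁ (fz , p)     = inj₂ (βC v p)
        ...   | inj₁ (fs y , p)   = inj₁ (y , p)
        vcov′ : ∀ v → v ∈ C → Covered (B E₂) v
        vcov′ v p with split v p
        ... | inj₁ a = let (y , r) = vcov E₁ v a in ι E₂ y , bag-ι E₂ y v r
        ... | inj₂ b = vcov E₂ v b
        ecov′ : ∀ u v → u ∈ C → v ∈ C → u ~ v → ∃ λ x → u ∈ bag (B E₂) x × v ∈ bag (B E₂) x
        first : ∀ u v → u ∈ s₁ ∪ Zc → v ∈ s₁ ∪ Zc → u ~ v → ∃ λ x → u ∈ bag (B E₂) x × v ∈ bag (B E₂) x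
        first u v a b e = let (y , p , r) = ecov E₁ u v a b e in ι E₂ y , bag-ι E₂ y u p , bag-ι E₂ y v r
        ecov′ u v p r e with split u p | split v r
        ... | inj₁ a | inj₁ b = first u v a b e
        ... | inj₂ a | inj₂ b = ecov E₂ u v a b e
        ... | inj₁ a | inj₂ b with ∪⁻ a | ∪⁻ b
        ...   | inj₂ z | _      = ecov E₂ u v (∪ʳ z) b e
        ...   | inj₁ _ | inj₂ z = first u v a (∪ʳ z) e
        ...   | inj₁ c | inj₁ d = ⊥-elim (noE u v c d e)
        ecov′ u v p r e | inj₂ a | inj₁ b with ∪⁻ a | ∪⁻ b
        ...   | inj₂ z | _      = first u v (∪ʳ z) b e
        ...   | inj₁ _ | inj₂ z = ecov E₂ u v a (∪ʳ z) e
        ...   | inj₁ c | inj₁ d = ⊥-elim (noE v u d c (~-sym e))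

    decomposition : (P : V → Set) → (∀ v → P v → v ∈ S) → (∀ v → v ∈ S → P v) → TreeDecomposition G P (w + q)
    decomposition P to from = record
      { tree = treeGraph (tree T) ; isTree = s≤s z≤n , tree-conn (tree T) , tree-acyclic (tree T)
      ; bag = bag T
      ; bag⊆S = λ t v p → from v (in-S v (t , ∈! p))
      ; vertexCov = λ v p → let (t , r) = vcov E v (to v p) in t , !∈ r
      ; edgeCov = λ u v p r e → let (t , a , b) = ecov E u v (to u p) (to v r) e in t , !∈ a , !∈ b
      ; coherent = λ v s t p r → strip (coherent T v s t (∈! p) (∈! r))
      -- Bags have at most `w + q` vertices, one fewer than width `w + q` permits.
      ; width = λ t → ≤-trans (≤-reflexive (countB≡# (bag T t))) (m≤n⇒m≤1+n (width T t)) }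
      where
      start₀ : Partial (w + q)
      start₀ = record { tree = root ; bag = λ _ → ∅ ; coherent = λ v x y p → ⊥-elim (∉∅ p)
                      ; width = λ _ → ≤-trans (≤-reflexive (#-∅ (λ _ → ∉∅))) z≤n }
      E = extend (# S) start₀ fz S ∅ ≤-refl (λ _ p → p) (λ v p → ⊥-elim (∉∅ p)) (≤-trans (≤-reflexive (#-∅ (λ _ → ∉∅))) z≤n)
            (λ v _ (_ , p) → ⊥-elim (∉∅ p)) (λ v p → p)
      T = B E
      in-S : ∀ v → Covered T v → v ∈ S
      in-S v c with new E v c
      ... | inj₁ (_ , p) = ⊥-elim (∉∅ p)
      ... | inj₂ p = p
      strip : ∀ {v s t} → Walk (treeGraph (tree T)) (λ x → v ∈ bag T x) s t → Walk (treeGraph (tree T)) (λ x → bag T x v ≡ true) s t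
      strip [ p ]        = [ !∈ p ]
      strip (p ∷⟨ e ⟩ r) = !∈ p ∷⟨ e ⟩ strip r

-- Menger's theorem, by induction on a list of edges

record Linkage (Γ : Graph) (X Y : Sub (n Γ)) (k : ℕ) : Set where
  open Walks Γ
  field
    lane : Fin k → Sub (n Γ)
    src dst : Fin k → V
    src∈ : ∀ i → src i ∈ X
    dst∈ : ∀ i → dst i ∈ Y
    path : ∀ i → Path (lane i) (src i) (dst i)
    disj : ∀ i j → i ≢ j → ∀ v → v ∈ lane i → v ∉ lane j

∁ : ∀ {m} → Sub m → Sub m
∁ Z = ⊤ˢ ∖ Z

∁⁺ : ∀ {m} {Z : Sub m} {v} → v ∉ Z → v ∈ ∁ Z
∁⁺ = ∖⁺ ∈⊤

Separates : (Γ : Graph) (X Y Z : Sub (n Γ)) → Set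
Separates Γ X Y Z = ∀ u v → u ∈ X → v ∈ Y → ¬ Walks.Path Γ (∁ Z) u v

-- If `v` were missed, the image would be a proper subset of `S` with `k` elements. In Menger's
-- theorem this makes every vertex of `P` the end of some lane.
onto : ∀ {m k} (f : Fin k → Fin m) (S : Sub m) → (∀ i j → f i ≡ f j → i ≡ j) → (∀ i → f i ∈ S) → # S ≤ k →
  ∀ v → v ∈ S → ∃ λ i → f i ≡ v
onto f S inj f∈ le v v∈ with any? (λ i → f i FP.≟ v)
... | yes p = p
... | no ¬p = ⊥-elim (<⇒≱ (≤-trans (s≤s (#-image-inj f inj)) (#-strict {S = image f} sub v∈ new)) le)
  where
  sub : image f ⊆ S
  sub u p with image⁻ p
  ... | i , refl = f∈ i
  new : v ∉ image f
  new p with image⁻ p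
  ... | i , e = ¬p (i , sym e)

module Edges (N : ℕ) where

  Joins : Fin N × Fin N → Fin N → Fin N → Set
  Joins (x , y) u v = (u ≡ x × v ≡ y) ⊎ (u ≡ y × v ≡ x)

  joins? : ∀ e u v → Dec (Joins e u v)
  joins? (x , y) u v = ((u FP.≟ x) ×-dec (v FP.≟ y)) ⊎-dec ((u FP.≟ y) ×-dec (v FP.≟ x))

  In : List (Fin N × Fin N) → Fin N → Fin N → Set
  In []       u v = ⊥
  In (e ∷ es) u v = Joins e u v ⊎ In es u v

  in? : ∀ es u v → Dec (In es u v)
  in? []       u v = no λ ()
  in? (e ∷ es) u v = joins? e u v ⊎-dec in? es u v

  in-sym : ∀ es {u v} → In es u v → In es v u
  in-sym (e ∷ es) (inj₁ (inj₁ (a , b))) = inj₁ (inj₂ (b , a))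
  in-sym (e ∷ es) (inj₁ (inj₂ (a , b))) = inj₁ (inj₁ (b , a))
  in-sym (e ∷ es) (inj₂ p)              = inj₂ (in-sym es p)

  E? : ∀ es u v → Dec (u ≢ v × In es u v)
  E? es u v = ¬? (u FP.≟ v) ×-dec in? es u v

  opaque
    eadj : List (Fin N × Fin N) → Fin N → Fin N → Bool
    eadj es u v = does (E? es u v)

    eadj⁺ : ∀ {es u v} → u ≢ v → In es u v → eadj es u v ≡ true
    eadj⁺ {es} {u} {v} p q = dec-true (E? es u v) (p , q)

    eadj⁻ : ∀ {es u v} → eadj es u v ≡ true → u ≢ v × In es u v
    eadj⁻ {es} {u} {v} e = does⁻ (E? es u v) e

  ⇔-Bool : ∀ {a b : Bool} → (a ≡ true → b ≡ true) → (b ≡ true → a ≡ true) → a ≡ b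
  ⇔-Bool {true}  {b}     f g = sym (f refl)
  ⇔-Bool {false} {false} f g = refl
  ⇔-Bool {false} {true}  f g = g refl

  gr : List (Fin N × Fin N) → Graph
  gr es = record
    { n = N ; adj = eadj es
    ; sym = λ u v → ⇔-Bool (flip {u} {v}) (flip {v} {u})
    ; irrefl = λ v → BP.¬-not λ e → proj₁ (eadj⁻ {es} e) refl }
    where
    flip : ∀ {u v} → eadj es u v ≡ true → eadj es v u ≡ true
    flip e = let (p , q) = eadj⁻ {es} e in eadj⁺ {es} (p ∘ sym) (in-sym es q)

  weaken : ∀ {e es S u v} → Walks.Path (gr es) S u v → Walks.Path (gr (e ∷ es)) S u v
  weaken [ p ]        = [ p ]
  weaken {e} {es} (p ∷⟨ a ⟩ r) = let (x , y) = eadj⁻ {es} a in p ∷⟨ eadj⁺ {e ∷ es} x (inj₂ y) ⟩ weaken r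

  -- The part of a lane before it first meets `P`. `T` is taken as a component of the lane minus
  -- `P`, so it may exceed the initial segment of the path; what counts is that `s` reaches all of
  -- it and that it avoids `P`.
  record Trunc (Γ : Graph) (P ln : Sub (n Γ)) (s : Fin (n Γ)) : Set where
    open Walks Γ
    field
      T    : Sub (n Γ)
      end′ : V
      end∈ : end′ ∈ ln
      endP : end′ ∈ P
      T⊆   : T ⊆ ln
      T∉   : ∀ v → v ∈ T → v ∉ P
      from : ∀ v → v ∈ T → Path T s v
      full : Path (T ∪ ｛ end′ ｝) s end′

  trunc : ∀ {Γ} (P ln : Sub (n Γ)) {s p} → Walks.Path Γ ln s p → p ∈ P → Trunc Γ P ln s
  trunc {Γ} P ln {s} {p} w p∈ with s ∈? P
  ... | yes s∈ = record { T = ∅ ; end′ = s ; end∈ = Walks.start Γ w ; endP = s∈ ; T⊆ = λ v q → ⊥-elim (∉∅ q)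
                        ; T∉ = λ v q → ⊥-elim (∉∅ q) ; from = λ v q → ⊥-elim (∉∅ q) ; full = [ ∪ʳ (｛｝⁺ s) ] }
  ... | no s∉ with Walks.crossing Γ (∁ P) w (∁⁺ s∉) (λ q → ∖ʳ q p∈)
  ...   | x , y , r , y∈ , e , y∉ = record
    { T = comp (ln ∩ ∁ P) s ; end′ = y ; end∈ = y∈ ; endP = decidable-stable (y ∈? P) (λ z → y∉ (∁⁺ z))
    ; T⊆ = λ v q → ∩ˡ (comp-⊆ v q) ; T∉ = λ v q → ∖ʳ (∩ʳ (comp-⊆ v q)) ; from = λ v q → comp-path q
    ; full = mapʷ ∪⊆ˡ (comp-path (comp-reach r)) ++ʷ edge (∪ˡ (comp-reach r)) (∪ʳ (｛｝⁺ y)) e }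
    where open Walks Γ

  module Step (e : Fin N × Fin N) (es : List (Fin N × Fin N)) (X Y : Sub N) (k : ℕ) where
    Γ′ = gr es
    Γ = gr (e ∷ es)
    module W′ = Walks Γ′
    module WΓ = Walks Γ

    liftL : Linkage Γ′ X Y k → Linkage Γ X Y k
    liftL L = record { lane = lane ; src = src ; dst = dst ; src∈ = src∈ ; dst∈ = dst∈ ; path = λ i → weaken (path i) ; disj = disj }
      where open Linkage L

    Out : Set
    Out = Linkage Γ X Y k ⊎ ∃ λ Z → # Z < k × Separates Γ X Y Z

    module _ (S : Sub N) (S<k : # S < k) (sepS : Separates Γ′ X Y S) where

      R : Sub N
      R = ⋃ X (W′.comp (∁ S))

      R-X : ∀ {u} → u ∈ X → u ∉ S → u ∈ R
      R-X p q = ⋃⁺ _ p (W′.comp-∋ (∁⁺ q))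

      R-step : ∀ {a b} → a ∈ R → b ∉ S → a W′.~ b → b ∈ R
      R-step p q a = let (u , u∈ , c) = ⋃⁻ p in ⋃⁺ u u∈ (W′.comp-closed c (∁⁺ q) a)

      R-S : ∀ {a} → a ∈ R → a ∉ S
      R-S p = let (u , u∈ , c) = ⋃⁻ p in ∖ʳ (W′.comp-⊆ _ c)

      R-Y : ∀ {a} → a ∈ R → a ∉ Y
      R-Y p q = let (u , u∈ , c) = ⋃⁻ p in sepS u _ u∈ q (W′.mapʷ W′.comp-⊆ (W′.comp-path c))

      R-walk : ∀ {a b T} → a ∈ R → (∀ v → v ∈ T → v ∉ S) → W′.Path T a b → b ∈ R
      R-walk p h [ _ ]        = p
      R-walk p h (_ ∷⟨ a ⟩ r) = R-walk (R-step p (h _ (W′.start r)) a) h r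

      old-edge : ∀ {a b} → a WΓ.~ b → ¬ Joins e a b → a W′.~ b
      old-edge a ¬j with eadj⁻ {e ∷ es} a
      ... | p , inj₁ j = ⊥-elim (¬j j)
      ... | p , inj₂ q = eadj⁺ {es} p q

      -- `S` stops separating only if the new edge leads from `R` to a vertex outside `R` and `S`;
      -- otherwise `R` remains closed in the larger graph.
      stay : (∀ {a b} → a ∈ R → b ∉ S → Joins e a b → b ∈ R) → Separates Γ X Y S
      stay h u v u∈ v∈ w = R-Y (go (R-X u∈ (∖ʳ (WΓ.start w))) w) v∈
        where
        go : ∀ {a b} → a ∈ R → WΓ.Path (∁ S) a b → b ∈ R
        go p [ _ ] = p
        go {a} p (_∷⟨_⟩_ {w = c} _ a~c r) with joins? e a c
        ... | yes j = go (h p (∖ʳ (WΓ.start r)) j) r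
        ... | no ¬j = go (R-step p (∖ʳ (WΓ.start r)) (old-edge a~c ¬j)) r

      module Main (x y : Fin N) (ejoin : ∀ {a b} → Joins e a b → Joins (x , y) a b) (xy : WΓ._~_ x y)
                  (x∈R : x ∈ R) (y∉R : y ∉ R) (y∉S : y ∉ S) where
        P Q : Sub N
        P = S ∪ ｛ x ｝
        Q = S ∪ ｛ y ｝

        P≤ : # P ≤ suc (# S)
        P≤ = ≤-trans (#-∪ S ｛ x ｝) (≤-trans (+-monoʳ-≤ (# S) (#-｛｝ x)) (≤-reflexive (+-comm (# S) 1)))

        R∖P-walk : ∀ {T a b} → WΓ.Path (T ∩ (R ∖ P)) a b → W′.Path T a b
        R∖P-walk [ p ] = [ ∩ˡ p ]
        R∖P-walk {b = b} (p ∷⟨ a ⟩ r) = ∩ˡ p ∷⟨ old-edge a nj ⟩ R∖P-walk r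
          where
          nj : ¬ Joins e _ _
          nj j with ejoin j
          ... | inj₁ (refl , _) = ∖ʳ (∩ʳ p) (∪ʳ (｛｝⁺ x))
          ... | inj₂ (refl , _) = y∉R (∖ˡ (∩ʳ p))

        -- A walk from `X` to `Y` has to meet `P`. Up to its first vertex there it stays in `R`, so
        -- it cannot use the new edge, whose ends are `x ∈ P` and `y ∉ R`. This initial part is thus
        -- a walk of the old graph, and `Z` meets it.
        sepP : ∀ Z → Separates Γ′ X P Z → Separates Γ X Y Z
        sepP Z sep u v u∈ v∈ w with u ∈? P
        ... | yes u∈P = sep u u u∈ u∈P [ WΓ.start w ]
        ... | no u∉P with WΓ.crossing (R ∖ P) w (∖⁺ (R-X u∈ (u∉P ∘ ∪ˡ)) u∉P) (λ q → R-Y (∖ˡ q) v∈)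
        ...   | a , b , r , b∈ , a~b , b∉ with b ∈? P
        ...     | no b∉P = b∉ (∖⁺ (R-step (∖ˡ (∩ʳ (WΓ.end r))) (b∉P ∘ ∪ˡ) (old-edge a~b nj)) b∉P)
          where
          nj : ¬ Joins e a b
          nj j with ejoin j
          ... | inj₁ (refl , _) = ∖ʳ (∩ʳ (WΓ.end r)) (∪ʳ (｛｝⁺ x))
          ... | inj₂ (_ , refl) = b∉P (∪ʳ (｛｝⁺ x))
        ...     | yes b∈P = sep u b u∈ b∈P (R∖P-walk r W′.++ʷ W′.edge (∩ˡ (WΓ.end r)) b∈ (old-edge a~b nj))
          where
          nj : ¬ Joins e a b
          nj j with ejoin j
          ... | inj₁ (refl , _) = ∖ʳ (∩ʳ (WΓ.end r)) (∪ʳ (｛｝⁺ x))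
          ... | inj₂ (refl , _) = y∉R (∖ˡ (∩ʳ (WΓ.end r)))

        far : Sub N
        far = ∁ (R ∪ Q)

        far-nj : ∀ {a b} → a ∈ far → ¬ Joins e a b
        far-nj p j with ejoin j
        ... | inj₁ (refl , _) = ∖ʳ p (∪ˡ x∈R)
        ... | inj₂ (refl , _) = ∖ʳ p (∪ʳ (∪ʳ (｛｝⁺ y)))

        far-walk : ∀ {T a b} → WΓ.Path (T ∩ far) a b → W′.Path T a b
        far-walk [ p ] = [ ∩ˡ p ]
        far-walk (p ∷⟨ a ⟩ r) = ∩ˡ p ∷⟨ old-edge a (far-nj (∩ʳ p)) ⟩ far-walk r

        sepQ : ∀ Z → Separates Γ′ Q Y Z → Separates Γ X Y Z
        sepQ Z sep u v u∈ v∈ w with v ∈? Q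
        ... | yes v∈Q = sep v v v∈Q v∈ [ WΓ.end w ]
        ... | no v∉Q with WΓ.crossing far (WΓ.reverseʷ w) (∁⁺ v∉) u∉
          where
          v∉ : v ∉ R ∪ Q
          v∉ q with ∪⁻ q
          ... | inj₁ a = R-Y a v∈
          ... | inj₂ b = v∉Q b
          u∉ : u ∉ far
          u∉ q with u ∈? S
          ... | yes s = ∖ʳ q (∪ʳ (∪ˡ s))
          ... | no s  = ∖ʳ q (∪ˡ (R-X u∈ s))
        ...   | a , b , r , b∈ , a~b , b∉ with ∪⁻ (decidable-stable (b ∈? (R ∪ Q)) (λ z → b∉ (∁⁺ z)))
        ...     | inj₁ b∈R = ∖ʳ a∈far (∪ˡ (R-step b∈R (λ s → ∖ʳ a∈far (∪ʳ (∪ˡ s))) (W′.~-sym (old-edge a~b (far-nj a∈far)))))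
          where
          a∈far : a ∈ far
          a∈far = ∩ʳ (WΓ.end r)
        ...     | inj₂ b∈Q = sep b v b∈Q v∈ (W′.edge b∈ (∩ˡ (WΓ.end r)) (W′.~-sym (old-edge a~b (far-nj (∩ʳ (WΓ.end r)))))
                                W′.++ʷ W′.reverseʷ (far-walk r))

        -- First halves stay in `R` until they end in `P`, second halves avoid `R`; so the two
        -- families meet only in `S`, where they are glued. The half ending at `x` and the one
        -- starting at `y` are joined by the new edge.
        module Join (P≤k : # P ≤ k) (LA : Linkage Γ′ X P k) (LB : Linkage Γ′ Q Y k) where
          module A = Linkage LA
          module B = Linkage LB
          tA : ∀ i → Trunc Γ′ P (A.lane i) (A.src i)
          tA i = trunc P (A.lane i) (A.path i) (A.dst∈ i)
          tB : ∀ j → Trunc Γ′ Q (B.lane j) (B.dst j)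
          tB j = trunc Q (B.lane j) (W′.reverseʷ (B.path j)) (B.src∈ j)
          module TA i = Trunc (tA i)
          module TB j = Trunc (tB j)
          p q : Fin k → Fin N
          p = TA.end′
          q = TB.end′
          p-inj : ∀ i j → p i ≡ p j → i ≡ j
          p-inj i j eq with i FP.≟ j
          ... | yes r = r
          ... | no ne = ⊥-elim (A.disj i j ne (p i) (TA.end∈ i) (subst (_∈ A.lane j) (sym eq) (TA.end∈ j)))
          q-inj : ∀ i j → q i ≡ q j → i ≡ j
          q-inj i j eq with i FP.≟ j
          ... | yes r = r
          ... | no ne = ⊥-elim (B.disj i j ne (q i) (TB.end∈ i) (subst (_∈ B.lane j) (sym eq) (TB.end∈ j)))
          T-R : ∀ i v → v ∈ TA.T i → v ∈ R
          T-R i v v∈ = R-walk (R-X (A.src∈ i) (λ s → TA.T∉ i _ (W′.start w) (∪ˡ s))) (λ u u∈ s → TA.T∉ i u u∈ (∪ˡ s)) w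
            where w = TA.from i v v∈
          T′-R : ∀ j v → v ∈ TB.T j → v ∉ R
          T′-R j v v∈ r = R-Y (R-walk r (λ u u∈ s → TB.T∉ j u u∈ (∪ˡ s)) (W′.reverseʷ (TB.from j v v∈))) (B.dst∈ j)
          -- the end of the first half that the second half starting at q continues
          mate : ∀ j → ∃ λ i → (p i ≡ q j × q j ∈ S) ⊎ (p i ≡ x × q j ≡ y)
          mate j with ∪⁻ (TB.endP j)
          ... | inj₁ s = let (i , e) = onto p P p-inj TA.endP P≤k (q j) (∪ˡ s) in i , inj₁ (e , s)
          ... | inj₂ t = let (i , e) = onto p P p-inj TA.endP P≤k x (∪ʳ (｛｝⁺ x)) in i , inj₂ (e , ｛｝⁻ t)
          i′ : Fin k → Fin k
          i′ j = proj₁ (mate j)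
          α β : Fin k → Sub N
          α i = TA.T i ∪ ｛ p i ｝
          β j = TB.T j ∪ ｛ q j ｝
          α⊆ : ∀ i v → v ∈ α i → v ∈ A.lane i
          α⊆ i v m with ∪⁻ m
          ... | inj₁ a = TA.T⊆ i v a
          ... | inj₂ b = subst (_∈ A.lane i) (sym (｛｝⁻ b)) (TA.end∈ i)
          β⊆ : ∀ j v → v ∈ β j → v ∈ B.lane j
          β⊆ j v m with ∪⁻ m
          ... | inj₁ a = TB.T⊆ j v a
          ... | inj₂ b = subst (_∈ B.lane j) (sym (｛｝⁻ b)) (TB.end∈ j)
          αβ : ∀ i j v → v ∈ α i → v ∈ β j → v ≡ p i × v ≡ q j × v ∈ S
          αβ i j v a b with ∪⁻ a | ∪⁻ b
          ... | inj₁ c | inj₁ d = ⊥-elim (T′-R j v d (T-R i v c))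
          ... | inj₁ c | inj₂ d with ∪⁻ (TB.endP j)
          ...   | inj₁ s = ⊥-elim (TA.T∉ i v c (∪ˡ (subst (_∈ S) (sym (｛｝⁻ d)) s)))
          ...   | inj₂ t = ⊥-elim (y∉R (subst (_∈ R) (trans (｛｝⁻ d) (｛｝⁻ t)) (T-R i v c)))
          αβ i j v a b | inj₂ c | inj₁ d with ∪⁻ (TA.endP i)
          ...   | inj₁ s = ⊥-elim (TB.T∉ j v d (∪ˡ (subst (_∈ S) (sym (｛｝⁻ c)) s)))
          ...   | inj₂ t = ⊥-elim (T′-R j v d (subst (_∈ R) (sym (trans (｛｝⁻ c) (｛｝⁻ t))) x∈R))
          αβ i j v a b | inj₂ c | inj₂ d with ∪⁻ (TA.endP i)
          ...   | inj₁ s = ｛｝⁻ c , ｛｝⁻ d , subst (_∈ S) (sym (｛｝⁻ c)) s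
          ...   | inj₂ t with ∪⁻ (TB.endP j)
          ...     | inj₁ s = ｛｝⁻ c , ｛｝⁻ d , subst (_∈ S) (sym (｛｝⁻ d)) s
          ...     | inj₂ t′ = ⊥-elim (y∉R (subst (_∈ R) (trans (sym (trans (｛｝⁻ c) (｛｝⁻ t))) (trans (｛｝⁻ d) (｛｝⁻ t′))) x∈R))
          i′-inj : ∀ j j′ → i′ j ≡ i′ j′ → j ≡ j′
          i′-inj j j′ eq with mate j | mate j′
          ... | i , inj₁ (a , _) | _ , inj₁ (b , _) = q-inj j j′ (trans (sym a) (trans (cong p eq) b))
          ... | i , inj₂ (_ , a) | _ , inj₂ (_ , b) = q-inj j j′ (trans a (sym b))
          ... | i , inj₁ (a , s) | _ , inj₂ (b , _) = ⊥-elim (R-S x∈R (subst (_∈ S) (trans (sym a) (trans (cong p eq) b)) s))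
          ... | i , inj₂ (a , _) | _ , inj₁ (b , s) = ⊥-elim (R-S x∈R (subst (_∈ S) (trans (sym b) (trans (cong p (sym eq)) a)) s))
          ln : Fin k → Sub N
          ln j = α (i′ j) ∪ β j
          route : ∀ j → WΓ.Path (ln j) (A.src (i′ j)) (B.dst j)
          route j with mate j
          ... | i , inj₁ (a , _) = WΓ.mapʷ WΓ.∪⊆ˡ (weaken (TA.full i)) WΓ.++ʷ
                  subst (λ z → WΓ.Path (α i ∪ β j) z (B.dst j)) (sym a) (WΓ.mapʷ WΓ.∪⊆ʳ (WΓ.reverseʷ (weaken (TB.full j))))
          ... | i , inj₂ (a , b) = WΓ.mapʷ WΓ.∪⊆ˡ (weaken (TA.full i)) WΓ.++ʷ
                  (WΓ.edge (∪ˡ (∪ʳ (｛｝⁺ (p i)))) (∪ʳ (∪ʳ (｛｝⁺ (q j)))) (subst₂ WΓ._~_ (sym a) (sym b) xy) WΓ.++ʷ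
                   WΓ.mapʷ WΓ.∪⊆ʳ (WΓ.reverseʷ (weaken (TB.full j))))
          half : ∀ j j′ → j ≢ j′ → ∀ v → v ∈ α (i′ j) → v ∈ β j′ → ⊥
          half j j′ ne v a b with αβ (i′ j) j′ v a b | proj₂ (mate j)
          ... | c , d , s | inj₁ (f , _) = ne (q-inj j j′ (trans (sym f) (trans (sym c) d)))
          ... | c , d , s | inj₂ (f , _) = R-S x∈R (subst (_∈ S) (trans c f) s)
          joined : Linkage Γ X Y k
          joined = record { lane = ln ; src = λ j → A.src (i′ j) ; dst = B.dst ; src∈ = λ j → A.src∈ (i′ j) ; dst∈ = B.dst∈
                          ; path = route ; disj = dis }
            where
            dis : ∀ j j′ → j ≢ j′ → ∀ v → v ∈ ln j → v ∉ ln j′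
            dis j j′ ne v a b with ∪⁻ a | ∪⁻ b
            ... | inj₁ c | inj₁ d = A.disj (i′ j) (i′ j′) (ne ∘ i′-inj j j′) v (α⊆ _ v c) (α⊆ _ v d)
            ... | inj₁ c | inj₂ d = half j j′ ne v c d
            ... | inj₂ c | inj₁ d = half j′ j (ne ∘ sym) v d c
            ... | inj₂ c | inj₂ d = B.disj j j′ ne v (β⊆ _ v c) (β⊆ _ v d)

        main : (∀ X Y → Linkage Γ′ X Y k ⊎ ∃ λ Z → # Z < k × Separates Γ′ X Y Z) → Out
        main ih with k ≤? # P
        ... | no lt = inj₂ (P , ≰⇒> lt , sepP P λ u v u∈ v∈ w → ∖ʳ (W′.end w) v∈)
        ... | yes _ with ih X P | ih Q Y
        ...   | inj₂ (Z , z , s) | _                = inj₂ (Z , z , sepP Z s)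
        ...   | inj₁ _           | inj₂ (Z , z , s) = inj₂ (Z , z , sepQ Z s)
        ...   | inj₁ LA          | inj₁ LB          = inj₁ (Join.joined (≤-trans P≤ S<k) LA LB)

  menger-list : (es : List (Fin N × Fin N)) (X Y : Sub N) (k : ℕ) →
    Linkage (gr es) X Y k ⊎ ∃ λ Z → # Z < k × Separates (gr es) X Y Z
  menger-list [] X Y k with k ≤? # (X ∩ Y)
  ... | yes le = inj₁ record
    { lane = λ i → ｛ at i ｝ ; src = at ; dst = at ; src∈ = λ i → ∩ˡ (mem i) ; dst∈ = λ i → ∩ʳ (mem i)
    ; path = λ i → [ ｛｝⁺ (at i) ] ; disj = λ i j ne v a b → ne (inj i j (trans (sym (｛｝⁻ a)) (｛｝⁻ b))) }
    where open Pick (pick (X ∩ Y) k le)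
  ... | no gt = inj₂ (X ∩ Y , ≰⇒> gt , sep)
    where
    sep : Separates (gr []) X Y (X ∩ Y)
    sep u v p q [ a ] = ∖ʳ a (∩⁺ p q)
    sep u v p q (_ ∷⟨ a ⟩ _) = proj₂ (eadj⁻ {[]} a)
  menger-list (e ∷ es) X Y k with menger-list es X Y k
  ... | inj₁ L = inj₁ (Step.liftL e es X Y k L)
  ... | inj₂ (S , S<k , sepS) = cases (x ∈? R) (y ∈? R) (x ∈? S) (y ∈? S) (x FP.≟ y)
    where
    open Step e es X Y k hiding (R)
    R = Step.R e es X Y k S S<k sepS
    x = proj₁ e
    y = proj₂ e
    cases : Dec (x ∈ R) → Dec (y ∈ R) → Dec (x ∈ S) → Dec (y ∈ S) → Dec (x ≡ y) → Out
    cases (yes x∈) (no y∉) _ (no y∉S) (no ne) =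
      Main.main S S<k sepS x y id (eadj⁺ {e ∷ es} ne (inj₁ (inj₁ (refl , refl)))) x∈ y∉ y∉S (λ X Y → menger-list es X Y k)
    cases (no x∉) (yes y∈) (no x∉S) _ (no ne) =
      Main.main S S<k sepS y x (λ { (inj₁ p) → inj₂ p ; (inj₂ p) → inj₁ p })
        (eadj⁺ {e ∷ es} (ne ∘ sym) (inj₁ (inj₂ (refl , refl)))) y∈ x∉ x∉S (λ X Y → menger-list es X Y k)
    cases (yes x∈) (yes y∈) _ _ _ = inj₂ (S , S<k , stay S S<k sepS λ { _ _ (inj₁ (_ , refl)) → y∈ ; _ _ (inj₂ (_ , refl)) → x∈ })
    cases (no x∉) (no y∉) _ _ _ = inj₂ (S , S<k , stay S S<k sepS λ { a _ (inj₁ (refl , _)) → ⊥-elim (x∉ a) ; a _ (inj₂ (refl , _)) → ⊥-elim (y∉ a) })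
    cases (yes x∈) (no y∉) _ (yes y∈S) _ = inj₂ (S , S<k , stay S S<k sepS λ { a s (inj₁ (_ , refl)) → ⊥-elim (s y∈S) ; a s (inj₂ (refl , _)) → ⊥-elim (y∉ a) })
    cases (no x∉) (yes y∈) (yes x∈S) _ _ = inj₂ (S , S<k , stay S S<k sepS λ { a s (inj₁ (refl , _)) → ⊥-elim (x∉ a) ; a s (inj₂ (_ , refl)) → ⊥-elim (s x∈S) })
    cases (yes x∈) (no y∉) _ (no _) (yes eq) = ⊥-elim (y∉ (subst (_∈ R) eq x∈))
    cases (no x∉) (yes y∈) (no _) _ (yes eq) = ⊥-elim (x∉ (subst (_∈ R) (sym eq) y∈))

menger : (Γ : Graph) (X Y : Sub (n Γ)) (k : ℕ) → Linkage Γ X Y k ⊎ ∃ λ Z → # Z < k × Separates Γ X Y Z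
menger Γ X Y k with Edges.menger-list (n Γ) es X Y k
  where
  es = filter (λ (u , v) → Walks._~?_ Γ u v) (cartesianProduct (allFin (n Γ)) (allFin (n Γ)))
... | inj₁ L = inj₁ record { lane = lane ; src = src ; dst = dst ; src∈ = src∈ ; dst∈ = dst∈ ; path = λ i → there′ (path i) ; disj = disj }
  where
  open Linkage L
  open Edges (n Γ)
  pairs = cartesianProduct (allFin (n Γ)) (allFin (n Γ))
  from : ∀ ps {u v} → In (filter (λ (u , v) → Walks._~?_ Γ u v) ps) u v → Adj Γ u v
  from ps i = go _ (λ p → proj₂ (∈-filter⁻ (λ (u , v) → Walks._~?_ Γ u v) {xs = ps} p)) i
    where
    go : ∀ qs → (∀ {a b} → (a , b) ML.∈ qs → Adj Γ a b) → ∀ {u v} → In qs u v → Adj Γ u v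
    go (e ∷ qs) h (inj₁ (inj₁ (refl , refl))) = h (here refl)
    go (e ∷ qs) h (inj₁ (inj₂ (refl , refl))) = Walks.~-sym Γ (h (here refl))
    go (e ∷ qs) h (inj₂ i) = go qs (h ∘ there) i
  there′ : ∀ {S u v} → Walks.Path (gr _) S u v → Walks.Path Γ S u v
  there′ [ p ] = [ p ]
  there′ (p ∷⟨ a ⟩ r) = p ∷⟨ from pairs (proj₂ (eadj⁻ a)) ⟩ there′ r
... | inj₂ (Z , z , s) = inj₂ (Z , z , λ u v u∈ v∈ w → s u v u∈ v∈ (back w))
  where
  open Edges (n Γ)
  to : ∀ qs {u v} → (u , v) ML.∈ qs → In qs u v
  to (e ∷ qs) (here refl) = inj₁ (inj₁ (refl , refl))
  to (e ∷ qs) (there p)   = inj₂ (to qs p)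
  back : ∀ {S u v} → Walks.Path Γ S u v → Walks.Path (gr _) S u v
  back [ p ] = [ p ]
  back {u = u} (_∷⟨_⟩_ {w = w} p a r) =
    p ∷⟨ eadj⁺ (λ { refl → Walks.~-irrefl Γ a })
           (to _ (∈-filter⁺ (λ (u , v) → Walks._~?_ Γ u v) (∈-cartesianProduct⁺ (∈-allFin u) (∈-allFin w)) a)) ⟩ back r

-- Greedy colouring

colouring : ∀ {m} (E : Fin m → Fin m → Bool) (d : ℕ) → (∀ u v → E u v ≡ E v u) → (∀ v → # (E v) ≤ d) →
  ∃ λ (χ : Fin m → Fin (suc d)) → ∀ u v → u ≢ v → E u v ≡ true → χ u ≢ χ v
colouring {zero} E d E-sym deg = (λ ()) , λ ()
colouring {suc m} E d E-sym deg with colouring (λ u v → E (fs u) (fs v)) d (λ u v → E-sym (fs u) (fs v))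
                                       (λ v → ≤-trans (#-tail (E (fs v))) (deg (fs v)))
... | χ , ok = χ′ , ok′
  where
  used : Sub (suc d)
  used = ⋃ (E fz ∘ fs) (λ j → ｛ χ j ｝)
  free : ∃ λ c → c ∉ used
  free with any? (λ c → ¬? (c ∈? used))
  ... | yes p = p
  ... | no ¬p = ⊥-elim (<⇒≱ (n<1+n d) (≤-trans (≤-reflexive (sym (#-⊤ {suc d}))) (≤-trans (#-mono all)
      (≤-trans (#-⋃-bound (E fz ∘ fs) (λ j → ｛ χ j ｝) 1 λ j _ → #-｛｝ (χ j))
      (≤-trans (≤-reflexive (*-identityˡ _)) (≤-trans (#-tail (E fz)) (deg fz)))))))
    where
    all : ⊤ˢ ⊆ used
    all c _ = decidable-stable (c ∈? used) λ q → ¬p (c , q)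
  χ′ : Fin (suc m) → Fin (suc d)
  χ′ fz     = proj₁ free
  χ′ (fs v) = χ v
  ok′ : ∀ u v → u ≢ v → E u v ≡ true → χ′ u ≢ χ′ v
  ok′ fz     fz     ne e eq = ne refl
  ok′ fz     (fs v) ne e eq = proj₂ free (⋃⁺ v (∈! e) (subst (_∈ ｛ χ v ｝) (sym eq) (｛｝⁺ (χ v))))
  ok′ (fs u) fz     ne e eq = proj₂ free (⋃⁺ u (∈! (trans (E-sym fz (fs u)) e)) (subst (_∈ ｛ χ u ｝) eq (｛｝⁺ (χ u))))
  ok′ (fs u) (fs v) ne e eq = ok u v (ne ∘ cong fs) e eq

-- If every `L i` met `Z`, choosing a common vertex for each `i` would inject `k` indices into `Z`.
avoid : ∀ {m k} (L : Fin k → Sub m) → (∀ i j → i ≢ j → ∀ v → v ∈ L i → v ∉ L j) → (Z : Sub m) → # Z < k →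
  ∃ λ i → ∀ v → v ∈ L i → v ∉ Z
avoid L disj Z lt with any? (λ i → all? (λ v → (v ∈? L i) →-dec ¬? (v ∈? Z)))
... | yes p = p
... | no ¬p = ⊥-elim (<⇒≱ lt (≤-trans (#-image-inj hit hit-inj) (#-mono sub)))
  where
  bad : ∀ i → ∃ λ v → v ∈ L i × v ∈ Z
  bad i with any? (λ v → (v ∈? L i) ×-dec (v ∈? Z))
  ... | yes q = q
  ... | no ¬q = ⊥-elim (¬p (i , λ v a b → ¬q (v , a , b)))
  hit = λ i → proj₁ (bad i)
  hit-inj : ∀ i j → hit i ≡ hit j → i ≡ j
  hit-inj i j e with i FP.≟ j
  ... | yes r = r
  ... | no ne = ⊥-elim (disj i j ne (hit i) (proj₁ (proj₂ (bad i))) (subst (_∈ L j) (sym e) (proj₁ (proj₂ (bad j)))))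
  sub : image hit ⊆ Z
  sub v q with image⁻ q
  ... | i , refl = proj₂ (proj₂ (bad i))

-- Simple paths

module SimplePaths (Γ : Graph) where
  open Walks Γ

  -- Each step removes the current vertex from the ground set of the remaining path, so the index
  -- itself enforces simplicity.
  data SP (S : Sub (n Γ)) : V → V → Set where
    one  : ∀ {a} → a ∈ S → SP S a a
    step : ∀ {a b c} → a ∈ S → a ~ c → SP (S ∖ ｛ a ｝) c b → SP S a b

  -- Cutting a walk after its last visit to `a` removes all loops through `a` at once.
  last-visit : ∀ {S a b} → a ≢ b → ∀ {u} → Path S u b → Path (S ∖ ｛ a ｝) u b ⊎ ∃ λ c → a ~ c × Path (S ∖ ｛ a ｝) c b
  last-visit ne [ p ] = inj₁ [ ∖⁺ p (λ q → ne (sym (｛｝⁻ q))) ]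
  last-visit {a = a} ne {u} (_∷⟨_⟩_ {w = w} p e r) with last-visit ne r
  ... | inj₂ q = inj₂ q
  ... | inj₁ q with u FP.≟ a
  ...   | yes refl = inj₂ (w , e , q)
  ...   | no ¬e    = inj₁ (∖⁺ p (λ x → ¬e (｛｝⁻ x)) ∷⟨ e ⟩ q)

  opaque
    simple : ∀ {S a b} → Path S a b → SP S a b
    simple {S} w = go (# S) ≤-refl w
      where
      go : ∀ f {S a b} → # S ≤ f → Path S a b → SP S a b
      go f {S} {a} {b} le w with a FP.≟ b
      ... | yes refl = one (start w)
      ... | no ne with last-visit ne w
      ...   | inj₁ q = ⊥-elim (∖ʳ (start q) (｛｝⁺ a))
      go zero {S} {a} le w | no ne | inj₂ (c , e , q) = ⊥-elim (<⇒≱ (#-∈ (start w)) le)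
      go (suc f) {S} {a} le w | no ne | inj₂ (c , e , q) =
        step (start w) e (go f (≤-pred (≤-trans (#-strict {v = a} (λ v → ∖ˡ) (start w) (λ z → ∖ʳ z (｛｝⁺ a))) le)) q)

-- An induced version of Menger's theorem for bounded degree

module InducedMenger (G : Graph) (Δ : ℕ) (Δ-bound : ∀ v → # (adj G v) ≤ Δ) where
  open Walks G
  open Degree Δ Δ-bound

  near : V → V → Set
  near a v = a ≡ v ⊎ a ~ v

  near? : ∀ a v → Dec (near a v)
  near? a v = (a FP.≟ v) ⊎-dec (a ~? v)

  Sep : (U X Y Z : Sub (n G)) → Set
  Sep U X Y Z = ∀ u v → u ∈ X → v ∈ Y → ¬ Path (U ∖ Z) u v

  Linked : (U X Y : Sub (n G)) → ℕ → Set
  Linked U X Y K = ∀ Z → # Z < K → ¬ Sep U X Y Z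

  -- Degree at most two inside `U`; `a` and `b` may coincide or lie outside `U`. The property passes
  -- to subsets of `U`, so later rounds keep what earlier ones gained.
  Deg2 : Sub (n G) → V → Set
  Deg2 U v = ∃₂ λ a b → ∀ x → x ∈ U → v ~ x → x ≡ a ⊎ x ≡ b

  -- One round: after contracting the stars around A, at most one path uses each star, so it can be
  -- routed through its centre using at most two further vertices of the star.
  module Round (U X Y A : Sub (n G)) (K : ℕ)
               (apart : ∀ a b v → a ∈ A → b ∈ A → near a v → near b v → a ≡ b)
               (linked : Linked U X Y (suc Δ * K)) where

    Centre : V → V → Set
    Centre v a = a ∈ A × a ∈ U × near a v

    rep′ : ∀ v → (∃ λ a → Centre v a) ⊎ (∀ a → ¬ Centre v a)
    rep′ v with any? (λ a → (a ∈? A) ×-dec ((a ∈? U) ×-dec near? a v))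
    ... | yes p = inj₁ p
    ... | no ¬p = inj₂ λ a q → ¬p (a , q)

    opaque
      rep : V → V
      rep v = [ proj₁ , (λ _ → v) ]′ (rep′ v)

      rep-spec : ∀ v → Centre v (rep v) ⊎ rep v ≡ v
      rep-spec v with rep′ v
      ... | inj₁ (a , c) = inj₁ c
      ... | inj₂ _       = inj₂ refl

      rep-centre : ∀ {v a} → Centre v a → rep v ≡ a
      rep-centre {v} {a} c with rep′ v
      ... | inj₁ (b , d) = apart b a v (proj₁ d) (proj₁ c) (proj₂ (proj₂ d)) (proj₂ (proj₂ c))
      ... | inj₂ none    = ⊥-elim (none a c)

    rep-near : ∀ v → near (rep v) v
    rep-near v with rep-spec v
    ... | inj₁ (_ , _ , q) = q
    ... | inj₂ e = inj₁ e

    Q? : ∀ a b → Dec (a ≢ b × ∃₂ λ u v → u ∈ U × v ∈ U × rep u ≡ a × rep v ≡ b × u ~ v)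
    Q? a b = ¬? (a FP.≟ b) ×-dec any? (λ u → any? (λ v → (u ∈? U) ×-dec ((v ∈? U) ×-dec ((rep u FP.≟ a) ×-dec ((rep v FP.≟ b) ×-dec (u ~? v))))))

    opaque
      qadj : V → V → Bool
      qadj a b = does (Q? a b)

      qadj⁺ : ∀ {a b} → (a ≢ b × ∃₂ λ u v → u ∈ U × v ∈ U × rep u ≡ a × rep v ≡ b × u ~ v) → qadj a b ≡ true
      qadj⁺ {a} {b} p = dec-true (Q? a b) p

      qadj⁻ : ∀ {a b} → qadj a b ≡ true → (a ≢ b × ∃₂ λ u v → u ∈ U × v ∈ U × rep u ≡ a × rep v ≡ b × u ~ v)
      qadj⁻ {a} {b} = does⁻ (Q? a b)

    quotient : Graph
    quotient = record
      { n = n G ; adj = qadj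
      ; sym = λ a b → Edges.⇔-Bool (n G) (flip a b) (flip b a)
      ; irrefl = λ a → BP.¬-not λ e → proj₁ (qadj⁻ e) refl }
      where
      flip : ∀ a b → qadj a b ≡ true → qadj b a ≡ true
      flip a b e = let (ne , u , v , u∈ , v∈ , p , q , w) = qadj⁻ e in qadj⁺ (ne ∘ sym , v , u , v∈ , u∈ , q , p , ~-sym w)

    hat : Sub (n G) → Sub (n G)
    hat S = ⋃ (S ∩ U) (λ x → ｛ rep x ｝)

    hat⁻ : ∀ {S a} → a ∈ hat S → ∃ λ x → x ∈ S × x ∈ U × rep x ≡ a
    hat⁻ p = let (x , q , r) = ⋃⁻ p in x , ∩ˡ q , ∩ʳ q , sym (｛｝⁻ r)

    hat⁺ : ∀ {S x} → x ∈ S → x ∈ U → rep x ∈ hat S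
    hat⁺ p q = ⋃⁺ _ (∩⁺ p q) (｛｝⁺ _)

    -- A separator of the quotient becomes one of `U` when each vertex is replaced by its closed
    -- neighbourhood. This is the factor `Δ + 1` lost per round.
    blow : Sub (n G) → Sub (n G)
    blow Z = ⋃ Z (λ z → ball z 1)

    blow⁺ : ∀ {Z v} → rep v ∈ Z → v ∈ blow Z
    blow⁺ {Z} {v} p = ⋃⁺ (rep v) p (nb (rep-near v))
      where
      nb : near (rep v) v → v ∈ ball (rep v) 1
      nb (inj₁ e) = ∪ˡ (subst (_∈ ｛ rep v ｝) e (｛｝⁺ (rep v)))
      nb (inj₂ e) = N-adj (｛｝⁺ (rep v)) e

    project : ∀ {Z u v} → Path (U ∖ blow Z) u v → Walks.Path quotient (∁ Z) (rep u) (rep v)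
    project [ p ] = [ ∁⁺ (∖ʳ p ∘ blow⁺) ]
    project {u = u} (_∷⟨_⟩_ {w = w} p e r) with rep u FP.≟ rep w
    ... | yes q = subst (λ z → Walks.Path quotient _ z _) (sym q) (project r)
    ... | no ne = ∁⁺ (∖ʳ p ∘ blow⁺) ∷⟨ qadj⁺ (ne , u , w , ∖ˡ p , ∖ˡ (start r) , refl , refl , e) ⟩ project r

    opaque
      linkage : Linkage quotient (hat X) (hat Y) K
      linkage with menger quotient (hat X) (hat Y) K
      ... | inj₁ L = L
      ... | inj₂ (Z , z , sep) = ⊥-elim (linked (blow Z) small λ u v u∈ v∈ w →
          sep (rep u) (rep v) (hat⁺ u∈ (∖ˡ (start w))) (hat⁺ v∈ (∖ˡ (end w))) (project w))
        where
        small : # (blow Z) < suc Δ * K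
        small = ≤-trans (s≤s (#-⋃-bound Z (λ z → ball z 1) (suc Δ) λ i _ → ≤-trans (#-ball i 1) (≤-reflexive (trans (^ᵒ-suc (suc Δ) 0) (trans (cong (suc Δ *_) (^ᵒ-zero (suc Δ))) (*-identityʳ (suc Δ)))))))
          (*-monoʳ-< (suc Δ) z)

    module Lk = Linkage linkage
    open SimplePaths quotient

    link : V → V → V → Sub (n G)
    link a u v with u FP.≟ v
    ... | yes _ = ｛ u ｝
    ... | no  _ = ｛ u ｝ ∪ ｛ a ｝ ∪ ｛ v ｝

    link⁻ : ∀ a u v {x} → x ∈ link a u v → x ≡ u ⊎ x ≡ v ⊎ (u ≢ v × x ≡ a)
    link⁻ a u v p with u FP.≟ v
    ... | yes _ = inj₁ (｛｝⁻ p)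
    ... | no ne with ∪⁻ p
    ...   | inj₁ q = inj₁ (｛｝⁻ q)
    ...   | inj₂ q with ∪⁻ q
    ...     | inj₁ r = inj₂ (inj₂ (ne , ｛｝⁻ r))
    ...     | inj₂ r = inj₂ (inj₁ (｛｝⁻ r))

    centre-of : ∀ {a u v} → rep u ≡ a → rep v ≡ a → u ≢ v → a ∈ A × a ∈ U × near a u × near a v
    centre-of {a} {u} {v} p q ne with rep-spec u | rep-spec v
    ... | inj₁ (x , y , z) | _ rewrite p = x , y , z , subst (λ t → near t v) q (rep-near v)
    ... | inj₂ e | inj₁ (x , y , z) rewrite q = x , y , subst (λ t → near t u) p (rep-near u) , z
    ... | inj₂ e | inj₂ f = ⊥-elim (ne (trans (sym e) (trans p (trans (sym q) f))))

    link-path : ∀ {a u v} → rep u ≡ a → rep v ≡ a → Path (link a u v) u v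
    link-path {a} {u} {v} p q with u FP.≟ v
    ... | yes refl = [ ｛｝⁺ u ]
    ... | no ne = let (_ , _ , x , y) = centre-of p q ne in to x ++ʷ from y
      where
      S = ｛ u ｝ ∪ ｛ a ｝ ∪ ｛ v ｝
      a∈ : a ∈ S
      a∈ = ∪ʳ (∪ˡ (｛｝⁺ a))
      to : near a u → Path S u a
      to (inj₁ refl) = [ a∈ ]
      to (inj₂ e)    = edge (∪ˡ (｛｝⁺ u)) a∈ (~-sym e)
      from : near a v → Path S a v
      from (inj₁ refl) = [ a∈ ]
      from (inj₂ e)    = edge a∈ (∪ʳ (∪ʳ (｛｝⁺ v))) e

    link-U : ∀ {a u v x} → rep u ≡ a → rep v ≡ a → u ∈ U → v ∈ U → x ∈ link a u v → x ∈ U × rep x ≡ a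
    link-U {a} {u} {v} p q u∈ v∈ x∈ with link⁻ a u v x∈
    ... | inj₁ refl = u∈ , p
    ... | inj₂ (inj₁ refl) = v∈ , q
    ... | inj₂ (inj₂ (ne , refl)) = let (c , d , _ , _) = centre-of p q ne in d , rep-centre (c , d , inj₁ refl)

    record Lift (S : Sub (n G)) (u : V) : Set where
      field
        ln    : Sub (n G)
        ln-U  : ∀ x → x ∈ ln → x ∈ U × rep x ∈ S
        y     : V
        y∈    : y ∈ Y
        route : Path ln u y
        deg2  : ∀ c → c ∈ A → c ∈ ln → Deg2 ln c

    centre-rep : ∀ {c x} → c ∈ A → c ∈ U → c ~ x → rep x ≡ rep c
    centre-rep p q e = trans (rep-centre (p , q , inj₂ e)) (sym (rep-centre (p , q , inj₁ refl)))

    link-deg2 : ∀ {a u v c} → rep u ≡ a → rep v ≡ a → u ∈ U → v ∈ U → c ∈ A → c ∈ link a u v → ∀ x → x ∈ link a u v → c ~ x → x ≡ u ⊎ x ≡ v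
    link-deg2 {a} {u} {v} p q u∈ v∈ c∈ c∈l x x∈ e with link⁻ a u v x∈
    ... | inj₁ r = inj₁ r
    ... | inj₂ (inj₁ r) = inj₂ r
    ... | inj₂ (inj₂ (ne , refl)) with link-U p q u∈ v∈ c∈l
    ...   | c∈U , repc with trans (sym (rep-centre (c∈ , c∈U , inj₁ refl))) repc
    ...     | refl = ⊥-elim (~-irrefl e)

    lift-path : ∀ {S a b} u → SP S a b → u ∈ U → rep u ≡ a → b ∈ hat Y → Lift S u
    lift-path {S} {a} u (one a∈) u∈ ru b∈ = let (y , y∈ , yU , ry) = hat⁻ b∈ in record
      { ln = link a u y ; ln-U = λ x p → let (s , t) = link-U ru ry u∈ yU p in s , subst (_∈ S) (sym t) a∈
      ; y = y ; y∈ = y∈ ; route = link-path ru ry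
      ; deg2 = λ c p q → u , y , link-deg2 ru ry u∈ yU p q }
    lift-path {S} {a} u (step {c = c} a∈ e r) u∈ ru b∈ with qadj⁻ e
    ... | ne , u′ , v′ , u′∈ , v′∈ , ru′ , rv′ , u′~v′ = record
      { ln = link a u u′ ∪ I.ln ; ln-U = lnU ; y = I.y ; y∈ = I.y∈
      ; route = mapʷ ∪⊆ˡ (link-path ru ru′) ++ʷ (∪ˡ (end (link-path ru ru′)) ∷⟨ u′~v′ ⟩ mapʷ ∪⊆ʳ I.route)
      ; deg2 = d2 }
      where
      module I = Lift (lift-path v′ r v′∈ rv′ b∈)
      lnU : ∀ x → x ∈ link a u u′ ∪ I.ln → x ∈ U × rep x ∈ S
      lnU x p with ∪⁻ p
      ... | inj₁ q = let (s , t) = link-U ru ru′ u∈ u′∈ q in s , subst (_∈ S) (sym t) a∈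
      ... | inj₂ q = let (s , t) = I.ln-U x q in s , ∖ˡ t
      other : ∀ x y → x ∈ link a u u′ → y ∈ I.ln → rep x ≢ rep y
      other x y p q e = ∖ʳ (proj₂ (I.ln-U y q)) (subst (_∈ ｛ a ｝) (trans (sym (proj₂ (link-U ru ru′ u∈ u′∈ p))) e) (｛｝⁺ a))
      d2 : ∀ c → c ∈ A → c ∈ link a u u′ ∪ I.ln → Deg2 (link a u u′ ∪ I.ln) c
      d2 c c∈ p with ∪⁻ p
      ... | inj₁ q = u , u′ , λ x x∈ e → [ (λ z → link-deg2 ru ru′ u∈ u′∈ c∈ q x z e) ,
                                (λ z → ⊥-elim (other c x q z (sym (centre-rep c∈ (proj₁ (lnU c p)) e)))) ]′ (∪⁻ x∈)
      ... | inj₂ q = let (s , t , h) = I.deg2 c c∈ q in s , t , λ x x∈ e →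
              [ (λ z → ⊥-elim (other x c z q (centre-rep c∈ (proj₁ (lnU c p)) e))) , (λ z → h x z e) ]′ (∪⁻ x∈)

    start-at : ∀ i → ∃ λ x → x ∈ X × x ∈ U × rep x ≡ Lk.src i
    start-at i = hat⁻ (Lk.src∈ i)

    opaque
      lifted : ∀ i → Lift (Lk.lane i) (proj₁ (start-at i))
      lifted i = lift-path _ (simple (Lk.path i)) (proj₁ (proj₂ (proj₂ (start-at i)))) (proj₂ (proj₂ (proj₂ (start-at i)))) (Lk.dst∈ i)

    module Lf i = Lift (lifted i)

    U′ : Sub (n G)
    U′ = ⋃ ⊤ˢ Lf.ln

    U′⊆ : U′ ⊆ U
    U′⊆ v p = let (i , _ , q) = ⋃⁻ p in proj₁ (Lf.ln-U i v q)

    lanes-disj : ∀ i j → i ≢ j → ∀ v → v ∈ Lf.ln i → v ∉ Lf.ln j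
    lanes-disj i j ne v p q = Lk.disj i j ne (rep v) (proj₂ (Lf.ln-U i v p)) (proj₂ (Lf.ln-U j v q))

    linked′ : Linked U′ X Y K
    linked′ Z lt sep with avoid Lf.ln lanes-disj Z lt
    ... | i , h = sep _ _ (proj₁ (proj₂ (start-at i))) (Lf.y∈ i) (mapʷ (λ v p → ∖⁺ (⋃⁺ i ∈⊤ p) (h v p)) (Lf.route i))

    -- All neighbours of a centre in `U` are contracted into it, so those in `U′` belong to the one
    -- lane using this star, and that lane keeps at most an entry and an exit next to the centre.
    resolved : ∀ c → c ∈ A → c ∈ U′ → Deg2 U′ c
    resolved c c∈ p with ⋃⁻ p
    ... | i , _ , q with Lf.deg2 i c c∈ q
    ...   | s , t , h = s , t , λ x x∈ e → h x (same x x∈ e) e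
      where
      same : ∀ x → x ∈ U′ → c ~ x → x ∈ Lf.ln i
      same x x∈ e with ⋃⁻ x∈
      ... | j , _ , r with i FP.≟ j
      ...   | yes refl = r
      ...   | no ne = ⊥-elim (Lk.disj i j ne (rep c) (proj₂ (Lf.ln-U i c q))
                  (subst (_∈ Lk.lane j) (centre-rep c∈ (U′⊆ c p) e) (proj₂ (Lf.ln-U j x r))))

  deg2-⊆ : ∀ {U U′ v} → U′ ⊆ U → Deg2 U v → Deg2 U′ v
  deg2-⊆ h (a , b , f) = a , b , λ x p → f x (h x p)

  meet? : ∀ u v → Dec (∃ λ x → near u x × near v x)
  meet? u v = any? (λ x → near? u x ×-dec near? v x)

  opaque
   -- Vertices of equal colour have disjoint closed neighbourhoods, so the stars of a colour class
   -- can be contracted simultaneously. Conflicts reach distance two, which gives `(Δ + 1)² + 1`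
   -- colours.
   χ-spec : ∃ λ (χ : V → Fin (suc (suc Δ ^ᵒ 2))) → ∀ u v → u ≢ v → (∃ λ x → near u x × near v x) → χ u ≢ χ v
   χ-spec = let (χ , ok) = colouring E (suc Δ ^ᵒ 2) E-sym E-deg in χ , λ u v ne m → ok u v ne (!∈ (set⁺ {P? = meet? u} m))
     where
     E : V → V → Bool
     E u = set (meet? u)
     E-sym : ∀ u v → E u v ≡ E v u
     E-sym u v = Edges.⇔-Bool (n G) (flip u v) (flip v u)
       where
       flip : ∀ u v → E u v ≡ true → E v u ≡ true
       flip u v e = let (x , a , b) = set⁻ {P? = meet? u} {v} (∈! e) in !∈ (set⁺ {P? = meet? v} {u} (x , b , a))
     E-deg : ∀ v → # (E v) ≤ suc Δ ^ᵒ 2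
     E-deg v = ≤-trans (#-mono sub) (#-ball v 2)
       where
       one-step : ∀ {u x r} → u ∈ ball v r → near u x → x ∈ ball v (suc r)
       one-step p (inj₁ refl) = N-self p
       one-step p (inj₂ e)    = N-adj p e
       back : ∀ {u x r} → x ∈ ball v r → near u x → u ∈ ball v (suc r)
       back p (inj₁ refl) = N-self p
       back p (inj₂ e)    = N-adj p (~-sym e)
       sub : E v ⊆ ball v 2
       sub u p = let (x , a , b) = set⁻ {P? = meet? v} p in back {r = 1} (one-step {r = 0} (｛｝⁺ v) a) b

  opaque
    round : ∀ U X Y A K → (∀ a b v → a ∈ A → b ∈ A → near a v → near b v → a ≡ b) → Linked U X Y (suc Δ * K) →
      ∃ λ U′ → U′ ⊆ U × Linked U′ X Y K × (∀ c → c ∈ A → c ∈ U′ → Deg2 U′ c)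
    round U X Y A K ap l = Round.U′ U X Y A K ap l , Round.U′⊆ U X Y A K ap l , Round.linked′ U X Y A K ap l , Round.resolved U X Y A K ap l

  χ : V → Fin (suc (suc Δ ^ᵒ 2))
  χ = proj₁ χ-spec

  class? : ∀ j v → Dec (toℕ (χ v) ≡ j)
  class? j v = toℕ (χ v) ≟ j

  class-apart : ∀ j a b v → a ∈ set (class? j) → b ∈ set (class? j) → near a v → near b v → a ≡ b
  class-apart j a b v p q r t = decidable-stable (a FP.≟ b) λ ne → proj₂ χ-spec a b ne (v , r , t)
    (FP.toℕ-injective (trans (set⁻ p) (sym (set⁻ q))))

  opaque
    -- One round per colour: the connectivity drops by a factor `Δ + 1` each time, and once all
    -- colours are treated every vertex has degree at most two in the surviving set.
    rounds : ∀ X Y K j U → Linked U X Y (suc Δ ^ᵒ j * K) →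
      ∃ λ U′ → U′ ⊆ U × Linked U′ X Y K × (∀ v → v ∈ U′ → toℕ (χ v) < j → Deg2 U′ v)
    rounds X Y K zero U l = U , (λ _ p → p) , subst (Linked U X Y) (trans (cong (_* K) (^ᵒ-zero (suc Δ))) (*-identityˡ K)) l , λ v p ()
    rounds X Y K (suc j) U l with round U X Y (set (class? j)) (suc Δ ^ᵒ j * K) (class-apart j)
                                    (subst (Linked U X Y) (trans (cong (_* K) (^ᵒ-suc (suc Δ) j)) (*-assoc (suc Δ) (suc Δ ^ᵒ j) K)) l)
    ... | U₁ , U₁⊆ , l₁ , res with rounds X Y K j U₁ l₁
    ...   | U₂ , U₂⊆ , l₂ , d = U₂ , (λ v p → U₁⊆ v (U₂⊆ v p)) , l₂ , d′
      where
      d′ : ∀ v → v ∈ U₂ → toℕ (χ v) < suc j → Deg2 U₂ v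
      d′ v p lt with toℕ (χ v) ≟ j
      ... | yes e = deg2-⊆ U₂⊆ (res v (set⁺ e) (U₂⊆ v p))
      ... | no ne = d v p (≤∧≢⇒< (≤-pred lt) ne)

  record Bundle (C X Y : Sub (n G)) (k : ℕ) : Set where
    field
      lane   : Fin k → Sub (n G)
      conn   : ∀ i → Connected′ (lane i)
      lane⊆  : ∀ i → lane i ⊆ C
      hitX   : ∀ i → ∃ λ v → v ∈ lane i × v ∈ X
      hitY   : ∀ i → ∃ λ v → v ∈ lane i × v ∈ Y
      aparts : ∀ i j → i ≢ j → Apart (lane i) (lane j)

  -- With all degrees in `U` at most two, a simple path can touch other lanes only at its two ends,
  -- where at most two neighbours each are available. So a lane touches at most four others, and one
  -- lane in five can be kept.
  module Final (U X Y : Sub (n G)) (k : ℕ) (deg2 : ∀ v → v ∈ U → Deg2 U v) (linked : Linked U X Y (k * 5)) where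

    I? : ∀ u v → Dec (u ∈ U × v ∈ U × u ~ v)
    I? u v = (u ∈? U) ×-dec ((v ∈? U) ×-dec (u ~? v))

    Γ : Graph
    Γ = record
      { n = n G ; adj = λ u → set (I? u)
      ; sym = λ u v → Edges.⇔-Bool (n G) (flip u v) (flip v u)
      ; irrefl = λ v → BP.¬-not λ e → ~-irrefl (proj₂ (proj₂ (set⁻ {P? = I? v} {v} (∈! e)))) }
      where
      flip : ∀ u v → set (I? u) v ≡ true → set (I? v) u ≡ true
      flip u v e = let (a , b , c) = set⁻ {P? = I? u} {v} (∈! e) in !∈ (set⁺ {P? = I? v} {u} (b , a , ~-sym c))

    Γ⁻ : ∀ {u v} → Adj Γ u v → u ∈ U × v ∈ U × u ~ v
    Γ⁻ {u} {v} e = set⁻ {P? = I? u} {v} (∈! e)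

    toΓ : ∀ {Z u v} → Path (U ∖ Z) u v → Walks.Path Γ (∁ Z) u v
    toΓ [ p ] = [ ∁⁺ (∖ʳ p) ]
    toΓ {u = u} (_∷⟨_⟩_ {w = w} p e r) = ∁⁺ (∖ʳ p) ∷⟨ !∈ (set⁺ {P? = I? u} {w} (∖ˡ p , ∖ˡ (start r) , e)) ⟩ toΓ r

    opaque
      linkage : Linkage Γ (X ∩ U) (Y ∩ U) (k * 5)
      linkage with menger Γ (X ∩ U) (Y ∩ U) (k * 5)
      ... | inj₁ L = L
      ... | inj₂ (Z , z , sep) = ⊥-elim (linked Z z λ u v u∈ v∈ w → sep u v (∩⁺ u∈ (∖ˡ (start w))) (∩⁺ v∈ (∖ˡ (end w))) (toΓ w))

    open SimplePaths Γ

    vs : ∀ {S a b} → SP S a b → Sub (n G)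
    vs {a = a} (one _)      = ｛ a ｝
    vs {a = a} (step _ _ r) = ｛ a ｝ ∪ vs r

    vs-start : ∀ {S a b} (p : SP S a b) → a ∈ vs p
    vs-start (one _)      = ｛｝⁺ _
    vs-start (step _ _ r) = ∪ˡ (｛｝⁺ _)

    vs-⊆ : ∀ {S a b} (p : SP S a b) → vs p ⊆ S
    vs-⊆ {S} (one q) v m = subst (_∈ S) (sym (｛｝⁻ m)) q
    vs-⊆ {S} (step q _ r) v m with ∪⁻ m
    ... | inj₁ a = subst (_∈ S) (sym (｛｝⁻ a)) q
    ... | inj₂ b = ∖ˡ (vs-⊆ r v b)

    vs-U : ∀ {S a b} (p : SP S a b) → a ∈ U → vs p ⊆ U
    vs-U (one q) a∈ v m = subst (_∈ U) (sym (｛｝⁻ m)) a∈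
    vs-U (step q e r) a∈ v m with ∪⁻ m
    ... | inj₁ a = subst (_∈ U) (sym (｛｝⁻ a)) a∈
    ... | inj₂ b = vs-U r (proj₁ (proj₂ (Γ⁻ e))) v b

    vs-path : ∀ {S a b} (p : SP S a b) → ∀ v → v ∈ vs p → Path (vs p) v b
    vs-path {a = a} (one q) v m = subst (λ z → Path ｛ a ｝ z a) (sym (｛｝⁻ m)) [ ｛｝⁺ a ]
    vs-path {a = a} {b} (step {c = c} q e r) v m with ∪⁻ m
    ... | inj₂ x = mapʷ ∪⊆ʳ (vs-path r v x)
    ... | inj₁ x = subst (λ z → Path (｛ a ｝ ∪ vs r) z b) (sym (｛｝⁻ x))
                     (∪ˡ (｛｝⁺ a) ∷⟨ proj₂ (proj₂ (Γ⁻ e)) ⟩ mapʷ ∪⊆ʳ (vs-path r c (vs-start r)))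

    three : ∀ {c x y z} → c ∈ U → x ∈ U → y ∈ U → z ∈ U → c ~ x → c ~ y → c ~ z → x ≢ y → x ≢ z → y ≢ z → ⊥
    three c∈ x∈ y∈ z∈ cx cy cz xy xz yz with deg2 _ c∈
    ... | a , b , h with h _ x∈ cx | h _ y∈ cy | h _ z∈ cz
    ... | inj₁ p | inj₁ q | _      = xy (trans p (sym q))
    ... | inj₁ p | inj₂ q | inj₁ r = xz (trans p (sym r))
    ... | inj₁ p | inj₂ q | inj₂ r = yz (trans q (sym r))
    ... | inj₂ p | inj₂ q | _      = xy (trans p (sym q))
    ... | inj₂ p | inj₁ q | inj₂ r = xz (trans p (sym r))
    ... | inj₂ p | inj₁ q | inj₁ r = yz (trans q (sym r))

    -- An inner vertex of a path spends both of its neighbours on the path.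
    contact : ∀ {S a b} (p : SP S a b) {x y} → x ∈ vs p → y ∉ vs p → y ∈ U → x ~ y → x ≡ a ⊎ x ≡ b
    contact (one _) x∈ _ _ _ = inj₁ (｛｝⁻ x∈)
    contact {a = a} (step {c = c} q e r) {x} {y} x∈ y∉ y∈U x~y with ∪⁻ x∈
    ... | inj₁ z = inj₁ (｛｝⁻ z)
    ... | inj₂ z with contact r z (y∉ ∘ ∪ʳ) y∈U x~y
    ...   | inj₂ w = inj₂ w
    ...   | inj₁ refl = second r e (y∉ ∘ ∪ʳ) (λ w → y∉ (∪ˡ w))
      where
      second : ∀ {b} (r : SP _ c b) → Adj Γ a c → y ∉ vs r → y ∉ ｛ a ｝ → c ≡ a ⊎ c ≡ b
      second (one _) e _ _ = inj₂ refl
      second (step {c = d} _ e′ r′) e y∉ y≢a = ⊥-elim (three (proj₁ (Γ⁻ e′)) (proj₁ (Γ⁻ e)) (proj₁ (proj₂ (Γ⁻ e′))) y∈U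
          (~-sym (proj₂ (proj₂ (Γ⁻ e)))) (proj₂ (proj₂ (Γ⁻ e′))) x~y
          (λ w → ∖ʳ (∖ˡ (vs-⊆ r′ d (vs-start r′))) (subst (_∈ ｛ a ｝) w (｛｝⁺ a)))
          (λ w → y≢a (subst (_∈ ｛ a ｝) w (｛｝⁺ a)))
          (λ w → y∉ (∪ʳ (subst (_∈ vs r′) w (vs-start r′)))))

    module Lk = Linkage linkage

    opaque
      sp : ∀ i → SP (Lk.lane i) (Lk.src i) (Lk.dst i)
      sp i = simple (Lk.path i)

    ln : Fin (k * 5) → Sub (n G)
    ln i = vs (sp i)

    ln-U : ∀ i → ln i ⊆ U
    ln-U i = vs-U (sp i) (∩ʳ (Lk.src∈ i))

    ln-disj : ∀ i j → i ≢ j → ∀ v → v ∈ ln i → v ∉ ln j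
    ln-disj i j ne v p q = Lk.disj i j ne v (vs-⊆ (sp i) v p) (vs-⊆ (sp j) v q)

    touch? : ∀ i j → Dec (i ≢ j × ∃₂ λ x y → x ∈ ln i × y ∈ ln j × x ~ y)
    touch? i j = ¬? (i FP.≟ j) ×-dec any? (λ x → any? (λ y → (x ∈? ln i) ×-dec ((y ∈? ln j) ×-dec (x ~? y))))

    E : Fin (k * 5) → Fin (k * 5) → Bool
    E i = set (touch? i)

    E-sym : ∀ i j → E i j ≡ E j i
    E-sym i j = Edges.⇔-Bool (n G) (flip i j) (flip j i)
      where
      flip : ∀ i j → E i j ≡ true → E j i ≡ true
      flip i j e = let (ne , x , y , p , q , r) = set⁻ {P? = touch? i} {j} (∈! e) in
        !∈ (set⁺ {P? = touch? j} {i} (ne ∘ sym , y , x , q , p , ~-sym r))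

    E-deg : ∀ i → # (E i) ≤ 4
    E-deg i = ≤-trans (#-image-inj hit hit-inj) (≤-trans (#-mono sub) (#-image ends))
      where
      dA = deg2 (Lk.src i) (∩ʳ (Lk.src∈ i))
      dB = deg2 (Lk.dst i) (∩ʳ (Lk.dst∈ i))
      ends : Fin 4 → V
      ends fz                = proj₁ dA
      ends (fs fz)           = proj₁ (proj₂ dA)
      ends (fs (fs fz))      = proj₁ dB
      ends (fs (fs (fs fz))) = proj₁ (proj₂ dB)
      info : ∀ t → i ≢ enum (E i) t × ∃₂ λ x y → x ∈ ln i × y ∈ ln (enum (E i) t) × x ~ y
      info t = set⁻ {P? = touch? i} (enum-∈ (E i) t)
      hit : Fin (# (E i)) → V
      hit t = proj₁ (proj₂ (proj₂ (info t)))
      hit-inj : ∀ s t → hit s ≡ hit t → s ≡ t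
      hit-inj s t e = enum-inj (E i) s t (decidable-stable (_ FP.≟ _) λ ne →
        ln-disj _ _ ne (hit s) (proj₁ (proj₂ (proj₂ (proj₂ (proj₂ (info s))))))
          (subst (_∈ ln (enum (E i) t)) (sym e) (proj₁ (proj₂ (proj₂ (proj₂ (proj₂ (info t))))))))
      sub : image hit ⊆ image ends
      sub v p with image⁻ p
      ... | t , refl with info t
      ...   | ne , x , y , x∈ , y∈ , x~y with contact (sp i) x∈ (λ q → ln-disj _ _ ne y q y∈) (ln-U _ y y∈) x~y
      ...     | inj₁ refl = [ (λ e → subst (_∈ image ends) (sym e) (image⁺ fz)) , (λ e → subst (_∈ image ends) (sym e) (image⁺ (fs fz))) ]′
                  (proj₂ (proj₂ dA) y (ln-U _ y y∈) x~y)
      ...     | inj₂ refl = [ (λ e → subst (_∈ image ends) (sym e) (image⁺ (fs (fs fz)))) , (λ e → subst (_∈ image ends) (sym e) (image⁺ (fs (fs (fs fz))))) ]′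
                  (proj₂ (proj₂ dB) y (ln-U _ y y∈) x~y)

    bundle : Bundle U X Y k
    bundle with independent E 4 E-sym (λ Q → ∑-bound Q _ 4 λ q _ → ≤-trans (#-mono λ _ → ∩ʳ) (E-deg q)) k ⊤ˢ
                  (≤-reflexive (sym (#-⊤ {k * 5})))
    ... | I , _ , size , ind = record
      { lane = λ i → ln (at i) ; conn = λ i → conn-hub (Lk.dst (at i)) (vs-path (sp (at i)))
      ; lane⊆ = λ i → ln-U (at i)
      ; hitX = λ i → Lk.src (at i) , vs-start (sp (at i)) , ∩ˡ (Lk.src∈ (at i))
      ; hitY = λ i → Lk.dst (at i) , end (vs-path (sp (at i)) _ (vs-start (sp (at i)))) , ∩ˡ (Lk.dst∈ (at i))
      ; aparts = λ i j ne u v p q → let ne′ = ne ∘ inj i j in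
          (λ e → ln-disj _ _ ne′ u p (subst (_∈ ln (at j)) (sym e) q)) ,
          λ e → ind (at i) (at j) (mem i) (mem j) ne′ (!∈ (set⁺ {P? = touch? (at i)} {at j} (ne′ , u , v , p , q , e))) }
      where open Pick (pick I k size)

  colours : ℕ
  colours = suc (suc Δ ^ᵒ 2)

  induced-menger : ∀ C X Y k → Linked C X Y (suc Δ ^ᵒ colours * (k * 5)) → Bundle C X Y k
  induced-menger C X Y k l with rounds X Y (k * 5) colours C l
  ... | U , U⊆ , l′ , d = record { lane = lane ; conn = conn ; lane⊆ = λ i v p → U⊆ v (lane⊆ i v p) ; hitX = hitX ; hitY = hitY ; aparts = aparts }
    where open Bundle (Final.bundle U X Y k (λ v p → d v p (FP.toℕ<n _)) l′)

-- Cells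

module Skeletons (G : Graph) where
  open Walks G

  -- A skeleton partitions Ω into cells with connected cores.  Edges between different cells have a light end,
  -- and every vertex of a cell is joined to its core by a tie that contains at most ν light vertices.
  record Tie (core cl light : Sub (n G)) (ν : ℕ) (v : V) : Set where
    field
      S      : Sub (n G)
      self   : v ∈ S
      S⊆     : S ⊆ cl
      conn   : Connected′ (core ∪ S)
      lights : # (S ∩ light) ≤ ν

  record Skeleton (Ω : Sub (n G)) (ν p : ℕ) : Set where
    field
      cl         : Fin p → Sub (n G)
      cl⊆        : ∀ q → cl q ⊆ Ω
      cover      : ∀ v → v ∈ Ω → ∃ λ q → v ∈ cl q
      unique     : ∀ {q q′ v} → v ∈ cl q → v ∈ cl q′ → q ≡ q′
      light      : Sub (n G)
      core       : Fin p → Sub (n G)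
      core∋      : ∀ q → ∃ λ v → v ∈ core q
      core-conn  : ∀ q → Connected′ (core q)
      core⊆      : ∀ q → core q ⊆ cl q
      core-heavy : ∀ q v → v ∈ core q → v ∉ light
      tie        : ∀ q v → v ∈ cl q → Tie (core q) (cl q) light ν v
      heavy      : ∀ {q q′ u v} → u ∈ cl q → v ∈ cl q′ → u ∉ light → v ∉ light → u ~ v → q ≡ q′

module Cells (G : Graph) (Δ : ℕ) (Δ-bound : ∀ v → # (adj G v) ≤ Δ)
             (r : Sub (n G) → ℕ) (r-∪ : ∀ {Z X Y} → Z ⊆ X ∪ Y → r Z ≤ r X + r Y) (r-∅ : r ∅ ≡ 0)
             (ρ : ℕ) (r-｛｝ : ∀ x → r ｛ x ｝ ≤ ρ) (m₀ : ℕ) where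
  open Walks G
  open Degree Δ Δ-bound
  open Skeletons G

  r-mono : ∀ {Z X} → Z ⊆ X → r Z ≤ r X
  r-mono {Z} {X} h = ≤-trans (r-∪ {Y = ∅} (λ v p → ∪ˡ (h v p))) (≤-reflexive (trans (cong (r X +_) r-∅) (+-identityʳ _)))

  r-⋃ : ∀ {k} (I : Sub k) (F : Fin k → Sub (n G)) → r (⋃ I F) ≤ ∑ (λ i → I i ▹ r (F i))
  r-⋃ {zero} I F = ≤-trans (r-mono {X = ∅} λ v p → ⊥-elim (none (⋃⁻ p))) (≤-reflexive r-∅)
    where
    none : ∀ {v} → (∃ λ (i : Fin 0) → i ∈ I × v ∈ F i) → ⊥
    none ()
  r-⋃ {suc k} I F = ≤-trans (r-∪ {X = head} sub) (+-mono-≤ hd (r-⋃ (I ∘ fs) (F ∘ fs)))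
    where
    head : Sub (n G)
    head = if I fz then F fz else ∅
    hd : r head ≤ I fz ▹ r (F fz)
    hd with I fz
    ... | true  = ≤-refl
    ... | false = ≤-reflexive r-∅
    sub : ⋃ I F ⊆ head ∪ ⋃ (I ∘ fs) (F ∘ fs)
    sub v p with ⋃⁻ p
    ... | fz   , i∈ , q = ∪ˡ (subst (λ b → v ∈ (if b then F fz else ∅)) (sym (!∈ i∈)) q)
    ... | fs i , i∈ , q = ∪ʳ (⋃⁺ i (∈! (!∈ i∈)) q)

  -- When one vertex joins `X`, everything newly absorbed is found within distance two of it: at
  -- most `(Δ + 1)²` places, each contributing a vertex and a component of order at most `m₀`.
  inc : ℕ
  inc = (ρ + m₀) * suc Δ ^ᵒ 2

  bound : ℕ
  bound = m₀ + inc

  module _ (K : Sub (n G)) where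

    rest : Sub (n G) → Sub (n G)
    rest X = K ∖ N[ X ]

    small? : ∀ X v → Dec (v ∈ rest X × r (comp (rest X) v) ≤ m₀)
    small? X v = (v ∈? rest X) ×-dec (_ ≤? _)

    -- Besides its neighbourhood, `X` swallows the components that would be too small to yield cells
    -- of their own.
    Cl : Sub (n G) → Sub (n G)
    Cl X = (N[ X ] ∩ K) ∪ set (small? X)

    Cl⊆ : ∀ X → Cl X ⊆ K
    Cl⊆ X v p with ∪⁻ p
    ... | inj₁ a = ∩ʳ a
    ... | inj₂ b = ∖ˡ (proj₁ (set⁻ {P? = small? X} b))

    -- A component that becomes small when x is added was cut off by N[x], so it contains a vertex at distance at most 2 from x.
    increment : ∀ X X′ x → X ⊆ X′ → X′ ⊆ X ∪ ｛ x ｝ → r (Cl X′) ≤ r (Cl X) + inc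
    increment X X′ x lo hi = ≤-trans (r-∪ sub) (+-monoʳ-≤ (r (Cl X)) (≤-trans (r-⋃ (ball x 2) F)
        (≤-trans (∑-bound (ball x 2) (r ∘ F) (ρ + m₀) λ i _ → F≤ i) (*-monoʳ-≤ (ρ + m₀) (#-ball x 2)))))
      where
      piece : V → Sub (n G)
      piece z with r (comp (rest X′) z) ≤? m₀
      ... | yes _ = comp (rest X′) z
      ... | no  _ = ∅
      piece⁺ : ∀ {z v} → r (comp (rest X′) z) ≤ m₀ → v ∈ comp (rest X′) z → v ∈ piece z
      piece⁺ {z} le p with r (comp (rest X′) z) ≤? m₀
      ... | yes _ = p
      ... | no ¬l = ⊥-elim (¬l le)
      F : V → Sub (n G)
      F z = ｛ z ｝ ∪ piece z
      F≤ : ∀ z → r (F z) ≤ ρ + m₀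
      F≤ z = ≤-trans (r-∪ (λ _ p → p)) (+-mono-≤ (r-｛｝ z) p≤)
        where
        p≤ : r (piece z) ≤ m₀
        p≤ with r (comp (rest X′) z) ≤? m₀
        ... | yes l = l
        ... | no _  = ≤-trans (≤-reflexive r-∅) z≤n
      N-split : ∀ {v} → v ∈ N[ X′ ] → v ∈ N[ X ] ⊎ v ∈ ball x 1
      N-split p with N⁻ p
      ... | u , u∈ , t with ∪⁻ (hi u u∈) | t
      ...   | inj₁ a | inj₁ refl = inj₁ (N-self a)
      ...   | inj₁ a | inj₂ e    = inj₁ (N-adj a e)
      ...   | inj₂ b | inj₁ refl = inj₂ (N-self b)
      ...   | inj₂ b | inj₂ e    = inj₂ (N-adj b e)
      N-lo : ∀ {v} → v ∈ N[ X ] → v ∈ N[ X′ ]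
      N-lo p with N⁻ p
      ... | u , u∈ , inj₁ refl = N-self (lo u u∈)
      ... | u , u∈ , inj₂ e    = N-adj (lo u u∈) e
      sub : Cl X′ ⊆ Cl X ∪ ⋃ (ball x 2) F
      sub v p with ∪⁻ p
      ... | inj₁ a with N-split (∩ˡ a)
      ...   | inj₁ b = ∪ˡ (∪ˡ (∩⁺ b (∩ʳ a)))
      ...   | inj₂ b = ∪ʳ (⋃⁺ v (N-self b) (∪ˡ (｛｝⁺ v)))
      sub v p | inj₂ b with set⁻ {P? = small? X′} b
      ... | v∈ , le with r (comp (rest X) v) ≤? m₀
      ...   | yes le′ = ∪ˡ (∪ʳ (set⁺ {P? = small? X} (∖⁺ (∖ˡ v∈) (∖ʳ v∈ ∘ N-lo) , le′)))
      ...   | no gt with any? (λ w → (w ∈? comp (rest X) v) ×-dec ¬? (w ∈? comp (rest X′) v))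
      ...     | no ¬w = ⊥-elim (gt (≤-trans (r-mono λ w q → decidable-stable (w ∈? _) λ z → ¬w (w , q , z)) le))
      ...     | yes (w , w∈ , w∉) with crossing (comp (rest X′) v) (comp-path w∈) (comp-∋ v∈) w∉
      ...       | a , b′ , wk , b∈ , a~b , b∉ with N-split (decidable-stable (b′ ∈? N[ X′ ])
                     λ z → b∉ (comp-closed (∩ʳ (end wk)) (∖⁺ (∖ˡ (comp-⊆ b′ b∈)) z) a~b))
      ...         | inj₁ c = ⊥-elim (∖ʳ (comp-⊆ b′ b∈) c)
      ...         | inj₂ c = ∪ʳ (⋃⁺ a (N-adj c (~-sym a~b)) (∪ʳ (piece⁺ (≤-trans (r-mono (comp-⊆comp a∈)) le) (comp-sym a∈))))
        where
        a∈ : a ∈ comp (rest X′) v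
        a∈ = ∩ʳ (end wk)

    record Grown : Set where
      field
        X    : Sub (n G)
        X⊆   : X ⊆ K
        X∋   : ∃ λ v → v ∈ X
        conn : Connected′ X
        lo   : m₀ < r (Cl X)
        hi   : r (Cl X) ≤ bound

    opaque
      -- `X` grows vertex by vertex until its closure first exceeds `m₀`; the previous closure did
      -- not, so `increment` gives the upper bound. This must happen, because an `X` that cannot
      -- grow inside the connected set `K` is all of `K`.
      grown : Connected′ K → m₀ < r K → Grown
      grown K-conn big = loop (suc (n G)) ｛ x₀ ｝ (m≤m+n _ _) (λ v p → subst (_∈ K) (sym (｛｝⁻ p)) x₀∈) (｛｝⁺ x₀) (conn-｛｝ x₀)
          (≤-trans (increment ∅ ｛ x₀ ｝ x₀ (λ v p → ⊥-elim (∉∅ p)) (λ v → ∪ʳ)) (+-monoˡ-≤ inc (≤-trans (r-mono Cl∅) (≤-trans (≤-reflexive r-∅) z≤n))))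
        where
        K∋ : ∃ λ v → v ∈ K
        K∋ with any? (λ v → v ∈? K)
        ... | yes p = p
        ... | no ¬p = ⊥-elim (<⇒≱ big (≤-trans (r-mono {X = ∅} λ v p → ⊥-elim (¬p (v , p))) (≤-trans (≤-reflexive r-∅) z≤n)))
        x₀ : V
        x₀ = proj₁ K∋
        x₀∈ : x₀ ∈ K
        x₀∈ = proj₂ K∋
        N∅ : ∀ {v} → v ∉ N[ ∅ ]
        N∅ p = ∉∅ (proj₁ (proj₂ (N⁻ p)))
        Cl∅ : Cl ∅ ⊆ ∅
        Cl∅ v p with ∪⁻ p
        ... | inj₁ a = ⊥-elim (N∅ (∩ˡ a))
        ... | inj₂ b with set⁻ {P? = small? ∅} b
        ...   | v∈ , le = ⊥-elim (<⇒≱ big (≤-trans (r-mono (conn⊆comp K-conn (λ u q → ∖⁺ q N∅) (∖ˡ v∈))) le))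
        loop : ∀ f X → n G < f + # X → X ⊆ K → x₀ ∈ X → Connected′ X → r (Cl X) ≤ bound → Grown
        loop zero X lt _ _ _ _ = ⊥-elim (<⇒≱ lt (#≤ X))
        loop (suc f) X lt X⊆ x∈ c hi with r (Cl X) ≤? m₀
        ... | no gt = record { X = X ; X⊆ = X⊆ ; X∋ = x₀ , x∈ ; conn = c ; lo = ≰⇒> gt ; hi = hi }
        ... | yes le with any? (λ u → any? (λ x → (u ∈? X) ×-dec ((x ∈? K) ×-dec ((u ~? x) ×-dec ¬? (x ∈? X)))))
        ...   | yes (u , x , u∈ , x∈K , e , x∉) = loop f (X ∪ ｛ x ｝)
                  (≤-trans lt (≤-trans (≤-reflexive (sym (+-suc f (# X)))) (+-monoʳ-≤ f (#-strict {v = x} ∪⊆ˡ (∪ʳ (｛｝⁺ x)) x∉))))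
                  (λ v p → [ X⊆ v , (λ q → subst (_∈ K) (sym (｛｝⁻ q)) x∈K) ]′ (∪⁻ p)) (∪ˡ x∈)
                  (conn-∪ c (conn-｛｝ x) u∈ (｛｝⁺ x) (inj₂ e))
                  (≤-trans (increment X (X ∪ ｛ x ｝) x (λ _ → ∪ˡ) (λ _ p → p)) (+-monoˡ-≤ inc le))
        ...   | no ¬p = ⊥-elim (<⇒≱ big (≤-trans (r-mono all) le))
          where
          all : K ⊆ Cl X
          all v v∈ with v ∈? X
          ... | yes q = ∪ˡ (∩⁺ (N-self q) v∈)
          ... | no q with crossing X (K-conn x₀ v x₀∈ v∈) x∈ q
          ...   | a , b , wk , b∈ , e , b∉ = ⊥-elim (¬p (a , b , ∩ʳ (end wk) , b∈ , e , b∉))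

  CellsOn : Sub (n G) → Set
  CellsOn R = ∃ λ p → Σ (Skeleton R 1 p) λ Sk → (∀ q → m₀ < r (Skeleton.cl Sk q)) × (∀ q → r (Skeleton.cl Sk q) ≤ bound)

  module Step (R : Sub (n G)) (big : ∀ v → v ∈ R → m₀ < r (comp R v)) (v₀ : V) (g : Grown (comp R v₀)) where
    module Gr = Grown g
    K X C₀ R′ : Sub (n G)
    K = comp R v₀
    X = Gr.X
    C₀ = Cl K X
    R′ = R ∖ C₀
    C₀R : C₀ ⊆ R
    C₀R v q = comp-⊆ v (Cl⊆ K X v q)
    X⊆C₀ : X ⊆ C₀
    X⊆C₀ v q = ∪ˡ (∩⁺ (N-self q) (Gr.X⊆ v q))
    R′K : ∀ {v} → v ∈ R′ → v ∈ K → v ∈ rest K X × m₀ < r (comp (rest K X) v)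
    R′K {v} q k = in-rest , ≰⇒> λ l → ∖ʳ q (∪ʳ (set⁺ {P? = small? K X} (in-rest , l)))
      where in-rest = ∖⁺ k λ z → ∖ʳ q (∪ˡ (∩⁺ z k))
    -- The invariant of the partition. Components of `R` other than `K` are untouched, and inside
    -- `K` every component of order at most `m₀` has been absorbed into `C₀`.
    big′ : ∀ v → v ∈ R′ → m₀ < r (comp R′ v)
    big′ v q with v ∈? K
    ... | no ¬k = ≤-trans (big v (∖ˡ q)) (r-mono (conn⊆comp comp-conn sub (comp-∋ (∖ˡ q))))
      where
      sub : comp R v ⊆ R′
      sub u z = ∖⁺ (comp-⊆ u z) λ c → ¬k (comp-walk (Cl⊆ K X u c) (mapʷ comp-⊆ (comp-path (comp-sym z))))
    ... | yes k with R′K q k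
    ...   | v∈ , gt = ≤-trans gt (r-mono (conn⊆comp comp-conn sub (comp-∋ v∈)))
      where
      sub : comp (rest K X) v ⊆ R′
      sub u z = ∖⁺ (comp-⊆ u (∖ˡ (comp-⊆ u z))) out
        where
        out : u ∉ C₀
        out c with ∪⁻ c
        ... | inj₁ a = ∖ʳ (comp-⊆ u z) (∩ˡ a)
        ... | inj₂ b = <⇒≱ gt (≤-trans (r-mono (comp-⊆comp (comp-sym z))) (proj₂ (set⁻ {P? = small? K X} b)))
    shrink : # R′ < # R
    shrink = #-strict (λ _ → ∖ˡ) (C₀R _ (X⊆C₀ _ (proj₂ Gr.X∋))) (λ z → ∖ʳ z (X⊆C₀ _ (proj₂ Gr.X∋)))

    module Combine (p : ℕ) (Sk : Skeleton R′ 1 p)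
                   (oldlo : ∀ q → m₀ < r (Skeleton.cl Sk q)) (oldhi : ∀ q → r (Skeleton.cl Sk q) ≤ bound) where
      module O = Skeleton Sk
      -- An edge from `C₀` to the rest of `R` starts here: neighbours of `X` in `R` belong to
      -- `N[ X ] ∩ K` and so to `C₀`, and a neighbour of an absorbed component in the rest of `K` is
      -- absorbed with it.
      new-light : Sub (n G)
      new-light = N[ X ] ∩ K ∖ X
      light′ : Sub (n G)
      light′ = new-light ∪ O.light ∩ R′
      cl′ : Fin (suc p) → Sub (n G)
      cl′ fz     = C₀
      cl′ (fs q) = O.cl q
      core′ : Fin (suc p) → Sub (n G)
      core′ fz     = X
      core′ (fs q) = O.core q
      old-light : ∀ {v} → v ∈ R′ → v ∈ light′ → v ∈ O.light
      old-light q m with ∪⁻ m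
      ... | inj₁ a = ⊥-elim (∖ʳ q (∪ˡ (∖ˡ a)))
      ... | inj₂ b = ∩ˡ b
      new-only : ∀ {v} → v ∈ C₀ → v ∈ light′ → v ∈ new-light
      new-only c m with ∪⁻ m
      ... | inj₁ a = a
      ... | inj₂ b = ⊥-elim (∖ʳ (∩ʳ b) c)
      -- A vertex of `N[ X ]` needs only itself. A vertex of an absorbed component uses that
      -- component and one vertex `n` of the surrounding layer, which is the only light vertex of
      -- the tie; hence skeletons of `B` have `ν = 1`.
      tie₀ : ∀ v → v ∈ C₀ → Tie X C₀ light′ 1 v
      tie₀ v c with ∪⁻ c
      ... | inj₁ a with N⁻ (∩ˡ a)
      ...   | u , u∈ , t = record
        { S = ｛ v ｝ ; self = ｛｝⁺ v ; S⊆ = λ z q → subst (_∈ C₀) (sym (｛｝⁻ q)) c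
        ; conn = conn-∪ Gr.conn (conn-｛｝ v) u∈ (｛｝⁺ v) t
        ; lights = ≤-trans (#-mono λ _ → ∩ˡ) (#-｛｝ v) }
      tie₀ v c | inj₂ b with set⁻ {P? = small? K X} b
      ... | v∈ , le′ with crossing (comp (rest K X) v) (comp-conn {R} {v₀} v (proj₁ Gr.X∋) (∖ˡ v∈) (Gr.X⊆ _ (proj₂ Gr.X∋))) (comp-∋ v∈)
                            (λ z → ∖ʳ (comp-⊆ _ z) (N-self (proj₂ Gr.X∋)))
      ...   | a , n , wk , n∈K , a~n , n∉ with decidable-stable (n ∈? N[ X ]) (λ z → n∉ (comp-closed (∩ʳ (end wk)) (∖⁺ n∈K z) a~n))
      ...     | n∈N with N⁻ n∈N
      ...       | u , u∈ , inj₁ refl = ⊥-elim (∖ʳ (comp-⊆ a (∩ʳ (end wk))) (N-adj u∈ (~-sym a~n)))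
      ...       | u , u∈ , inj₂ u~n = record
        { S = S ; self = ∪ʳ (comp-∋ v∈) ; S⊆ = S⊆
        ; conn = conn-⊆⊇ assoc assoc′ (conn-∪ (conn-∪ Gr.conn (conn-｛｝ n) u∈ (｛｝⁺ n) (inj₂ u~n)) comp-conn (∪ʳ (｛｝⁺ n)) (∩ʳ (end wk)) (inj₂ (~-sym a~n)))
        ; lights = ≤-trans (#-mono only) (#-｛｝ n) }
        where
        T = comp (rest K X) v
        S = ｛ n ｝ ∪ T
        heavyT : ∀ z → z ∈ T → z ∈ C₀
        heavyT z q = ∪ʳ (set⁺ {P? = small? K X} (comp-⊆ z q , ≤-trans (r-mono (comp-⊆comp q)) le′))
        S⊆ : S ⊆ C₀
        S⊆ z q with ∪⁻ q
        ... | inj₁ e = subst (_∈ C₀) (sym (｛｝⁻ e)) (∪ˡ (∩⁺ n∈N n∈K))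
        ... | inj₂ t = heavyT z t
        assoc : (X ∪ ｛ n ｝) ∪ T ⊆ X ∪ S
        assoc z q with ∪⁻ q
        ... | inj₂ t = ∪ʳ (∪ʳ t)
        ... | inj₁ t with ∪⁻ t
        ...   | inj₁ s = ∪ˡ s
        ...   | inj₂ s = ∪ʳ (∪ˡ s)
        assoc′ : X ∪ S ⊆ (X ∪ ｛ n ｝) ∪ T
        assoc′ z q with ∪⁻ q
        ... | inj₁ s = ∪ˡ (∪ˡ s)
        ... | inj₂ t with ∪⁻ t
        ...   | inj₁ s = ∪ˡ (∪ʳ s)
        ...   | inj₂ s = ∪ʳ s
        only : S ∩ light′ ⊆ ｛ n ｝
        only z q with ∪⁻ (∩ˡ q)
        ... | inj₁ e = e
        ... | inj₂ t = ⊥-elim (∖ʳ (comp-⊆ z t) (∩ˡ (∖ˡ (new-only (heavyT z t) (∩ʳ q)))))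
      tie′ : ∀ q v → v ∈ cl′ q → Tie (core′ q) (cl′ q) light′ 1 v
      tie′ fz     v c = tie₀ v c
      tie′ (fs q) v c = record { S = T.S ; self = T.self ; S⊆ = T.S⊆ ; conn = T.conn
          ; lights = ≤-trans (#-mono λ z m → ∩⁺ (∩ˡ m) (old-light (O.cl⊆ q z (T.S⊆ z (∩ˡ m))) (∩ʳ m))) T.lights }
        where module T = Tie (O.tie q v c)
      sealed : ∀ {u v} → u ∈ C₀ → v ∈ R′ → u ∉ light′ → u ~ v → ⊥
      sealed {u} {v} c q h e with ∪⁻ c
      ... | inj₁ a with u ∈? X
      ...   | no ¬x = h (∪ˡ (∖⁺ a ¬x))
      ...   | yes x = ∖ʳ q (∪ˡ (∩⁺ (N-adj x e) (comp-closed (Gr.X⊆ u x) (∖ˡ q) e)))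
      sealed {u} {v} c q h e | inj₂ b with set⁻ {P? = small? K X} b
      ... | u∈ , le′ with R′K q (comp-closed (∖ˡ u∈) (∖ˡ q) e)
      ...   | v∈ , gt = <⇒≱ gt (≤-trans (r-mono (comp-⊆comp (comp-closed (comp-∋ u∈) v∈ e))) le′)
      sk : Skeleton R 1 (suc p)
      sk = record
        { cl = cl′ ; cl⊆ = λ { fz → C₀R ; (fs q) v z → ∖ˡ (O.cl⊆ q v z) }
        ; cover = cov ; unique = uniq ; light = light′ ; core = core′
        ; core∋ = λ { fz → Gr.X∋ ; (fs q) → O.core∋ q }
        ; core-conn = λ { fz → Gr.conn ; (fs q) → O.core-conn q }
        ; core⊆ = λ { fz → X⊆C₀ ; (fs q) → O.core⊆ q }
        ; core-heavy = λ { fz v x l → ∖ʳ (new-only (X⊆C₀ v x) l) x ; (fs q) v x l → O.core-heavy q v x (old-light (O.cl⊆ q v (O.core⊆ q v x)) l) }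
        ; tie = tie′ ; heavy = hv }
        where
        cov : ∀ v → v ∈ R → ∃ λ q → v ∈ cl′ q
        cov v v∈ with v ∈? C₀
        ... | yes c = fz , c
        ... | no ¬c = let (q , c) = O.cover v (∖⁺ v∈ ¬c) in fs q , c
        uniq : ∀ {q q′ v} → v ∈ cl′ q → v ∈ cl′ q′ → q ≡ q′
        uniq {fz}   {fz}    a b = refl
        uniq {fz}   {fs q′} a b = ⊥-elim (∖ʳ (O.cl⊆ q′ _ b) a)
        uniq {fs q} {fz}    a b = ⊥-elim (∖ʳ (O.cl⊆ q _ a) b)
        uniq {fs q} {fs q′} a b = cong fs (O.unique a b)
        hv : ∀ {q q′ u v} → u ∈ cl′ q → v ∈ cl′ q′ → u ∉ light′ → v ∉ light′ → u ~ v → q ≡ q′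
        hv {fz}   {fz}    a b _ _ _ = refl
        hv {fz}   {fs q′} a b h _ e = ⊥-elim (sealed a (O.cl⊆ q′ _ b) h e)
        hv {fs q} {fz}    a b _ h e = ⊥-elim (sealed b (O.cl⊆ q _ a) h (~-sym e))
        hv {fs q} {fs q′} {u} {v} a b h h′ e = cong fs (O.heavy a b (λ l → h (∪ʳ (∩⁺ l (O.cl⊆ q u a)))) (λ l → h′ (∪ʳ (∩⁺ l (O.cl⊆ q′ v b)))) e)
      lo : ∀ q → m₀ < r (cl′ q)
      lo fz     = Gr.lo
      lo (fs q) = oldlo q
      hi : ∀ q → r (cl′ q) ≤ bound
      hi fz     = Gr.hi
      hi (fs q) = oldhi q
      combined : CellsOn R
      combined = suc p , sk , lo , hi

  opaque
    -- Since all remaining components keep order above `m₀`, each of them can start a new cell and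
    -- nothing is left over at the end.
    cells : ∀ f R → # R ≤ f → (∀ v → v ∈ R → m₀ < r (comp R v)) → CellsOn R
    cells f R le big with any? (λ v → v ∈? R)
    ... | no none = 0 , record
      { cl = λ () ; cl⊆ = λ () ; cover = λ v p → ⊥-elim (none (v , p)) ; unique = λ { {()} } ; light = ∅ ; core = λ () ; core∋ = λ ()
      ; core-conn = λ () ; core⊆ = λ () ; core-heavy = λ () ; tie = λ () ; heavy = λ { {()} } } , (λ ()) , λ ()
    cells zero R le big | yes (v , v∈) = ⊥-elim (<⇒≱ (#-∈ v∈) le)
    cells (suc f) R le big | yes (v₀ , v₀∈) with grown (comp R v₀) comp-conn (big v₀ v₀∈)
    ... | g with cells f (Step.R′ R big v₀ g) (≤-pred (≤-trans (Step.shrink R big v₀ g) le)) (Step.big′ R big v₀ g)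
    ...   | p , Sk , lo , hi = Step.Combine.combined R big v₀ g p Sk lo hi

-- Assembling induced minor models

module Models (H G : Graph) where
  open Walks G

  h : ℕ
  h = n H

  mkMinor : (X : Fin h → Sub (n G)) → (∀ a → ∃ λ v → v ∈ X a) → (∀ a b → a ≢ b → ∀ v → v ∈ X a → v ∉ X b) →
    (∀ a → Connected′ (X a)) →
    (∀ a b → a ≢ b → Adj H a b → ∃₂ λ u v → u ∈ X a × v ∈ X b × u ~ v) →
    (∀ a b u v → a ≢ b → u ∈ X a → v ∈ X b → u ~ v → Adj H a b) → InducedMinor H G
  mkMinor X ne disj conn edge⁺ edge⁻ = X , (λ a → let (v , p) = ne a in v , !∈ p) , (λ a b a≢b v p q → disj a b a≢b v (∈! p) (∈! q)) ,
    (λ a u v p q → strip (conn a u v (∈! p) (∈! q))) ,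
    λ a b a≢b → (λ e → let (u , v , p , q , r) = edge⁺ a b a≢b e in u , v , !∈ p , !∈ q , r) ,
                λ (u , v , p , q , r) → edge⁻ a b u v a≢b (∈! p) (∈! q) r
    where
    strip : ∀ {S u v} → Path S u v → Walk G (λ v → S v ≡ true) u v
    strip [ p ]        = [ !∈ p ]
    strip (p ∷⟨ e ⟩ r) = !∈ p ∷⟨ e ⟩ strip r

  module Glue (P : Fin h → Sub (n G)) (Z : Fin h → Fin h → Sub (n G))
              (P∋ : ∀ a → ∃ λ v → v ∈ P a) (P-conn : ∀ a → Connected′ (P a)) (P-apart : ∀ a b → a ≢ b → Apart (P a) (P b))
              (Z-link : ∀ a b → a F.< b → Adj H a b → ∃₂ λ x y → x ∈ P a × y ∈ P b × Path (P a ∪ Z a b ∪ P b) x y)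
              (Z-P : ∀ a b c → a F.< b → Adj H a b → c ≢ a → c ≢ b → Apart (Z a b) (P c))
              (Z-Z : ∀ a b c d → a F.< b → Adj H a b → c F.< d → Adj H c d → (a , b) ≢ (c , d) → Apart (Z a b) (Z c d)) where

    E? : ∀ a b → Dec (a F.< b × Adj H a b)
    E? a b = (a F.<? b) ×-dec (adj H a b BP.≟ true)

    others : Fin h → Sub (n G)
    others a = ⋃ (⊤ˢ ∖ ｛ a ｝) P

    Q : Fin h → Sub (n G)
    Q a = P a ∪ ⋃ (set (E? a)) (Z a)

    -- Connectors go to the smaller index. As `Z a b` may run through `P b`, removing the other
    -- centres can cut it into pieces; only the piece attached to `P a` is kept.
    X : Fin h → Sub (n G)
    X a = comp (Q a ∖ others a) (proj₁ (P∋ a))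

    not-other : ∀ {a v} → v ∈ P a → v ∉ others a
    not-other {a} {v} p q with ⋃⁻ q
    ... | c , c∈ , r = proj₁ (P-apart a c (λ e → ∖ʳ c∈ (subst (_∈ ｛ a ｝) e (｛｝⁺ a))) v v p r) refl

    P⊆X : ∀ a → P a ⊆ X a
    P⊆X a = conn⊆comp (P-conn a) (λ v p → ∖⁺ (∪ˡ p) (not-other p)) (proj₂ (P∋ a))

    X⁻ : ∀ {a v} → v ∈ X a → (v ∈ P a ⊎ ∃ λ b → a F.< b × Adj H a b × v ∈ Z a b) × (∀ c → c ≢ a → v ∉ P c)
    X⁻ {a} {v} p = kind (∪⁻ (∖ˡ (comp-⊆ v p))) , λ c ne q → ∖ʳ (comp-⊆ v p) (⋃⁺ c (∖⁺ ∈⊤ (ne ∘ ｛｝⁻)) q)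
      where
      kind : v ∈ P a ⊎ v ∈ ⋃ (set (E? a)) (Z a) → v ∈ P a ⊎ ∃ λ b → a F.< b × Adj H a b × v ∈ Z a b
      kind (inj₁ q) = inj₁ q
      kind (inj₂ q) = let (b , b∈ , r) = ⋃⁻ q ; (lt , e) = set⁻ {P? = E? a} b∈ in inj₂ (b , lt , e , r)

    disj : ∀ a b → a ≢ b → ∀ v → v ∈ X a → v ∉ X b
    disj a b ne v p q with X⁻ p | X⁻ q
    ... | inj₁ x , _ | _ , f = f a ne x
    ... | inj₂ _ , f | inj₁ y , _ = f b (ne ∘ sym) y
    ... | inj₂ (c , lt , e , z) , _ | inj₂ (d , lt′ , e′ , z′) , _ = proj₁ (Z-Z a c b d lt e lt′ e′ (ne ∘ cong proj₁) v v z z′) refl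

    -- Consider the first vertex of the path outside `X a`. If it were not in `P b`, it would lie in
    -- `Z a b` off the other centres, and the component `X a` would have contained it.
    link< : ∀ a b → a F.< b → Adj H a b → ∃₂ λ u v → u ∈ X a × v ∈ X b × u ~ v
    link< a b lt e with Z-link a b lt e
    ... | x , y , x∈ , y∈ , w with crossing (X a) w (P⊆X a x x∈) (λ q → proj₂ (X⁻ q) b (λ r → FP.<-irrefl (sym r) lt) y∈)
    ...   | u , v , wk , v∈ , u~v , v∉ = u , v , ∩ʳ (end wk) , v∈X , u~v
      where
      v∈X : v ∈ X b
      v∈X with ∪⁻ v∈
      ... | inj₁ p = ⊥-elim (v∉ (P⊆X a v p))
      ... | inj₂ q with ∪⁻ q
      ...   | inj₂ p = P⊆X b v p
      ...   | inj₁ z with v ∈? P b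
      ...     | yes p = P⊆X b v p
      ...     | no ¬p = ⊥-elim (v∉ (comp-closed (∩ʳ (end wk)) (∖⁺ (∪ʳ (⋃⁺ b (set⁺ {P? = E? a} (lt , e)) z)) out) u~v))
        where
        out : v ∉ others a
        out o with ⋃⁻ o
        ... | c , c∈ , r with c FP.≟ b
        ...   | yes refl = ¬p r
        ...   | no ne = proj₁ (Z-P a b c lt e (λ { refl → ∖ʳ c∈ (｛｝⁺ c) }) ne v v z r) refl

    glue : InducedMinor H G
    glue = mkMinor X (λ a → _ , P⊆X a _ (proj₂ (P∋ a))) disj (λ a → comp-conn) edge⁺ edge⁻
      where
      edge⁺ : ∀ a b → a ≢ b → Adj H a b → ∃₂ λ u v → u ∈ X a × v ∈ X b × u ~ v
      edge⁺ a b ne e with FP.<-cmp a b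
      ... | tri< lt _ _ = link< a b lt e
      ... | tri≈ _ eq _ = ⊥-elim (ne eq)
      ... | tri> _ _ gt = let (u , v , p , q , r) = link< b a gt (trans (adj-sym H b a) e) in v , u , q , p , ~-sym r
      edge⁻ : ∀ a b u v → a ≢ b → u ∈ X a → v ∈ X b → u ~ v → Adj H a b
      edge⁻ a b u v ne p q e with proj₁ (X⁻ p) | proj₁ (X⁻ q)
      ... | inj₁ x | inj₁ y = ⊥-elim (proj₂ (P-apart a b ne u v x y) e)
      ... | inj₁ x | inj₂ (c , lt , e′ , z) with a FP.≟ c
      ...   | yes refl = trans (adj-sym H a b) e′
      ...   | no ne′ = ⊥-elim (proj₂ (Z-P b c a lt e′ ne ne′ v u z x) (~-sym e))
      edge⁻ a b u v ne p q e | inj₂ (c , lt , e′ , z) | inj₁ y with b FP.≟ c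
      ...   | yes refl = e′
      ...   | no ne′ = ⊥-elim (proj₂ (Z-P a c b lt e′ (ne ∘ sym) ne′ u v z y) e)
      edge⁻ a b u v ne p q e | inj₂ (c , lt , e′ , z) | inj₂ (d , lt′ , e″ , z′) =
        ⊥-elim (proj₂ (Z-Z a c b d lt e′ lt′ e″ (ne ∘ cong proj₁) u v z z′) e)

-- Dense graphs have large complete minors

#-disj : ∀ {m} {A B C : Sub m} → A ⊆ C → B ⊆ C → (∀ v → v ∈ A → v ∉ B) → # A + # B ≤ # C
#-disj {A = A} {B} {C} a b d = ≤-trans (+-mono-≤ (#-mono {T = C ∩ A} λ v p → ∩⁺ (a v p) p) (#-mono {T = C ∖ A} λ v p → ∖⁺ (b v p) (λ q → d v q p)))
  (≤-reflexive (trans (+-comm (# (C ∩ A)) _) (sym (#-∪∖ C A))))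

-- The required ratio of the degree sum to the number of vertices. Contracting an edge with `x`
-- common neighbours costs a vertex and `2 + 2x` of the degree sum, so `2 + 2c` forces at least `c`
-- common neighbours when contraction destroys the density.
threshold : ℕ → ℕ
threshold zero    = 0
threshold (suc t) = 2 + (threshold t + threshold t)

module Mader (Γ : Graph) where
  open Walks Γ

  record CompleteMinor (t : ℕ) (U : Sub (n Γ)) : Set where
    field
      B      : Fin t → Sub (n Γ)
      B⊆     : ∀ i → B i ⊆ U
      B∋     : ∀ i → ∃ λ v → v ∈ B i
      B-conn : ∀ i → Connected′ (B i)
      B-disj : ∀ i j → i ≢ j → ∀ v → v ∈ B i → v ∉ B j
      B-adj  : ∀ i j → i ≢ j → ∃₂ λ u v → u ∈ B i × v ∈ B j × u ~ v

  e : Sub (n Γ) → ℕ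
  e U = ∑ (λ u → U u ▹ deg (adj Γ) U u)

  e-remove : ∀ R v → e R ≤ e (R ∖ ｛ v ｝) + (deg (adj Γ) R v + deg (adj Γ) R v)
  e-remove R v = ≤-trans (∑-mono pointwise) (≤-trans (≤-reflexive (∑-+ (λ u → R′ u ▹ D u) (λ u → (｛ v ｝ u ▹ D u) + (R u ▹ (adj Γ v u ▹ 1)))))
      (+-monoʳ-≤ (e R′) (≤-trans (≤-reflexive (∑-+ (λ u → ｛ v ｝ u ▹ D u) (λ u → R u ▹ (adj Γ v u ▹ 1)))) (+-mono-≤ first second))))
    where
    R′ = R ∖ ｛ v ｝
    D : V → ℕ
    D u = deg (adj Γ) R′ u
    split : ∀ u → deg (adj Γ) R u ≤ D u + (adj Γ v u ▹ 1)
    split u with v ~? u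
    ... | yes a = ≤-trans (#-mono {T = R′ ∩ adj Γ u ∪ ｛ v ｝} λ w p → sub w p) (≤-trans (#-∪ _ ｛ v ｝) (+-monoʳ-≤ (D u) (≤-trans (#-｛｝ v) (≤-reflexive (sym (▹-true 1 a))))))
      where
      sub : ∀ w → w ∈ R ∩ adj Γ u → w ∈ R′ ∩ adj Γ u ∪ ｛ v ｝
      sub w p with w FP.≟ v
      ... | yes refl = ∪ʳ (｛｝⁺ w)
      ... | no ne = ∪ˡ (∩⁺ (∖⁺ (∩ˡ p) (ne ∘ ｛｝⁻)) (∩ʳ p))
    ... | no ¬a = ≤-trans (#-mono λ w p → ∩⁺ (∖⁺ (∩ˡ p) (λ q → ¬a (~-sym (subst (u ~_) (｛｝⁻ q) (!∈ (∩ʳ p)))))) (∩ʳ p)) (m≤m+n _ _)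
    R-split : ∀ u → R u ≡ true → 1 ≤ (R′ u ▹ 1) + (｛ v ｝ u ▹ 1)
    R-split u p with u FP.≟ v
    ... | yes refl = ≤-trans (≤-reflexive (sym (▹-true 1 (!∈ (｛｝⁺ u))))) (m≤n+m _ _)
    ... | no ne = ≤-trans (≤-reflexive (sym (▹-true 1 (!∈ (∖⁺ {S = R} {｛ v ｝} {u} (∈! p) (ne ∘ ｛｝⁻)))))) (m≤m+n _ _)
    dist : ∀ a b x → 1 ≤ (a ▹ 1) + (b ▹ 1) → x ≤ (a ▹ x) + (b ▹ x)
    dist true  b     x _ = m≤m+n x _
    dist false true  x _ = ≤-refl
    dist false false x ()
    pointwise : ∀ u → R u ▹ deg (adj Γ) R u ≤ R′ u ▹ D u + (｛ v ｝ u ▹ D u + (R u ▹ (adj Γ v u ▹ 1)))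
    pointwise u = ▹-≤ (R u) λ p → ≤-trans (split u) (≤-trans (+-mono-≤ (dist (R′ u) (｛ v ｝ u) (D u) (R-split u p)) (≤-reflexive (sym (▹-true _ p))))
      (≤-reflexive (+-assoc (R′ u ▹ D u) _ _)))
    first : ∑ (λ u → ｛ v ｝ u ▹ D u) ≤ deg (adj Γ) R v
    first = ≤-trans (∑-bound ｛ v ｝ D (deg (adj Γ) R v) λ i p → subst (λ z → D z ≤ deg (adj Γ) R v) (sym (｛｝⁻ p)) (#-mono λ w q → ∩⁺ (∖ˡ (∩ˡ q)) (∩ʳ q)))
      (≤-trans (*-monoʳ-≤ (deg (adj Γ) R v) (#-｛｝ v)) (≤-reflexive (*-identityʳ (deg (adj Γ) R v))))
    second : ∑ (λ u → R u ▹ (adj Γ v u ▹ 1)) ≤ deg (adj Γ) R v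
    second = ≤-trans (∑-mono λ u → ▹-≤ (R u) λ p → ▹-≤ (adj Γ v u) λ q → ≤-reflexive (sym (▹-true 1 (!∈ (∩⁺ {S = R} {adj Γ v} {u} (∈! p) (∈! q))))))
      (≤-reflexive (sym (#-def (R ∩ adj Γ v))))

  -- By the first two hypotheses, absorbing `v` lowers the degree sum of the contracted graph by
  -- more than `2 + 2d`; by the last two it drops by at most `2 + 2 dN`.
  arith : ∀ d eR eR′ nR dR dN #N #N′ → (2 + (d + d)) * suc nR ≤ eR + (#N + #N) → eR′ + (#N′ + #N′) < (2 + (d + d)) * nR →
    eR ≤ eR′ + (dR + dR) → #N + dR ≤ #N′ + suc dN → d ≤ dN
  arith d eR eR′ nR dR dN #N #N′ a b c f = ≮⇒≥ λ lt → <-irrefl refl (begin-strict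
      (2 + (d + d)) * suc nR + (#N′ + #N′)                     ≤⟨ +-monoˡ-≤ (#N′ + #N′) a ⟩
      eR + (#N + #N) + (#N′ + #N′)                             ≤⟨ +-monoˡ-≤ (#N′ + #N′) (+-monoˡ-≤ (#N + #N) c) ⟩
      eR′ + (dR + dR) + (#N + #N) + (#N′ + #N′)                ≡⟨ e₁ eR′ dR #N #N′ ⟩
      eR′ + (#N′ + #N′) + ((#N + dR) + (#N + dR))              <⟨ +-mono-<-≤ b (+-mono-≤ f f) ⟩
      (2 + (d + d)) * nR + ((#N′ + suc dN) + (#N′ + suc dN))   ≤⟨ +-monoʳ-≤ ((2 + (d + d)) * nR) (+-mono-≤ (+-monoʳ-≤ #N′ lt) (+-monoʳ-≤ #N′ lt)) ⟩
      (2 + (d + d)) * nR + ((#N′ + d) + (#N′ + d))             ≤⟨ m≤m+n _ 2 ⟩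
      (2 + (d + d)) * nR + ((#N′ + d) + (#N′ + d)) + 2         ≡⟨ e₂ d nR #N′ ⟩
      (2 + (d + d)) * suc nR + (#N′ + #N′)                     ∎)
    where
    open ≤-Reasoning
    e₁ : ∀ x r y z → x + (r + r) + (y + y) + (z + z) ≡ x + (z + z) + ((y + r) + (y + r))
    e₁ = solve-∀
    e₂ : ∀ d x z → (2 + (d + d)) * x + ((z + d) + (z + d)) + 2 ≡ (2 + (d + d)) * suc x + (z + z)
    e₂ = solve-∀

  module Grow (t : ℕ) (ih : ∀ U → 1 ≤ # U → threshold t * # U ≤ e U → CompleteMinor t U) (U : Sub (n Γ)) where
    c = threshold t
    c′ = threshold (suc t)

    Rst Nb : Sub (n Γ) → Sub (n Γ)
    Rst S = U ∖ S
    Nb S = N[ S ] ∩ Rst S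

    -- Density of the graph in which `S` is contracted to a single vertex: each vertex of `Nb S`
    -- adds an edge, which counts twice in the degree sum.
    Φ : Sub (n Γ) → Set
    Φ S = c′ * suc (# (Rst S)) ≤ e (Rst S) + (# (Nb S) + # (Nb S))

    Nb-grow : ∀ S v → v ∈ Nb S → # (Nb S) + deg (adj Γ) (Rst S) v ≤ # (Nb (S ∪ ｛ v ｝)) + suc (deg (adj Γ) (Nb S) v)
    Nb-grow S v v∈ = ≤-trans (+-mono-≤ a b) (≤-trans (≤-reflexive (e₃ (# (Nb S ∖ ｛ v ｝)) (# M) (deg (adj Γ) (Nb S) v))) (+-monoˡ-≤ (suc (deg (adj Γ) (Nb S) v)) (#-disj subA subB dis)))
      where
      S′ = S ∪ ｛ v ｝
      M = (Rst S ∩ adj Γ v) ∖ Nb S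
      e₃ : ∀ x y z → (x + 1) + (y + z) ≡ (x + y) + suc z
      e₃ = solve-∀
      a : # (Nb S) ≤ # (Nb S ∖ ｛ v ｝) + 1
      a = ≤-trans (#-∖ (Nb S) ｛ v ｝) (+-monoʳ-≤ _ (#-｛｝ v))
      b : deg (adj Γ) (Rst S) v ≤ # M + deg (adj Γ) (Nb S) v
      b = ≤-trans (≤-reflexive (#-∪∖ _ (Nb S))) (+-monoʳ-≤ (# M) (#-mono λ w p → ∩⁺ (∩ʳ p) (∩ʳ (∩ˡ p))))
      R′ : ∀ w → w ∈ Rst S → w ≢ v → w ∈ Rst S′
      R′ w p ne = ∖⁺ (∖ˡ p) λ q → [ ∖ʳ p , ne ∘ ｛｝⁻ ]′ (∪⁻ q)
      subA : Nb S ∖ ｛ v ｝ ⊆ Nb S′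
      subA w p = ∩⁺ (nb (N⁻ (∩ˡ (∖ˡ p)))) (R′ w (∩ʳ (∖ˡ p)) λ { refl → ∖ʳ p (｛｝⁺ w) })
        where
        nb : (∃ λ u → u ∈ S × (u ≡ w ⊎ u ~ w)) → w ∈ N[ S′ ]
        nb (u , u∈ , inj₁ refl) = N-self (∪ˡ u∈)
        nb (u , u∈ , inj₂ q)    = N-adj (∪ˡ u∈) q
      subB : M ⊆ Nb S′
      subB w p = ∩⁺ (N-adj (∪ʳ (｛｝⁺ v)) (!∈ (∩ʳ (∖ˡ p)))) (R′ w (∩ˡ (∖ˡ p)) λ { refl → ~-irrefl (!∈ (∩ʳ (∖ˡ p))) })
      dis : ∀ w → w ∈ Nb S ∖ ｛ v ｝ → w ∉ M
      dis w p q = ∖ʳ q (∖ˡ p)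

    Rst-drop : ∀ S v → v ∈ Rst S → suc (# (Rst (S ∪ ｛ v ｝))) ≤ # (Rst S)
    Rst-drop S v v∈ = #-strict {v = v} (λ w p → ∖⁺ (∖ˡ p) (∖ʳ p ∘ ∪ˡ)) v∈ (λ p → ∖ʳ p (∪ʳ (｛｝⁺ v)))

    e-drop : ∀ S v → e (Rst S) ≤ e (Rst (S ∪ ｛ v ｝)) + (deg (adj Γ) (Rst S) v + deg (adj Γ) (Rst S) v)
    e-drop S v = ≤-trans (e-remove (Rst S) v) (+-monoˡ-≤ (deg (adj Γ) (Rst S) v + deg (adj Γ) (Rst S) v) (∑-mono λ u → ▹-≤ ((Rst S ∖ ｛ v ｝) u) λ p →
        ≤-trans (#-mono λ w q → ∩⁺ (mv w (∩ˡ q)) (∩ʳ q)) (≤-reflexive (sym (▹-true _ (!∈ (mv u (∈! p))))))))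
      where
      mv : ∀ w → w ∈ Rst S ∖ ｛ v ｝ → w ∈ Rst (S ∪ ｛ v ｝)
      mv w p = ∖⁺ (∖ˡ (∖ˡ p)) λ q → [ ∖ʳ (∖ˡ p) , ∖ʳ p ]′ (∪⁻ q)

    with-hub : ∀ S → S ⊆ U → (∃ λ v → v ∈ S) → Connected′ S → CompleteMinor t (Nb S) → CompleteMinor (suc t) U
    with-hub S S⊆ S∋ S-conn cm = record
      { B = B′ ; B⊆ = λ { fz → S⊆ ; (fs i) v p → ∖ˡ (∩ʳ (C.B⊆ i v p)) } ; B∋ = λ { fz → S∋ ; (fs i) → C.B∋ i }
      ; B-conn = λ { fz → S-conn ; (fs i) → C.B-conn i } ; B-disj = dis ; B-adj = ad }
      where
      module C = CompleteMinor cm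
      B′ : Fin (suc t) → Sub (n Γ)
      B′ fz     = S
      B′ (fs i) = C.B i
      dis : ∀ i j → i ≢ j → ∀ v → v ∈ B′ i → v ∉ B′ j
      dis fz     fz     ne v p q = ne refl
      dis fz     (fs j) ne v p q = ∖ʳ (∩ʳ (C.B⊆ j v q)) p
      dis (fs i) fz     ne v p q = ∖ʳ (∩ʳ (C.B⊆ i v p)) q
      dis (fs i) (fs j) ne v p q = C.B-disj i j (ne ∘ cong fs) v p q
      hub : ∀ i → ∃₂ λ u v → u ∈ S × v ∈ C.B i × u ~ v
      hub i with C.B∋ i
      ... | v , v∈ with N⁻ (∩ˡ (C.B⊆ i v v∈))
      ...   | u , u∈ , inj₁ refl = ⊥-elim (∖ʳ (∩ʳ (C.B⊆ i v v∈)) u∈)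
      ...   | u , u∈ , inj₂ q = u , v , u∈ , v∈ , q
      ad : ∀ i j → i ≢ j → ∃₂ λ u v → u ∈ B′ i × v ∈ B′ j × u ~ v
      ad fz     fz     ne = ⊥-elim (ne refl)
      ad fz     (fs j) ne = hub j
      ad (fs i) fz     ne = let (u , v , p , q , r) = hub i in v , u , q , p , ~-sym r
      ad (fs i) (fs j) ne = C.B-adj i j (ne ∘ cong fs)

    -- A maximal connected S whose contraction keeps the density has a dense neighbourhood.
    loop : (fuel : ℕ) (S : Sub (n Γ)) → # (Rst S) ≤ fuel → S ⊆ U → (∃ λ v → v ∈ S) → Connected′ S → Φ S →
      (∀ R → R ⊆ U → # R < # U → 1 ≤ # R → c′ * # R ≤ e R → CompleteMinor (suc t) R) → CompleteMinor (suc t) U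
    loop f S le S⊆ S∋ S-conn φ smaller
      with any? (λ v → (v ∈? Nb S) ×-dec (c′ * suc (# (Rst (S ∪ ｛ v ｝))) ≤? e (Rst (S ∪ ｛ v ｝)) + (# (Nb (S ∪ ｛ v ｝)) + # (Nb (S ∪ ｛ v ｝)))))
    loop zero S le S⊆ S∋ S-conn φ smaller | yes (v , v∈ , _) = ⊥-elim (<⇒≱ (#-∈ (∩ʳ v∈)) le)
    loop (suc f) S le S⊆ S∋ S-conn φ smaller | yes (v , v∈ , φ′) =
      loop f (S ∪ ｛ v ｝) (≤-pred (≤-trans (Rst-drop S v (∩ʳ v∈)) le))
        (λ w p → [ S⊆ w , (λ q → subst (_∈ U) (sym (｛｝⁻ q)) (∖ˡ (∩ʳ v∈))) ]′ (∪⁻ p)) (proj₁ S∋ , ∪ˡ (proj₂ S∋)) conn′ φ′ smaller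
      where
      conn′ : Connected′ (S ∪ ｛ v ｝)
      conn′ = let (u , u∈ , q) = N⁻ (∩ˡ v∈) in conn-∪ S-conn (conn-｛｝ v) u∈ (｛｝⁺ v) q
    loop f S le S⊆ S∋ S-conn φ smaller | no ¬p with 1 ≤? # (Nb S)
    ... | yes pos = with-hub S S⊆ S∋ S-conn (ih (Nb S) pos (∑-lower (Nb S) (deg (adj Γ) (Nb S)) c dense))
      where
      dense : ∀ v → v ∈ Nb S → c ≤ deg (adj Γ) (Nb S) v
      dense v v∈ = arith c (e (Rst S)) (e (Rst (S ∪ ｛ v ｝))) (# (Rst S)) (deg (adj Γ) (Rst S) v) (deg (adj Γ) (Nb S) v) (# (Nb S)) (# (Nb (S ∪ ｛ v ｝))) φ
        (≤-trans (≰⇒> λ z → ¬p (v , v∈ , z)) (*-monoʳ-≤ c′ (Rst-drop S v (∩ʳ v∈)))) (e-drop S v) (Nb-grow S v v∈)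
    -- Here the contracted `S` is an isolated vertex, so `Rst S` alone carries the density, and it
    -- is smaller than `U`.
    ... | no none = lower (smaller (Rst S) (λ _ → ∖ˡ) (#-strict (λ _ → ∖ˡ) (S⊆ _ (proj₂ S∋)) (λ p → ∖ʳ p (proj₂ S∋))) pos′ (≤-trans (*-monoʳ-≤ c′ (n≤1+n _)) φ′))
      where
      Nb0 : # (Nb S) ≡ 0
      Nb0 = n≤0⇒n≡0 (≤-pred (≰⇒> none))
      φ′ : c′ * suc (# (Rst S)) ≤ e (Rst S)
      φ′ = ≤-trans φ (≤-reflexive (trans (cong₂ (λ a b → e (Rst S) + (a + b)) Nb0 Nb0) (+-identityʳ _)))
      pos′ : 1 ≤ # (Rst S)
      pos′ with 1 ≤? # (Rst S)
      ... | yes q = q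
      ... | no ¬q = ⊥-elim (<⇒≱ (s≤s z≤n) (≤-trans φ′ (≤-reflexive (trans (∑-cong {g = λ _ → 0} λ u → zero′ u) (∑-0 {n Γ})))))
        where
        zero′ : ∀ u → Rst S u ▹ deg (adj Γ) (Rst S) u ≡ 0
        zero′ u = n≤0⇒n≡0 (▹-≤ (Rst S u) λ p → ⊥-elim (¬q (#-∈ {S = Rst S} {u} (∈! p))))
      lower : CompleteMinor (suc t) (Rst S) → CompleteMinor (suc t) U
      lower cm = record { B = B ; B⊆ = λ i v p → ∖ˡ (B⊆ i v p) ; B∋ = B∋ ; B-conn = B-conn ; B-disj = B-disj ; B-adj = B-adj }
        where open CompleteMinor cm

  opaque
    mader : ∀ t U → 1 ≤ # U → threshold t * # U ≤ e U → CompleteMinor t U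
    mader zero U pos d = record { B = λ () ; B⊆ = λ () ; B∋ = λ () ; B-conn = λ () ; B-disj = λ () ; B-adj = λ () }
    mader (suc t) U pos d = go (# U) U ≤-refl pos d
      where
      go : ∀ f U → # U ≤ f → 1 ≤ # U → threshold (suc t) * # U ≤ e U → CompleteMinor (suc t) U
      go zero U le pos d = ⊥-elim (<⇒≱ pos le)
      go (suc f) U le pos d with #-∃ pos
      ... | v , v∈ = Grow.loop t (mader t) U (n Γ) ｛ v ｝ (#≤ _) (λ w p → subst (_∈ U) (sym (｛｝⁻ p)) v∈) (v , ｛｝⁺ v) (conn-｛｝ v) φ
            (λ R R⊆ lt → go f R (≤-pred (≤-trans lt le)))
        where
        N⊇ : U ∩ adj Γ v ⊆ Grow.Nb t (mader t) U ｛ v ｝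
        N⊇ w p = ∩⁺ (N-adj (｛｝⁺ v) (!∈ (∩ʳ p))) (∖⁺ (∩ˡ p) λ q → ~-irrefl (subst (v ~_) (｛｝⁻ q) (!∈ (∩ʳ p))))
        φ : Grow.Φ t (mader t) U ｛ v ｝
        φ = ≤-trans (*-monoʳ-≤ (threshold (suc t)) (#-strict {v = v} (λ _ → ∖ˡ) v∈ (λ p → ∖ʳ p (｛｝⁺ v))))
          (≤-trans d (≤-trans (e-remove U v) (+-monoʳ-≤ (e (U ∖ ｛ v ｝)) (+-mono-≤ (#-mono N⊇) (#-mono N⊇)))))

-- Colourings with few monochromatic conflicts

min-average : ∀ {c} (f : Fin (suc c) → ℕ) → ∃ λ κ → suc c * f κ ≤ ∑ f
min-average {c} f = let (κ , _ , le) = average≤ ⊤ˢ (λ κ → suc c * f κ) (∑ f) (≤-trans (s≤s z≤n) (≤-reflexive (sym (#-⊤ {suc c}))))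
                          (≤-reflexive (trans (∑-* (suc c) f) (trans (*-comm (suc c) (∑ f)) (cong (∑ f *_) (sym (#-⊤ {suc c})))))) in κ , le

∑-δ : ∀ {c} (x : Fin c) (w : ℕ) → ∑ (λ κ → does (κ FP.≟ x) ▹ w) ≡ w
∑-δ {suc c} fz     w = trans (cong (w +_) (∑-0 {c})) (+-identityʳ w)
∑-δ {suc c} (fs x) w = ∑-δ x w

∑-δ′ : ∀ {c} (x : Fin c) (w : ℕ) → ∑ (λ κ → does (x FP.≟ κ) ▹ w) ≡ w
∑-δ′ {suc c} fz     w = trans (cong (w +_) (∑-0 {c})) (+-identityʳ w)
∑-δ′ {suc c} (fs x) w = ∑-δ′ x w

∑∑ : ∀ {p q} → (Fin p → Fin q → ℕ) → ℕ
∑∑ f = ∑ (λ i → ∑ (f i))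

∑∑-mono : ∀ {p q} {f g : Fin p → Fin q → ℕ} → (∀ i j → f i j ≤ g i j) → ∑∑ f ≤ ∑∑ g
∑∑-mono h = ∑-mono λ i → ∑-mono (h i)

∑∑-+ : ∀ {p q} (f g : Fin p → Fin q → ℕ) → ∑∑ (λ i j → f i j + g i j) ≡ ∑∑ f + ∑∑ g
∑∑-+ f g = trans (∑-cong λ i → ∑-+ (f i) (g i)) (∑-+ (λ i → ∑ (f i)) (λ i → ∑ (g i)))

∑∑-swap : ∀ {p q i j} (f : Fin p → Fin q → Fin i → Fin j → ℕ) →
  ∑∑ (λ a b → ∑∑ (f a b)) ≡ ∑∑ (λ x y → ∑∑ (λ a b → f a b x y))
∑∑-swap f = trans (∑-cong λ a → ∑-swap (λ b x → ∑ (f a b x))) (trans (∑-swap (λ a x → ∑ (λ b → ∑ (f a b x))))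
  (∑-cong λ x → trans (∑-cong λ a → ∑-swap (λ b y → f a b x y)) (∑-swap (λ a y → ∑ (λ b → f a b x y)))))

∑-▹ : ∀ {m} (b : Bool) (f : Fin m → ℕ) → ∑ (λ i → b ▹ f i) ≡ b ▹ ∑ f
∑-▹ true  f = refl
∑-▹ {m} false f = ∑-0 {m}

clash : ∀ {p c} → (Fin p → Fin c) → Fin p → Fin p → Bool
clash χ z q = not (does (z FP.≟ q)) ∧ does (χ z FP.≟ χ q)

conflicts : ∀ {p c} → (Fin p → Fin p → ℕ) → (Fin p → Fin c) → ℕ
conflicts ω χ = ∑∑ (λ z q → clash χ z q ▹ ω z q)

-- The derandomised form of a random colouring: averaged over all `c + 1` colours, a new vertex
-- conflicts with that share of its weight, so its cheapest colour does no worse.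
few-conflicts : ∀ {p} c (ω : Fin p → Fin p → ℕ) → ∃ λ (χ : Fin p → Fin (suc c)) → suc c * conflicts ω χ ≤ ∑∑ ω
few-conflicts {zero} c ω = (λ ()) , ≤-reflexive (*-zeroʳ (suc c))
few-conflicts {suc p} c ω with few-conflicts c (λ z q → ω (fs z) (fs q))
... | χ , ih with min-average (λ κ → ∑ (λ q → does (κ FP.≟ χ q) ▹ ω fz (fs q)) + ∑ (λ z → does (χ z FP.≟ κ) ▹ ω (fs z) fz))
...   | κ , le = χ′ , total
  where
  χ′ : Fin (suc p) → Fin (suc c)
  χ′ fz     = κ
  χ′ (fs q) = χ q
  row col : Fin (suc c) → ℕ
  row κ = ∑ (λ q → does (κ FP.≟ χ q) ▹ ω fz (fs q))
  col κ = ∑ (λ z → does (χ z FP.≟ κ) ▹ ω (fs z) fz)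
  rest = ∑∑ (λ z q → ω (fs z) (fs q))
  sum-row : ∑ row ≡ ∑ (λ q → ω fz (fs q))
  sum-row = trans (∑-swap (λ κ q → does (κ FP.≟ χ q) ▹ ω fz (fs q))) (∑-cong λ q → ∑-δ (χ q) _)
  sum-col : ∑ col ≡ ∑ (λ z → ω (fs z) fz)
  sum-col = trans (∑-swap (λ κ z → does (χ z FP.≟ κ) ▹ ω (fs z) fz)) (∑-cong λ z → ∑-δ′ (χ z) _)
  shape : conflicts ω χ′ ≡ (row κ + col κ) + conflicts (λ z q → ω (fs z) (fs q)) χ
  shape = trans (cong (row κ +_) (∑-+ (λ z → does (χ z FP.≟ κ) ▹ ω (fs z) fz) _)) (sym (+-assoc (row κ) (col κ) _))
  total-shape : (∑ row + ∑ col) + rest ≤ ∑∑ ω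
  total-shape = ≤-trans (≤-reflexive (trans (cong₂ (λ a b → (a + b) + rest) sum-row sum-col) (trans (+-assoc (∑ (λ q → ω fz (fs q))) _ rest)
      (cong (∑ (λ q → ω fz (fs q)) +_) (sym (∑-+ (λ z → ω (fs z) fz) (λ z → ∑ (λ q → ω (fs z) (fs q))))))))) (+-monoˡ-≤ _ (m≤n+m _ (ω fz fz)))
  total : suc c * conflicts ω χ′ ≤ ∑∑ ω
  total = ≤-trans (≤-reflexive (trans (cong (suc c *_) shape) (*-distribˡ-+ (suc c) (row κ + col κ) _)))
    (≤-trans (+-mono-≤ (≤-trans le (≤-reflexive (∑-+ row col))) ih) total-shape)

mkGraph : ∀ {p} (E : Fin p → Fin p → Bool) → (∀ u v → E u v ≡ E v u) → (∀ v → E v v ≡ false) → Graph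
mkGraph {p} E E-sym E-irrefl = record { n = p ; adj = E ; sym = E-sym ; irrefl = E-irrefl }

-- Hereditary sparsity of the contact graph of cells

module Contacts (G : Graph) (Ω : Sub (n G)) (ν p : ℕ) (Sk : Skeletons.Skeleton G Ω ν p) where
  open Walks G
  open Skeletons G
  open Skeleton Sk

  Touch : Fin p → Fin p → Set
  Touch q q′ = q ≢ q′ × ∃₂ λ u v → u ∈ cl q × v ∈ cl q′ × u ~ v

  touch? : ∀ q q′ → Dec (Touch q q′)
  touch? q q′ = ¬? (q FP.≟ q′) ×-dec any? (λ u → any? (λ v → (u ∈? cl q) ×-dec ((v ∈? cl q′) ×-dec (u ~? v))))

  opaque
    M : Fin p → Fin p → Bool
    M q q′ = does (touch? q q′)

    M⁺ : ∀ {q q′} → Touch q q′ → M q q′ ≡ true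
    M⁺ {q} {q′} = dec-true (touch? q q′)

    M⁻ : ∀ {q q′} → M q q′ ≡ true → Touch q q′
    M⁻ {q} {q′} = does⁻ (touch? q q′)

  ⇔-Bool : ∀ {a b : Bool} → (a ≡ true → b ≡ true) → (b ≡ true → a ≡ true) → a ≡ b
  ⇔-Bool {true}  {b}     f g = sym (f refl)
  ⇔-Bool {false} {false} f g = refl
  ⇔-Bool {false} {true}  f g = g refl

  M-sym : ∀ q q′ → M q q′ ≡ M q′ q
  M-sym q q′ = ⇔-Bool (flip q q′) (flip q′ q)
    where
    flip : ∀ q q′ → M q q′ ≡ true → M q′ q ≡ true
    flip q q′ e = let (ne , u , v , a , b , r) = M⁻ e in M⁺ (ne ∘ sym , v , u , b , a , ~-sym r)

  -- A connection between two touching cells: one edge together with ties from its ends to the two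
  -- cores.
  record Bridge (q q′ : Fin p) (σ₁ σ₂ : Sub (n G)) : Set where
    field
      {u v} : V
      u∈     : u ∈ σ₁
      v∈     : v ∈ σ₂
      u~v    : u ~ v
      σ₁⊆    : σ₁ ⊆ cl q
      σ₂⊆    : σ₂ ⊆ cl q′
      conn₁  : Connected′ (core q ∪ σ₁)
      conn₂  : Connected′ (core q′ ∪ σ₂)

  private
    bridge : ∀ q q′ → Dec (Touch q q′) → Sub (n G) × Sub (n G)
    bridge q q′ (no _)  = ∅ , ∅
    bridge q q′ (yes (_ , u , v , u∈ , v∈ , _)) = Tie.S (tie q u u∈) , Tie.S (tie q′ v v∈)

  opaque
    σ₁ σ₂ : Fin p → Fin p → Sub (n G)
    σ₁ q q′ = proj₁ (bridge q q′ (touch? q q′))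
    σ₂ q q′ = proj₂ (bridge q q′ (touch? q q′))

    bridge-spec : ∀ q q′ → M q q′ ≡ true → Bridge q q′ (σ₁ q q′) (σ₂ q q′)
    bridge-spec q q′ e with touch? q q′ | M⁻ e
    ... | no ¬t | t = ⊥-elim (¬t t)
    ... | yes (_ , u , v , u∈ , v∈ , r) | _ = record
      { u∈ = Tie.self (tie q u u∈) ; v∈ = Tie.self (tie q′ v v∈) ; u~v = r ; σ₁⊆ = Tie.S⊆ (tie q u u∈) ; σ₂⊆ = Tie.S⊆ (tie q′ v v∈)
      ; conn₁ = Tie.conn (tie q u u∈) ; conn₂ = Tie.conn (tie q′ v v∈) }

    few-lights : ∀ q q′ → # ((σ₁ q q′ ∪ σ₂ q q′) ∩ light) ≤ ν + ν
    few-lights q q′ with touch? q q′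
    ... | no _ = ≤-trans (≤-reflexive (#-∅ λ v m → [ ∉∅ , ∉∅ ]′ (∪⁻ (∩ˡ m)))) z≤n
    ... | yes (_ , u , v , u∈ , v∈ , r) = ≤-trans (#-mono λ w m → [ (λ a → ∪ˡ (∩⁺ a (∩ʳ m))) , (λ b → ∪ʳ (∩⁺ b (∩ʳ m))) ]′ (∪⁻ (∩ˡ m)))
        (≤-trans (#-∪ (Tie.S (tie q u u∈) ∩ light) _) (+-mono-≤ (Tie.lights (tie q u u∈)) (Tie.lights (tie q′ v v∈))))

  bad? : ∀ q q′ z → Dec ((z ≢ q × z ≢ q′) × ∃₂ λ x y → x ∈ (σ₁ q q′ ∪ σ₂ q q′) ∩ light × y ∈ cl z × x ~ y)
  bad? q q′ z = (¬? (z FP.≟ q) ×-dec ¬? (z FP.≟ q′)) ×-dec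
    any? (λ x → any? (λ y → (x ∈? (σ₁ q q′ ∪ σ₂ q q′) ∩ light) ×-dec ((y ∈? cl z) ×-dec (x ~? y))))

  -- Third cells that a light vertex of the bridge sees. Heavy vertices can be ignored because every
  -- edge between different cells has a light end, which will lie on some bridge of the model; so
  -- the degree bound keeps this set small.
  Bad : Fin p → Fin p → Sub p
  Bad q q′ = set (bad? q q′)

  module Build (H : Graph) (Fij : Fin p → Fin p → Bool) (Fij-sym : ∀ q q′ → Fij q q′ ≡ Fij q′ q) (Fij-irrefl : ∀ q → Fij q q ≡ false)
               (U : Sub p) (F-M : ∀ {q q′} → Fij q q′ ≡ true → M q q′ ≡ true)
               (F-bad : ∀ {q q′ z} → Fij q q′ ≡ true → z ∈ U → z ∉ Bad q q′)
               (cm : Mader.CompleteMinor (mkGraph Fij Fij-sym Fij-irrefl) (n H) U) where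
    private
      t : ℕ
      t = n H
      Γ : Graph
      Γ = mkGraph Fij Fij-sym Fij-irrefl
    open Mader.CompleteMinor cm

    used? : ∀ q q′ → Dec (Fij q q′ ≡ true × ∃₂ λ a b → q ∈ B a × q′ ∈ B b × (a ≡ b ⊎ Adj H a b))
    used? q q′ = (Fij q q′ BP.≟ true) ×-dec any? (λ a → any? (λ b → (q ∈? B a) ×-dec ((q′ ∈? B b) ×-dec ((a FP.≟ b) ⊎-dec (adj H a b BP.≟ true)))))

    Used : Fin p → Fin p → Set
    Used q q′ = Fij q q′ ≡ true × ∃₂ λ a b → q ∈ B a × q′ ∈ B b × (a ≡ b ⊎ Adj H a b)

    In : Fin t → V → Set
    In a x = (∃ λ q → q ∈ B a × x ∈ core q) ⊎ ∃₂ λ q q′ → Used q q′ × ((q ∈ B a × x ∈ σ₁ q q′) ⊎ (q′ ∈ B a × x ∈ σ₂ q q′))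

    in-X? : ∀ a x → Dec (In a x)
    in-X? a x = any? (λ q → (q ∈? B a) ×-dec (x ∈? core q)) ⊎-dec
      any? (λ q → any? (λ q′ → used? q q′ ×-dec (((q ∈? B a) ×-dec (x ∈? σ₁ q q′)) ⊎-dec ((q′ ∈? B a) ×-dec (x ∈? σ₂ q q′)))))

    X : Fin t → Sub (n G)
    X a = set (in-X? a)

    module Br {q q′} (e : Fij q q′ ≡ true) = Bridge (bridge-spec q q′ (F-M {q} {q′} e))

    same-index : ∀ {a b q} → q ∈ B a → q ∈ B b → a ≡ b
    same-index {a} {b} {q} x y = decidable-stable (a FP.≟ b) λ ne → B-disj a b ne q x y

    cell-of : ∀ {a x} → x ∈ X a → ∃ λ q → q ∈ B a × x ∈ cl q
    cell-of {a} {x} m with set⁻ {P? = in-X? a} m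
    ... | inj₁ (q , b , r) = q , b , core⊆ q x r
    ... | inj₂ (q , q′ , (e , _) , inj₁ (b , s)) = q , b , Br.σ₁⊆ {q} {q′} e x s
    ... | inj₂ (q , q′ , (e , _) , inj₂ (b , s)) = q′ , b , Br.σ₂⊆ {q} {q′} e x s

    -- Cores are heavy, so `x` lies on a used bridge. Its light vertices see no cell of `U` except
    -- the two that the bridge joins, so the cell of `y` is one of these, and bridges between
    -- different branch sets are used only along edges of `H`.
    light-edge : ∀ {a b x y} → x ∈ X a → y ∈ X b → a ≢ b → x ∈ light → x ~ y → Adj H a b
    light-edge {a} {b} {x} {y} x∈ y∈ ne l r with cell-of y∈ | set⁻ {P? = in-X? a} x∈
    ... | z , z∈ , y∈z | inj₁ (q , _ , c) = ⊥-elim (core-heavy q x c l)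
    ... | z , z∈ , y∈z | inj₂ (q , q′ , (e , a′ , b′ , qa , qb , rel) , side) = decide side
      where
      x∈σ : x ∈ (σ₁ q q′ ∪ σ₂ q q′) ∩ light
      x∈σ = ∩⁺ ([ (λ s → ∪ˡ (proj₂ s)) , (λ s → ∪ʳ (proj₂ s)) ]′ side) l
      fin : a ≡ a′ → b ≡ b′ → Adj H a b
      fin refl refl = [ (λ s → ⊥-elim (ne s)) , id ]′ rel
      fin′ : a ≡ b′ → b ≡ a′ → Adj H a b
      fin′ refl refl = [ (λ s → ⊥-elim (ne (sym s))) , (λ s → trans (adj-sym H b′ a′) s) ]′ rel
      decide : (q ∈ B a × x ∈ σ₁ q q′) ⊎ (q′ ∈ B a × x ∈ σ₂ q q′) → Adj H a b
      decide sd with z FP.≟ q | z FP.≟ q′ | sd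
      ... | no n₁ | no n₂ | _ = ⊥-elim (F-bad {q} {q′} e (B⊆ b z z∈) (set⁺ {P? = bad? q q′} ((n₁ , n₂) , x , y , x∈σ , y∈z , r)))
      ... | yes refl | _ | inj₁ (qa′ , _) = ⊥-elim (ne (same-index qa′ z∈))
      ... | yes refl | _ | inj₂ (qb′ , _) = fin′ (same-index qb′ qb) (same-index z∈ qa)
      ... | no _ | yes refl | inj₁ (qa′ , _) = fin (same-index qa′ qa) (same-index z∈ qb)
      ... | no _ | yes refl | inj₂ (qb′ , _) = ⊥-elim (ne (same-index qb′ z∈))

    edge⁻ : ∀ a b u v → a ≢ b → u ∈ X a → v ∈ X b → u ~ v → Adj H a b
    edge⁻ a b u v ne u∈ v∈ r with u ∈? light | v ∈? light
    ... | yes l | _ = light-edge u∈ v∈ ne l r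
    ... | no _ | yes l = trans (adj-sym H a b) (light-edge v∈ u∈ (ne ∘ sym) l (~-sym r))
    ... | no h₁ | no h₂ with cell-of u∈ | cell-of v∈
    ...   | q , qa , uq | q′ , qb , vq with heavy uq vq h₁ h₂ r
    ...     | refl = ⊥-elim (ne (same-index qa qb))

    disj : ∀ a b → a ≢ b → ∀ v → v ∈ X a → v ∉ X b
    disj a b ne v p q with cell-of p | cell-of q
    ... | z , za , vz | z′ , zb , vz′ with unique vz vz′
    ...   | refl = ne (same-index za zb)

    core-X : ∀ {a q} → q ∈ B a → core q ⊆ X a
    core-X b x r = set⁺ {P? = in-X? _} (inj₁ (_ , b , r))

    walk-X : ∀ {a q q′} → Walks.Path Γ (B a) q q′ → ∀ x y → x ∈ core q → y ∈ core q′ → Path (X a) x y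
    walk-X {q = q} [ b ] x y p r = mapʷ (core-X b) (core-conn q x y p r)
    walk-X {a} {q} {q′} (_∷⟨_⟩_ {w = z} b e w) x y p r =
      mapʷ left (Br.conn₁ {q} {z} e x _ (∪ˡ p) (∪ʳ (Br.u∈ {q} {z} e))) ++ʷ
      (left _ (∪ʳ (Br.u∈ {q} {z} e)) ∷⟨ Br.u~v {q} {z} e ⟩
      (mapʷ right (Br.conn₂ {q} {z} e _ _ (∪ʳ (Br.v∈ {q} {z} e)) (∪ˡ (proj₂ (core∋ z)))) ++ʷ walk-X w _ y (proj₂ (core∋ z)) r))
      where
      z∈ = Walks.start Γ w
      use : Used q z
      use = e , a , a , b , z∈ , inj₁ refl
      left : core q ∪ σ₁ q z ⊆ X a
      left v m = [ core-X b v , (λ s → set⁺ {P? = in-X? a} (inj₂ (q , z , use , inj₁ (b , s)))) ]′ (∪⁻ m)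
      right : core z ∪ σ₂ q z ⊆ X a
      right v m = [ core-X z∈ v , (λ s → set⁺ {P? = in-X? a} (inj₂ (q , z , use , inj₂ (z∈ , s)))) ]′ (∪⁻ m)

    conn : ∀ a → Connected′ (X a)
    conn a = conn-hub c₀ go
      where
      q₀ = proj₁ (B∋ a)
      c₀ = proj₁ (core∋ q₀)
      on : ∀ {q x y} → q ∈ B a → x ∈ X a → y ∈ core q → Path (X a) x y → Path (X a) x c₀
      on {q} {x} {y} b x∈ y∈ w = w ++ʷ walk-X (B-conn a q q₀ b (proj₂ (B∋ a))) y c₀ y∈ (proj₂ (core∋ q₀))
      go : ∀ x → x ∈ X a → Path (X a) x c₀
      go x m with set⁻ {P? = in-X? a} m
      ... | inj₁ (q , b , r) = on b m r [ m ]
      ... | inj₂ (q , q′ , use@(e , _) , inj₁ (b , s)) = on b m (proj₂ (core∋ q)) (mapʷ sub (Br.conn₁ {q} {q′} e x _ (∪ʳ s) (∪ˡ (proj₂ (core∋ q)))))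
        where
        sub : core q ∪ σ₁ q q′ ⊆ X a
        sub v k = [ core-X b v , (λ z → set⁺ {P? = in-X? a} (inj₂ (q , q′ , use , inj₁ (b , z)))) ]′ (∪⁻ k)
      ... | inj₂ (q , q′ , use@(e , _) , inj₂ (b , s)) = on b m (proj₂ (core∋ q′)) (mapʷ sub (Br.conn₂ {q} {q′} e x _ (∪ʳ s) (∪ˡ (proj₂ (core∋ q′)))))
        where
        sub : core q′ ∪ σ₂ q q′ ⊆ X a
        sub v k = [ core-X b v , (λ z → set⁺ {P? = in-X? a} (inj₂ (q , q′ , use , inj₂ (b , z)))) ]′ (∪⁻ k)

    minor : InducedMinor H G
    minor = Models.mkMinor H G X (λ a → _ , core-X (proj₂ (B∋ a)) _ (proj₂ (core∋ (proj₁ (B∋ a))))) disj conn edge⁺ edge⁻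
      where
      edge⁺ : ∀ a b → a ≢ b → Adj H a b → ∃₂ λ u v → u ∈ X a × v ∈ X b × u ~ v
      edge⁺ a b ne r with B-adj a b ne
      ... | q , q′ , qa , qb , e = _ , _ , set⁺ {P? = in-X? a} (inj₂ (q , q′ , use , inj₁ (qa , Br.u∈ {q} {q′} e))) ,
              set⁺ {P? = in-X? b} (inj₂ (q , q′ , use , inj₂ (qb , Br.v∈ {q} {q′} e))) , Br.u~v {q} {q′} e
        where
        use : Used q q′
        use = e , a , b , qa , qb , inj₂ r

  module _ (Δ : ℕ) (Δ-bound : ∀ v → # (adj G v) ≤ Δ) where

    β : ℕ
    β = Δ * (ν + ν)

    home : V → Sub p
    home y = λ z → cl z y

    #-home : ∀ y → # (home y) ≤ 1
    #-home y with any? (λ z → z ∈? home y)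
    ... | no ¬p = ≤-trans (≤-reflexive (#-∅ λ z m → ¬p (z , m))) z≤n
    ... | yes (z , m) = ≤-trans (#-mono {T = ｛ z ｝} λ w m′ → subst (_∈ ｛ z ｝) (unique {v = y} (∈! (!∈ m)) (∈! (!∈ m′))) (｛｝⁺ z)) (#-｛｝ z)

    #-Bad : ∀ q q′ → # (Bad q q′) ≤ β
    #-Bad q q′ = ≤-trans (#-mono sub) (≤-trans (#-⋃-bound L (λ x → ⋃ (adj G x) home) Δ inner) (*-monoʳ-≤ Δ (few-lights q q′)))
      where
      L = (σ₁ q q′ ∪ σ₂ q q′) ∩ light
      sub : Bad q q′ ⊆ ⋃ L (λ x → ⋃ (adj G x) home)
      sub z m = let (_ , x , y , x∈ , y∈ , r) = set⁻ {P? = bad? q q′} m in ⋃⁺ x x∈ (⋃⁺ y (∈! r) (∈! (!∈ y∈)))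
      inner : ∀ x → x ∈ L → # (⋃ (adj G x) home) ≤ Δ
      inner x _ = ≤-trans (#-⋃-bound (adj G x) home 1 λ y _ → #-home y) (≤-trans (≤-reflexive (*-identityˡ _)) (Δ-bound x))

    module Dense (H : Graph) (noH : ¬ InducedMinor H G) (Q : Sub p) (c : ℕ) (c-eq : suc c ≡ suc (β + β) * 4) where

      t : ℕ
      t = n H

      thr : ℕ
      thr = threshold t

      opaque
        E : Fin p → Fin p → Bool
        E q q′ = Q q ∧ (Q ∩ M q) q′

        E⁻ : ∀ {q q′} → E q q′ ≡ true → q ∈ Q × q′ ∈ Q × M q q′ ≡ true
        E⁻ {q} {q′} e with Q q in eq
        ... | true = ∈! eq , ∩ˡ {S = Q} {M q} {q′} (∈! e) , !∈ (∩ʳ {S = Q} {M q} {q′} (∈! e))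

        E⁺ : ∀ {q q′} → q ∈ Q → q′ ∈ Q → M q q′ ≡ true → E q q′ ≡ true
        E⁺ {q} {q′} a b m = cong₂ _∧_ (!∈ a) (!∈ (∩⁺ {S = Q} {M q} {q′} b (∈! m)))

      E-sym : ∀ q q′ → E q q′ ≡ true → E q′ q ≡ true
      E-sym q q′ e = let (a , b , m) = E⁻ e in E⁺ b a (trans (M-sym q′ q) m)

      total : ℕ
      total = ∑∑ (λ q q′ → E q q′ ▹ 1)

      opaque
        unfolding E

        total≡ : ∑ (λ q → Q q ▹ deg M Q q) ≡ total
        total≡ = ∑-cong λ q → trans (cong (Q q ▹_) (#-def (Q ∩ M q))) (trans (sym (∑-▹ (Q q) (λ q′ → (Q ∩ M q) q′ ▹ 1))) (∑-cong λ q′ → nest (Q q) ((Q ∩ M q) q′)))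
          where
          nest : ∀ a b → a ▹ (b ▹ 1) ≡ (a ∧ b) ▹ 1
          nest true  b = refl
          nest false b = refl

      -- The cells that should not share the colour of `q` if the contact with `q′` is to be usable.
      -- Their number `2β + 1` explains the choice of `4 (2β + 1)` colours.
      Rs : Fin p → Fin p → Sub p
      Rs q q′ = Bad q q′ ∪ Bad q′ q ∪ ｛ q′ ｝

      #-Rs : ∀ q q′ → # (Rs q q′) ≤ suc (β + β)
      #-Rs q q′ = ≤-trans (#-∪ (Bad q q′) _) (≤-trans (+-mono-≤ (#-Bad q q′) (≤-trans (#-∪ (Bad q′ q) _) (+-mono-≤ (#-Bad q′ q) (#-｛｝ q′)))) (≤-reflexive (e₁ β)))
        where
        e₁ : ∀ b → b + (b + 1) ≡ suc (b + b)
        e₁ = solve-∀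

      ω : Fin p → Fin p → ℕ
      ω z q = ∑ (λ q′ → E q q′ ▹ (Rs q q′ z ▹ 1))

      ω-total : ∑∑ ω ≤ suc (β + β) * total
      ω-total = ≤-trans (≤-reflexive (∑-swap ω)) (≤-trans (∑-mono row) (≤-reflexive (∑-* (suc (β + β)) (λ q → ∑ (λ q′ → E q q′ ▹ 1)))))
        where
        row : ∀ q → ∑ (λ z → ω z q) ≤ suc (β + β) * ∑ (λ q′ → E q q′ ▹ 1)
        row q = ≤-trans (≤-reflexive (∑-swap (λ z q′ → E q q′ ▹ (Rs q q′ z ▹ 1)))) (≤-trans (∑-mono cell) (≤-reflexive (∑-* (suc (β + β)) (λ q′ → E q q′ ▹ 1))))
          where
          cell : ∀ q′ → ∑ (λ z → E q q′ ▹ (Rs q q′ z ▹ 1)) ≤ suc (β + β) * (E q q′ ▹ 1)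
          cell q′ with E q q′
          ... | true  = ≤-trans (≤-reflexive (sym (#-def (Rs q q′)))) (≤-trans (#-Rs q q′) (≤-reflexive (sym (*-identityʳ _))))
          ... | false = ≤-trans (≤-reflexive (∑-0 {p})) z≤n

      χ-data : ∃ λ (χ : Fin p → Fin (suc c)) → suc c * conflicts ω χ ≤ ∑∑ ω
      χ-data = few-conflicts c ω

      module Coloured (χ : Fin p → Fin (suc c)) (χ-ok : suc c * conflicts ω χ ≤ ∑∑ ω) (dense : thr * (4 * suc c) * # Q < total) where

        b₁? : ∀ q q′ → Dec (E q q′ ≡ true × ∃ λ z → z ≢ q × z ∈ Rs q q′ × χ z ≡ χ q)
        b₁? q q′ = (E q q′ BP.≟ true) ×-dec any? (λ z → ¬? (z FP.≟ q) ×-dec ((z ∈? Rs q q′) ×-dec (χ z FP.≟ χ q)))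

        opaque
          b₁ : Fin p → Fin p → Bool
          b₁ q q′ = does (b₁? q q′)

          b₁⁺ : ∀ {q q′} → (E q q′ ≡ true × ∃ λ z → z ≢ q × z ∈ Rs q q′ × χ z ≡ χ q) → b₁ q q′ ≡ true
          b₁⁺ {q} {q′} = dec-true (b₁? q q′)

          b₁⁻ : ∀ {q q′} → b₁ q q′ ≡ true → E q q′ ≡ true × ∃ λ z → z ≢ q × z ∈ Rs q q′ × χ z ≡ χ q
          b₁⁻ {q} {q′} = does⁻ (b₁? q q′)

        few-bad : ∑∑ (λ q q′ → b₁ q q′ ▹ 1) ≤ conflicts ω χ
        few-bad = ≤-trans (∑-mono row) (≤-reflexive (sym (∑-swap (λ z q → clash χ z q ▹ ω z q))))
          where
          row : ∀ q → ∑ (λ q′ → b₁ q q′ ▹ 1) ≤ ∑ (λ z → clash χ z q ▹ ω z q)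
          row q = ≤-trans (∑-mono cell) (≤-trans (≤-reflexive (∑-swap (λ q′ z → clash χ z q ▹ (E q q′ ▹ (Rs q q′ z ▹ 1)))))
                    (≤-reflexive (∑-cong λ z → ∑-▹ (clash χ z q) (λ q′ → E q q′ ▹ (Rs q q′ z ▹ 1)))))
            where
            cell : ∀ q′ → b₁ q q′ ▹ 1 ≤ ∑ (λ z → clash χ z q ▹ (E q q′ ▹ (Rs q q′ z ▹ 1)))
            cell q′ = ▹-≤ (b₁ q q′) λ b → let (e , z , ne , z∈ , same) = b₁⁻ b in
              ≤-trans (≤-reflexive (sym (trans (▹-true _ (cong₂ (λ x y → not x ∧ y) (dec-false (z FP.≟ q) ne) (dec-true (χ z FP.≟ χ q) same)))
                (trans (▹-true _ e) (▹-true 1 (!∈ z∈)))))) (∑-∋ (λ z → clash χ z q ▹ (E q q′ ▹ (Rs q q′ z ▹ 1))) z)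

        opaque
          good : Fin p → Fin p → Bool
          good q q′ = E q q′ ∧ (not (b₁ q q′) ∧ not (b₁ q′ q))

          good⁻ : ∀ {q q′} → good q q′ ≡ true → E q q′ ≡ true × ¬ (b₁ q q′ ≡ true) × ¬ (b₁ q′ q ≡ true)
          good⁻ {q} {q′} = go (E q q′) (b₁ q q′) (b₁ q′ q)
            where
            go : ∀ x y z → x ∧ (not y ∧ not z) ≡ true → x ≡ true × ¬ (y ≡ true) × ¬ (z ≡ true)
            go true false false _ = refl , (λ ()) , λ ()

          good⁺ : ∀ {q q′} → E q q′ ≡ true → ¬ (b₁ q q′ ≡ true) → ¬ (b₁ q′ q ≡ true) → good q q′ ≡ true
          good⁺ e a b = cong₂ _∧_ e (cong₂ (λ x y → not x ∧ not y) (BP.¬-not a) (BP.¬-not b))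

          good-or : ∀ q q′ → E q q′ ▹ 1 ≤ good q q′ ▹ 1 + (b₁ q q′ ▹ 1 + b₁ q′ q ▹ 1)
          good-or q q′ = point (E q q′) (b₁ q q′) (b₁ q′ q)
            where
            point : ∀ x y z → x ▹ 1 ≤ (x ∧ (not y ∧ not z)) ▹ 1 + (y ▹ 1 + z ▹ 1)
            point false y     z     = z≤n
            point true  true  z     = s≤s z≤n
            point true  false true  = s≤s z≤n
            point true  false false = s≤s z≤n

        Good : ℕ
        Good = ∑∑ (λ q q′ → good q q′ ▹ 1)

        -- With `4 (2β + 1)` colours the conflicts amount to at most a quarter of `total`. A contact
        -- can be spoilt at either end, so at least half of `total` survives.
        total≤ : total ≤ 2 * Good
        total≤ = +-cancelʳ-≤ (4 * conflicts ω χ) total (2 * Good) (≤-trans (+-monoʳ-≤ total four) (≤-trans (≤-reflexive (e₂ total)) (≤-trans (*-monoʳ-≤ 2 split) (≤-reflexive (e₃ Good (conflicts ω χ))))))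
          where
          e₂ : ∀ x → x + x ≡ 2 * x
          e₂ = solve-∀
          e₃ : ∀ g x → 2 * (g + (x + x)) ≡ 2 * g + 4 * x
          e₃ = solve-∀
          e₄ : ∀ x → suc (β + β) * (4 * x) ≡ suc c * x
          e₄ x = trans (sym (*-assoc (suc (β + β)) 4 x)) (cong (_* x) (sym c-eq))
          four : 4 * conflicts ω χ ≤ total
          four = *-cancelˡ-≤ (suc (β + β)) (≤-trans (≤-reflexive (e₄ (conflicts ω χ))) (≤-trans χ-ok ω-total))
          split : total ≤ Good + (conflicts ω χ + conflicts ω χ)
          split = ≤-trans (∑∑-mono good-or)
            (≤-trans (≤-reflexive (trans (∑∑-+ (λ q q′ → good q q′ ▹ 1) (λ q q′ → b₁ q q′ ▹ 1 + b₁ q′ q ▹ 1)) (cong (Good +_) (∑∑-+ (λ q q′ → b₁ q q′ ▹ 1) (λ q q′ → b₁ q′ q ▹ 1)))))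
            (+-monoʳ-≤ Good (+-mono-≤ few-bad (≤-trans (≤-reflexive (∑-swap (λ q q′ → b₁ q′ q ▹ 1))) few-bad))))

        ends? : ∀ i j q q′ → Dec ((χ q ≡ i × χ q′ ≡ j) ⊎ (χ q ≡ j × χ q′ ≡ i))
        ends? i j q q′ = ((χ q FP.≟ i) ×-dec (χ q′ FP.≟ j)) ⊎-dec ((χ q FP.≟ j) ×-dec (χ q′ FP.≟ i))

        opaque
          F : Fin (suc c) → Fin (suc c) → Fin p → Fin p → Bool
          F i j q q′ = good q q′ ∧ does (ends? i j q q′)

          F⁺ : ∀ {i j q q′} → good q q′ ≡ true → (χ q ≡ i × χ q′ ≡ j) ⊎ (χ q ≡ j × χ q′ ≡ i) → F i j q q′ ≡ true
          F⁺ {i} {j} {q} {q′} g x = cong₂ _∧_ g (dec-true (ends? i j q q′) x)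

          F⁻′ : ∀ {i j q q′} → F i j q q′ ≡ true → good q q′ ≡ true × ((χ q ≡ i × χ q′ ≡ j) ⊎ (χ q ≡ j × χ q′ ≡ i))
          F⁻′ {i} {j} {q} {q′} e = let (a , b) = go (good q q′) (does (ends? i j q q′)) e in a , does⁻ (ends? i j q q′) b
            where
            go : ∀ x y → x ∧ y ≡ true → x ≡ true × y ≡ true
            go true true _ = refl , refl

        in? : ∀ i j q → Dec (q ∈ Q × (χ q ≡ i ⊎ χ q ≡ j))
        in? i j q = (q ∈? Q) ×-dec ((χ q FP.≟ i) ⊎-dec (χ q FP.≟ j))

        -- A good contact has no bad cell in the colour of either of its ends, so restricting to
        -- these two colours makes it safe.
        U : Fin (suc c) → Fin (suc c) → Sub p
        U i j = set (in? i j)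

        edges : Fin (suc c) → Fin (suc c) → ℕ
        edges i j = ∑∑ (λ q q′ → F i j q q′ ▹ 1)

        many-edges : Good ≤ ∑∑ edges
        many-edges = ≤-trans (∑∑-mono point) (≤-reflexive (∑∑-swap (λ q q′ i j → F i j q q′ ▹ 1)))
          where
          point : ∀ q q′ → good q q′ ▹ 1 ≤ ∑∑ (λ i j → F i j q q′ ▹ 1)
          point q q′ = ▹-≤ (good q q′) λ g → ≤-trans (≤-reflexive (sym (▹-true 1 (F⁺ {χ q} {χ q′} g (inj₁ (refl , refl))))))
            (≤-trans (∑-∋ (λ j → F (χ q) j q q′ ▹ 1) (χ q′)) (∑-∋ (λ i → ∑ (λ j → F i j q q′ ▹ 1)) (χ q)))

        few-vertices : ∑∑ (λ i j → # (U i j)) ≤ 2 * suc c * # Q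
        few-vertices = ≤-trans (≤-reflexive (∑-cong λ i → ∑-cong λ j → #-def (U i j))) (≤-trans (≤-reflexive swap3) (≤-trans (∑-mono col) (≤-reflexive (∑-#* Q (2 * suc c)))))
          where
          swap3 : ∑ (λ i → ∑ (λ j → ∑ (λ q → U i j q ▹ 1))) ≡ ∑ (λ q → ∑ (λ i → ∑ (λ j → U i j q ▹ 1)))
          swap3 = trans (∑-cong λ i → ∑-swap (λ j q → U i j q ▹ 1)) (∑-swap (λ i q → ∑ (λ j → U i j q ▹ 1)))
          e₅ : ∀ x → x * 1 + x * 1 ≡ 2 * x
          e₅ = solve-∀
          point : ∀ q i j → U i j q ▹ 1 ≤ Q q ▹ (does (χ q FP.≟ i) ▹ 1 + does (χ q FP.≟ j) ▹ 1)
          point q i j = ▹-≤ (U i j q) λ e → let (a , b) = set⁻ {P? = in? i j} {q} (∈! e) in ≤-trans (one b) (≤-reflexive (sym (▹-true _ (!∈ a))))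
            where
            one : χ q ≡ i ⊎ χ q ≡ j → 1 ≤ does (χ q FP.≟ i) ▹ 1 + does (χ q FP.≟ j) ▹ 1
            one (inj₁ x) = ≤-trans (≤-reflexive (sym (▹-true 1 (dec-true (χ q FP.≟ i) x)))) (m≤m+n _ _)
            one (inj₂ x) = ≤-trans (≤-reflexive (sym (▹-true 1 (dec-true (χ q FP.≟ j) x)))) (m≤n+m _ _)
          col : ∀ q → ∑ (λ i → ∑ (λ j → U i j q ▹ 1)) ≤ Q q ▹ (2 * suc c)
          col q = ≤-trans (∑-mono λ i → ∑-mono λ j → point q i j) (≤-reflexive (trans (∑-cong λ i → ∑-▹ (Q q) (f i)) (trans (∑-▹ (Q q) (λ i → ∑ (f i))) (cong (Q q ▹_) inner))))
            where
            f : Fin (suc c) → Fin (suc c) → ℕ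
            f i j = does (χ q FP.≟ i) ▹ 1 + does (χ q FP.≟ j) ▹ 1
            inner : ∑ (λ i → ∑ (f i)) ≡ 2 * suc c
            inner = trans (∑∑-+ (λ i j → does (χ q FP.≟ i) ▹ 1) (λ i j → does (χ q FP.≟ j) ▹ 1))
              (trans (cong₂ _+_ (trans (∑-swap (λ i (j : Fin (suc c)) → does (χ q FP.≟ i) ▹ 1)) (trans (∑-cong {dim = suc c} λ j → ∑-δ′ (χ q) 1) (∑-const {suc c} 1)))
                                (trans (∑-cong {dim = suc c} λ i → ∑-δ′ (χ q) 1) (∑-const {suc c} 1))) (e₅ (suc c)))

        -- Averaging over ordered pairs of colours: each good contact appears for some pair, while
        -- the vertex sets have total size at most `2 (c + 1) * # Q`.
        chosen : ∃₂ λ i j → thr * # (U i j) < edges i j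
        chosen = go (any? (λ i → any? (λ j → thr * # (U i j) <? edges i j)))
          where
          e₆ : ∀ a b x → 2 * (a * (2 * b * x)) ≡ a * (4 * b) * x
          e₆ = solve-∀
          go : Dec (∃₂ λ i j → thr * # (U i j) < edges i j) → ∃₂ λ i j → thr * # (U i j) < edges i j
          go (yes q) = q
          go (no none) = ⊥-elim (<⇒≱ dense (≤-trans total≤ (≤-trans (*-monoʳ-≤ 2 (≤-trans many-edges
              (≤-trans (∑∑-mono λ i j → ≮⇒≥ λ l → none (i , j , l)) (≤-trans (≤-reflexive (trans (∑-cong λ i → ∑-* thr (λ j → # (U i j))) (∑-* thr (λ i → ∑ (λ j → # (U i j))))))
              (*-monoʳ-≤ thr few-vertices))))) (≤-reflexive (e₆ thr (suc c) (# Q))))))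

        module Minor (i j : Fin (suc c)) (enough : thr * # (U i j) < edges i j) where

          Fij : Fin p → Fin p → Bool
          Fij = F i j

          F⁻ : ∀ {q q′} → Fij q q′ ≡ true → good q q′ ≡ true × ((χ q ≡ i × χ q′ ≡ j) ⊎ (χ q ≡ j × χ q′ ≡ i))
          F⁻ e = F⁻′ e

          good-sym : ∀ q q′ → good q q′ ≡ true → good q′ q ≡ true
          good-sym q q′ g = let (e , a , b) = good⁻ {q} {q′} g in good⁺ (E-sym q q′ e) b a

          Γ : Graph
          Γ = record
            { n = p ; adj = Fij ; sym = λ q q′ → ⇔-Bool (flip q q′) (flip q′ q)
            ; irrefl = λ q → BP.¬-not λ e → let (g , _) = F⁻ {q} {q} e ; (_ , _ , m) = E⁻ (proj₁ (good⁻ {q} {q} g)) in proj₁ (M⁻ m) refl }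
            where
            flip : ∀ q q′ → Fij q q′ ≡ true → Fij q′ q ≡ true
            flip q q′ e = let (g , x) = F⁻ {q} {q′} e in F⁺ (good-sym q q′ g) (sw x)
              where
              sw : ∀ {a b} → (χ a ≡ i × χ b ≡ j) ⊎ (χ a ≡ j × χ b ≡ i) → (χ b ≡ i × χ a ≡ j) ⊎ (χ b ≡ j × χ a ≡ i)
              sw (inj₁ (x , y)) = inj₂ (y , x)
              sw (inj₂ (x , y)) = inj₁ (y , x)

          F-M : ∀ {q q′} → Fij q q′ ≡ true → M q q′ ≡ true
          F-M {q} {q′} e = proj₂ (proj₂ (E⁻ (proj₁ (good⁻ {q} {q′} (proj₁ (F⁻ {q} {q′} e))))))

          F-U : ∀ {q q′} → Fij q q′ ≡ true → q ∈ U i j × q′ ∈ U i j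
          F-U {q} {q′} e = let (g , x) = F⁻ {q} {q′} e ; (a , b , _) = E⁻ (proj₁ (good⁻ {q} {q′} g)) in
              set⁺ {P? = in? i j} (a , [ (λ z → inj₁ (proj₁ z)) , (λ z → inj₂ (proj₁ z)) ]′ x) ,
              set⁺ {P? = in? i j} (b , [ (λ z → inj₂ (proj₂ z)) , (λ z → inj₁ (proj₂ z)) ]′ x)

          F-bad : ∀ {q q′ z} → Fij q q′ ≡ true → z ∈ U i j → z ∉ Bad q q′
          F-bad {q} {q′} {z} e z∈ b with F⁻ {q} {q′} e | set⁻ {P? = bad? q q′} b
          ... | g , x | (ne , ne′) , _ with good⁻ {q} {q′} g
          ...   | Eqq , n₁ , n₂ = which x (proj₂ (set⁻ {P? = in? i j} z∈))
            where
            off : χ z ≢ χ q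
            off s = n₁ (b₁⁺ (Eqq , z , ne , ∪ˡ b , s))
            off′ : χ z ≢ χ q′
            off′ s = n₂ (b₁⁺ (E-sym q q′ Eqq , z , ne′ , ∪ʳ (∪ˡ b) , s))
            which : (χ q ≡ i × χ q′ ≡ j) ⊎ (χ q ≡ j × χ q′ ≡ i) → χ z ≡ i ⊎ χ z ≡ j → ⊥
            which (inj₁ (a , b)) (inj₁ y) = off (trans y (sym a))
            which (inj₁ (a , b)) (inj₂ y) = off′ (trans y (sym b))
            which (inj₂ (a , b)) (inj₁ y) = off′ (trans y (sym b))
            which (inj₂ (a , b)) (inj₂ y) = off (trans y (sym a))

          edges≤e : edges i j ≤ Mader.e Γ (U i j)
          edges≤e = ∑-mono λ q → row q
            where
            row : ∀ q → ∑ (λ q′ → Fij q q′ ▹ 1) ≤ U i j q ▹ deg Fij (U i j) q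
            row q with q ∈? U i j
            ... | yes q∈ = ≤-trans (∑-mono λ q′ → ▹-≤ (Fij q q′) λ e → ≤-reflexive (sym (▹-true 1 (!∈ (∩⁺ {S = U i j} {Fij q} {q′} (proj₂ (F-U {q} {q′} e)) (∈! e))))))
                (≤-trans (≤-reflexive (sym (#-def (U i j ∩ Fij q)))) (≤-reflexive (sym (▹-true _ (!∈ q∈)))))
            ... | no q∉ = ≤-trans (∑-mono {g = λ _ → 0} λ q′ → ▹-≤ (Fij q q′) λ e → ⊥-elim (q∉ (proj₁ (F-U {q} {q′} e)))) (≤-trans (≤-reflexive (∑-0 {p})) z≤n)

          U-pos : 1 ≤ # (U i j)
          U-pos with 1 ≤? # (U i j)
          ... | yes le = le
          ... | no ¬le = ⊥-elim (<⇒≱ enough (≤-trans (∑∑-mono {g = λ _ _ → 0} λ q q′ → ▹-≤ (Fij q q′) λ e → ⊥-elim (¬le (#-∈ (proj₁ (F-U {q} {q′} e)))))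
                (≤-trans (≤-reflexive (trans (∑-cong {p} {λ _ → ∑ {p} (λ _ → 0)} {λ _ → 0} λ q → ∑-0 {p}) (∑-0 {p}))) z≤n)))

      opaque
        sparse-on : ∑ (λ q → Q q ▹ deg M Q q) ≤ thr * (4 * suc c) * # Q
        sparse-on = ≮⇒≥ λ lt → let (χ , ok) = χ-data ; d = ≤-trans lt (≤-reflexive total≡) ; (i , j , en) = Coloured.chosen χ ok d in
          noH (Build.minor H (Coloured.F χ ok d i j) (adj-sym (Coloured.Minor.Γ χ ok d i j en)) (adj-irrefl (Coloured.Minor.Γ χ ok d i j en))
            (Coloured.U χ ok d i j) (Coloured.Minor.F-M χ ok d i j en) (Coloured.Minor.F-bad χ ok d i j en)
            (Mader.mader (Coloured.Minor.Γ χ ok d i j en) t _ (Coloured.Minor.U-pos χ ok d i j en)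
              (≤-trans (<⇒≤ en) (Coloured.Minor.edges≤e χ ok d i j en))))

-- `suc (3 + 8 β)` with `β = Δ (ν + ν)` is the number `4 (2β + 1)` of colours. The factor 4 combines
-- the lost half of the contacts with the double count of cells over pairs of colours.
density : ℕ → ℕ → ℕ → ℕ
density Δ ν t = threshold t * (4 * suc (3 + 8 * (Δ * (ν + ν))))

contacts-sparse : ∀ (H G : Graph) (Δ : ℕ) → (∀ v → # (adj G v) ≤ Δ) → ¬ InducedMinor H G →
  ∀ Ω ν p (Sk : Skeletons.Skeleton G Ω ν p) → Sparse (Contacts.M G Ω ν p Sk) (density Δ ν (n H))
contacts-sparse H G Δ Δ-bound noH Ω ν p Sk Q = Contacts.Dense.sparse-on G Ω ν p Sk Δ Δ-bound H noH Q (3 + 8 * (Δ * (ν + ν))) (eq (Δ * (ν + ν)))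
  where
  eq : ∀ b → suc (3 + 8 * b) ≡ suc (b + b) * 4
  eq = solve-∀

-- Selection lemmas

-- On any `Q` there are at most `o * # Q` arcs, and each contributes to the degree of at most two
-- vertices.
sym-sparse : ∀ {m} (R : Fin m → Fin m → Bool) (o : ℕ) → (∀ i → # (R i) ≤ o) → Sparse (λ i k → R i k ∨ R k i) (o + o)
sym-sparse {m} R o h Q = ≤-trans (∑-mono row) (≤-trans (≤-reflexive (∑-+ (λ i → Q i ▹ # (R i)) (λ i → ∑ (λ k → Q k ▹ (R k i ▹ 1)))))
    (≤-trans (+-mono-≤ (∑-bound Q (# ∘ R) o λ i _ → h i) second) (≤-reflexive (sym (*-distribʳ-+ (# Q) o o)))))
  where
  row : ∀ i → Q i ▹ deg (λ i k → R i k ∨ R k i) Q i ≤ Q i ▹ # (R i) + ∑ (λ k → Q k ▹ (R k i ▹ 1))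
  row i = ▹-≤ (Q i) λ q → ≤-trans (≤-trans (≤-reflexive (#-def _)) (≤-trans (∑-mono cell) (≤-reflexive (∑-+ (λ k → R i k ▹ 1) (λ k → Q k ▹ (R k i ▹ 1))))))
      (+-monoˡ-≤ _ (≤-reflexive (trans (sym (#-def (R i))) (sym (▹-true _ q)))))
    where
    cell : ∀ k → (Q ∩ (λ k → R i k ∨ R k i)) k ▹ 1 ≤ R i k ▹ 1 + Q k ▹ (R k i ▹ 1)
    cell k = ▹-≤ _ λ e → two (R i k) (R k i) (!∈ (∩ˡ {S = Q} {λ k → R i k ∨ R k i} {k} (∈! e))) (!∈ (∩ʳ {S = Q} {λ k → R i k ∨ R k i} {k} (∈! e)))
      where
      two : ∀ a b → Q k ≡ true → a ∨ b ≡ true → 1 ≤ a ▹ 1 + Q k ▹ (b ▹ 1)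
      two true  b    q _ = s≤s z≤n
      two false true q _ = ≤-reflexive (sym (▹-true 1 q))
  second : ∑ (λ i → ∑ (λ k → Q k ▹ (R k i ▹ 1))) ≤ o * # Q
  second = ≤-trans (≤-reflexive (∑-swap (λ i k → Q k ▹ (R k i ▹ 1)))) (≤-trans (≤-reflexive (∑-cong λ k → trans (∑-▹ (Q k) (λ i → R k i ▹ 1)) (cong (Q k ▹_) (sym (#-def (R k))))))
    (∑-bound Q (# ∘ R) o λ k _ → h k))

hits : ∀ {m k} → (Fin k → Sub m) → Sub m → Sub k
hits L T = set (λ i → any? (λ v → (v ∈? L i) ×-dec (v ∈? T)))

hits⁺ : ∀ {m k} {L : Fin k → Sub m} {T i v} → v ∈ L i → v ∈ T → i ∈ hits L T
hits⁺ {v = v} p q = set⁺ (v , p , q)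

hits⁻ : ∀ {m k} {L : Fin k → Sub m} {T i} → i ∈ hits L T → ∃ λ v → v ∈ L i × v ∈ T
hits⁻ = set⁻

#-hits : ∀ {m k} (L : Fin k → Sub m) → (∀ i j → i ≢ j → ∀ v → v ∈ L i → v ∉ L j) → ∀ T → # (hits L T) ≤ # T
#-hits L disj T = ≤-trans (#-mono sub) (≤-trans (#-⋃-bound T (λ v i → L i v) 1 one) (≤-reflexive (*-identityˡ _)))
  where
  sub : hits L T ⊆ ⋃ T (λ v i → L i v)
  sub i p = let (v , a , b) = hits⁻ {L = L} {T} p in ⋃⁺ v b (∈! (!∈ a))
  one : ∀ v → v ∈ T → # (λ i → L i v) ≤ 1
  one v _ with any? (λ i → v ∈? L i)
  ... | no ¬p = ≤-trans (≤-reflexive (#-∅ λ i e → ¬p (i , ∈! (!∈ e)))) z≤n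
  ... | yes (i , p) = ≤-trans (#-mono {T = ｛ i ｝} λ j q → subst (_∈ ｛ i ｝) (decidable-stable (i FP.≟ j) λ ne → disj i j ne v p (∈! (!∈ q))) (｛｝⁺ i)) (#-｛｝ i)

popular : ∀ {m k} (L : Sub m) (Ex : Sub k) (F : Fin k → Sub m) → 1 ≤ # L → L ⊆ ⋃ Ex F → ∃ λ q → q ∈ Ex × # L ≤ # Ex * # (F q)
popular L Ex F pos cover with any? (λ q → (q ∈? Ex) ×-dec (# L ≤? # Ex * # (F q)))
... | yes p = p
... | no ¬p = ⊥-elim (<⇒≱ pos (≤-reflexive (zero-case (# L) (# Ex) (≤-trans (*-monoʳ-≤ (# Ex) (≤-trans (#-mono cover) (#-⋃ Ex F)))
      (≤-trans (≤-reflexive (trans (sym (∑-* (# Ex) (λ q → Ex q ▹ # (F q)))) (∑-cong λ q → swap′ (Ex q) {# Ex} {# (F q)}))) (∑-bound Ex (λ q → # Ex * # (F q)) (pred (# L)) small))) pos2)))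
  where
  swap′ : ∀ b {x y} → x * (b ▹ y) ≡ b ▹ (x * y)
  swap′ true  = refl
  swap′ false {x} = *-zeroʳ x
  small : ∀ q → q ∈ Ex → # Ex * # (F q) ≤ pred (# L)
  small q q∈ = ≤-pred (≤-trans (≰⇒> λ l → ¬p (q , q∈ , l)) (≤-reflexive (sym (suc-pred (# L) {{>-nonZero pos}}))))
  pos2 : 1 ≤ # Ex
  pos2 = let (v , v∈) = #-∃ pos ; (q , q∈ , _) = ⋃⁻ (cover v v∈) in #-∈ q∈
  zero-case : ∀ l x → x * l ≤ pred l * x → 1 ≤ x → l ≡ 0
  zero-case zero    x _  _ = refl
  zero-case (suc l) x le p = ⊥-elim (<⇒≱ p (+-cancelʳ-≤ (x * l) x 0 (≤-trans (≤-reflexive (sym (*-suc x l))) (≤-trans le (≤-reflexive (*-comm l x))))))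

-- Repeated pigeonhole in the manner of Kővári, Sós and Turán: some `i` belongs to `tch q` for a
-- `1 / B` share of `Hs`. Fix it, restrict `Hs` and repeat `s` times; the excess `s` in `μ + s` pays
-- for the elements removed from `S`.
common : ∀ {K p} (tch : Fin p → Sub K) (μ B : ℕ) → 1 ≤ μ → 1 ≤ B → (s N : ℕ) → 1 ≤ N → (S : Sub K) (Hs : Sub p) → # S ≤ B * μ → N * B ^ s ≤ # Hs →
  (∀ q → q ∈ Hs → μ + s ≤ # (S ∩ tch q)) →
  ∃₂ λ I Hs′ → I ⊆ S × s ≤ # I × Hs′ ⊆ Hs × N ≤ # Hs′ × (∀ i q → i ∈ I → q ∈ Hs′ → i ∈ tch q)
common tch μ B μ≥1 B≥1 zero N N≥1 S Hs sz big rich =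
  ∅ , Hs , (λ _ p → ⊥-elim (∉∅ p)) , z≤n , (λ _ p → p) , ≤-trans (≤-reflexive (sym (*-identityʳ N))) big , λ _ _ p → ⊥-elim (∉∅ p)
common {K} {p} tch μ B μ≥1 B≥1 (suc s) N N≥1 S Hs sz big rich = step choose
  where
  f : Fin K → ℕ
  f i = # (Hs ∩ (λ q → tch q i))
  count : μ * # Hs ≤ ∑ (λ i → S i ▹ f i)
  count = ≤-trans (∑-lower Hs (λ q → # (S ∩ tch q)) μ λ q q∈ → ≤-trans (m≤m+n μ (suc s)) (rich q q∈)) (≤-reflexive swapped)
    where
    nest : ∀ (T : Sub K) (T′ : Sub p) i q → T′ q ▹ ((S ∩ T) i ▹ 1) ≡ S i ▹ ((T′ q ∧ T i) ▹ 1)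
    nest T T′ i q with T′ q | S i in eq
    ... | true | true = cong (_▹ 1) (bool (S ∩ T) eq)
      where
      bool : ∀ X → S i ≡ true → (S ∩ T) i ≡ T i
      bool X e with T i in et
      ... | true = !∈ (∩⁺ {S = S} {T} {i} (∈! e) (∈! et))
      ... | false = BP.¬-not λ z → BP.not-¬ et (!∈ (∩ʳ {S = S} {T} {i} (∈! z)))
    ... | true | false = cong (_▹ 1) (BP.¬-not λ z → BP.not-¬ eq (!∈ (∩ˡ {S = S} {T} {i} (∈! z))))
    ... | false | true = refl
    ... | false | false = refl
    inter : ∀ i q → (Hs ∩ (λ q → tch q i)) q ≡ Hs q ∧ tch q i
    inter i q with Hs q in e₁ | tch q i in e₂
    ... | true | true = !∈ (∩⁺ {S = Hs} {λ q → tch q i} {q} (∈! e₁) (∈! e₂))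
    ... | true | false = BP.¬-not λ z → BP.not-¬ e₂ (!∈ (∩ʳ {S = Hs} {λ q → tch q i} {q} (∈! z)))
    ... | false | _ = BP.¬-not λ z → BP.not-¬ e₁ (!∈ (∩ˡ {S = Hs} {λ q → tch q i} {q} (∈! z)))
    swapped : ∑ (λ q → Hs q ▹ # (S ∩ tch q)) ≡ ∑ (λ i → S i ▹ f i)
    swapped = trans (∑-cong λ q → trans (cong (Hs q ▹_) (#-def (S ∩ tch q))) (sym (∑-▹ (Hs q) (λ i → (S ∩ tch q) i ▹ 1))))
      (trans (∑-swap (λ q i → Hs q ▹ ((S ∩ tch q) i ▹ 1))) (∑-cong λ i → trans (∑-cong λ q → nest (tch q) Hs i q)
      (trans (∑-▹ (S i) (λ q → (Hs q ∧ tch q i) ▹ 1)) (cong (S i ▹_) (trans (∑-cong λ q → cong (_▹ 1) (sym (inter i q))) (sym (#-def _)))))))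
  Hs≥1 : 1 ≤ # Hs
  Hs≥1 = ≤-trans (*-mono-≤ N≥1 (^-pos (suc s))) big
    where
    ^-pos : ∀ s → 1 ≤ B ^ s
    ^-pos zero    = ≤-refl
    ^-pos (suc s) = *-mono-≤ B≥1 (^-pos s)
  choose : ∃ λ i → i ∈ S × # Hs ≤ B * f i
  choose with any? (λ i → (i ∈? S) ×-dec (# Hs ≤? B * f i))
  ... | yes q = q
  ... | no ¬q = ⊥-elim (impossible (# Hs) Hs≥1 (*-mono-≤ B≥1 μ≥1) (begin
        B * μ * # Hs                             ≡⟨ *-assoc B μ (# Hs) ⟩
        B * (μ * # Hs)                           ≤⟨ *-monoʳ-≤ B count ⟩
        B * ∑ (λ i → S i ▹ f i)                  ≡⟨ sym (∑-* B (λ i → S i ▹ f i)) ⟩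
        ∑ (λ i → B * (S i ▹ f i))                ≡⟨ ∑-cong (λ i → swap′ (S i) B (f i)) ⟩
        ∑ (λ i → S i ▹ (B * f i))                ≤⟨ ∑-bound S (λ i → B * f i) (pred (# Hs)) small ⟩
        pred (# Hs) * # S                        ≤⟨ *-monoʳ-≤ (pred (# Hs)) sz ⟩
        pred (# Hs) * (B * μ)                    ∎))
    where
    open ≤-Reasoning
    swap′ : ∀ b x y → x * (b ▹ y) ≡ b ▹ (x * y)
    swap′ true  x y = refl
    swap′ false x y = *-zeroʳ x
    small : ∀ i → i ∈ S → B * f i ≤ pred (# Hs)
    small i i∈ = ≤-pred (≤-trans (≰⇒> λ l → ¬q (i , i∈ , l)) (≤-reflexive (sym (suc-pred (# Hs) {{>-nonZero Hs≥1}}))))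
    impossible : ∀ x {y} → 1 ≤ x → 1 ≤ y → y * x ≤ pred x * y → ⊥
    impossible (suc x) {y} _ y≥1 le = <⇒≱ y≥1 (+-cancelʳ-≤ (y * x) y 0 (≤-trans (≤-reflexive (sym (*-suc y x))) (≤-trans le (≤-reflexive (*-comm x y)))))
  step : (∃ λ i → i ∈ S × # Hs ≤ B * f i) →
    ∃₂ λ I Hs′ → I ⊆ S × suc s ≤ # I × Hs′ ⊆ Hs × N ≤ # Hs′ × (∀ i q → i ∈ I → q ∈ Hs′ → i ∈ tch q)
  step (i , i∈ , le) with common tch μ B μ≥1 B≥1 s N N≥1 (S ∖ ｛ i ｝) (Hs ∩ (λ q → tch q i)) (≤-trans (#-mono λ _ → ∖ˡ) sz) big′ rich′
    where
    big′ : N * B ^ s ≤ f i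
    big′ = *-cancelˡ-≤ B {{>-nonZero B≥1}} (≤-trans (≤-reflexive (trans (sym (*-assoc B N (B ^ s))) (trans (cong (_* B ^ s) (*-comm B N)) (*-assoc N B (B ^ s))))) (≤-trans big le))
    rich′ : ∀ q → q ∈ Hs ∩ (λ q → tch q i) → μ + s ≤ # ((S ∖ ｛ i ｝) ∩ tch q)
    rich′ q q∈ = +-cancelʳ-≤ 1 _ _ (≤-trans (≤-reflexive (trans (+-comm (μ + s) 1) (sym (+-suc μ s)))) (≤-trans (rich q (∩ˡ q∈))
      (≤-trans (#-mono sub) (≤-trans (#-∪ ((S ∖ ｛ i ｝) ∩ tch q) ｛ i ｝) (+-monoʳ-≤ _ (#-｛｝ i))))))
      where
      sub : S ∩ tch q ⊆ (S ∖ ｛ i ｝) ∩ tch q ∪ ｛ i ｝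
      sub j m with j FP.≟ i
      ... | yes refl = ∪ʳ (｛｝⁺ j)
      ... | no ne = ∪ˡ (∩⁺ (∖⁺ (∩ˡ m) (ne ∘ ｛｝⁻)) (∩ʳ m))
  ... | I , Hs′ , I⊆ , sI , Hs′⊆ , NH , all = I ∪ ｛ i ｝ , Hs′ , sub , size , (λ q m → ∩ˡ (Hs′⊆ q m)) , NH , all′
    where
    sub : I ∪ ｛ i ｝ ⊆ S
    sub j m = [ (λ a → ∖ˡ (I⊆ j a)) , (λ b → subst (_∈ S) (sym (｛｝⁻ b)) i∈) ]′ (∪⁻ m)
    size : suc s ≤ # (I ∪ ｛ i ｝)
    size = ≤-trans (s≤s sI) (#-strict {v = i} (λ _ → ∪ˡ) (∪ʳ (｛｝⁺ i)) λ m → ∖ʳ (I⊆ i m) (｛｝⁺ i))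
    all′ : ∀ j q → j ∈ I ∪ ｛ i ｝ → q ∈ Hs′ → j ∈ tch q
    all′ j q m q∈ = [ (λ a → all j q a q∈) , (λ b → subst (_∈ tch q) (sym (｛｝⁻ b)) (∈! (!∈ (∩ʳ (Hs′⊆ q q∈))))) ]′ (∪⁻ m)

-- Lanes with many common cells

module Lanes (H G : Graph) (Δ : ℕ) (Δ-bound : ∀ v → # (adj G v) ≤ Δ) (noH : ¬ InducedMinor H G)
             (Ω : Sub (n G)) (ν p : ℕ) (Sk : Skeletons.Skeleton G Ω ν p)
             (A : Sub (n G)) (A⊆ : A ⊆ Ω) (A-light : ∀ a → a ∈ A → a ∈ Skeletons.Skeleton.light Sk)
             (A-heavy : ∀ u a → u ∈ Ω → u ∉ Skeletons.Skeleton.light Sk → a ∈ A → ¬ Adj G u a) where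
  open Walks G
  open Degree Δ Δ-bound
  open Skeletons G
  open Skeleton Sk
  open Contacts G Ω ν p Sk using (M; M⁺; M-sym)

  -- `N₁` cells contain `h * h` pairwise non-touching ones, one for each ordered pair of vertices of
  -- `H`. A lane's ties obstruct at most `o` lanes through their light vertices, so `s₁` lanes
  -- contain `h` that do not obstruct one another.
  h D N₁ o s₁ : ℕ
  h = n H
  D = density Δ ν (n H)
  N₁ = (h * h) * suc D
  o = suc Δ * ν * (h * h)
  s₁ = h * suc (o + o)

  M-sparse : Sparse M D
  M-sparse = contacts-sparse H G Δ Δ-bound noH Ω ν p Sk

  Touches : Sub (n G) → Fin p → Set
  Touches L q = ∃ λ v → v ∈ N[ L ] ∩ A × v ∈ cl q

  module CommonCells (L : Fin s₁ → Sub (n G)) (L∋ : ∀ i → ∃ λ v → v ∈ L i) (L⊆ : ∀ i → L i ⊆ A) (L-conn : ∀ i → Connected′ (L i))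
                     (L-apart : ∀ i j → i ≢ j → Apart (L i) (L j))
                     (cellAt : Fin (h * h) → Fin p) (cellAt-inj : ∀ x y → cellAt x ≡ cellAt y → x ≡ y)
                     (cells-apart : ∀ x y → x ≢ y → ¬ (M (cellAt x) (cellAt y) ≡ true))
                     (touch : ∀ i x → Touches (L i) (cellAt x)) where

    pt : Fin s₁ → Fin (h * h) → V
    pt i x = proj₁ (touch i x)

    T : ∀ i x → Tie (core (cellAt x)) (cl (cellAt x)) light ν (pt i x)
    T i x = tie (cellAt x) (pt i x) (proj₂ (proj₂ (touch i x)))

    lightsOf : Fin s₁ → Sub (n G)
    lightsOf i = ⋃ ⊤ˢ (λ x → N[ Tie.S (T i x) ∩ light ])

    R : Fin s₁ → Fin s₁ → Bool
    R i = hits L (lightsOf i)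

    R-deg : ∀ i → # (R i) ≤ o
    R-deg i = ≤-trans (#-hits L (λ i j ne v a b → proj₁ (L-apart i j ne v v a b) refl) (lightsOf i))
      (≤-trans (#-⋃-bound ⊤ˢ _ (suc Δ * ν) (λ x _ → ≤-trans (#-N _) (*-monoʳ-≤ (suc Δ) (Tie.lights (T i x))))) (≤-reflexive (cong (suc Δ * ν *_) (#-⊤ {h * h}))))

    free : ∃ λ I → I ⊆ ⊤ˢ × h ≤ # I × Independent (λ i k → R i k ∨ R k i) I
    free = independent (λ i k → R i k ∨ R k i) (o + o) (λ i k → BP.∨-comm (R i k) (R k i)) (sym-sparse R o R-deg) h ⊤ˢ (≤-reflexive (sym (#-⊤ {s₁})))

    module Chosen (at : Fin h → Fin s₁) (at-inj : ∀ a b → at a ≡ at b → a ≡ b) (noR : ∀ a c → a ≢ c → ¬ (R (at a) (at c) ≡ true)) where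

      P : Fin h → Sub (n G)
      P a = L (at a)

      x⟨_,_⟩ : Fin h → Fin h → Fin (h * h)
      x⟨ a , b ⟩ = F.combine a b

      Z : Fin h → Fin h → Sub (n G)
      Z a b = core (cellAt x⟨ a , b ⟩) ∪ Tie.S (T (at a) x⟨ a , b ⟩) ∪ Tie.S (T (at b) x⟨ a , b ⟩)

      Z⊆ : ∀ a b → Z a b ⊆ cl (cellAt x⟨ a , b ⟩)
      Z⊆ a b v m with ∪⁻ m
      ... | inj₁ c = core⊆ _ v c
      ... | inj₂ m′ = [ Tie.S⊆ (T (at a) x⟨ a , b ⟩) v , Tie.S⊆ (T (at b) x⟨ a , b ⟩) v ]′ (∪⁻ m′)

      tie-apart : ∀ a c x → a ≢ c → ∀ u v → u ∈ Tie.S (T (at a) x) → u ∈ light → v ∈ P c → u ≢ v × ¬ (u ~ v)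
      tie-apart a c x ne u v u∈ l v∈ = (λ e → hit (N-self (subst (_∈ S ∩ light) e (∩⁺ u∈ l)))) , λ e → hit (N-adj (∩⁺ u∈ l) e)
        where
        S = Tie.S (T (at a) x)
        hit : v ∈ N[ S ∩ light ] → ⊥
        hit m = noR a c ne (!∈ (hits⁺ {L = L} {lightsOf (at a)} {at c} v∈ (⋃⁺ x ∈⊤ m)))

      -- Heavy vertices of a cell have no neighbour on any lane, and the light vertices of the two
      -- ties are kept off the third lane by the selection of lanes.
      Z-P : ∀ a b c → a F.< b → Adj H a b → c ≢ a → c ≢ b → Apart (Z a b) (P c)
      Z-P a b c _ _ c≢a c≢b u v u∈ v∈ with u ∈? light
      ... | no ¬l = (λ e → ¬l (subst (_∈ light) (sym e) (A-light v (L⊆ _ v v∈)))) , A-heavy u v (cl⊆ _ u (Z⊆ a b u u∈)) ¬l (L⊆ _ v v∈)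
      ... | yes l with ∪⁻ u∈
      ...   | inj₁ k = ⊥-elim (core-heavy _ u k l)
      ...   | inj₂ m with ∪⁻ m
      ...     | inj₁ m₁ = tie-apart a c x⟨ a , b ⟩ (c≢a ∘ sym) u v m₁ l v∈
      ...     | inj₂ m₂ = tie-apart b c x⟨ a , b ⟩ (c≢b ∘ sym) u v m₂ l v∈

      Z-Z : ∀ a b c d → a F.< b → Adj H a b → c F.< d → Adj H c d → (a , b) ≢ (c , d) → Apart (Z a b) (Z c d)
      Z-Z a b c d _ _ _ _ ne u v u∈ v∈ = (λ { refl → x≢ (cellAt-inj _ _ (unique (Z⊆ a b u u∈) (Z⊆ c d u v∈))) }) ,
          λ e → cells-apart _ _ x≢ (M⁺ ((λ q → x≢ (cellAt-inj _ _ q)) , u , v , Z⊆ a b u u∈ , Z⊆ c d v v∈ , e))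
        where
        x≢ : x⟨ a , b ⟩ ≢ x⟨ c , d ⟩
        x≢ e = let (p , q) = FP.combine-injective a b c d e in ne (cong₂ _,_ p q)

      Z-link : ∀ a b → a F.< b → Adj H a b → ∃₂ λ u v → u ∈ P a × v ∈ P b × Path (P a ∪ Z a b ∪ P b) u v
      Z-link a b _ _ = ua , ub , ua∈ , ub∈ , in-a ++ʷ (cross ++ʷ reverseʷ in-b)
        where
        x = x⟨ a , b ⟩
        W = P a ∪ Z a b ∪ P b
        na = N⁻ (∩ˡ (proj₁ (proj₂ (touch (at a) x))))
        nb = N⁻ (∩ˡ (proj₁ (proj₂ (touch (at b) x))))
        ua = proj₁ na
        ub = proj₁ nb
        ua∈ : ua ∈ P a
        ua∈ = proj₁ (proj₂ na)
        ub∈ : ub ∈ P b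
        ub∈ = proj₁ (proj₂ nb)
        Sa = Tie.S (T (at a) x)
        Sb = Tie.S (T (at b) x)
        subA : core (cellAt x) ∪ Sa ⊆ W
        subA v m = ∪ʳ (∪ˡ ([ ∪ˡ , (λ k → ∪ʳ (∪ˡ k)) ]′ (∪⁻ m)))
        subB : core (cellAt x) ∪ Sb ⊆ W
        subB v m = ∪ʳ (∪ˡ ([ ∪ˡ , (λ k → ∪ʳ (∪ʳ k)) ]′ (∪⁻ m)))
        pa = Tie.self (T (at a) x)
        pb = Tie.self (T (at b) x)
        hop : ∀ {u v} → u ∈ W → v ∈ W → u ≡ v ⊎ u ~ v → Path W u v
        hop u∈ v∈ (inj₁ refl) = [ u∈ ]
        hop u∈ v∈ (inj₂ e)    = edge u∈ v∈ e
        in-a : Path W ua (pt (at a) x)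
        in-a = hop (∪ˡ ua∈) (subA _ (∪ʳ pa)) (proj₂ (proj₂ na))
        in-b : Path W ub (pt (at b) x)
        in-b = hop (∪ʳ (∪ʳ ub∈)) (subB _ (∪ʳ pb)) (proj₂ (proj₂ nb))
        k = proj₂ (core∋ (cellAt x))
        cross : Path W (pt (at a) x) (pt (at b) x)
        cross = mapʷ subA (Tie.conn (T (at a) x) _ _ (∪ʳ pa) (∪ˡ k)) ++ʷ mapʷ subB (Tie.conn (T (at b) x) _ _ (∪ˡ k) (∪ʳ pb))

      minor-clash : ⊥
      minor-clash = noH (Models.Glue.glue H G P Z (λ a → L∋ (at a)) (λ a → L-conn (at a))
        (λ a b ne → L-apart (at a) (at b) (ne ∘ at-inj a b)) Z-link Z-P Z-Z)

    absurd : ⊥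
    absurd = Chosen.minor-clash at inj λ a c ne r →
        proj₂ (proj₂ (proj₂ free)) (at a) (at c) (mem a) (mem c) (ne ∘ inj a c) (cong (_∨ R (at c) (at a)) r)
      where open Pick (pick (proj₁ free) h (proj₁ (proj₂ (proj₂ free))))

  common-cells : ∀ {K} (L : Fin K → Sub (n G)) → (∀ i → ∃ λ v → v ∈ L i) → (∀ i → L i ⊆ A) → (∀ i → Connected′ (L i)) →
    (I : Sub K) → s₁ ≤ # I → (∀ i j → i ∈ I → j ∈ I → i ≢ j → Apart (L i) (L j)) →
    (Qs : Sub p) → N₁ ≤ # Qs → (∀ i q → i ∈ I → q ∈ Qs → Touches (L i) q) → ⊥
  common-cells L L∋ L⊆ L-conn I sI apart Qs NQ touch with independent M D M-sym M-sparse (h * h) Qs NQ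
  ... | J , J⊆ , sJ , ind = CommonCells.absurd (λ i → L (PI.at i)) (λ i → L∋ (PI.at i)) (λ i → L⊆ (PI.at i)) (λ i → L-conn (PI.at i))
      (λ i j ne → apart (PI.at i) (PI.at j) (PI.mem i) (PI.mem j) (ne ∘ PI.inj i j)) PJ.at PJ.inj
      (λ x y ne → ind (PJ.at x) (PJ.at y) (PJ.mem x) (PJ.mem y) (ne ∘ PJ.inj x y))
      (λ i x → touch (PI.at i) (PJ.at x) (PI.mem i) (J⊆ _ (PJ.mem x)))
    where
    module PI = Pick (pick I s₁ sI)
    module PJ = Pick (pick J (h * h) sJ)

-- A hierarchy of constants for counting cells

module Thresholds (N₁ s₁ D R : ℕ) where

  -- `many x` cells suffice for `common`, with `B = 2 * R * x`, to find `s₁` lanes on `N₁ + 1`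
  -- common cells. The ratio of `hub` to `many` is chosen so that the cells served by hubs of all
  -- `N₁` stages make up at most a fifth.
  many hub : ℕ → ℕ
  many x = suc N₁ * (2 * R * x) ^ s₁
  hub x = 5 * suc N₁ * suc D * many x

  opaque
    -- After `j` steps of following lanes, at least `goal / e j` of them are still together: without
    -- a hub, `j + 1` cells have at most `(j + 1) * hub (e j)` further neighbours to spread over.
    e : ℕ → ℕ
    e zero    = 1
    e (suc j) = e j * (suc j * hub (e j))

    e-zero : e 0 ≡ 1
    e-zero = refl

    e-suc : ∀ j → e (suc j) ≡ e j * (suc j * hub (e j))
    e-suc j = refl

  goal : ℕ
  goal = 2 * suc s₁ * e N₁

  module _ (R≥1 : 1 ≤ R) where

    many≥1 : ∀ {x} → 1 ≤ x → 1 ≤ many x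
    many≥1 {x} p = *-mono-≤ (s≤s (z≤n {N₁})) (pw s₁)
      where
      pw : ∀ s → 1 ≤ (2 * R * x) ^ s
      pw zero    = ≤-refl
      pw (suc s) = *-mono-≤ (*-mono-≤ (*-mono-≤ (s≤s (z≤n {1})) R≥1) p) (pw s)

    hub≥1 : ∀ {x} → 1 ≤ x → 1 ≤ hub x
    hub≥1 p = *-mono-≤ (*-mono-≤ (*-mono-≤ (s≤s (z≤n {4})) (s≤s (z≤n {N₁}))) (s≤s (z≤n {D}))) (many≥1 p)

    e≥1 : ∀ j → 1 ≤ e j
    e≥1 zero    = ≤-reflexive (sym e-zero)
    e≥1 (suc j) = ≤-trans (*-mono-≤ (e≥1 j) (*-mono-≤ (s≤s (z≤n {j})) (hub≥1 (e≥1 j)))) (≤-reflexive (sym (e-suc j)))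

    e-divides : ∀ j k → ∃ λ f → 1 ≤ f × e (k + j) ≡ e j * f
    e-divides j zero    = 1 , ≤-refl , sym (*-identityʳ (e j))
    e-divides j (suc k) = let (f , f≥ , eq) = e-divides j k ; x = suc (k + j) * hub (e (k + j)) in
      f * x , *-mono-≤ f≥ (*-mono-≤ (s≤s (z≤n {k + j})) (hub≥1 (e≥1 (k + j)))) , trans (e-suc (k + j)) (trans (cong (_* x) eq) (*-assoc (e j) f x))

    goal-split : ∀ j → j ≤ N₁ → ∃ λ g → goal ≡ e j * g × 2 * suc s₁ ≤ g
    goal-split j le = let (f , f≥ , eq) = e-divides j (N₁ ∸ j) ; eq′ = trans (cong e (sym (m∸n+n≡m le))) eq in
      2 * suc s₁ * f , trans (cong (2 * suc s₁ *_) eq′) (trans (sym (*-assoc (2 * suc s₁) (e j) f)) (trans (cong (_* f) (*-comm (2 * suc s₁) (e j))) (*-assoc (e j) (2 * suc s₁) f))) ,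
      ≤-trans (≤-reflexive (sym (*-identityʳ (2 * suc s₁)))) (*-monoʳ-≤ (2 * suc s₁) f≥)

    goal≥1 : 1 ≤ goal
    goal≥1 = *-mono-≤ (s≤s (z≤n {s₁ + suc (s₁ + 0)})) (e≥1 N₁)

-- The number of cells is linear in the number of lanes

module FewCells (H G : Graph) (Δ : ℕ) (Δ-bound : ∀ v → # (adj G v) ≤ Δ) (noH : ¬ InducedMinor H G)
             (Ω : Sub (n G)) (ν p : ℕ) (Sk : Skeletons.Skeleton G Ω ν p)
             (A : Sub (n G)) (A⊆ : A ⊆ Ω) (A-light : ∀ a → a ∈ A → a ∈ Skeletons.Skeleton.light Sk)
             (A-heavy : ∀ u a → u ∈ Ω → u ∉ Skeletons.Skeleton.light Sk → a ∈ A → ¬ Adj G u a)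
             {K : ℕ} (L : Fin K → Sub (n G)) (L∋ : ∀ i → ∃ λ v → v ∈ L i) (L⊆ : ∀ i → L i ⊆ A) (L-conn : ∀ i → Walks.Connected′ G (L i))
             (typ : Fin K → Bool) (L-apart : ∀ i j → i ≢ j → typ i ≡ typ j → Walks.Apart G (L i) (L j))
             (R : ℕ) (R≥1 : 1 ≤ R) (N₁ s₁ D : ℕ)
             (N₁≡ : Lanes.N₁ H G Δ Δ-bound noH Ω ν p Sk A A⊆ A-light A-heavy ≡ N₁)
             (s₁≡ : Lanes.s₁ H G Δ Δ-bound noH Ω ν p Sk A A⊆ A-light A-heavy ≡ s₁)
             (M-sparse : Sparse (Contacts.M G Ω ν p Sk) D) where
  open Walks G
  open Skeletons G
  open Skeleton Sk
  open Contacts G Ω ν p Sk using (M; M⁺)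
  open Thresholds N₁ s₁ D R

  Touches : Sub (n G) → Fin p → Set
  Touches X q = ∃ λ v → v ∈ N[ X ] ∩ A × v ∈ cl q

  touches? : ∀ X q → Dec (Touches X q)
  touches? X q = any? (λ v → (v ∈? N[ X ] ∩ A) ×-dec (v ∈? cl q))

  tch : Fin p → Sub K
  tch q = set (λ i → touches? (L i) q)

  tch⁺ : ∀ {q i} → Touches (L i) q → i ∈ tch q
  tch⁺ = set⁺

  tch⁻ : ∀ {q i} → i ∈ tch q → Touches (L i) q
  tch⁻ = set⁻

  row : Fin K → Sub p
  row i = λ q → tch q i

  L⁺-conn : ∀ i → Connected′ (N[ L i ] ∩ A)
  L⁺-conn i = conn-hub x₀ go
    where
    x₀ = proj₁ (L∋ i)
    up : L i ⊆ N[ L i ] ∩ A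
    up v m = ∩⁺ (N-self m) (L⊆ i v m)
    go : ∀ u → u ∈ N[ L i ] ∩ A → Path (N[ L i ] ∩ A) u x₀
    go u m with N⁻ (∩ˡ m)
    ... | w , w∈ , inj₁ refl = mapʷ up (L-conn i w x₀ w∈ (proj₂ (L∋ i)))
    ... | w , w∈ , inj₂ r = m ∷⟨ ~-sym r ⟩ mapʷ up (L-conn i w x₀ w∈ (proj₂ (L∋ i)))

  S1 : (θ : Bool) (I : Sub K) → s₁ ≤ # I → (∀ i → i ∈ I → typ i ≡ θ) → (Qs : Sub p) → N₁ ≤ # Qs → (∀ i q → i ∈ I → q ∈ Qs → i ∈ tch q) → ⊥
  S1 θ I sI same Qs NQ all = Lanes.common-cells H G Δ Δ-bound noH Ω ν p Sk A A⊆ A-light A-heavy L L∋ L⊆ L-conn I (≤-trans (≤-reflexive s₁≡) sI)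
    (λ i j a b ne → L-apart i j ne (trans (same i a) (sym (same j b)))) Qs (≤-trans (≤-reflexive N₁≡) NQ) (λ i q a b → tch⁻ (all i q a b))

  degree-sum : ∑ (λ g → # (M g)) ≤ D * p
  degree-sum = ≤-trans (∑-mono λ g → #-mono {S = M g} {⊤ˢ ∩ M g} λ q m → ∩⁺ ∈⊤ m) (≤-trans (M-sparse ⊤ˢ) (≤-reflexive (cong (D *_) (#-⊤ {p}))))

  -- A lane with its neighbours in `A` is connected; where it leaves the union of the cells in `Q`,
  -- it crosses an edge into a touching cell.
  exits : ∀ {Q : Sub p} i → # Q < # (row i) → (∃ λ q → q ∈ Q × i ∈ tch q) → ∃₂ λ g q → g ∈ Q × M g q ≡ true × q ∉ Q × i ∈ tch q
  exits {Q} i lt (q₀ , q₀∈ , t₀) with any? (λ q → (q ∈? row i) ×-dec ¬? (q ∈? Q))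
  ... | no ¬p = ⊥-elim (<⇒≱ lt (#-mono λ q m → decidable-stable (q ∈? Q) λ z → ¬p (q , m , z)))
  ... | yes (q₁ , t₁ , q₁∉) = found
    where
    T = ⋃ Q cl
    a = tch⁻ {q₀} {i} t₀
    b = tch⁻ {q₁} {i} (∈! (!∈ t₁))
    b∉ : proj₁ b ∉ T
    b∉ m = let (q , q∈ , c) = ⋃⁻ m in q₁∉ (subst (_∈ Q) (unique c (proj₂ (proj₂ b))) q∈)
    found : ∃₂ λ g q → g ∈ Q × M g q ≡ true × q ∉ Q × i ∈ tch q
    found with crossing T (L⁺-conn i (proj₁ a) (proj₁ b) (proj₁ (proj₂ a)) (proj₁ (proj₂ b))) (⋃⁺ q₀ q₀∈ (proj₂ (proj₂ a))) b∉
    ... | x , y , w , y∈ , x~y , y∉ with ⋃⁻ (∩ʳ (end w)) | cover y (A⊆ y (∩ʳ y∈))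
    ...   | g , g∈ , xg | q , yq = g , q , g∈ , M⁺ ((λ { refl → y∉ (⋃⁺ g g∈ yq) }) , x , y , xg , yq , x~y) , (λ m → y∉ (⋃⁺ q m yq)) , tch⁺ (y , y∈ , yq)

  module Type (θ : Bool) where

    TT : Sub K
    TT = set (λ i → typ i BP.≟ θ)

    TT⁻ : ∀ {i} → i ∈ TT → typ i ≡ θ
    TT⁻ = set⁻

    long? : ∀ i → Dec (N₁ < # (row i))
    long? i = _ <? _

    Long : Sub K
    Long = set long?

    Shared : ℕ → Fin p → Fin p → Set
    Shared j g q = goal ≤ # ((TT ∩ tch g) ∩ tch q) * e j

    Stuck : Fin p → Set
    Stuck q = ∃ λ (j : Fin N₁) → ∃ λ g → hub (e (toℕ j)) < # (M g) × Shared (toℕ j) g q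

    -- Follow the lanes through q to common further cells until they disperse at a cell of large degree.
    run : ∀ q f j (Q : Sub p) (I : Sub K) → f + j ≡ N₁ → # Q ≡ suc j → q ∈ Q → I ⊆ TT ∩ Long → (∀ i q′ → i ∈ I → q′ ∈ Q → i ∈ tch q′) → goal ≤ # I * e j → Stuck q
    -- After `N₁` steps, `N₁ + 1` cells would share at least `s₁` lanes of one type, which `S1`
    -- forbids.
    run q zero j Q I refl sz q∈ I⊆ all le = ⊥-elim (S1 θ I sI (λ i m → TT⁻ (∩ˡ (I⊆ i m))) Q (≤-trans (n≤1+n j) (≤-reflexive (sym sz))) all)
      where
      sI : s₁ ≤ # I
      sI = *-cancelʳ-≤ s₁ (# I) (e j) {{>-nonZero (e≥1 R≥1 j)}} (≤-trans (*-monoˡ-≤ (e j) (≤-trans (n≤1+n s₁) (m≤m+n (suc s₁) _))) le)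
    run q (suc f) j Q I fj sz q∈ I⊆ all le with any? (λ g → (g ∈? Q) ×-dec (hub (e j) <? # (M g)))
    ... | yes (g , g∈ , big) = F.fromℕ< j<N , g , subst (λ x → hub (e x) < # (M g)) (sym (FP.toℕ-fromℕ< j<N)) big ,
            subst (λ x → Shared x g q) (sym (FP.toℕ-fromℕ< j<N)) (≤-trans le (*-monoˡ-≤ (e j) (#-mono λ i m → ∩⁺ (∩⁺ (∩ˡ (I⊆ i m)) (all i g m g∈)) (all i q m q∈))))
      where
      j<N : j < N₁
      j<N = ≤-trans (s≤s (m≤n+m j f)) (≤-reflexive fj)
    ... | no none = next (popular I Ex tchI I≥1 covered)
      where
      j<N : j < N₁
      j<N = ≤-trans (s≤s (m≤n+m j f)) (≤-reflexive fj)
      I≥1 : 1 ≤ # I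
      I≥1 with 1 ≤? # I
      ... | yes z = z
      ... | no ¬z = ⊥-elim (<⇒≱ (goal≥1 R≥1) (≤-trans le (≤-reflexive (cong (_* e j) (n≤0⇒n≡0 (≤-pred (≰⇒> ¬z)))))))
      Ex : Sub p
      Ex = ⋃ Q M ∖ Q
      tchI : Fin p → Sub K
      tchI q′ = I ∩ tch q′
      covered : I ⊆ ⋃ Ex tchI
      covered i m with exits i (≤-trans (≤-reflexive (cong suc sz)) (≤-trans (s≤s j<N) (set⁻ {P? = long?} (∩ʳ (I⊆ i m))))) (q , q∈ , all i q m q∈)
      ... | g , q′ , g∈ , r , q′∉ , t = ⋃⁺ q′ (∖⁺ (⋃⁺ g g∈ (∈! r)) q′∉) (∩⁺ m t)
      Ex≤ : # Ex ≤ suc j * hub (e j)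
      Ex≤ = ≤-trans (#-mono λ _ → ∖ˡ) (≤-trans (#-⋃-bound Q M (hub (e j)) λ g g∈ → ≮⇒≥ λ l → none (g , g∈ , l)) (≤-reflexive (trans (*-comm (hub (e j)) (# Q)) (cong (_* hub (e j)) sz))))
      next : (∃ λ q′ → q′ ∈ Ex × # I ≤ # Ex * # (tchI q′)) → Stuck q
      next (q′ , q′∈ , big) = run q f (suc j) (Q ∪ ｛ q′ ｝) (tchI q′) (trans (+-suc f j) fj) sz′ (∪ˡ q∈) (λ i m → I⊆ i (∩ˡ m)) all′ le′
        where
        sz′ : # (Q ∪ ｛ q′ ｝) ≡ suc (suc j)
        sz′ = ≤-antisym (≤-trans (#-∪ Q ｛ q′ ｝) (≤-trans (+-mono-≤ (≤-reflexive sz) (#-｛｝ q′)) (≤-reflexive (+-comm (suc j) 1))))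
                (≤-trans (≤-reflexive (cong suc (sym sz))) (#-strict {v = q′} (λ _ → ∪ˡ) (∪ʳ (｛｝⁺ q′)) (∖ʳ q′∈)))
        all′ : ∀ i x → i ∈ tchI q′ → x ∈ Q ∪ ｛ q′ ｝ → i ∈ tch x
        all′ i x m x∈ = [ all i x (∩ˡ m) , (λ b → subst (λ z → i ∈ tch z) (sym (｛｝⁻ b)) (∩ʳ m)) ]′ (∪⁻ x∈)
        le′ : goal ≤ # (tchI q′) * e (suc j)
        le′ = ≤-trans le (≤-trans (*-monoˡ-≤ (e j) (≤-trans big (*-monoˡ-≤ (# (tchI q′)) Ex≤)))
          (≤-reflexive (trans (regroup (suc j * hub (e j)) (# (tchI q′)) (e j)) (cong (# (tchI q′) *_) (sym (e-suc j))))))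
          where
          regroup : ∀ a b c → a * b * c ≡ b * (c * a)
          regroup = solve-∀

    rich? : ∀ q → Dec (goal ≤ # ((TT ∩ Long) ∩ tch q))
    rich? q = _ ≤? _

    Rich : Sub p
    Rich = set rich?

    stuck : ∀ q → q ∈ Rich → Stuck q
    stuck q m = run q N₁ 0 ｛ q ｝ ((TT ∩ Long) ∩ tch q) (+-identityʳ N₁) (≤-antisym (#-｛｝ q) (#-∈ (｛｝⁺ q))) (｛｝⁺ q) (λ i z → ∩ˡ z)
      (λ i x z x∈ → subst (λ y → i ∈ tch y) (sym (｛｝⁻ x∈)) (∩ʳ z)) (≤-trans (set⁻ {P? = rich?} m) (≤-reflexive (sym (trans (cong (# ((TT ∩ Long) ∩ tch q) *_) e-zero) (*-identityʳ (# ((TT ∩ Long) ∩ tch q)))))))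

    shared? : ∀ j g q → Dec (Shared j g q)
    shared? j g q = _ ≤? _

    module _ (cov-hi : ∀ q → # (tch q) ≤ R * goal) where

      -- Write `goal` as `e j * m` with `m = μ + s₁` and `m ≤ 2μ`. The lanes at `g` number at most
      -- `(2 * R * e j) * μ`, while each cell counted here shares `m` of them; too many such cells
      -- would let `common` contradict `S1`.
      few-shared : ∀ j g → j ≤ N₁ → # (set (shared? j g)) ≤ many (e j)
      few-shared j g j≤ = ≮⇒≥ λ lt → absurd (<⇒≤ lt)
        where
        gs = goal-split R≥1 j j≤
        m = proj₁ gs
        μ = m ∸ s₁
        s≤m : 2 * suc s₁ ≤ m
        s≤m = proj₂ (proj₂ gs)
        s₁≤m : s₁ ≤ m
        s₁≤m = ≤-trans (≤-trans (n≤1+n s₁) (m≤m+n (suc s₁) _)) s≤m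
        μ+s : μ + s₁ ≡ m
        μ+s = m∸n+n≡m s₁≤m
        s<μ : suc s₁ ≤ μ
        s<μ = +-cancelʳ-≤ s₁ (suc s₁) μ (≤-trans (+-monoʳ-≤ (suc s₁) (n≤1+n s₁)) (≤-trans (≤-reflexive (cong (suc s₁ +_) (sym (+-identityʳ (suc s₁))))) (≤-trans s≤m (≤-reflexive (sym μ+s)))))
        m≤2μ : m ≤ 2 * μ
        m≤2μ = ≤-trans (≤-reflexive (sym μ+s)) (≤-trans (+-monoʳ-≤ μ (≤-trans (n≤1+n s₁) s<μ)) (≤-reflexive (cong (μ +_) (sym (+-identityʳ μ)))))
        size : # (TT ∩ tch g) ≤ 2 * R * e j * μ
        size = ≤-trans (#-mono λ _ → ∩ʳ) (≤-trans (cov-hi g) (≤-trans (≤-reflexive (cong (R *_) (proj₁ (proj₂ gs)))) (≤-trans (*-monoʳ-≤ R (*-monoʳ-≤ (e j) m≤2μ)) (≤-reflexive (regroup R (e j) μ)))))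
          where
          regroup : ∀ a b c → a * (b * (2 * c)) ≡ 2 * a * b * c
          regroup = solve-∀
        B≥1 : 1 ≤ 2 * R * e j
        B≥1 = *-mono-≤ (*-mono-≤ (s≤s (z≤n {1})) R≥1) (e≥1 R≥1 j)
        absurd : many (e j) ≤ # (set (shared? j g)) → ⊥
        absurd big with common tch μ (2 * R * e j) (≤-trans (s≤s z≤n) s<μ) B≥1 s₁ (suc N₁) (s≤s z≤n) (TT ∩ tch g) (set (shared? j g)) size big
              (λ q q∈ → ≤-trans (≤-reflexive μ+s) (*-cancelʳ-≤ m _ (e j) {{>-nonZero (e≥1 R≥1 j)}}
                 (≤-trans (≤-reflexive (trans (*-comm m (e j)) (sym (proj₁ (proj₂ gs))))) (set⁻ {P? = shared? j g} q∈))))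
        ... | I , Hs , I⊆ , sI , _ , NH , all = S1 θ I sI (λ i z → TT⁻ (∩ˡ (I⊆ i z))) Hs (≤-trans (n≤1+n N₁) NH) all

      hubs : Fin N₁ → Sub p
      hubs j = set (λ g → hub (e (toℕ j)) <? # (M g))

      few-hubs : ∀ j → hub (e (toℕ j)) * # (hubs j) ≤ D * p
      few-hubs j = ≤-trans (∑-lower (hubs j) (λ g → # (M g)) (hub (e (toℕ j))) λ g g∈ → <⇒≤ (set⁻ {P? = λ g → hub (e (toℕ j)) <? # (M g)} g∈))
        (≤-trans (∑-mono λ g → ▹-≤ (hubs j g) λ _ → ≤-refl) degree-sum)

      -- A rich cell shares lanes with a hub of some stage `j`. By sparsity there are at most
      -- `D * p / hub (e j)` such hubs, and each serves at most `many (e j)` cells; summing over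
      -- `N₁` stages gives at most a fifth of `p`.
      few-rich : 5 * # Rich ≤ p
      few-rich = *-cancelˡ-≤ (suc N₁ * suc D) (begin
          suc N₁ * suc D * (5 * # Rich)                                              ≡⟨ regroup (suc N₁) (suc D) (# Rich) ⟩
          5 * suc N₁ * suc D * # Rich                                                ≤⟨ *-monoʳ-≤ (5 * suc N₁ * suc D) rich≤ ⟩
          5 * suc N₁ * suc D * ∑ (λ j → many (e (toℕ j)) * # (hubs j))               ≡⟨ sym (∑-* (5 * suc N₁ * suc D) (λ j → many (e (toℕ j)) * # (hubs j))) ⟩
          ∑ (λ j → 5 * suc N₁ * suc D * (many (e (toℕ j)) * # (hubs j)))             ≡⟨ ∑-cong {N₁} (λ j → sym (*-assoc (5 * suc N₁ * suc D) (many (e (toℕ j))) (# (hubs j)))) ⟩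
          ∑ (λ j → hub (e (toℕ j)) * # (hubs j))                                     ≤⟨ ∑-mono few-hubs ⟩
          ∑ {N₁} (λ _ → D * p)                                                       ≡⟨ ∑-const {N₁} (D * p) ⟩
          N₁ * (D * p)                                                               ≤⟨ *-mono-≤ (n≤1+n N₁) (*-monoˡ-≤ p (n≤1+n D)) ⟩
          suc N₁ * (suc D * p)                                                       ≡⟨ sym (*-assoc (suc N₁) (suc D) p) ⟩
          suc N₁ * suc D * p                                                         ∎)
        where
        open ≤-Reasoning
        regroup : ∀ a b c → a * b * (5 * c) ≡ 5 * a * b * c
        regroup = solve-∀
        cov : Rich ⊆ ⋃ ⊤ˢ (λ j → ⋃ (hubs j) (λ g → set (shared? (toℕ j) g)))
        cov q m = let (j , g , big , sh) = stuck q m in ⋃⁺ j ∈⊤ (⋃⁺ g (set⁺ {P? = λ g → hub (e (toℕ j)) <? # (M g)} big) (set⁺ {P? = shared? (toℕ j) g} sh))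
        rich≤ : # Rich ≤ ∑ (λ j → many (e (toℕ j)) * # (hubs j))
        rich≤ = ≤-trans (#-mono cov) (≤-trans (#-⋃ ⊤ˢ (λ j → ⋃ (hubs j) (λ g → set (shared? (toℕ j) g))))
          (∑-mono {N₁} λ j → #-⋃-bound (hubs j) (λ g → set (shared? (toℕ j) g)) (many (e (toℕ j))) λ g _ → few-shared (toℕ j) g (<⇒≤ (FP.toℕ<n j))))

  module _ (cov-lo : ∀ q → 4 * goal < # (tch q)) (cov-hi : ∀ q → # (tch q) ≤ R * goal) where

    Lg = Type.Long true

    crowded? : ∀ q → Dec (2 * goal ≤ # (tch q ∖ Lg))
    crowded? q = _ ≤? _

    -- Incidences of short lanes are counted twice: every short lane touches at most `N₁` cells,
    -- every crowded cell at least `2 * goal` short lanes.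
    few-crowded : K * N₁ ≤ p → 2 * # (set crowded?) ≤ p
    few-crowded le = *-cancelˡ-≤ goal {{>-nonZero (goal≥1 R≥1)}} (begin
        goal * (2 * # (set crowded?))                        ≡⟨ regroup goal (# (set crowded?)) ⟩
        2 * goal * # (set crowded?)                          ≤⟨ ∑-lower (set crowded?) (λ q → # (tch q ∖ Lg)) (2 * goal) (λ q m → set⁻ {P? = crowded?} m) ⟩
        ∑ (λ q → set crowded? q ▹ # (tch q ∖ Lg))            ≤⟨ ∑-mono (λ q → ▹-≤ (set crowded? q) λ _ → ≤-refl) ⟩
        ∑ (λ q → # (tch q ∖ Lg))                             ≡⟨ ∑-cong (λ q → #-def (tch q ∖ Lg)) ⟩
        ∑ (λ q → ∑ (λ i → (tch q ∖ Lg) i ▹ 1))               ≡⟨ ∑-swap (λ q i → (tch q ∖ Lg) i ▹ 1) ⟩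
        ∑ (λ i → ∑ (λ q → (tch q ∖ Lg) i ▹ 1))               ≤⟨ ∑-mono short ⟩
        ∑ {K} (λ _ → N₁)                                     ≡⟨ ∑-const {K} N₁ ⟩
        K * N₁                                               ≤⟨ le ⟩
        p                                                    ≡⟨ sym (*-identityˡ p) ⟩
        1 * p                                                ≤⟨ *-monoˡ-≤ p (goal≥1 R≥1) ⟩
        goal * p                                             ∎)
      where
      open ≤-Reasoning
      regroup : ∀ a b → a * (2 * b) ≡ 2 * a * b
      regroup = solve-∀
      short : ∀ i → ∑ (λ q → (tch q ∖ Lg) i ▹ 1) ≤ N₁
      short i with Type.long? true i
      ... | yes l = ≤-trans (∑-mono {g = λ _ → 0} λ q → ▹-≤ ((tch q ∖ Lg) i) λ m → ⊥-elim (∖ʳ {S = tch q} {Lg} {i} (∈! m) (set⁺ {P? = Type.long? true} l))) (≤-trans (≤-reflexive (∑-0 {p})) z≤n)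
      ... | no ¬l = ≤-trans (∑-mono λ q → ▹-≤ ((tch q ∖ Lg) i) λ m → ≤-reflexive (sym (▹-true 1 (!∈ (∖ˡ {S = tch q} {Lg} {i} (∈! m)))))) (≤-trans (≤-reflexive (sym (#-def (row i)))) (≮⇒≥ ¬l))

    -- Of more than `4 * goal` lanes, fewer than `2 * goal` are short. If fewer than `goal` long
    -- ones have the first type, at least `goal` have the second.
    cover-rich : ∀ q → q ∉ set crowded? → q ∈ Type.Rich true ∪ Type.Rich false
    cover-rich q nc with goal ≤? # ((Type.TT true ∩ Lg) ∩ tch q)
    ... | yes l = ∪ˡ (set⁺ {P? = Type.rich? true} l)
    ... | no ¬l = ∪ʳ (set⁺ {P? = Type.rich? false} (+-cancelˡ-≤ (3 * goal) _ _ (begin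
          3 * goal + goal                                                                      ≡⟨ e₁ goal ⟩
          4 * goal                                                                             ≤⟨ <⇒≤ (cov-lo q) ⟩
          # (tch q)                                                                            ≤⟨ #-mono sub ⟩
          # ((tch q ∖ Lg) ∪ ((Tt ∩ Lg) ∩ tch q) ∪ ((Tf ∩ Type.Long false) ∩ tch q))            ≤⟨ #-∪ (tch q ∖ Lg) _ ⟩
          # (tch q ∖ Lg) + # (((Tt ∩ Lg) ∩ tch q) ∪ ((Tf ∩ Type.Long false) ∩ tch q))          ≤⟨ +-mono-≤ (<⇒≤ (≰⇒> λ z → nc (set⁺ {P? = crowded?} z))) (≤-trans (#-∪ ((Tt ∩ Lg) ∩ tch q) _) (+-monoˡ-≤ _ (<⇒≤ (≰⇒> ¬l)))) ⟩
          2 * goal + (goal + # ((Tf ∩ Type.Long false) ∩ tch q))                               ≡⟨ e₂ goal _ ⟩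
          3 * goal + # ((Tf ∩ Type.Long false) ∩ tch q)                                        ∎)))
      where
      open ≤-Reasoning
      Tt = Type.TT true
      Tf = Type.TT false
      e₁ : ∀ g → 3 * g + g ≡ 4 * g
      e₁ = solve-∀
      e₂ : ∀ g x → 2 * g + (g + x) ≡ 3 * g + x
      e₂ = solve-∀
      sub : tch q ⊆ (tch q ∖ Lg) ∪ ((Tt ∩ Lg) ∩ tch q) ∪ ((Tf ∩ Type.Long false) ∩ tch q)
      sub i m with i ∈? Lg
      ... | no ¬g = ∪ˡ (∖⁺ m ¬g)
      ... | yes g with typ i in eq
      ...   | true  = ∪ʳ (∪ˡ (∩⁺ (∩⁺ (set⁺ {P? = λ i → typ i BP.≟ true} eq) g) m))
      ...   | false = ∪ʳ (∪ʳ (∩⁺ (∩⁺ (set⁺ {P? = λ i → typ i BP.≟ false} eq) (set⁺ {P? = Type.long? false} (set⁻ {P? = Type.long? true} g))) m))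

    -- Otherwise at most half of the cells are crowded and at most two fifths are rich, which
    -- together cannot cover all cells unless there are none.
    few-cells : p ≤ K * N₁
    few-cells with K * N₁ ≤? p
    ... | no ¬l = <⇒≤ (≰⇒> ¬l)
    ... | yes le = ≤-trans (≤-reflexive p≡0) z≤n
      where
      open ≤-Reasoning
      a = # (Type.Rich true)
      b = # (Type.Rich false)
      half : p ≤ # (set crowded?) + (a + b)
      half = ≤-trans (≤-reflexive (sym (#-⊤ {p}))) (≤-trans (#-mono {T = set crowded? ∪ Type.Rich true ∪ Type.Rich false} λ q _ → split q)
               (≤-trans (#-∪ (set crowded?) _) (+-monoʳ-≤ _ (#-∪ (Type.Rich true) (Type.Rich false)))))
        where
        split : ∀ q → q ∈ set crowded? ∪ Type.Rich true ∪ Type.Rich false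
        split q with q ∈? set crowded?
        ... | yes m = ∪ˡ m
        ... | no m  = ∪ʳ (cover-rich q m)
      bound : 10 * p ≤ 9 * p
      bound = begin
        10 * p                                        ≤⟨ *-monoʳ-≤ 10 half ⟩
        10 * (# (set crowded?) + (a + b))             ≡⟨ e₁ (# (set crowded?)) a b ⟩
        5 * (2 * # (set crowded?)) + 2 * (5 * a + 5 * b)   ≤⟨ +-mono-≤ (*-monoʳ-≤ 5 (few-crowded le)) (*-monoʳ-≤ 2 (+-mono-≤ (Type.few-rich true cov-hi) (Type.few-rich false cov-hi))) ⟩
        5 * p + 2 * (p + p)                           ≡⟨ e₂ p ⟩
        9 * p                                         ∎
        where
        e₁ : ∀ c a b → 10 * (c + (a + b)) ≡ 5 * (2 * c) + 2 * (5 * a + 5 * b)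
        e₁ = solve-∀
        e₂ : ∀ p → 5 * p + 2 * (p + p) ≡ 9 * p
        e₂ = solve-∀
      p≡0 : p ≡ 0
      p≡0 = n≤0⇒n≡0 (+-cancelʳ-≤ (9 * p) p 0 bound)

least : {P : ℕ → Set} → (∀ i → Dec (P i)) → ∀ k → P k → ∃ λ i → P i × (∀ j → P j → i ≤ j)
least P? zero    p = 0 , p , λ _ _ → z≤n
least {P} P? (suc k) p with P? 0
... | yes p₀ = 0 , p₀ , λ _ _ → z≤n
... | no ¬p₀ with least {P ∘ suc} (P? ∘ suc) k p
...   | i , pᵢ , min = suc i , pᵢ , λ { zero p₀ → ⊥-elim (¬p₀ p₀) ; (suc j) pⱼ → s≤s (min j pⱼ) }

-- Breadth-first layerings

module Layers (G : Graph) where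
  open Walks G

  root? : ∀ z → Dec (∀ u → u ∈ comp ⊤ˢ z → toℕ z ≤ toℕ u)
  root? z = all? (λ u → (u ∈? comp ⊤ˢ z) →-dec (toℕ z ≤? toℕ u))

  Roots : Sub (n G)
  Roots = set root?

  root∃ : ∀ v → ∃ λ z → z ∈ Roots × z ∈ comp ⊤ˢ v
  root∃ v with least {λ i → ∃ λ u → u ∈ comp ⊤ˢ v × toℕ u ≡ i} (λ i → any? (λ u → (u ∈? comp ⊤ˢ v) ×-dec (toℕ u ≟ i))) (toℕ v) (v , comp-∋ ∈⊤ , refl)
  ... | .(toℕ z) , (z , z∈ , refl) , min = z , set⁺ {P? = root?} (λ u u∈ → min (toℕ u) (u , comp-⊆comp z∈ u u∈ , refl)) , z∈

  root-unique : ∀ {z z′} → z ∈ Roots → z′ ∈ Roots → z′ ∈ comp ⊤ˢ z → z ≡ z′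
  root-unique p q c = FP.toℕ-injective (≤-antisym (set⁻ {P? = root?} p _ c) (set⁻ {P? = root?} q _ (comp-sym c)))

  within : ℕ → Sub (n G)
  within zero    = Roots
  within (suc i) = N[ within i ]

  private
    within-walk : ∀ {u v} i → Path ⊤ˢ u v → u ∈ within i → ∃ λ i′ → v ∈ within i′
    within-walk i [ _ ]        p = i , p
    within-walk i (_ ∷⟨ e ⟩ w) p = within-walk (suc i) w (N-adj p e)

    reached : ∀ v → ∃ λ i → v ∈ within i
    reached v = let (z , z∈ , c) = root∃ v in within-walk 0 (reverseʷ (mapʷ comp-⊆ (comp-path c))) z∈

    levels : ∀ v → ∃ λ i → v ∈ within i × (∀ j → v ∈ within j → i ≤ j)
    levels v = least (λ i → v ∈? within i) (proj₁ (reached v)) (proj₂ (reached v))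

  opaque
    level : V → ℕ
    level v = proj₁ (levels v)

    level-within : ∀ v → v ∈ within (level v)
    level-within v = proj₁ (proj₂ (levels v))

    level-least : ∀ {v} i → v ∈ within i → level v ≤ i
    level-least {v} i p = proj₂ (proj₂ (levels v)) i p

  level-step : ∀ {u v} → u ~ v → level v ≤ suc (level u)
  level-step {u} e = level-least (suc (level u)) (N-adj (level-within u) e)

  layering : IsLayering G level
  layering u v e = dist (level-step e) (level-step (~-sym e))
    where
    dist : ∀ {a b} → b ≤ suc a → a ≤ suc b → ∣ a - b ∣ ≤ 1
    dist {zero}  {b}     p q = p
    dist {suc a} {zero}  p q = q
    dist {suc a} {suc b} p q = dist (≤-pred p) (≤-pred q)

  level-zero : ∀ {v} → level v ≡ 0 → v ∈ Roots
  level-zero {v} e = subst (λ i → v ∈ within i) e (level-within v)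

  parent : ∀ v l → level v ≡ suc l → ∃ λ u → u ~ v × level u ≡ l
  parent v l e with N⁻ (subst (λ i → v ∈ within i) e (level-within v))
  ... | u , u∈ , inj₁ refl = ⊥-elim (1+n≰n (≤-trans (≤-reflexive (sym e)) (level-least l u∈)))
  ... | u , u∈ , inj₂ r = u , r , ≤-antisym (level-least l u∈) (≤-pred (≤-trans (≤-reflexive (sym e)) (level-step r)))

  opaque
    above : ∀ v → Σ V λ u → ∀ l → level v ≡ suc l → u ~ v × level u ≡ l
    above v = go (level v) refl
      where
      go : ∀ l → level v ≡ l → Σ V λ u → ∀ l → level v ≡ suc l → u ~ v × level u ≡ l
      -- A root has no parent; `v` is a placeholder and the condition on it is vacuous.
      go zero    e = v , λ l e′ → ⊥-elim (1+n≢0 (trans (sym e′) e))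
      go (suc l) e = proj₁ (parent v l e) , λ l′ e′ → proj₁ (proj₂ (parent v l e)) , trans (proj₂ (proj₂ (parent v l e))) (suc-injective (trans (sym e) e′))

  par : V → V
  par v = proj₁ (above v)

  par-spec : ∀ {v l} → level v ≡ suc l → par v ~ v × level (par v) ≡ l
  par-spec {v} {l} = proj₂ (above v) l

  climb : ℕ → V → V
  climb zero    v = v
  climb (suc k) v = climb k (par v)

  stalk : ℕ → V → Sub (n G)
  stalk zero    v = ｛ v ｝
  stalk (suc k) v = ｛ v ｝ ∪ stalk k (par v)

  stalk-self : ∀ k v → v ∈ stalk k v
  stalk-self zero    v = ｛｝⁺ v
  stalk-self (suc k) v = ∪ˡ (｛｝⁺ v)

  stalk-foot : ∀ k v → climb k v ∈ stalk k v
  stalk-foot zero    v = ｛｝⁺ v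
  stalk-foot (suc k) v = ∪ʳ (stalk-foot k (par v))

  #-stalk : ∀ k v → # (stalk k v) ≤ suc k
  #-stalk zero    v = #-｛｝ v
  #-stalk (suc k) v = ≤-trans (#-∪ ｛ v ｝ (stalk k (par v))) (+-mono-≤ (#-｛｝ v) (#-stalk k (par v)))

  module Below (j : ℕ) where

    -- Truncated subtraction makes this the identity up to level `j` and the chosen ancestor on
    -- level `j` beyond it.
    α : V → V
    α v = climb (level v ∸ j) v

    α-low : ∀ {v} → level v ≤ j → α v ≡ v
    α-low {v} le = cong (λ k → climb k v) (m≤n⇒m∸n≡0 le)

    down : ∀ {k v} → level v ∸ j ≡ suc k → par v ~ v × level (par v) ∸ j ≡ k × suc (level (par v)) ≡ level v
    down {k} {v} e = proj₁ ps , trans (cong (_∸ j) (proj₂ ps)) (m+n∸n≡m k j) , trans (cong suc (proj₂ ps)) (sym lv)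
      where
      j≤ : j ≤ level v
      j≤ = <⇒≤ (m∸n≢0⇒n<m λ z → 1+n≢0 (trans (sym e) z))
      lv : level v ≡ suc k + j
      lv = trans (sym (m∸n+n≡m j≤)) (cong (_+ j) e)
      ps = par-spec lv

    α-below : ∀ k v → level v ∸ j ≡ k → level (climb k v) ≤ j
    α-below zero    v e = m∸n≡0⇒m≤n e
    α-below (suc k) v e = α-below k (par v) (proj₁ (proj₂ (down e)))

    stalk-conn : ∀ k v → level v ∸ j ≡ k → Connected′ (stalk k v)
    stalk-conn zero    v e = conn-｛｝ v
    stalk-conn (suc k) v e = let (r , e′ , _) = down e in
      conn-∪ (conn-｛｝ v) (stalk-conn k (par v) e′) (｛｝⁺ v) (stalk-self k (par v)) (inj₂ (~-sym r))

    stalk-level : ∀ k v x → level v ∸ j ≡ k → x ∈ stalk k v → level x ≤ level v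
    stalk-level zero    v x e m = ≤-reflexive (cong level (｛｝⁻ m))
    stalk-level (suc k) v x e m with ∪⁻ m
    ... | inj₁ a = ≤-reflexive (cong level (｛｝⁻ a))
    ... | inj₂ b = let (_ , e′ , l) = down e in ≤-trans (stalk-level k (par v) x e′ b) (≤-trans (n≤1+n _) (≤-reflexive l))

    stalk-α : ∀ k v x → level v ∸ j ≡ k → x ∈ stalk k v → α x ≡ climb k v
    stalk-α zero    v x e m with ｛｝⁻ m
    ... | refl = cong (λ k → climb k x) e
    stalk-α (suc k) v x e m with ∪⁻ m
    ... | inj₂ b = stalk-α k (par v) x (proj₁ (proj₂ (down e))) b
    ... | inj₁ a with ｛｝⁻ a
    ...   | refl = cong (λ k → climb k x) e

    climb-near : ∀ k v → level v ∸ j ≡ k → v ∈ ball (climb k v) k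
    climb-near zero    v e = ｛｝⁺ v
    climb-near (suc k) v e = let (r , e′ , _) = down e in N-adj (climb-near k (par v) e′) r

  ball-mono : ∀ x {a b} → a ≤ b → ball x a ⊆ ball x b
  ball-mono x {a} {b} le v m = subst (λ c → v ∈ ball x c) (m∸n+n≡m le) (grow (b ∸ a) {a} m)
    where
    grow : ∀ c {a} → v ∈ ball x a → v ∈ ball x (c + a)
    grow zero    m = m
    grow (suc c) {a} m = N-self (grow c {a} m)

-- Within one component, B consists of the layers below the window (with one layer left out), A is the part of
-- the window under consideration, Ω contains both, and α sends a vertex to its ancestor in the last layer of B.
record Frame (G : Graph) (B Ω A : Sub (n G)) (ν ρ : ℕ) : Set where
  open Walks G
  field
    α       : V → V
    B-conn  : Connected′ B
    B⊆Ω     : B ⊆ Ω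
    A⊆Ω     : A ⊆ Ω
    B-A     : Apart B A
    α∈B     : ∀ v → v ∈ Ω → α v ∈ B
    α-id    : ∀ v → v ∈ B → α v ≡ v
    stem    : V → Sub (n G)
    self    : ∀ v → v ∈ Ω → v ∈ stem v
    foot    : ∀ v → v ∈ Ω → α v ∈ stem v
    stem⊆   : ∀ v → v ∈ Ω → stem v ⊆ Ω
    stem-conn : ∀ v → v ∈ Ω → Connected′ (stem v)
    stem-α  : ∀ v x → v ∈ Ω → x ∈ stem v → α x ≡ α v
    #-stem  : ∀ v → v ∈ Ω → # (stem v) ≤ ν

  over : Sub (n G) → Sub (n G)
  over X = set (λ v → α v ∈? X)

  over⁺ : ∀ {X v} → α v ∈ X → v ∈ over X
  over⁺ {X} = set⁺ {P? = λ v → α v ∈? X}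

  over⁻ : ∀ {X v} → v ∈ over X → α v ∈ X
  over⁻ {X} = set⁻ {P? = λ v → α v ∈? X}

  field
    fibre   : ∀ x → # (A ∩ over ｛ x ｝) ≤ ρ

module _ {G : Graph} {B Ω A : Sub (n G)} {ν ρ : ℕ} (F : Frame G B Ω A ν ρ) where
  open Walks G
  open Skeletons G
  open Frame F

  -- Everything outside `B` becomes light. A tie follows the stem to its foot in `B` and continues
  -- with the tie there, so it has at most `ν + 1` light vertices. Heavy vertices now lie in `B`,
  -- hence have no neighbour in `A`.
  module Extend (p : ℕ) (Sk : Skeleton B 1 p) where
    module O = Skeleton Sk

    light′ : Sub (n G)
    light′ = O.light ∪ (⊤ˢ ∖ B)

    cl′ : Fin p → Sub (n G)
    cl′ q = Ω ∩ over (O.cl q)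

    inB : ∀ {v} → v ∉ light′ → v ∈ B
    inB {v} h = decidable-stable (v ∈? B) λ z → h (∪ʳ (∖⁺ ∈⊤ z))

    cl-lift : ∀ {q v} → v ∈ O.cl q → v ∈ cl′ q
    cl-lift {q} {v} m = let b = O.cl⊆ q v m in ∩⁺ (B⊆Ω v b) (over⁺ (subst (_∈ O.cl q) (sym (α-id v b)) m))

    old-light : ∀ {v} → v ∈ B → v ∈ light′ → v ∈ O.light
    old-light b m = [ id , (λ z → ⊥-elim (∖ʳ z b)) ]′ (∪⁻ m)

    tie′ : ∀ q v → v ∈ cl′ q → Tie (O.core q) (cl′ q) light′ (ν + 1) v
    tie′ q v m = record
      { S = stem v ∪ T.S ; self = ∪ˡ (self v v∈)
      ; S⊆ = λ x x∈ → [ (λ a → ∩⁺ (stem⊆ v v∈ x a) (over⁺ (subst (_∈ O.cl q) (sym (stem-α v x v∈ a)) (over⁻ (∩ʳ m))))) , (λ b → cl-lift (T.S⊆ x b)) ]′ (∪⁻ x∈)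
      ; conn = conn-⊆⊇ (λ x → [ [ ∪ˡ , (λ t → ∪ʳ (∪ʳ t)) ]′ ∘ ∪⁻ , (λ s → ∪ʳ (∪ˡ s)) ]′ ∘ ∪⁻)
                       (λ x → [ (λ c → ∪ˡ (∪ˡ c)) , [ ∪ʳ , (λ t → ∪ˡ (∪ʳ t)) ]′ ∘ ∪⁻ ]′ ∘ ∪⁻)
                       (conn-∪ T.conn (stem-conn v v∈) (∪ʳ T.self) (foot v v∈) (inj₁ refl))
      ; lights = ≤-trans (#-mono {T = stem v ∪ (T.S ∩ O.light)} λ x x∈ → [ ∪ˡ , (λ t → ∪ʳ (∩⁺ t (old-light (O.cl⊆ q x (T.S⊆ x t)) (∩ʳ x∈)))) ]′ (∪⁻ (∩ˡ x∈)))
                   (≤-trans (#-∪ (stem v) (T.S ∩ O.light)) (+-mono-≤ (#-stem v v∈) T.lights)) }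
      where
      v∈ : v ∈ Ω
      v∈ = ∩ˡ m
      module T = Tie (O.tie q (α v) (over⁻ (∩ʳ m)))

    extended : Skeleton Ω (ν + 1) p
    extended = record
      { cl = cl′ ; cl⊆ = λ q v → ∩ˡ
      ; cover = λ v m → let (q , c) = O.cover (α v) (α∈B v m) in q , ∩⁺ m (over⁺ c)
      ; unique = λ a b → O.unique (over⁻ (∩ʳ a)) (over⁻ (∩ʳ b))
      ; light = light′ ; core = O.core ; core∋ = O.core∋ ; core-conn = O.core-conn
      ; core⊆ = λ q v m → cl-lift (O.core⊆ q v m)
      ; core-heavy = λ q v m l → O.core-heavy q v m (old-light (O.cl⊆ q v (O.core⊆ q v m)) l)
      ; tie = tie′
      ; heavy = λ {q} {q′} {u} {v} a b h h′ e → O.heavy (subst (_∈ O.cl q) (α-id u (inB h)) (over⁻ (∩ʳ a))) (subst (_∈ O.cl q′) (α-id v (inB h′)) (over⁻ (∩ʳ b)))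
          (λ l → h (∪ˡ l)) (λ l → h′ (∪ˡ l)) e }

    A-light : ∀ a → a ∈ A → a ∈ light′
    A-light a m = ∪ʳ (∖⁺ ∈⊤ λ b → proj₁ (B-A a a b m) refl)

    A-heavy : ∀ u a → u ∈ Ω → u ∉ light′ → a ∈ A → ¬ Adj G u a
    A-heavy u a _ h m = proj₂ (B-A u a (inB h) m)

-- Frames from a breadth-first layering

module FrameOf (G : Graph) (Δ : ℕ) (Δ-bound : ∀ v → # (adj G v) ≤ Δ) (z : Fin (n G)) (j s : ℕ) where
  open Walks G
  open Degree Δ Δ-bound
  open Layers G
  open Below j

  upto : ℕ → Sub (n G)
  upto l = comp ⊤ˢ z ∩ set (λ v → level v ≤? l)

  upto⁺ : ∀ {l v} → v ∈ comp ⊤ˢ z → level v ≤ l → v ∈ upto l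
  upto⁺ {l} c le = ∩⁺ c (set⁺ {P? = λ v → level v ≤? l} le)

  upto⁻ : ∀ {l v} → v ∈ upto l → level v ≤ l
  upto⁻ {l} m = set⁻ {P? = λ v → level v ≤? l} (∩ʳ m)

  stem : V → Sub (n G)
  stem v = stalk (level v ∸ j) v

  same-comp : ∀ {v} x → v ∈ comp ⊤ˢ z → x ∈ stem v → x ∈ comp ⊤ˢ z
  same-comp {v} x c m = comp-walk c (mapʷ (λ _ _ → ∈⊤) (stalk-conn (level v ∸ j) v refl v x (stalk-self (level v ∸ j) v) m))

  to-root : ∀ l v → level v ≡ l → level v ≤ j → v ∈ comp ⊤ˢ z → Path (upto j) v (proj₁ (root∃ z))
  to-root zero v e le c = subst (Path (upto j) v) (root-unique (level-zero e) (proj₁ (proj₂ (root∃ z))) (comp-⊆comp (comp-sym c) _ (proj₂ (proj₂ (root∃ z))))) [ upto⁺ c le ]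
  to-root (suc l) v e le c = let (r , e′) = par-spec e in
    upto⁺ c le ∷⟨ ~-sym r ⟩ to-root l (par v) e′ (≤-trans (≤-trans (≤-reflexive e′) (n≤1+n l)) (≤-trans (≤-reflexive (sym e)) le)) (comp-closed c ∈⊤ (~-sym r))

  #-fibre : ∀ (A : Sub (n G)) x → A ⊆ upto (j + s) → (∀ v → v ∈ A → α v ≡ x) → # A ≤ suc Δ ^ᵒ s
  #-fibre A x A⊆ foot = ≤-trans (#-mono λ v m → ball-mono x (≤-trans (∸-monoˡ-≤ j (upto⁻ (A⊆ v m))) (≤-reflexive (m+n∸m≡n j s)))
    v (subst (λ y → v ∈ ball y (level v ∸ j)) (foot v m) (climb-near (level v ∸ j) v refl))) (#-ball x s)

  -- A stem descends at most `s` levels, which gives `s + 1` vertices, and all vertices of `A`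
  -- hanging from `x` lie in the ball of radius `s` around `x`. The strict bound `suc j < level v`
  -- keeps layer `j + 1` between `B` and `A`.
  frame : (A : Sub (n G)) → A ⊆ upto (j + s) → (∀ v → v ∈ A → suc j < level v) → Frame G (upto j) (upto (j + s)) A (suc s) (suc Δ ^ᵒ s)
  frame A A⊆ high = record
    { α = α
    ; B-conn = conn-hub (proj₁ (root∃ z)) (λ u m → to-root (level u) u refl (upto⁻ m) (∩ˡ m))
    ; B⊆Ω = λ v m → upto⁺ (∩ˡ m) (≤-trans (upto⁻ m) (m≤m+n j s))
    ; A⊆Ω = A⊆
    ; B-A = λ u v u∈ v∈ → (λ { refl → 1+n≰n (≤-trans (≤-trans (n≤1+n _) (high u v∈)) (upto⁻ u∈)) }) ,
                           λ e → 1+n≰n (≤-trans (≤-pred (≤-trans (high v v∈) (level-step e))) (upto⁻ u∈))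
    ; α∈B = λ v m → upto⁺ (same-comp _ (∩ˡ m) (stalk-foot (level v ∸ j) v)) (α-below (level v ∸ j) v refl)
    ; α-id = λ v m → α-low (upto⁻ m)
    ; stem = stem
    ; self = λ v _ → stalk-self (level v ∸ j) v
    ; foot = λ v _ → stalk-foot (level v ∸ j) v
    ; stem⊆ = λ v m x x∈ → upto⁺ (same-comp x (∩ˡ m) x∈) (≤-trans (stalk-level (level v ∸ j) v x refl x∈) (upto⁻ m))
    ; stem-conn = λ v _ → stalk-conn (level v ∸ j) v refl
    ; stem-α = λ v x _ m → stalk-α (level v ∸ j) v x refl m
    ; #-stem = λ v m → ≤-trans (#-stalk (level v ∸ j) v) (s≤s (≤-trans (∸-monoˡ-≤ j (upto⁻ m)) (≤-reflexive (m+n∸m≡n j s))))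
    ; fibre = λ x → #-fibre _ x (λ v m → A⊆ v (∩ˡ m)) (λ v m → ｛｝⁻ (set⁻ {P? = λ v → α v ∈? ｛ x ｝} (∩ʳ m))) }

#-unique : ∀ {m} (S : Sub m) → (∀ u v → u ∈ S → v ∈ S → u ≡ v) → # S ≤ 1
#-unique S h with any? (λ v → v ∈? S)
... | no ¬p = ≤-trans (≤-reflexive (#-∅ λ v m → ¬p (v , m))) z≤n
... | yes (u , u∈) = ≤-trans (#-mono {T = ｛ u ｝} λ v v∈ → subst (_∈ ｛ u ｝) (h u v u∈ v∈) (｛｝⁺ u)) (#-｛｝ u)

-- Contacts between two families of lanes

record Crossings (G : Graph) {K : ℕ} (L : Fin K → Sub (n G)) (x y : ℕ) : Set where
  field
    p    : ℕ
    tch  : Fin p → Sub K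
    few  : p ≤ K * x
    load : ∀ q → # (tch q) ≤ y
    meet : ∀ i j → ¬ Walks.Apart G (L i) (L j) → ∃ λ q → i ∈ tch q × j ∈ tch q

module Crossing (H G : Graph) (Δ : ℕ) (Δ-bound : ∀ v → # (adj G v) ≤ Δ) (noH : ¬ InducedMinor H G)
                {B Ω A : Sub (n G)} {ν ρ : ℕ} (F : Frame G B Ω A ν ρ)
                {K : ℕ} (K≥1 : 1 ≤ K) (L : Fin K → Sub (n G)) (L∋ : ∀ i → ∃ λ v → v ∈ L i) (L⊆ : ∀ i → L i ⊆ A) (L-conn : ∀ i → Walks.Connected′ G (L i))
                (typ : Fin K → Bool) (L-apart : ∀ i j → i ≢ j → typ i ≡ typ j → Walks.Apart G (L i) (L j))
                (N₁ s₁ D R goal : ℕ) (D≡ : density Δ (ν + 1) (n H) ≡ D)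
                (N₁≡ : (n H * n H) * suc (density Δ (ν + 1) (n H)) ≡ N₁)
                (s₁≡ : n H * suc (suc Δ * (ν + 1) * (n H * n H) + suc Δ * (ν + 1) * (n H * n H)) ≡ s₁)
                (R≡ : 4 + (2 * (suc Δ * ρ) + 4) * suc Δ ^ᵒ 2 ≡ R)
                (goal≡ : Thresholds.goal N₁ s₁ D R ≡ goal) where
  open Walks G
  open Degree Δ Δ-bound
  open Skeletons G
  open Frame F

  R≥4 : 4 ≤ R
  R≥4 = ≤-trans (m≤m+n 4 _) (≤-reflexive R≡)

  R≥1 : 1 ≤ R
  R≥1 = ≤-trans (s≤s z≤n) R≥4

  goal≥1 : 1 ≤ goal
  goal≥1 = ≤-trans (Thresholds.goal≥1 N₁ s₁ D R R≥1) (≤-reflexive goal≡)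

  reach? : ∀ X i → Dec (∃ λ v → v ∈ N[ L i ] ∩ A × v ∈ over X)
  reach? X i = any? (λ v → (v ∈? N[ L i ] ∩ A) ×-dec (v ∈? over X))

  reach : Sub (n G) → Sub K
  reach X = set (reach? X)

  reach⁺ : ∀ {X i v} → v ∈ N[ L i ] ∩ A → v ∈ over X → i ∈ reach X
  reach⁺ {X} {v = v} p q = set⁺ {P? = reach? X} (v , p , q)

  reach⁻ : ∀ {X i} → i ∈ reach X → ∃ λ v → v ∈ N[ L i ] ∩ A × v ∈ over X
  reach⁻ {X} = set⁻ {P? = reach? X}

  r : Sub (n G) → ℕ
  r X = # (reach X)

  r-∪ : ∀ {Z X Y} → Z ⊆ X ∪ Y → r Z ≤ r X + r Y
  r-∪ {Z} {X} {Y} h = ≤-trans (#-mono λ i m → let (v , a , b) = reach⁻ {Z} m in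
    [ (λ c → ∪ˡ (reach⁺ {X} a (over⁺ c))) , (λ c → ∪ʳ (reach⁺ {Y} a (over⁺ c))) ]′ (∪⁻ (h (α v) (over⁻ b)))) (#-∪ (reach X) (reach Y))

  r-∅ : r ∅ ≡ 0
  r-∅ = #-∅ λ i m → ∉∅ (over⁻ (proj₂ (proj₂ (reach⁻ {∅} m))))

  typed? : ∀ (θ : Bool) v i → Dec (typ i ≡ θ × v ∈ L i)
  typed? θ v i = (typ i BP.≟ θ) ×-dec (v ∈? L i)

  one-typed : ∀ θ v → # (set (typed? θ v)) ≤ 1
  one-typed θ v = #-unique _ λ i j a b → decidable-stable (i FP.≟ j) λ ne →
    let (e , p) = set⁻ {P? = typed? θ v} a ; (e′ , p′) = set⁻ {P? = typed? θ v} b in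
    proj₁ (L-apart i j ne (trans e (sym e′)) v v p p′) refl

  -- A lane counted here meets the closed neighbourhood of `A ∩ over ｛ x ｝`, which has at most
  -- `(Δ + 1) * ρ` vertices, and a vertex lies on at most one lane of each type.
  r-｛｝ : ∀ x → r ｛ x ｝ ≤ 2 * (suc Δ * ρ)
  r-｛｝ x = ≤-trans (#-mono sub) (≤-trans (#-⋃-bound T through 2 λ v _ → ≤-trans (#-∪ (set (typed? true v)) (set (typed? false v))) (+-mono-≤ (one-typed true v) (one-typed false v)))
      (*-monoʳ-≤ 2 (≤-trans (#-N (A ∩ over ｛ x ｝)) (*-monoʳ-≤ (suc Δ) (fibre x)))))
    where
    T = N[ A ∩ over ｛ x ｝ ]
    through : V → Sub K
    through v = set (typed? true v) ∪ set (typed? false v)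
    thr : ∀ {u i} → u ∈ L i → i ∈ through u
    thr {u} {i} m with typ i in eq
    ... | true  = ∪ˡ (set⁺ {P? = typed? true u} (eq , m))
    ... | false = ∪ʳ (set⁺ {P? = typed? false u} (eq , m))
    sub : reach ｛ x ｝ ⊆ ⋃ T through
    sub i m with reach⁻ {｛ x ｝} m
    ... | v , a , b with N⁻ (∩ˡ a)
    ...   | u , u∈ , inj₁ refl = ⋃⁺ u (N-self (∩⁺ (∩ʳ a) b)) (thr u∈)
    ...   | u , u∈ , inj₂ e    = ⋃⁺ u (N-adj (∩⁺ (∩ʳ a) b) (~-sym e)) (thr u∈)

  m₀ : ℕ
  m₀ = 4 * goal

  contact : ∀ i j → ¬ Apart (L i) (L j) → ∃ λ v → v ∈ N[ L i ] ∩ A × v ∈ L j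
  contact i j na with any? (λ v → (v ∈? N[ L i ] ∩ A) ×-dec (v ∈? L j))
  ... | yes p = p
  ... | no ¬p = ⊥-elim (na λ u v a b → (λ { refl → ¬p (u , ∩⁺ (N-self a) (L⊆ j u b) , b) }) , λ e → ¬p (v , ∩⁺ (N-adj a e) (L⊆ j v b) , b))

  module _ (p : ℕ) (Sk : Skeleton B 1 p) (lo : ∀ q → m₀ < r (Skeleton.cl Sk q)) (hi : ∀ q → r (Skeleton.cl Sk q) ≤ R * goal) where
    module E = Extend F p Sk
    module FC = FewCells H G Δ Δ-bound noH Ω (ν + 1) p E.extended A A⊆Ω E.A-light E.A-heavy L L∋ L⊆ L-conn typ L-apart R R≥1 N₁ s₁ D N₁≡ s₁≡
      (subst (Sparse (Contacts.M G Ω (ν + 1) p E.extended)) D≡ (contacts-sparse H G Δ Δ-bound noH Ω (ν + 1) p E.extended))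

    to : ∀ q → reach (Skeleton.cl Sk q) ⊆ FC.tch q
    to q i m = let (v , a , b) = reach⁻ {Skeleton.cl Sk q} m in FC.tch⁺ (v , a , ∩⁺ (A⊆Ω v (∩ʳ a)) b)

    from : ∀ q → FC.tch q ⊆ reach (Skeleton.cl Sk q)
    from q i m = let (v , a , b) = FC.tch⁻ m in reach⁺ {Skeleton.cl Sk q} a (∩ʳ b)

    crossings-from : Crossings G L (suc N₁) (R * goal)
    crossings-from = record
      { p = p ; tch = FC.tch
      ; few = ≤-trans (FC.few-cells (λ q → ≤-trans (s≤s (≤-reflexive (cong (4 *_) goal≡))) (≤-trans (lo q) (#-mono (to q))))
                        (λ q → ≤-trans (hi′ q) (≤-reflexive (cong (R *_) (sym goal≡))))) (*-monoʳ-≤ K (n≤1+n N₁))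
      ; load = hi′
      ; meet = λ i j na → met i j (contact i j na) }
      where
      hi′ : ∀ q → # (FC.tch q) ≤ R * goal
      hi′ q = ≤-trans (#-mono (from q)) (hi q)
      met : ∀ i j → (∃ λ v → v ∈ N[ L i ] ∩ A × v ∈ L j) → ∃ λ q → i ∈ FC.tch q × j ∈ FC.tch q
      met i j (v , a , b) = let (q , c) = Skeleton.cover Sk (α v) (α∈B v (A⊆Ω v (∩ʳ a))) in
        q , to q i (reach⁺ {Skeleton.cl Sk q} a (over⁺ c)) , to q j (reach⁺ {Skeleton.cl Sk q} (∩⁺ (N-self b) (∩ʳ a)) (over⁺ c))

  module Cs = Cells G Δ Δ-bound r (λ {Z} {X} {Y} → r-∪ {Z} {X} {Y}) r-∅ (2 * (suc Δ * ρ)) r-｛｝ m₀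

  -- The origin of `R`: multiplying the constant term `2 * (suc Δ * ρ)` by `goal` as well makes the
  -- upper bound for a cell a multiple of `goal`.
  bound≤ : Cs.bound ≤ R * goal
  bound≤ = begin
      4 * goal + (2 * (suc Δ * ρ) + 4 * goal) * suc Δ ^ᵒ 2                   ≤⟨ +-monoʳ-≤ (4 * goal) (*-monoˡ-≤ (suc Δ ^ᵒ 2) (+-monoˡ-≤ (4 * goal) stretch)) ⟩
      4 * goal + (2 * (suc Δ * ρ) * goal + 4 * goal) * suc Δ ^ᵒ 2            ≡⟨ regroup (2 * (suc Δ * ρ)) goal (suc Δ ^ᵒ 2) ⟩
      (4 + (2 * (suc Δ * ρ) + 4) * suc Δ ^ᵒ 2) * goal                        ≡⟨ cong (_* goal) R≡ ⟩
      R * goal                                                               ∎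
    where
    open ≤-Reasoning
    stretch : 2 * (suc Δ * ρ) ≤ 2 * (suc Δ * ρ) * goal
    stretch = ≤-trans (≤-reflexive (sym (*-identityʳ _))) (*-monoʳ-≤ (2 * (suc Δ * ρ)) goal≥1)
    regroup : ∀ a g x → 4 * g + (a * g + 4 * g) * x ≡ (4 + (a + 4) * x) * g
    regroup = solve-∀

  all-reach : ∀ i → i ∈ reach B
  all-reach i = let (v , m) = L∋ i in reach⁺ {B} (∩⁺ (N-self m) (L⊆ i v m)) (over⁺ (α∈B v (A⊆Ω v (L⊆ i v m))))

  opaque
    crossings : Crossings G L (suc N₁) (R * goal)
    crossings with K ≤? m₀
    -- So few lanes exist that one artificial cell met by all of them respects the load.
    ... | yes le = record
      { p = 1 ; tch = λ _ → ⊤ˢ ; few = *-mono-≤ K≥1 (s≤s (z≤n {N₁}))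
      ; load = λ _ → ≤-trans (≤-reflexive (#-⊤ {K})) (≤-trans le (*-monoˡ-≤ goal R≥4)) ; meet = λ _ _ _ → fz , ∈⊤ , ∈⊤ }
    ... | no gt = go (Cs.cells (# B) B ≤-refl λ v m → ≤-trans (≤-trans (≰⇒> gt) (≤-trans (≤-reflexive (sym (#-⊤ {K}))) (#-mono λ i _ → all-reach i)))
          (Cs.r-mono (conn⊆comp B-conn (λ _ z → z) m)))
      where
      go : Cs.CellsOn B → Crossings G L (suc N₁) (R * goal)
      go (p , Sk , lo , hi) = crossings-from p Sk lo (λ q → ≤-trans (hi q) bound≤)

#-∘ : ∀ {m k} (S : Sub m) (f : Fin k → Fin m) → (∀ i j → f i ≡ f j → i ≡ j) → # (S ∘ f) ≤ # S
#-∘ S f inj = ≤-trans (#-image-inj (f ∘ enum (S ∘ f)) λ i j e → enum-inj (S ∘ f) i j (inj _ _ e))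
  (#-mono λ v m → let (i , e) = image⁻ {f = f ∘ enum (S ∘ f)} m in subst (_∈ S) (sym e) (∈! (!∈ (enum-∈ (S ∘ f) i))))

-- Each contact is charged to a cell met by both lanes; a cell receives at most `y * y` charges.
contact-pairs : ∀ {G K} {L : Fin K → Sub (n G)} {x y} → Crossings G L x y → ∀ {k} (f g : Fin k → Fin K) →
  (∀ i j → f i ≡ f j → i ≡ j) → (∀ i j → g i ≡ g j → i ≡ j) →
  (X : Fin k → Fin k → Bool) → (∀ i j → X i j ≡ true → ¬ Walks.Apart G (L (f i)) (L (g j))) → ∑ (λ i → # (X i)) ≤ K * x * (y * y)
contact-pairs {K = K} {x = x} {y} Cr {k} f g f-inj g-inj X X⁻ = begin
    ∑ (λ i → # (X i))                                             ≤⟨ ∑-mono (λ i → ≤-trans (#-mono (sub i)) (#-⋃-bound (col i) (λ q j → tch q (g j)) y λ q _ → ≤-trans (#-∘ (tch q) g g-inj) (load q))) ⟩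
    ∑ (λ i → y * # (col i))                                       ≡⟨ ∑-* y (λ i → # (col i)) ⟩
    y * ∑ (λ i → # (col i))                                       ≡⟨ cong (y *_) (trans (∑-cong λ i → #-def (col i)) (trans (∑-swap (λ i q → tch q (f i) ▹ 1)) (∑-cong λ q → sym (#-def (tch q ∘ f))))) ⟩
    y * ∑ (λ q → # (tch q ∘ f))                                   ≤⟨ *-monoʳ-≤ y (∑-mono λ q → ≤-trans (#-∘ (tch q) f f-inj) (load q)) ⟩
    y * ∑ {p} (λ _ → y)                                           ≡⟨ cong (y *_) (∑-const {p} y) ⟩
    y * (p * y)                                                   ≤⟨ *-monoʳ-≤ y (*-monoˡ-≤ y few) ⟩
    y * (K * x * y)                                               ≡⟨ regroup y (K * x) ⟩
    K * x * (y * y)                                               ∎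
  where
  open ≤-Reasoning
  open Crossings Cr
  regroup : ∀ a b → a * (b * a) ≡ b * (a * a)
  regroup = solve-∀
  col : Fin k → Sub p
  col i q = tch q (f i)
  sub : ∀ i → X i ⊆ ⋃ (col i) (λ q j → tch q (g j))
  sub i j m = let (q , a , b) = meet (f i) (g j) (X⁻ i j (!∈ m)) in ⋃⁺ q (∈! (!∈ a)) (∈! (!∈ b))

-- Greedy choice by averaging: `M * C ≤ d * s` ensures that some candidate for the first index
-- causes at most `d` conflicts in total. It removes at most `d` candidates from any later list, and
-- a reserve of `s` always remains to average over.
transversal : ∀ {k} (M C d s : ℕ) → 1 ≤ s → M * C ≤ d * s → ∀ m → m ≤ M → (S : Fin m → Sub k) (X : Fin m → Fin m → Fin k → Fin k → Bool) →
  (∀ e → s + m * d ≤ # (S e)) → (∀ e f → e F.< f → ∑ (λ i → # (X e f i)) ≤ C) →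
  Σ (Fin m → Fin k) λ at → (∀ e → at e ∈ S e) × (∀ e f → e F.< f → ¬ (X e f (at e) (at f) ≡ true))
transversal M C d s s≥1 MC zero m≤ S X sz few = (λ ()) , (λ ()) , λ ()
transversal {k} M C d s s≥1 MC (suc m) m≤ S X sz few = go (average≤ (S fz) cost d (≤-trans s≥1 s≤) total)
  where
  cost : Fin k → ℕ
  cost i = ∑ (λ f → # (X fz (fs f) i))
  s≤ : s ≤ # (S fz)
  s≤ = ≤-trans (m≤m+n s _) (sz fz)
  open ≤-Reasoning
  total : ∑ (λ i → S fz i ▹ cost i) ≤ d * # (S fz)
  total = begin
    ∑ (λ i → S fz i ▹ cost i)                      ≤⟨ ∑-mono (λ i → ▹-≤ (S fz i) λ _ → ≤-refl) ⟩
    ∑ cost                                         ≡⟨ ∑-swap (λ i f → # (X fz (fs f) i)) ⟩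
    ∑ (λ f → ∑ (λ i → # (X fz (fs f) i)))          ≤⟨ ∑-mono (λ f → few fz (fs f) (s≤s z≤n)) ⟩
    ∑ {m} (λ _ → C)                                ≡⟨ ∑-const {m} C ⟩
    m * C                                          ≤⟨ *-monoˡ-≤ C (≤-trans (n≤1+n m) m≤) ⟩
    M * C                                          ≤⟨ MC ⟩
    d * s                                          ≤⟨ *-monoʳ-≤ d s≤ ⟩
    d * # (S fz)                                   ∎
  go : (∃ λ i → i ∈ S fz × cost i ≤ d) → Σ (Fin (suc m) → Fin k) λ at → (∀ e → at e ∈ S e) × (∀ e f → e F.< f → ¬ (X e f (at e) (at f) ≡ true))
  go (i , i∈ , ci) = at , at∈ , ok
    where
    S′ : Fin m → Sub k
    S′ f = S (fs f) ∖ X fz (fs f) i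
    sz′ : ∀ f → s + m * d ≤ # (S′ f)
    sz′ f = +-cancelʳ-≤ d _ _ (begin
      s + m * d + d                               ≡⟨ trans (+-assoc s (m * d) d) (cong (s +_) (+-comm (m * d) d)) ⟩
      s + suc m * d                               ≤⟨ sz (fs f) ⟩
      # (S (fs f))                                ≤⟨ #-∖ (S (fs f)) (X fz (fs f) i) ⟩
      # (S′ f) + # (X fz (fs f) i)                ≤⟨ +-monoʳ-≤ (# (S′ f)) (≤-trans (∑-∋ (λ f → # (X fz (fs f) i)) f) ci) ⟩
      # (S′ f) + d                                ∎)
    rec = transversal M C d s s≥1 MC m (≤-trans (n≤1+n m) m≤) S′ (λ e f → X (fs e) (fs f)) sz′ (λ e f lt → few (fs e) (fs f) (s≤s lt))
    at : Fin (suc m) → Fin k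
    at fz     = i
    at (fs e) = proj₁ rec e
    at∈ : ∀ e → at e ∈ S e
    at∈ fz     = i∈
    at∈ (fs e) = ∖ˡ (proj₁ (proj₂ rec) e)
    ok : ∀ e f → e F.< f → ¬ (X e f (at e) (at f) ≡ true)
    ok fz     (fs f) lt       r = ∖ʳ (proj₁ (proj₂ rec) f) (∈! r)
    ok (fs e) (fs f) (s≤s lt) r = proj₂ (proj₂ rec) e f lt r

-- Assembling an induced minor from lanes between independent cells

module Assemble (H G : Graph) (Δ : ℕ) (Δ-bound : ∀ v → # (adj G v) ≤ Δ)
                (Ω : Sub (n G)) (ν p : ℕ) (Sk : Skeletons.Skeleton G Ω ν p)
                (A : Sub (n G)) (A-light : ∀ a → a ∈ A → a ∈ Skeletons.Skeleton.light Sk)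
                (A-heavy : ∀ u a → u ∈ Ω → u ∉ Skeletons.Skeleton.light Sk → a ∈ A → ¬ Adj G u a)
                (cellAt : Fin (n H) → Fin p) (cellAt-inj : ∀ x y → cellAt x ≡ cellAt y → x ≡ y)
                (cells-apart : ∀ x y → x ≢ y → ¬ (Contacts.M G Ω ν p Sk (cellAt x) (cellAt y) ≡ true))
                {M k : ℕ} (src dst : Fin M → Fin (n H)) (key : Fin (n H) → Fin (n H) → Fin M)
                (src-key : ∀ a b → src (key a b) ≡ a) (dst-key : ∀ a b → dst (key a b) ≡ b)
                (lane : Fin M → Fin k → Sub (n G)) (lane⊆ : ∀ e i → lane e i ⊆ A) (lane-conn : ∀ e i → Walks.Connected′ G (lane e i))
                (lane-apart : ∀ e i j → i ≢ j → Walks.Apart G (lane e i) (lane e j))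
                (first : ∀ e i → ∃ λ v → v ∈ lane e i × v ∈ Skeletons.Skeleton.cl Sk (cellAt (src e)))
                (last : ∀ e i → ∃ λ v → v ∈ lane e i × v ∈ Skeletons.Skeleton.cl Sk (cellAt (dst e))) where
  open Walks G
  open Degree Δ Δ-bound
  open Skeletons G
  open Skeleton Sk
  open Contacts G Ω ν p Sk using (M⁺)

  Tx : ∀ e i → Tie (core (cellAt (src e))) (cl (cellAt (src e))) light ν (proj₁ (first e i))
  Tx e i = tie (cellAt (src e)) _ (proj₂ (proj₂ (first e i)))

  Ty : ∀ e i → Tie (core (cellAt (dst e))) (cl (cellAt (dst e))) light ν (proj₁ (last e i))
  Ty e i = tie (cellAt (dst e)) _ (proj₂ (proj₂ (last e i)))

  -- Where another lane would touch the ties that this lane adds to its end cells. Only light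
  -- vertices cast shade, since heavy ones have no neighbour in `A`.
  shade : Fin M → Fin k → Sub (n G)
  shade e i = N[ Tie.S (Tx e i) ∩ light ] ∪ N[ Tie.S (Ty e i) ∩ light ]

  o : ℕ
  o = suc Δ * ν + suc Δ * ν

  #-shade : ∀ e i → # (shade e i) ≤ o
  #-shade e i = ≤-trans (#-∪ N[ Tie.S (Tx e i) ∩ light ] N[ Tie.S (Ty e i) ∩ light ]) (+-mono-≤
    (≤-trans (#-N _) (*-monoʳ-≤ (suc Δ) (Tie.lights (Tx e i)))) (≤-trans (#-N _) (*-monoʳ-≤ (suc Δ) (Tie.lights (Ty e i)))))

  apart? : ∀ S T → Dec (Apart S T)
  apart? S T = all? (λ u → all? (λ v → (u ∈? S) →-dec ((v ∈? T) →-dec (¬? (u FP.≟ v) ×-dec ¬? (u ~? v)))))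

  touching : Fin M → Fin M → Fin k → Sub k
  touching e f i = set (λ j → ¬? (apart? (lane e i) (lane f j)))

  shaded : Fin M → Fin M → Fin k → Sub k
  shaded e f i = hits (lane f) (shade e i)

  conflict : Fin M → Fin M → Fin k → Sub k
  conflict e f i = touching e f i ∪ shaded e f i ∪ (λ j → shaded f e j i)

  #-shaded : ∀ e f i → # (shaded e f i) ≤ o
  #-shaded e f i = ≤-trans (#-hits (lane f) (λ i j ne v a b → proj₁ (lane-apart f i j ne v v a b) refl) (shade e i)) (#-shade e i)

  conflicts-bound : ∀ C₀ e f → ∑ (λ i → # (touching e f i)) ≤ C₀ → ∑ (λ i → # (conflict e f i)) ≤ C₀ + (k * o + k * o)
  conflicts-bound C₀ e f le = begin
      ∑ (λ i → # (conflict e f i))                                                  ≤⟨ ∑-mono (λ i → ≤-trans (#-∪ (touching e f i) _) (+-monoʳ-≤ (# (touching e f i)) (#-∪ (shaded e f i) _))) ⟩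
      ∑ (λ i → # (touching e f i) + (# (shaded e f i) + # (λ j → shaded f e j i)))  ≡⟨ trans (∑-+ (λ i → # (touching e f i)) _) (cong (∑ (λ i → # (touching e f i)) +_) (∑-+ (λ i → # (shaded e f i)) (λ i → # (λ j → shaded f e j i)))) ⟩
      ∑ (λ i → # (touching e f i)) + (∑ (λ i → # (shaded e f i)) + ∑ (λ i → # (λ j → shaded f e j i)))
                                                                                    ≤⟨ +-mono-≤ le (+-mono-≤ (sh e f) (≤-trans (≤-reflexive flip′) (sh f e))) ⟩
      C₀ + (k * o + k * o)                                                          ∎
    where
    open ≤-Reasoning
    sh : ∀ e f → ∑ (λ i → # (shaded e f i)) ≤ k * o
    sh e f = ≤-trans (∑-mono (#-shaded e f)) (≤-reflexive (∑-const {k} o))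
    flip′ : ∑ (λ i → # (λ j → shaded f e j i)) ≡ ∑ (λ j → # (shaded f e j))
    flip′ = trans (∑-cong λ i → #-def (λ j → shaded f e j i)) (trans (∑-swap (λ i j → shaded f e j i ▹ 1)) (∑-cong λ j → sym (#-def (shaded f e j))))

  module Chosen (at : Fin M → Fin k) (free : ∀ e f → e F.< f → ¬ (conflict e f (at e) (at f) ≡ true)) where

    W : Fin M → Sub (n G)
    W e = lane e (at e)

    W-apart : ∀ e f → e ≢ f → Apart (W e) (W f)
    W-apart e f ne with FP.<-cmp e f
    ... | tri≈ _ q _ = ⊥-elim (ne q)
    ... | tri< l _ _ = decidable-stable (apart? (W e) (W f)) λ z → free e f l (!∈ (∪ˡ {S = touching e f (at e)} (set⁺ {P? = λ j → ¬? (apart? (lane e (at e)) (lane f j))} z)))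
    ... | tri> _ _ g = apart-sym (decidable-stable (apart? (W f) (W e)) λ z → free f e g (!∈ (∪ˡ {S = touching f e (at f)} (set⁺ {P? = λ j → ¬? (apart? (lane f (at f)) (lane e j))} z))))

    W-shade : ∀ e f → e ≢ f → ∀ v → v ∈ W f → v ∉ shade e (at e)
    W-shade e f ne v v∈ m with FP.<-cmp e f
    ... | tri≈ _ q _ = ne q
    ... | tri< l _ _ = free e f l (!∈ (∪ʳ {S = touching e f (at e)} (∪ˡ {S = shaded e f (at e)} (hits⁺ {L = lane f} {shade e (at e)} v∈ m))))
    ... | tri> _ _ g = free f e g (!∈ (∪ʳ {S = touching f e (at f)} (∪ʳ {S = shaded f e (at f)} {λ j → shaded e f j (at f)} (∈! (!∈ (hits⁺ {L = lane f} {shade e (at e)} v∈ m))))))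

    Sx Sy : Fin M → Sub (n G)
    Sx e = Tie.S (Tx e (at e))
    Sy e = Tie.S (Ty e (at e))

    from-src from-dst : Fin (n H) → Sub M
    from-src c = set (λ e → src e FP.≟ c)
    from-dst c = set (λ e → dst e FP.≟ c)

    P : Fin (n H) → Sub (n G)
    P c = core (cellAt c) ∪ ⋃ (from-src c) Sx ∪ ⋃ (from-dst c) Sy

    Px : ∀ e → Sx e ⊆ P (src e)
    Px e v m = ∪ʳ (∪ˡ (⋃⁺ e (set⁺ {P? = λ f → src f FP.≟ src e} refl) m))

    Py : ∀ e → Sy e ⊆ P (dst e)
    Py e v m = ∪ʳ (∪ʳ (⋃⁺ e (set⁺ {P? = λ f → dst f FP.≟ dst e} refl) m))

    P⁻ : ∀ {c v} → v ∈ P c → v ∈ core (cellAt c) ⊎ (∃ λ e → src e ≡ c × v ∈ Sx e) ⊎ (∃ λ e → dst e ≡ c × v ∈ Sy e)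
    P⁻ {c} m with ∪⁻ m
    ... | inj₁ a = inj₁ a
    ... | inj₂ b with ∪⁻ b
    ...   | inj₁ x = let (e , q , s) = ⋃⁻ x in inj₂ (inj₁ (e , set⁻ {P? = λ e → src e FP.≟ c} q , s))
    ...   | inj₂ y = let (e , q , s) = ⋃⁻ y in inj₂ (inj₂ (e , set⁻ {P? = λ e → dst e FP.≟ c} q , s))

    P⊆ : ∀ c → P c ⊆ cl (cellAt c)
    P⊆ c v m with P⁻ m
    ... | inj₁ a = core⊆ _ v a
    ... | inj₂ (inj₁ (e , refl , s)) = Tie.S⊆ (Tx e (at e)) v s
    ... | inj₂ (inj₂ (e , refl , s)) = Tie.S⊆ (Ty e (at e)) v s

    P-conn : ∀ c → Connected′ (P c)
    P-conn c = conn-hub (proj₁ (core∋ (cellAt c))) go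
      where
      hub = proj₂ (core∋ (cellAt c))
      go : ∀ u → u ∈ P c → Path (P c) u (proj₁ (core∋ (cellAt c)))
      go u m with P⁻ m
      ... | inj₁ a = mapʷ (λ _ → ∪ˡ) (core-conn (cellAt c) u _ a hub)
      ... | inj₂ (inj₁ (e , refl , s)) = mapʷ (λ v z → [ ∪ˡ , Px e v ]′ (∪⁻ z)) (Tie.conn (Tx e (at e)) u _ (∪ʳ s) (∪ˡ hub))
      ... | inj₂ (inj₂ (e , refl , s)) = mapʷ (λ v z → [ ∪ˡ , Py e v ]′ (∪⁻ z)) (Tie.conn (Ty e (at e)) u _ (∪ʳ s) (∪ˡ hub))

    P-apart : ∀ a b → a ≢ b → Apart (P a) (P b)
    P-apart a b ne u v u∈ v∈ = (λ { refl → ne (cellAt-inj _ _ (unique (P⊆ a u u∈) (P⊆ b u v∈))) }) ,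
      λ e → cells-apart a b ne (M⁺ ((λ q → ne (cellAt-inj _ _ q)) , u , v , P⊆ a u u∈ , P⊆ b v v∈ , e))

    W-P : ∀ f c → c ≢ src f → c ≢ dst f → Apart (W f) (P c)
    W-P f c n₁ n₂ = apart-sym go
      where
      off : ∀ e {X} → e ≢ f → N[ X ∩ light ] ⊆ shade e (at e) → ∀ u v → u ∈ X → u ∈ light → v ∈ W f → u ≢ v × ¬ (u ~ v)
      off e {X} ne sub u v u∈ l v∈ = (λ { refl → W-shade e f ne u v∈ (sub u (N-self (∩⁺ u∈ l))) }) , λ r → W-shade e f ne v v∈ (sub v (N-adj (∩⁺ u∈ l) r))
      go : Apart (P c) (W f)
      go u v u∈ v∈ with u ∈? light
      ... | no ¬l = (λ e → ¬l (subst (_∈ light) (sym e) (A-light v (lane⊆ f (at f) v v∈)))) , A-heavy u v (cl⊆ _ u (P⊆ c u u∈)) ¬l (lane⊆ f (at f) v v∈)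
      ... | yes l with P⁻ u∈
      ...   | inj₁ a = ⊥-elim (core-heavy _ u a l)
      ...   | inj₂ (inj₁ (e , refl , s)) = off e (λ { refl → n₁ refl }) (λ _ → ∪ˡ) u v s l v∈
      ...   | inj₂ (inj₂ (e , refl , s)) = off e (λ { refl → n₂ refl }) (λ _ → ∪ʳ) u v s l v∈

    Z : Fin (n H) → Fin (n H) → Sub (n G)
    Z a b = W (key a b)

    W-link : ∀ e → ∃₂ λ u v → u ∈ P (src e) × v ∈ P (dst e) × Path (W e) u v
    W-link e = proj₁ (first e (at e)) , proj₁ (last e (at e)) , Px e _ (Tie.self (Tx e (at e))) , Py e _ (Tie.self (Ty e (at e))) ,
      lane-conn e (at e) _ _ (proj₁ (proj₂ (first e (at e)))) (proj₁ (proj₂ (last e (at e))))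

    minor : InducedMinor H G
    minor = Models.Glue.glue H G P Z (λ c → let (v , m) = core∋ (cellAt c) in v , ∪ˡ m) P-conn P-apart
      (λ a b _ _ → let (u , v , u∈ , v∈ , w) = W-link (key a b) in
        u , v , subst (λ c → u ∈ P c) (src-key a b) u∈ , subst (λ c → v ∈ P c) (dst-key a b) v∈ , mapʷ (λ _ z → ∪ʳ (∪ˡ z)) w)
      (λ a b c _ _ c≢a c≢b → W-P (key a b) c (λ e → c≢a (trans e (src-key a b))) (λ e → c≢b (trans e (dst-key a b))))
      (λ a b c d _ _ _ _ ne → W-apart (key a b) (key c d) λ e → ne (cong₂ _,_ (trans (sym (src-key a b)) (trans (cong src e) (src-key c d))) (trans (sym (dst-key a b)) (trans (cong dst e) (dst-key c d)))))

  assemble : ∀ C₀ d s → 1 ≤ s → M * (C₀ + (k * o + k * o)) ≤ d * s → s + M * d ≤ k →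
    (∀ e f → e ≢ f → ∑ (λ i → # (touching e f i)) ≤ C₀) → InducedMinor H G
  assemble C₀ d s s≥1 le sz few = go (transversal M (C₀ + (k * o + k * o)) d s s≥1 le M ≤-refl (λ _ → ⊤ˢ) conflict
      (λ _ → ≤-trans sz (≤-reflexive (sym (#-⊤ {k})))) (λ e f l → conflicts-bound C₀ e f (few e f (λ { refl → <-irrefl refl l }))))
    where
    go : (Σ (Fin M → Fin k) λ at → (∀ e → at e ∈ ⊤ˢ) × (∀ e f → e F.< f → ¬ (conflict e f (at e) (at f) ≡ true))) → InducedMinor H G
    go (at , _ , free) = Chosen.minor at free

-- The order function of an unbreakable set

module Tangle (G : Graph) (C W : Sub (n G)) (q : ℕ) (unbreakable : Decompose.Unbreakable G C W q) (large : 4 * q < # W) where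
  open Walks G
  open Decompose G

  Cut : Sub (n G) → Sub (n G) → Sub (n G) → Set
  Cut T Z D = NoEdge (side₁ C Z D) (side₂ C Z D) × # (W ∩ side₁ C Z D) ≤ q × T ⊆ D ∪ Z

  cut-resp : ∀ {T Z Z′ D D′} → (∀ v → Z v ≡ Z′ v) → (∀ v → D v ≡ D′ v) → Cut T Z D → Cut T Z′ D′
  cut-resp z d (a , b , c) =
    (λ u v p r → a u v (side₁-⊆ (≗-∈ z) (≗-∈ (≗-sym d)) u p) (side₂-⊆ (≗-∈ z) (≗-∈ d) v r)) ,
    ≤-trans (#-mono (∩-⊆ (side₁-⊆ (≗-∈ z) (≗-∈ (≗-sym d))))) b ,
    λ v m → [ (λ x → ∪ˡ (≗-∈ d v x)) , (λ x → ∪ʳ (≗-∈ z v x)) ]′ (∪⁻ (c v m))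

  cut? : ∀ T Z D → Dec (Cut T Z D)
  cut? T Z D = all? (λ u → all? λ v → (u ∈? side₁ C Z D) →-dec ((v ∈? side₂ C Z D) →-dec ¬? (u ~? v))) ×-dec
    ((_ ≤? _) ×-dec all? (λ v → (v ∈? T) →-dec (v ∈? D ∪ Z)))

  -- The second alternative caps `κ` at `q + 1`, so a least order always exists; beyond order `q`,
  -- unbreakability gives no information.
  Order : Sub (n G) → ℕ → Set
  Order T s = (∃ λ Z → # Z ≤ s × ∃ λ D → Cut T Z D) ⊎ s ≡ suc q

  order? : ∀ T s → Dec (Order T s)
  order? T s = anySub? (λ {Z} {Z′} z (le , D , c) → ≤-trans (#-mono (≗-∈ (≗-sym z))) le , D , cut-resp {Z = Z} {Z′} z (λ _ → refl) c)
      (λ Z → (# Z ≤? s) ×-dec anySub? (λ d c → cut-resp {Z = Z} {Z} (λ _ → refl) d c) (λ D → cut? T Z D)) ⊎-dec (s ≟ suc q)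

  opaque
    κ : Sub (n G) → ℕ
    κ T = proj₁ (least (order? T) (suc q) (inj₂ refl))

    κ-order : ∀ T → Order T (κ T)
    κ-order T = proj₁ (proj₂ (least (order? T) (suc q) (inj₂ refl)))

    κ≤ : ∀ {T s} → Order T s → κ T ≤ s
    κ≤ {T} {s} = proj₂ (proj₂ (least (order? T) (suc q) (inj₂ refl))) s

  κ-cut : ∀ {T} → κ T ≤ q → ∃ λ Z → # Z ≤ κ T × ∃ λ D → Cut T Z D
  κ-cut {T} le with κ-order T
  ... | inj₁ c = c
  ... | inj₂ e = ⊥-elim (1+n≰n (≤-trans (≤-reflexive (sym e)) le))

  cut-κ : ∀ {T} Z D → Cut T Z D → κ T ≤ # Z
  cut-κ Z D c = κ≤ (inj₁ (Z , ≤-refl , D , c))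

  κ≤# : ∀ T → κ T ≤ # T
  κ≤# T = cut-κ T ∅ ((λ u v a _ _ → ∉∅ (∩ʳ (∖ˡ a))) , ≤-trans (≤-reflexive (#-∅ λ v m → ∉∅ (∩ʳ (∖ˡ (∩ʳ m))))) z≤n , λ v → ∪ʳ)

  split : ∀ Z D → # (W ∩ side₁ C Z D) + # (W ∩ side₂ C Z D) ≤ # W
  split Z D = ≤-trans (+-monoʳ-≤ (# (W ∩ side₁ C Z D)) (#-mono λ v m → ∖⁺ (∩ˡ m) λ a → ∖ʳ (∖ˡ (∩ʳ m)) (∩ʳ (∖ˡ a))))
    (≤-reflexive (trans (+-comm (# (W ∩ side₁ C Z D)) _) (sym (#-∪∖ W (side₁ C Z D)))))

  small₁ : ∀ Z D → # W ≤ # (W ∩ side₂ C Z D) + q → # (W ∩ side₁ C Z D) ≤ q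
  small₁ Z D le = +-cancelʳ-≤ (# (W ∩ side₂ C Z D)) _ _ (≤-trans (split Z D) (≤-trans le (≤-reflexive (+-comm _ q))))

  small₂ : ∀ Z D → # W ≤ # (W ∩ side₁ C Z D) + q → # (W ∩ side₂ C Z D) ≤ q
  small₂ Z D le = +-cancelˡ-≤ (# (W ∩ side₁ C Z D)) _ _ (≤-trans (split Z D) le)

  -- Unite two optimal cuts. If the new separator has at most `q` vertices, one side is small for
  -- `W`; it must be the united one, which has at most `2q` elements of `W` whereas `4q < # W`. If
  -- it is larger, the cap `q + 1` suffices.
  κ-∪ : ∀ {T X Y} → T ⊆ X ∪ Y → κ T ≤ κ X + κ Y
  κ-∪ {T} {X} {Y} sub = go (κ-order X) (κ-order Y)
    where
    top : ∀ {s} → suc q ≤ s → κ T ≤ s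
    top le = ≤-trans (κ≤ (inj₂ refl)) le
    go : Order X (κ X) → Order Y (κ Y) → κ T ≤ κ X + κ Y
    go (inj₂ e) _ = top (≤-trans (≤-reflexive (sym e)) (m≤m+n _ _))
    go (inj₁ _) (inj₂ e) = top (≤-trans (≤-reflexive (sym e)) (m≤n+m _ _))
    go (inj₁ (Z₁ , z₁ , D₁ , a₁ , b₁ , c₁)) (inj₁ (Z₂ , z₂ , D₂ , a₂ , b₂ , c₂)) = decide (# Z ≤? q)
      where
      Z = Z₁ ∪ Z₂
      D = D₁ ∪ D₂
      #Z : # Z ≤ κ X + κ Y
      #Z = ≤-trans (#-∪ Z₁ Z₂) (+-mono-≤ z₁ z₂)
      in₂ : ∀ {v} → v ∈ side₂ C Z D → v ∈ side₂ C Z₁ D₁ × v ∈ side₂ C Z₂ D₂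
      in₂ {v} m = side₂-⊆ (λ _ → ∪ˡ) (λ _ → ∪ˡ) v m , side₂-⊆ (λ _ → ∪ʳ) (λ _ → ∪ʳ) v m
      in₁ : ∀ {u} → u ∈ side₁ C Z D → u ∈ side₁ C Z₁ D₁ ⊎ u ∈ side₁ C Z₂ D₂
      in₁ {u} m with ∪⁻ (∩ʳ (∖ˡ m))
      ... | inj₁ d = inj₁ (∖⁺ (∩⁺ (∩ˡ (∖ˡ m)) d) (∖ʳ m ∘ ∪ˡ))
      ... | inj₂ d = inj₂ (∖⁺ (∩⁺ (∩ˡ (∖ˡ m)) d) (∖ʳ m ∘ ∪ʳ))
      ne : NoEdge (side₁ C Z D) (side₂ C Z D)
      ne u v a b = [ (λ x → a₁ u v x (proj₁ (in₂ b))) , (λ x → a₂ u v x (proj₂ (in₂ b))) ]′ (in₁ a)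
      T⊆ : T ⊆ D ∪ Z
      T⊆ v m = [ (λ x → [ (λ d → ∪ˡ (∪ˡ d)) , (λ z → ∪ʳ (∪ˡ z)) ]′ (∪⁻ (c₁ v x))) , (λ y → [ (λ d → ∪ˡ (∪ʳ d)) , (λ z → ∪ʳ (∪ʳ z)) ]′ (∪⁻ (c₂ v y))) ]′ (∪⁻ (sub v m))
      decide : Dec (# Z ≤ q) → κ T ≤ κ X + κ Y
      decide (no gt) = top (≤-trans (≰⇒> gt) #Z)
      decide (yes le) with unbreakable Z D le ne
      ... | inj₂ big = ≤-trans (cut-κ Z D (ne , small₁ Z D big , T⊆)) #Z
      ... | inj₁ big = ⊥-elim (<⇒≱ large (begin
          # W                                                              ≤⟨ big ⟩
          # (W ∩ side₁ C Z D) + q                                          ≤⟨ +-monoˡ-≤ q (#-mono λ v m → [ (λ x → ∪ˡ (∩⁺ (∩ˡ m) x)) , (λ x → ∪ʳ (∩⁺ (∩ˡ m) x)) ]′ (in₁ (∩ʳ m))) ⟩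
          # ((W ∩ side₁ C Z₁ D₁) ∪ (W ∩ side₁ C Z₂ D₂)) + q                ≤⟨ +-monoˡ-≤ q (≤-trans (#-∪ (W ∩ side₁ C Z₁ D₁) (W ∩ side₁ C Z₂ D₂)) (+-mono-≤ b₁ b₂)) ⟩
          q + q + q                                                        ≤⟨ m≤m+n _ q ⟩
          q + q + q + q                                                    ≡⟨ four q ⟩
          4 * q                                                            ∎))
        where
        open ≤-Reasoning
        four : ∀ x → x + x + x + x ≡ 4 * x
        four = solve-∀

  module Linking (Δ : ℕ) (Δ-bound : ∀ v → # (adj G v) ≤ Δ) (A : Sub (n G)) (A⊆ : A ⊆ C) (closed : ∀ u v → u ∈ A → v ∈ C → u ~ v → v ∈ A) where
    open InducedMenger G Δ Δ-bound using (Linked; Sep)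

    -- A smaller separator `Z` inside `A` separates `C` as well, because `A` is closed in `C`.
    -- Whichever side is small for `W` contains `X` or `Y` up to `Z`, so the order of that set would
    -- be below `K`.
    linked : ∀ X Y K → X ⊆ A → Y ⊆ A → K ≤ q → K ≤ κ X → K ≤ κ Y → Linked A X Y K
    linked X Y K X⊆ Y⊆ K≤ kX kY Z lt sep = cases (unbreakable Z D (≤-trans (<⇒≤ lt) K≤) ne)
      where
      D D′ : Sub (n G)
      D = ⋃ X (comp (A ∖ Z))
      D′ = ⊤ˢ ∖ D
      ne : NoEdge (side₁ C Z D) (side₂ C Z D)
      ne u v a b e with ⋃⁻ (∩ʳ (∖ˡ a))
      ... | x , x∈ , c = ∖ʳ (∖ˡ b) (⋃⁺ x x∈ (comp-closed c (∖⁺ (closed u v (∖ˡ (comp-⊆ u c)) (∖ˡ (∖ˡ b)) e) (∖ʳ b)) e))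
      X⊆D : X ⊆ D ∪ Z
      X⊆D v m with v ∈? Z
      ... | yes z = ∪ʳ z
      ... | no ¬z = ∪ˡ (⋃⁺ v m (comp-∋ (∖⁺ (X⊆ v m) ¬z)))
      Y⊆D′ : Y ⊆ D′ ∪ Z
      Y⊆D′ v m = ∪ˡ (∖⁺ ∈⊤ λ d → let (x , x∈ , c) = ⋃⁻ d in sep x v x∈ m (mapʷ comp-⊆ (comp-path c)))
      flip₁ : side₁ C Z D′ ⊆ side₂ C Z D
      flip₁ v m = ∖⁺ (∖⁺ (∩ˡ (∖ˡ m)) (∖ʳ (∩ʳ (∖ˡ m)))) (∖ʳ m)
      flip₂ : side₂ C Z D′ ⊆ side₁ C Z D
      flip₂ v m = ∖⁺ (∩⁺ (∖ˡ (∖ˡ m)) (decidable-stable (v ∈? D) λ z → ∖ʳ (∖ˡ m) (∖⁺ ∈⊤ z))) (∖ʳ m)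
      cases : (# W ≤ # (W ∩ side₁ C Z D) + q) ⊎ (# W ≤ # (W ∩ side₂ C Z D) + q) → ⊥
      cases (inj₂ big) = <⇒≱ lt (≤-trans kX (cut-κ Z D (ne , small₁ Z D big , X⊆D)))
      cases (inj₁ big) = <⇒≱ lt (≤-trans kY (cut-κ Z D′ ((λ u v a b e → ne v u (flip₂ v b) (flip₁ u a) (~-sym e)) ,
        ≤-trans (#-mono (∩-⊆ flip₁)) (small₂ Z D big) , Y⊆D′)))

  -- A cut of order at most `q` would leave at most `2q` elements in `W ∩ A`, and so at most `4q` in
  -- `W`.
  κ-large : ∀ {T A} → A ⊆ C → A ⊆ T → # W ≤ # (W ∩ A) + (q + q) → q < κ T
  κ-large {T} {A} A⊆ A⊆T le = ≰⇒> λ l → absurd l (κ-cut l)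
    where
    open ≤-Reasoning
    four : ∀ x → x + x + (x + x) ≡ 4 * x
    four = solve-∀
    absurd : κ T ≤ q → (∃ λ Z → # Z ≤ κ T × ∃ λ D → Cut T Z D) → ⊥
    absurd l (Z , z , D , a , b , c) = <⇒≱ large (begin
        # W                                          ≤⟨ le ⟩
        # (W ∩ A) + (q + q)                          ≤⟨ +-monoˡ-≤ (q + q) (#-mono cov) ⟩
        # ((W ∩ side₁ C Z D) ∪ Z) + (q + q)          ≤⟨ +-monoˡ-≤ (q + q) (≤-trans (#-∪ (W ∩ side₁ C Z D) Z) (+-mono-≤ b (≤-trans z l))) ⟩
        q + q + (q + q)                              ≡⟨ four q ⟩
        4 * q                                        ∎)
      where
      cov : W ∩ A ⊆ (W ∩ side₁ C Z D) ∪ Z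
      cov v m with v ∈? Z
      ... | yes y = ∪ʳ y
      ... | no ¬y = [ (λ d → ∪ˡ (∩⁺ (∩ˡ m) (∖⁺ (∩⁺ (A⊆ v (∩ʳ m)) d) ¬y))) , ∪ʳ ]′ (∪⁻ (c v (A⊆T v (∩ʳ m))))

  -- Components are added in the order of vertex indices. At the first moment when all but `q` of
  -- `W` is covered, what was covered before holds at most `q` elements, by unbreakability with an
  -- empty separator. So the component just added holds all but `2q`.
  main-component : ∃ λ z → # W ≤ # (W ∩ comp ⊤ˢ z) + (q + q)
  main-component = jump (least heavy? (n G) full)
    where
    before? : ∀ t v → Dec (∃ λ z → z ∈ comp ⊤ˢ v × toℕ z < t)
    before? t v = any? (λ z → (z ∈? comp ⊤ˢ v) ×-dec (toℕ z <? t))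
    before : ℕ → Sub (n G)
    before t = set (before? t)
    heavy? : ∀ t → Dec (# W ≤ # (W ∩ before t) + q)
    heavy? t = _ ≤? _
    full : # W ≤ # (W ∩ before (n G)) + q
    full = ≤-trans (#-mono λ v m → ∩⁺ m (set⁺ {P? = before? (n G)} (v , comp-∋ ∈⊤ , FP.toℕ<n v))) (m≤m+n _ q)
    rest : ∀ t → ¬ (# W ≤ # (W ∩ before t) + q) → # W ≤ # (W ∖ before t) + q
    rest t nh with unbreakable ∅ (before t) (≤-trans (≤-reflexive (#-∅ λ _ → ∉∅)) z≤n)
                    (λ u v a b e → let (z , c , l) = set⁻ {P? = before? t} (∩ʳ (∖ˡ a)) in
                      ∖ʳ (∖ˡ b) (set⁺ {P? = before? t} (z , comp-⊆comp (comp-closed (comp-∋ ∈⊤) ∈⊤ (~-sym e)) z c , l)))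
    ... | inj₁ big = ⊥-elim (nh (≤-trans big (+-monoˡ-≤ q (#-mono (∩-⊆ λ v m → ∩ʳ (∖ˡ m))))))
    ... | inj₂ big = ≤-trans big (+-monoˡ-≤ q (#-mono λ v m → ∖⁺ (∩ˡ m) (∖ʳ (∖ˡ (∩ʳ m)))))
    jump : (∃ λ t → (# W ≤ # (W ∩ before t) + q) × (∀ j → # W ≤ # (W ∩ before j) + q → t ≤ j)) → ∃ λ z → # W ≤ # (W ∩ comp ⊤ˢ z) + (q + q)
    jump (zero , h , _) = ⊥-elim (<⇒≱ large (≤-trans h (≤-trans (+-monoˡ-≤ q (≤-reflexive (#-∅ λ v m → ⊥-elim (none (set⁻ {P? = before? 0} (∩ʳ m)))))) (m≤m+n q _))))
      where
      none : ∀ {v} → (∃ λ z → z ∈ comp ⊤ˢ v × toℕ z < 0) → ⊥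
      none (_ , _ , ())
    jump (suc t , h , min) = found (any? (λ z → toℕ z ≟ t))
      where
      after : # W ≤ # (W ∖ before t) + q
      after = rest t λ z → 1+n≰n (min t z)
      new : ∀ v → v ∈ before (suc t) → v ∉ before t → ∃ λ z → z ∈ comp ⊤ˢ v × toℕ z ≡ t
      new v a b = let (z , c , l) = set⁻ {P? = before? (suc t)} a in
        z , c , ≤-antisym (≤-pred l) (≮⇒≥ λ l′ → b (set⁺ {P? = before? t} (z , c , l′)))
      Q = (W ∩ before (suc t)) ∖ before t
      #Q : # W ≤ # Q + (q + q)
      #Q = +-cancelʳ-≤ (# (W ∩ before t)) _ _ (begin
          # W + # (W ∩ before t)                                      ≤⟨ +-monoˡ-≤ _ h ⟩
          # (W ∩ before (suc t)) + q + # (W ∩ before t)               ≤⟨ +-monoˡ-≤ _ (+-monoˡ-≤ q (≤-trans (≤-reflexive (#-∪∖ (W ∩ before (suc t)) (before t))) (+-monoʳ-≤ (# Q) (#-mono {T = W ∩ before t} λ v m → ∩⁺ (∩ˡ (∩ˡ m)) (∩ʳ m))))) ⟩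
          # Q + # (W ∩ before t) + q + # (W ∩ before t)               ≤⟨ +-monoʳ-≤ (# Q + # (W ∩ before t) + q) small ⟩
          # Q + # (W ∩ before t) + q + q                              ≡⟨ regroup (# Q) (# (W ∩ before t)) q ⟩
          # Q + (q + q) + # (W ∩ before t)                            ∎)
        where
        open ≤-Reasoning
        regroup : ∀ a b c → a + b + c + c ≡ a + (c + c) + b
        regroup = solve-∀
        small : # (W ∩ before t) ≤ q
        small = +-cancelˡ-≤ (# (W ∖ before t)) _ _ (≤-trans (≤-reflexive (sym (#-∪∖ W (before t)))) after)
      found : Dec (∃ λ z → toℕ z ≡ t) → ∃ λ z → # W ≤ # (W ∩ comp ⊤ˢ z) + (q + q)
      found (yes (z , ez)) = z , ≤-trans #Q (+-monoˡ-≤ (q + q) (#-mono λ v m → let (y , c , e) = new v (∩ʳ (∖ˡ m)) (∖ʳ m) in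
        ∩⁺ (∩ˡ (∖ˡ m)) (comp-sym (subst (_∈ comp ⊤ˢ v) (FP.toℕ-injective (trans e (sym ez))) c))))
      found (no ¬z) = ⊥-elim (<⇒≱ large (≤-trans #Q (≤-trans (+-monoˡ-≤ (q + q) (≤-reflexive (#-∅ λ v m →
        let (y , _ , e) = new v (∩ʳ (∖ˡ m)) (∖ʳ m) in ¬z (y , e)))) (≤-trans (m≤m+n (q + q) (q + q)) (≤-reflexive (four q))))))
        where
        four : ∀ x → x + x + (x + x) ≡ 4 * x
        four = solve-∀

-- Constants for a window of given height

module Constants (h Δ s : ℕ) where
  ν ρ D N₁ s₁ R goal load o c d sz k m bound q w : ℕ
  ν = suc s
  ρ = suc Δ ^ᵒ s
  D = density Δ (ν + 1) h
  N₁ = (h * h) * suc D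
  s₁ = h * suc (suc Δ * (ν + 1) * (h * h) + suc Δ * (ν + 1) * (h * h))
  R = 4 + (2 * (suc Δ * ρ) + 4) * suc Δ ^ᵒ 2
  goal = Thresholds.goal N₁ s₁ D R
  load = R * goal
  o = suc Δ * (ν + 1) + suc Δ * (ν + 1)
  -- Two bundles of `k` lanes have at most `c * k` conflicts: their contacts, and the shade cast in
  -- either direction.
  c = 2 * suc N₁ * (load * load) + 2 * o
  -- The factor 2 comes from `k ≤ 2 * sz`, which yields `(h * h) * (c * k) ≤ d * sz` for the `h * h`
  -- bundles.
  d = (h * h) * c * 2
  sz = suc ((h * h) * d)
  k = sz + (h * h) * d
  m = suc Δ ^ᵒ (suc (suc Δ ^ᵒ 2)) * (k * 5)
  bound = m + (ρ + m) * suc Δ ^ᵒ 2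
  -- `B` has order above `q` while a cell has at most `bound`, so at least `h * suc D` cells exist
  -- and `h` of them are independent. The summand `m` keeps the connectivity needed for the bundles
  -- within `q`.
  q = h * suc D * bound + m
  -- `4 * q` serves the subadditivity of the order function, and `ρ` serves windows beginning in the
  -- first two layers, where `W` would have to fit into a ball.
  w = suc (4 * q + ρ)

-- Contacts between two bundles

module TwoBundles (H G : Graph) (Δ : ℕ) (Δ-bound : ∀ v → # (adj G v) ≤ Δ) (noH : ¬ InducedMinor H G)
                  {B Ω A : Sub (n G)} (s : ℕ) (F : Frame G B Ω A (suc s) (suc Δ ^ᵒ s)) where
  open Walks G
  open Constants (n H) Δ s using (N₁; s₁; D; R; goal; load)

  module _ {k : ℕ} (k≥1 : 1 ≤ k) (L : Fin k ⊎ Fin k → Sub (n G)) (L∋ : ∀ x → ∃ λ v → v ∈ L x) (L⊆ : ∀ x → L x ⊆ A) (L-conn : ∀ x → Connected′ (L x))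
           (apart₁ : ∀ i j → i ≢ j → Apart (L (inj₁ i)) (L (inj₁ j))) (apart₂ : ∀ i j → i ≢ j → Apart (L (inj₂ i)) (L (inj₂ j))) where

    side : Fin k ⊎ Fin k → Bool
    side = [ (λ _ → true) , (λ _ → false) ]′

    apart : ∀ x y → x ≢ y → side x ≡ side y → Apart (L x) (L y)
    apart (inj₁ i) (inj₁ j) ne _ = apart₁ i j (ne ∘ cong inj₁)
    apart (inj₂ i) (inj₂ j) ne _ = apart₂ i j (ne ∘ cong inj₂)

    split-inj : ∀ i j → F.splitAt k i ≡ F.splitAt k j → i ≡ j
    split-inj i j e = trans (sym (FP.join-splitAt k k i)) (trans (cong (F.join k k) e) (FP.join-splitAt k k j))

    crossings : Crossings G (L ∘ F.splitAt k) (suc N₁) load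
    crossings = Crossing.crossings H G Δ Δ-bound noH F (≤-trans k≥1 (m≤m+n k k)) (L ∘ F.splitAt k) (λ i → L∋ (F.splitAt k i)) (λ i → L⊆ (F.splitAt k i)) (λ i → L-conn (F.splitAt k i))
      (side ∘ F.splitAt k) (λ i j ne → apart (F.splitAt k i) (F.splitAt k j) (ne ∘ split-inj i j)) N₁ s₁ D R goal refl refl refl refl refl

    few-contacts : (X : Fin k → Fin k → Bool) → (∀ i j → X i j ≡ true → ¬ Apart (L (inj₁ i)) (L (inj₂ j))) → ∑ (λ i → # (X i)) ≤ (k + k) * suc N₁ * (load * load)
    few-contacts X X⁻ = contact-pairs crossings (F._↑ˡ k) (k F.↑ʳ_) (λ i j → FP.↑ˡ-injective k i j) (λ i j → FP.↑ʳ-injective k i j) X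
      λ i j x a → X⁻ i j x (subst₂ (λ x y → Apart (L x) (L y)) (FP.splitAt-↑ˡ k i k) (FP.splitAt-↑ʳ k k j) a)

-- An unbreakable set above a frame yields the induced minor

module Unbroken (H G : Graph) (Δ : ℕ) (Δ-bound : ∀ v → # (adj G v) ≤ Δ) (noH : ¬ InducedMinor H G)
                (C W : Sub (n G)) (q : ℕ) (unbreakable : Decompose.Unbreakable G C W q) (large : 4 * q < # W)
                {B Ω A : Sub (n G)} (s : ℕ) (F : Frame G B Ω A (suc s) (suc Δ ^ᵒ s))
                (A⊆ : A ⊆ C) (closed : ∀ u v → u ∈ A → v ∈ C → Adj G u v → v ∈ A) (most : # W ≤ # (W ∩ A) + (q + q)) where
  open Walks G
  open Skeletons G
  open Frame F
  open Tangle G C W q unbreakable large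
  open Linking Δ Δ-bound A A⊆ closed
  open InducedMenger G Δ Δ-bound
  open Constants (n H) Δ s using (ν; ρ; D; N₁; load; o)

  r : Sub (n G) → ℕ
  r X = κ (A ∩ over X)

  r-∪ : ∀ {Z X Y} → Z ⊆ X ∪ Y → r Z ≤ r X + r Y
  r-∪ h = κ-∪ λ v m → [ (λ x → ∪ˡ (∩⁺ (∩ˡ m) (over⁺ x))) , (λ y → ∪ʳ (∩⁺ (∩ˡ m) (over⁺ y))) ]′ (∪⁻ (h (α v) (over⁻ (∩ʳ m))))

  r-∅ : r ∅ ≡ 0
  r-∅ = n≤0⇒n≡0 (≤-trans (κ≤# _) (≤-reflexive (#-∅ λ v m → ∉∅ (over⁻ (∩ʳ m)))))

  r-｛｝ : ∀ x → r ｛ x ｝ ≤ ρ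
  r-｛｝ x = ≤-trans (κ≤# _) (fibre x)

  r-B : q < r B
  r-B = κ-large A⊆ (λ v m → ∩⁺ m (over⁺ (α∈B v (A⊆Ω v m)))) most

  module _ (k d sz m bound : ℕ) (k≥1 : 1 ≤ k) (sz≥1 : 1 ≤ sz) (sz≤ : sz + (n H * n H) * d ≤ k)
           (d-large : (n H * n H) * ((k + k) * suc N₁ * (load * load) + (k * o + k * o)) ≤ d * sz)
           (m≡ : suc Δ ^ᵒ colours * (k * 5) ≡ m) (bound≡ : m + (ρ + m) * suc Δ ^ᵒ 2 ≡ bound) (q-large : n H * suc D * bound + m ≤ q) where

    module Cs = Cells G Δ Δ-bound r (λ {Z} {X} {Y} → r-∪ {Z} {X} {Y}) r-∅ ρ r-｛｝ m

    m≤q : m ≤ q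
    m≤q = ≤-trans (m≤n+m m _) q-large

    module WithCells (p : ℕ) (Sk : Skeleton B 1 p) (lo : ∀ x → m < r (Skeleton.cl Sk x)) (hi : ∀ x → r (Skeleton.cl Sk x) ≤ bound) where
      module E = Extend F p Sk
      module O = Skeleton Sk

      many : n H * suc D ≤ p
      many = ≮⇒≥ λ lt → <⇒≱ r-B (begin
          r B                                          ≤⟨ Cs.r-mono (λ v m → let (x , c) = O.cover v m in ⋃⁺ x ∈⊤ c) ⟩
          r (⋃ ⊤ˢ O.cl)                                ≤⟨ Cs.r-⋃ ⊤ˢ O.cl ⟩
          ∑ (λ x → r (O.cl x))                         ≤⟨ ∑-mono hi ⟩
          ∑ {p} (λ _ → bound)                          ≡⟨ ∑-const {p} bound ⟩
          p * bound                                    ≤⟨ *-monoˡ-≤ bound (<⇒≤ lt) ⟩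
          n H * suc D * bound                          ≤⟨ m≤m+n _ m ⟩
          n H * suc D * bound + m                      ≤⟨ q-large ⟩
          q                                            ∎)
        where open ≤-Reasoning

      top : Fin p → Sub (n G)
      top x = A ∩ over (O.cl x)

      bundle : ∀ x y → Bundle A (top x) (top y) k
      bundle x y = induced-menger A (top x) (top y) k (subst (Linked A (top x) (top y)) (sym m≡)
        (linked (top x) (top y) m (λ _ → ∩ˡ) (λ _ → ∩ˡ) m≤q (<⇒≤ (lo x)) (<⇒≤ (lo y))))

      module Chosen (cellAt : Fin (n H) → Fin p) (cellAt-inj : ∀ a b → cellAt a ≡ cellAt b → a ≡ b)
                    (cells-apart : ∀ a b → a ≢ b → ¬ (Contacts.M G Ω (ν + 1) p E.extended (cellAt a) (cellAt b) ≡ true))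
                    (bd : ∀ a b → Bundle A (top (cellAt a)) (top (cellAt b)) k) where

        src dst : Fin (n H * n H) → Fin (n H)
        src e = proj₁ (F.remQuot (n H) e)
        dst e = proj₂ (F.remQuot {n H} (n H) e)

        on : ∀ e → Bundle A (top (cellAt (src e))) (top (cellAt (dst e))) k
        on e = bd (src e) (dst e)

        lane : Fin (n H * n H) → Fin k → Sub (n G)
        lane e = Bundle.lane (on e)

        in-cell : ∀ {x v} → v ∈ top x → v ∈ E.cl′ x
        in-cell m = ∩⁺ (A⊆Ω _ (∩ˡ m)) (∩ʳ m)

        first : ∀ e i → ∃ λ v → v ∈ lane e i × v ∈ E.cl′ (cellAt (src e))
        first e i = let (v , a , b) = Bundle.hitX (on e) i in v , a , in-cell b

        last : ∀ e i → ∃ λ v → v ∈ lane e i × v ∈ E.cl′ (cellAt (dst e))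
        last e i = let (v , a , b) = Bundle.hitY (on e) i in v , a , in-cell b

        module As = Assemble H G Δ Δ-bound Ω (ν + 1) p E.extended A E.A-light E.A-heavy cellAt cellAt-inj cells-apart {k = k} src dst F.combine
          (λ a b → cong proj₁ (FP.remQuot-combine a b)) (λ a b → cong proj₂ (FP.remQuot-combine {n H} {n H} a b))
          lane (λ e → Bundle.lane⊆ (on e)) (λ e → Bundle.conn (on e)) (λ e → Bundle.aparts (on e))
          first last

        few : ∀ e f → e ≢ f → ∑ (λ i → # (As.touching e f i)) ≤ (k + k) * suc N₁ * (load * load)
        few e f _ = TwoBundles.few-contacts H G Δ Δ-bound noH s F k≥1 [ lane e , lane f ]′
          (λ { (inj₁ i) → map₂ proj₁ (first e i) ; (inj₂ i) → map₂ proj₁ (first f i) })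
          (λ { (inj₁ i) → Bundle.lane⊆ (on e) i ; (inj₂ i) → Bundle.lane⊆ (on f) i })
          (λ { (inj₁ i) → Bundle.conn (on e) i ; (inj₂ i) → Bundle.conn (on f) i })
          (Bundle.aparts (on e)) (Bundle.aparts (on f)) (As.touching e f)
          (λ i j x → set⁻ {P? = λ j → ¬? (As.apart? (lane e i) (lane f j))} (∈! x))

        minor : InducedMinor H G
        minor = As.assemble ((k + k) * suc N₁ * (load * load)) d sz sz≥1 d-large sz≤ few

      absurd : ⊥
      absurd = go (independent (Contacts.M G Ω (ν + 1) p E.extended) D (Contacts.M-sym G Ω (ν + 1) p E.extended)
          (contacts-sparse H G Δ Δ-bound noH Ω (ν + 1) p E.extended) (n H) ⊤ˢ (≤-trans many (≤-reflexive (sym (#-⊤ {p})))))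
        where
        go : (∃ λ I → I ⊆ ⊤ˢ × n H ≤ # I × Independent (Contacts.M G Ω (ν + 1) p E.extended) I) → ⊥
        go (I , _ , sI , ind) = noH (Chosen.minor at inj (λ a b ne → ind (at a) (at b) (mem a) (mem b) (ne ∘ inj a b)) (λ a b → bundle (at a) (at b)))
          where open Pick (pick I (n H) sI)

    absurd : ⊥
    absurd = go (Cs.cells (# B) B ≤-refl λ v b → ≤-trans (s≤s m≤q) (≤-trans r-B (Cs.r-mono (conn⊆comp B-conn (λ _ z → z) b))))
      where
      go : Cs.CellsOn B → ⊥
      go (p , Sk , lo , hi) = WithCells.absurd p Sk lo (λ x → ≤-trans (hi x) (≤-reflexive bound≡))

module Bounds (h Δ s : ℕ) where
  open Constants h Δ s

  d-large : (h * h) * ((k + k) * suc N₁ * (load * load) + (k * o + k * o)) ≤ d * sz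
  d-large = ≤-trans (≤-reflexive (regroup (h * h) k (suc N₁) (load * load) o))
    (≤-trans (*-monoʳ-≤ ((h * h) * c) k≤) (≤-reflexive (sym (*-assoc ((h * h) * c) 2 sz))))
    where
    regroup : ∀ M k x y o → M * ((k + k) * x * y + (k * o + k * o)) ≡ M * (2 * x * y + 2 * o) * k
    regroup = solve-∀
    k≤ : k ≤ 2 * sz
    k≤ = +-monoʳ-≤ sz (≤-trans (n≤1+n _) (≤-reflexive (sym (+-identityʳ sz))))

-- Windows of the breadth-first layering

module _ (H G : Graph) (Δ : ℕ) (Δ-bound : ∀ v → # (adj G v) ≤ Δ) (noH : ¬ InducedMinor H G) (ℓ i : ℕ) where
  open Walks G
  open Layers G
  open Decompose G
  s : ℕ
  -- The two extra layers account for the descent from the window through the omitted layer `i - 1`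
  -- to the last layer `i - 2` of `B`.
  s = ℓ + 2
  open Constants (n H) Δ s

  window : Sub (n G)
  window = set (λ v → (i ≤? level v) ×-dec (level v <? i + ℓ))

  window⁻ : ∀ {v} → v ∈ window → (i ≤ level v) × (level v < i + ℓ)
  window⁻ = set⁻ {P? = λ v → (i ≤? level v) ×-dec (level v <? i + ℓ)}

  module _ (C W : Sub (n G)) (C⊆ : C ⊆ window) (W⊆ : W ⊆ C) (W≡ : # W ≡ w) (unbreakable : Unbreakable C W q) where

    large : 4 * q < # W
    large = ≤-trans (s≤s (m≤m+n (4 * q) ρ)) (≤-reflexive (sym W≡))

    module At (z : V) (most : # W ≤ # (W ∩ comp ⊤ˢ z) + (q + q)) where

      A : Sub (n G)
      A = C ∩ comp ⊤ˢ z

      most′ : # W ≤ # (W ∩ A) + (q + q)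
      most′ = ≤-trans most (+-monoˡ-≤ (q + q) (#-mono λ v m → ∩⁺ (∩ˡ m) (∩⁺ (W⊆ v (∩ˡ m)) (∩ʳ m))))

      closed : ∀ u v → u ∈ A → v ∈ C → u ~ v → v ∈ A
      closed u v a c e = ∩⁺ c (comp-closed (∩ʳ a) ∈⊤ e)

      -- A window that starts in the first two layers meets every component in a small ball.
      low-absurd : i ≤ 1 → ⊥
      low-absurd i≤1 = 1+n≰n (begin
          suc (4 * q + ρ)                     ≡⟨ sym W≡ ⟩
          # W                                 ≤⟨ most′ ⟩
          # (W ∩ A) + (q + q)                 ≤⟨ +-monoˡ-≤ (q + q) (≤-trans (#-mono λ _ → ∩ʳ) (FO.#-fibre A (proj₁ (root∃ z)) A⊆ root-of)) ⟩
          ρ + (q + q)                         ≤⟨ m≤m+n _ (q + q) ⟩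
          ρ + (q + q) + (q + q)               ≡⟨ regroup ρ q ⟩
          4 * q + ρ                           ∎)
        where
        open ≤-Reasoning
        module FO = FrameOf G Δ Δ-bound z 0 s
        regroup : ∀ a b → a + (b + b) + (b + b) ≡ 4 * b + a
        regroup = solve-∀
        A⊆ : A ⊆ FO.upto (0 + s)
        A⊆ v m = FO.upto⁺ (∩ʳ m) (≤-trans (≤-pred (≤-trans (proj₂ (window⁻ (C⊆ v (∩ˡ m)))) (+-monoˡ-≤ ℓ i≤1))) (m≤m+n ℓ 2))
        root-of : ∀ v → v ∈ A → Below.α 0 v ≡ proj₁ (root∃ z)
        root-of v m = root-unique (level-zero (n≤0⇒n≡0 (Below.α-below 0 (level v ∸ 0) v refl))) (proj₁ (proj₂ (root∃ z)))
          (comp-⊆comp (comp-sym (FO.same-comp _ (∩ʳ m) (stalk-foot (level v ∸ 0) v))) _ (proj₂ (proj₂ (root∃ z))))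

      high-absurd : ∀ j → i ≡ suc (suc j) → ⊥
      high-absurd j e = Unbroken.absurd H G Δ Δ-bound noH C W q unbreakable large s
          (FrameOf.frame G Δ Δ-bound z j s A (λ v m → FrameOf.upto⁺ G Δ Δ-bound z j s (∩ʳ m) (below v (∩ˡ m))) (λ v m → ≤-trans (≤-reflexive (sym e)) (proj₁ (window⁻ (C⊆ v (∩ˡ m))))))
          (λ _ → ∩ˡ) closed most′ k d sz m bound (s≤s z≤n) (s≤s z≤n) ≤-refl (Bounds.d-large (n H) Δ s) refl refl ≤-refl
        where
        shift : ∀ j ℓ → suc (suc j) + ℓ ≡ j + (ℓ + 2)
        shift = solve-∀
        below : ∀ v → v ∈ C → level v ≤ j + s
        below v m = ≤-trans (<⇒≤ (proj₂ (window⁻ (C⊆ v m)))) (≤-reflexive (trans (cong (_+ ℓ) e) (shift j ℓ)))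

      absurd : ∀ i′ → i ≡ i′ → ⊥
      absurd zero          e = low-absurd (≤-trans (≤-reflexive e) z≤n)
      absurd (suc zero)    e = low-absurd (≤-reflexive e)
      absurd (suc (suc j)) e = high-absurd j e

    not-unbreakable : ⊥
    not-unbreakable = let (z , most) = Tangle.main-component G C W q unbreakable large in At.absurd z most i refl

  window-treewidth : TreewidthAtMost G (Window {G} level i ℓ) (w + q)
  window-treewidth = decomposition w q window not-unbreakable (Window {G} level i ℓ)
    (λ v → set⁺ {P? = λ v → (i ≤? level v) ×-dec (level v <? i + ℓ)}) (λ v → window⁻)

theorem3 : (H : Graph) → (Δ : ℕ) →
  Σ (ℕ → ℕ) λ f → (G : Graph) → MaxDegreeAtMost G Δ → ¬ InducedMinor H G →
    Σ (Fin′ G → ℕ) λ L → IsLayering G L ×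
      ((ℓ i : ℕ) → TreewidthAtMost G (Window {G} L i ℓ) (f ℓ))
theorem3 H Δ = (λ ℓ → Constants.w (n H) Δ (ℓ + 2) + Constants.q (n H) Δ (ℓ + 2)) , λ G Δ-bound noH →
  Layers.level G , Layers.layering G , window-treewidth H G Δ (λ v → subst (_≤ Δ) (countB≡# (adj G v)) (Δ-bound v)) noH
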